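{- For every $\varepsilon>0$ there exists $n_0$ such that the following holds for every $n\ge n_0$. If $\mathcal H$ is an $n$-vertex $C_5^{3- }$-free $3$-graph with exactly $\mathrm{ex}(n,C_5^{3- })$ edges, then there is a partition $V_1\cup V_2\cup V_3=V(\mathcal H)$ such that (i) $\big||V_i|-\frac n3\big|\le\varepsilon n$ for every $i\in\{1,2,3\}$, and (ii) $\mathcal H\setminus\bigcup_{i=1}^3\mathcal H[V_i]=\mathcal K[V_1,V_2,V_3]$.
   Context: $C_5^{3- }$ is the $3$-graph on $\{1,\dots,5\}$ with edges $\{1,2,3\},\{2,3,4\},\{3,4,5\},\{4,5,1\}$; $\mathrm{ex}(n,C_5^{3- })$ is the maximum number of edges of an $n$-vertex $3$-graph containing no copy of $C_5^{3- }$. $\mathcal H[V_i]$ denotes the set of edges of $\mathcal H$ contained in $V_i$, and $\mathcal K[V_1,V_2,V_3]$ is the set of all triples meeting each of $V_1,V_2,V_3$ in exactly one vertex. -}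

module Defs where

open import Data.Nat as ℕ using (ℕ)
open import Data.Fin using (Fin; _<_; _≟_) renaming (zero to f0; suc to fs)
open import Data.Fin.Properties using (_<?_)
open import Data.Bool using (Bool; true; false; _≟_)
open import Data.List using (List; length; filter; allFin; concatMap; map)
open import Data.Product using (_×_; _,_; Σ)
open import Function using (_∘_)
open import Relation.Binary.PropositionalEquality using (_≡_; _≢_)
open import Relation.Nullary using (¬_; _×-dec_)
open import Data.Integer using (+_)
open import Data.Rational as ℚ using (ℚ; _/_)

record ThreeGraph (n : ℕ) : Set where
  field
    edge   : Fin n → Fin n → Fin n → Bool
    sym₁₂  : ∀ x y z → edge x y z ≡ edge y x z
    sym₂₃  : ∀ x y z → edge x y z ≡ edge x z y
    loopless : ∀ x z → edge x x z ≡ false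
open ThreeGraph public

triples : (n : ℕ) → List (Fin n × Fin n × Fin n)
triples n = concatMap (λ x → concatMap (λ y → map (λ z → x , y , z) (allFin n)) (allFin n)) (allFin n)

numEdges : ∀ {n} → ThreeGraph n → ℕ
numEdges {n} H = length (filter (λ { (x , y , z) → (x <? y) ×-dec ((y <? z) ×-dec (edge H x y z Data.Bool.≟ true)) }) (triples n))

-- C₅^{3-} on {0,…,4}: edges {0,1,2},{1,2,3},{2,3,4},{3,4,0}
-- (vertex i+1 of the paper is vertex i here).
-- A copy in H: an injective map f : Fin 5 → Fin n sending these to edges.
ContainsC5minus : ∀ {n} → ThreeGraph n → Set
ContainsC5minus {n} H =
  Σ (Fin 5 → Fin n) λ f →
    (∀ i j → f i ≡ f j → i ≡ j) ×
    edge H (f f0) (f (fs f0)) (f (fs (fs f0))) ≡ true ×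
    edge H (f (fs f0)) (f (fs (fs f0))) (f (fs (fs (fs f0)))) ≡ true ×
    edge H (f (fs (fs f0))) (f (fs (fs (fs f0)))) (f (fs (fs (fs (fs f0))))) ≡ true ×
    edge H (f (fs (fs (fs f0)))) (f (fs (fs (fs (fs f0))))) (f f0) ≡ true

C5minusFree : ∀ {n} → ThreeGraph n → Set
C5minusFree H = ¬ ContainsC5minus H

IsExtremal : ∀ {n} → ThreeGraph n → Set
IsExtremal {n} H = C5minusFree H × (∀ (G : ThreeGraph n) → C5minusFree G → numEdges G ℕ.≤ numEdges H)

partSize : ∀ {n} → (Fin n → Fin 3) → Fin 3 → ℕ
partSize {n} p i = length (filter (λ x → p x Data.Fin.≟ i) (allFin n))

ℕtoℚ : ℕ → ℚ
ℕtoℚ m = (+ m) / 1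

-- Let R b a c say that a and c have, in the link of b, more than a bounded number of common neighbours.
-- A C₅³⁻ would arise if an edge abc also satisfied R a b c, or if two of the relations R a b c, R b a c, R c a b
-- held at once, so up to few exceptions every triple satisfies E + R + R + R ≤ 1. In the link of b the vertices
-- related to a include the neighbours of each neighbour of a; weighting by 1/d and using x/y + y/x ≥ 2 gives
-- ΣR ≥ Σ(degrees), hence 4|H| ≤ C(n,3) asymptotically. An iterated construction makes this sharp, so an extremal H
-- has little slack, and for a well-chosen edge xyz the neighbourhoods N(yz), N(xz), N(xy) form a near partition.
-- Inside each part H is again nearly extremal, which bounds every vertex degree by (u/w)n², with u/w improving from 1
-- to (2w + u)/(9w) at each pass. After three passes a comparison with the join K[V₁,V₂,V₃] ∪ ⋃ H[Vᵢ], which is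
-- C₅³⁻-free, excludes every mixed edge and every missing crossing triple.
module Submission where

open import Data.Bool using (Bool; true; false; not; _∧_; _∨_) renaming (_≟_ to _≟ᵇ_)
open import Data.Empty using (⊥; ⊥-elim)
open import Data.Fin using (Fin; toℕ) renaming (zero to f0; suc to fs; _≟_ to _≟ᶠ_)
open import Data.Fin.Properties using (toℕ-injective) renaming (_<?_ to _<ᶠ?_; <-cmp to <ᶠ-cmp; <-trans to <ᶠ-trans; <-asym to <ᶠ-asym)
open import Data.List using (List; []; _∷_; length; filter; map; concatMap; allFin; tabulate)
open import Data.List.Membership.Propositional using (_∈_)
open import Data.List.Membership.Propositional.Properties using (∈-allFin; ∈-filter⁺; ∈-filter⁻)
open import Data.List.Properties using (length-++; filter-++; length-filter; length-tabulate)
open import Data.List.Relation.Unary.All as All using (All)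
open import Data.List.Relation.Unary.AllPairs as AllPairs using ()
open import Data.List.Relation.Unary.Any using (here; there)
open import Data.List.Relation.Unary.Unique.Propositional using (Unique)
open import Data.List.Relation.Unary.Unique.Propositional.Properties using (allFin⁺; filter⁺)
open import Data.Nat using (ℕ; zero; suc; _+_; _*_; _∸_; _/_; _%_; _!; _≤_; _<_; _≥_; _≤ᵇ_; _≤?_; _<?_; ∣_-_∣; z≤n; s≤s; NonZero; >-nonZero)
open import Data.Nat.DivMod using (m/n*n≡m; m≡m%n+[m/n]*n; m%n<n; m/n<m)
open import Data.Nat.Divisibility using (_∣_; ∣-trans; ∣m⇒∣m*n; ∣-refl; m≤n⇒m!∣n!)
open import Data.Nat.Properties
open import Data.Nat.Tactic.RingSolver using (solve; solve-∀)
open import Data.Product using (Σ; _×_; _,_; proj₁; proj₂)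
open import Data.Sum using (_⊎_; inj₁; inj₂)
open import Function using (_∘_)
open import Function.Bundles using (_⇔_; mk⇔)
open import Relation.Binary.Definitions using (DecidableEquality; tri<; tri≈; tri>)
open import Relation.Binary.PropositionalEquality using (_≡_; _≢_; refl; sym; trans; cong; cong₂; subst; subst₂; module ≡-Reasoning)
open import Relation.Nullary using (¬_; Dec; does; yes; no)
open import Relation.Nullary.Decidable using (dec-true; dec-false)

-- All counts run over ordered tuples and stay in ℕ: an estimate up to o(nʲ) is written
-- `k * X ≤ c * nʲ` with `k` at will, and division is replaced by multiplication with a common
-- multiple. The pass from u/w to (2w + u)/(9w) has the fixed point 1/4, which is the share of
-- ordered pairs in a vertex link of the iterated construction; three passes from 1 reach 183/729,
-- about 0.2510. The closing comparison dictates this precision, because its margins are thin. A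
-- vertex that belongs to no part has to have fewer than 2n²/9 ordered link pairs, the number it
-- would get as a crossing vertex; the estimate obtained is 998/4500, about 0.2218. A vertex that
-- belongs to a part lacks at most 77n²/4500 of its crossing pairs. From this the count `bad` of
-- mixed edges is at most 1.97 times the number M of missing crossing triples, whereas maximality
-- makes it at least 2M. Hence both vanish.

infixl 6 _⊕_
infixr 7 _⊗_

-- Linear certificates, Boolean case checking and finite sums.

_⊕_ : ∀ {a b c d} → a ≤ b → c ≤ d → a + c ≤ b + d
_⊕_ = +-mono-≤

_⊗_ : ∀ m {a b} → a ≤ b → m * a ≤ m * b
m ⊗ h = *-monoʳ-≤ m h

-- Certificate form of linear arithmetic: X ≤ Y is the combination of hypotheses and k the slack.
lin : ∀ {a b X Y} k → X ≤ Y → a + Y + k ≡ b + X → a ≤ b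
lin {a} {b} {X} {Y} k h e = +-cancelʳ-≤ Y a b (begin
  a + Y     ≤⟨ m≤m+n (a + Y) k ⟩
  a + Y + k ≡⟨ e ⟩
  b + X     ≤⟨ +-monoʳ-≤ b h ⟩
  b + Y     ∎)
  where open ≤-Reasoning

-- The goal is multiplied by `suc c`, so a certificate written `linc 7` proves eight times the
-- inequality.
linc : ∀ c {a b X Y} k → X ≤ Y → suc c * a + Y + k ≡ suc c * b + X → a ≤ b
linc c {a} {b} k h e = *-cancelˡ-≤ (suc c) (lin {suc c * a} {suc c * b} k h e)

ι : Bool → ℕ
ι true  = 1
ι false = 0

ι≤1 : ∀ b → ι b ≤ 1
ι≤1 true  = ≤-refl
ι≤1 false = z≤n

BFun : ℕ → Set
BFun zero    = ℕ
BFun (suc k) = Bool → BFun k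

boolCheck : ∀ k → BFun k → BFun k → Bool
boolCheck zero    f g = f ≤ᵇ g
boolCheck (suc k) f g = boolCheck k (f true) (g true) ∧ boolCheck k (f false) (g false)

BLe : ∀ k → BFun k → BFun k → Set
BLe zero    f g = f ≤ g
BLe (suc k) f g = ∀ b → BLe k (f b) (g b)

∧-true : ∀ {a b} → a ∧ b ≡ true → a ≡ true × b ≡ true
∧-true {true} {true} _ = refl , refl

≤ᵇ-true : ∀ {m n} → (m ≤ᵇ n) ≡ true → m ≤ n
≤ᵇ-true {m} {n} h = ≤ᵇ⇒≤ m n (subst Data.Bool.T (sym h) _)

≤ᵇ-false : ∀ {m n} → (m ≤ᵇ n) ≡ false → n < m
≤ᵇ-false {m} {n} h = ≰⇒> λ m≤n → subst Data.Bool.T h (≤⇒≤ᵇ m≤n)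

-- Inequalities between 0/1-polynomials are proved by evaluation on all Boolean inputs.
byCases : ∀ k f g → boolCheck k f g ≡ true → BLe k f g
byCases zero    f g h       = ≤ᵇ-true h
byCases (suc k) f g h true  = byCases k (f true) (g true) (proj₁ (∧-true h))
byCases (suc k) f g h false = byCases k (f false) (g false) (proj₂ (∧-true {boolCheck k (f true) (g true)} h))

∑-+-interchange : ∀ a b c d → a + b + (c + d) ≡ a + c + (b + d)
∑-+-interchange = solve-∀

module _ {V : Set} where

  ∑ : List V → (V → ℕ) → ℕ
  ∑ []       f = 0
  ∑ (x ∷ xs) f = f x + ∑ xs f

  ∑-mono∈ : ∀ xs {f g : V → ℕ} → (∀ x → x ∈ xs → f x ≤ g x) → ∑ xs f ≤ ∑ xs g
  ∑-mono∈ []       h = z≤n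
  ∑-mono∈ (x ∷ xs) h = h x (here refl) ⊕ ∑-mono∈ xs (λ y y∈ → h y (there y∈))

  ∑-mono : ∀ xs {f g : V → ℕ} → (∀ x → f x ≤ g x) → ∑ xs f ≤ ∑ xs g
  ∑-mono xs h = ∑-mono∈ xs (λ x _ → h x)

  ∑-cong : ∀ xs {f g : V → ℕ} → (∀ x → f x ≡ g x) → ∑ xs f ≡ ∑ xs g
  ∑-cong []       h = refl
  ∑-cong (x ∷ xs) h = cong₂ _+_ (h x) (∑-cong xs h)

  ∑-+ : ∀ xs (f g : V → ℕ) → ∑ xs (λ x → f x + g x) ≡ ∑ xs f + ∑ xs g
  ∑-+ []       f g = refl
  ∑-+ (x ∷ xs) f g = trans (cong (f x + g x +_) (∑-+ xs f g)) (∑-+-interchange (f x) (g x) (∑ xs f) (∑ xs g))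

  ∑-* : ∀ xs c (f : V → ℕ) → ∑ xs (λ x → c * f x) ≡ c * ∑ xs f
  ∑-* []       c f = sym (*-zeroʳ c)
  ∑-* (x ∷ xs) c f = trans (cong (c * f x +_) (∑-* xs c f)) (sym (*-distribˡ-+ c (f x) (∑ xs f)))

  ∑-const : ∀ xs c → ∑ xs (λ _ → c) ≡ length xs * c
  ∑-const []       c = refl
  ∑-const (x ∷ xs) c = cong (c +_) (∑-const xs c)

  ∑-swap : ∀ xs ys (f : V → V → ℕ) → ∑ xs (λ x → ∑ ys (f x)) ≡ ∑ ys (λ y → ∑ xs (λ x → f x y))
  ∑-swap []       ys f = sym (trans (∑-const ys 0) (*-zeroʳ (length ys)))
  ∑-swap (x ∷ xs) ys f = trans (cong (∑ ys (f x) +_) (∑-swap xs ys f)) (sym (∑-+ ys (f x) _))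

  ∑-filter : ∀ {P : V → Set} (P? : ∀ x → Dec (P x)) xs (f : V → ℕ) → ∑ (filter P? xs) f ≡ ∑ xs (λ x → ι (does (P? x)) * f x)
  ∑-filter P? []       f = refl
  ∑-filter P? (x ∷ xs) f with does (P? x)
  ... | true  = cong₂ _+_ (sym (*-identityˡ (f x))) (∑-filter P? xs f)
  ... | false = ∑-filter P? xs f

  ∑-length : ∀ xs → ∑ xs (λ _ → 1) ≡ length xs
  ∑-length xs = trans (∑-const xs 1) (*-identityʳ (length xs))

  ∑-<⇒∃ : ∀ xs (f g : V → ℕ) → ∑ xs f < ∑ xs g → Σ V λ x → f x < g x
  ∑-<⇒∃ (x ∷ xs) f g h with f x <? g x
  ... | yes p = x , p
  ... | no ¬p = ∑-<⇒∃ xs f g (+-cancelˡ-< (g x) _ _ (≤-<-trans (+-monoˡ-≤ (∑ xs f) (≮⇒≥ ¬p)) h))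

  ∑≡0 : ∀ xs {f : V → ℕ} → ∑ xs f ≡ 0 → ∀ {x} → x ∈ xs → f x ≡ 0
  ∑≡0 (x ∷ xs) {f} h (here refl) = m+n≡0⇒m≡0 (f x) h
  ∑≡0 (x ∷ xs) {f} h (there x∈)  = ∑≡0 xs (m+n≡0⇒n≡0 (f x) h) x∈

  -- Used with `no5`, which identifies any two witnesses: a forbidden configuration thereby saves
  -- one power of n in a count.
  ∑-atMostOne : ∀ xs → Unique xs → (f : V → Bool) → (∀ x y → f x ≡ true → f y ≡ true → x ≡ y) → ∑ xs (λ x → ι (f x)) ≤ 1
  ∑-atMostOne []       _         f h = z≤n
  ∑-atMostOne (x ∷ xs) (x∉ AllPairs.∷ u) f h with f x in eq
  ... | false = ∑-atMostOne xs u f h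
  ... | true  = s≤s (≤-reflexive (others xs x∉))
    where
    others : ∀ ys → All (x ≢_) ys → ∑ ys (λ y → ι (f y)) ≡ 0
    others []       _        = refl
    others (y ∷ ys) (p All.∷ ps) with f y in eq′
    ... | false = others ys ps
    ... | true  = ⊥-elim (p (h x y eq eq′))

module Sums {V : Set} (vs : List V) where

  ∣vs∣ : ℕ
  ∣vs∣ = length vs

  Fun : ℕ → Set
  Fun zero    = ℕ
  Fun (suc k) = V → Fun k

  Sum : ∀ k → Fun k → ℕ
  Sum zero    f = f
  Sum (suc k) f = ∑ vs (λ x → Sum k (f x))

  Le : ∀ k → Fun k → Fun k → Set
  Le zero    f g = f ≤ g
  Le (suc k) f g = ∀ x → Le k (f x) (g x)

  Eq : ∀ k → Fun k → Fun k → Set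
  Eq zero    f g = f ≡ g
  Eq (suc k) f g = ∀ x → Eq k (f x) (g x)

  plus : ∀ k → Fun k → Fun k → Fun k
  plus zero    f g = f + g
  plus (suc k) f g = λ x → plus k (f x) (g x)

  scale : ∀ k → ℕ → Fun k → Fun k
  scale zero    c f = c * f
  scale (suc k) c f = λ x → scale k c (f x)

  swapAt : ℕ → ∀ k → Fun k → Fun k
  swapAt zero    (suc (suc k)) f = λ x y → f y x
  swapAt (suc i) (suc k)       f = λ x → swapAt i k (f x)
  swapAt _       _             f = f

  -- Entry `i` exchanges the arguments `i` and `i + 1`, and the head of the list acts last. Every
  -- reordering of summation variables is spelled as such a word, so that `perm` can state it up to
  -- computation.
  swaps : ∀ k → List ℕ → Fun k → Fun k
  swaps k []       f = f
  swaps k (i ∷ is) f = swapAt i k (swaps k is f)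

  sum-mono : ∀ k {f g} → Le k f g → Sum k f ≤ Sum k g
  sum-mono zero    h = h
  sum-mono (suc k) h = ∑-mono vs (λ x → sum-mono k (h x))

  sum-cong : ∀ k {f g} → Eq k f g → Sum k f ≡ Sum k g
  sum-cong zero    h = h
  sum-cong (suc k) h = ∑-cong vs (λ x → sum-cong k (h x))

  sum-+ : ∀ k f g → Sum k (plus k f g) ≡ Sum k f + Sum k g
  sum-+ zero    f g = refl
  sum-+ (suc k) f g = trans (∑-cong vs (λ x → sum-+ k (f x) (g x))) (∑-+ vs _ _)

  sum-* : ∀ k c f → Sum k (scale k c f) ≡ c * Sum k f
  sum-* zero    c f = refl
  sum-* (suc k) c f = trans (∑-cong vs (λ x → sum-* k c (f x))) (∑-* vs c _)

  sum-swap : ∀ i k f → Sum k (swapAt i k f) ≡ Sum k f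
  sum-swap zero    zero          f = refl
  sum-swap zero    (suc zero)    f = refl
  sum-swap zero    (suc (suc k)) f = ∑-swap vs vs _
  sum-swap (suc i) zero          f = refl
  sum-swap (suc i) (suc k)       f = ∑-cong vs (λ x → sum-swap i k (f x))

  perm : ∀ k is f → Sum k (swaps k is f) ≡ Sum k f
  perm k []       f = refl
  perm k (i ∷ is) f = trans (sum-swap i k (swaps k is f)) (perm k is f)

  sum-drop : ∀ k f → Sum (suc k) (λ _ → f) ≡ ∣vs∣ * Sum k f
  sum-drop k f = ∑-const vs (Sum k f)

  sum-<⇒∃ : ∀ f g → Sum 3 f < Sum 3 g → Σ V λ x → Σ V λ y → Σ V λ z → f x y z < g x y z
  sum-<⇒∃ f g h with ∑-<⇒∃ vs _ _ h
  ... | x , h₁ with ∑-<⇒∃ vs _ _ h₁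
  ... | y , h₂ with ∑-<⇒∃ vs _ _ h₂
  ... | z , h₃ = x , y , z , h₃

  sum-mono₂ : ∀ k {f} g₁ g₂ → Le k f (plus k g₁ g₂) → Sum k f ≤ Sum k g₁ + Sum k g₂
  sum-mono₂ k g₁ g₂ h = ≤-trans (sum-mono k h) (≤-reflexive (sum-+ k g₁ g₂))

  sum-mono₃ : ∀ k {f} g₁ g₂ g₃ → Le k f (plus k (plus k g₁ g₂) g₃) → Sum k f ≤ Sum k g₁ + Sum k g₂ + Sum k g₃
  sum-mono₃ k g₁ g₂ g₃ h = ≤-trans (sum-mono₂ k (plus k g₁ g₂) g₃ h) (≤-reflexive (sum-+ k g₁ g₂) ⊕ ≤-refl)

  sum-mono₄ : ∀ k {f} g₁ g₂ g₃ g₄ → Le k f (plus k (plus k (plus k g₁ g₂) g₃) g₄) →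
              Sum k f ≤ Sum k g₁ + Sum k g₂ + Sum k g₃ + Sum k g₄
  sum-mono₄ k g₁ g₂ g₃ g₄ h =
    ≤-trans (sum-mono₂ k (plus k (plus k g₁ g₂) g₃) g₄ h) (sum-mono₃ k g₁ g₂ g₃ (le-refl k _) ⊕ ≤-refl)
    where
    le-refl : ∀ k f → Le k f f
    le-refl zero    f = ≤-refl
    le-refl (suc k) f = λ x → le-refl k (f x)

  sum-+₃ : ∀ k f g h → Sum k (plus k (plus k f g) h) ≡ Sum k f + Sum k g + Sum k h
  sum-+₃ k f g h = trans (sum-+ k (plus k f g) h) (cong (_+ Sum k h) (sum-+ k f g))

  sum-+₄ : ∀ k f g h i → Sum k (plus k (plus k (plus k f g) h) i) ≡ Sum k f + Sum k g + Sum k h + Sum k i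
  sum-+₄ k f g h i = trans (sum-+ k (plus k (plus k f g) h) i) (cong (_+ Sum k i) (sum-+₃ k f g h))

-- Links, the relations `R` and the exclusion inequality.

ι-∧ : ∀ a b → ι (a ∧ b) ≡ ι a * ι b
ι-∧ true  b = sym (+-identityʳ (ι b))
ι-∧ false b = refl

-- The vertex set is kept apart as a list `vs`. The subgraph induced by a part is then the same
-- `Free` with a shorter list, which makes the recursion into the parts immediate.
record Free (V : Set) : Set where
  field
    e     : V → V → V → Bool
    sym₁₂ : ∀ x y z → e x y z ≡ e y x z
    sym₂₃ : ∀ x y z → e x y z ≡ e x z y
    -- A copy of C₅³⁻ is a cyclic sequence a u b c w in which only w a u need not be an edge.
    no5   : ∀ {a b c u w} → e a u b ≡ true → e u b c ≡ true → e b c w ≡ true → e c w a ≡ true → u ≡ w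

  rotˡ : ∀ x y z → e x y z ≡ e y z x
  rotˡ x y z = trans (sym₁₂ x y z) (sym₂₃ y x z)

  rotʳ : ∀ x y z → e x y z ≡ e z x y
  rotʳ x y z = trans (sym₂₃ x y z) (sym₁₂ x z y)

  rev : ∀ x y z → e x y z ≡ e z y x
  rev x y z = trans (rotˡ x y z) (sym₁₂ y z x)

  E nE : V → V → V → ℕ
  E x y z  = ι (e x y z)
  nE x y z = ι (not (e x y z))

∑Eε≤-shuffle : ∀ x y z → x * (y * z) ≡ z * (x * y)
∑Eε≤-shuffle = solve-∀

module Counts {V : Set} (H : Free V) (vs : List V) (k : ℕ) where

  open Free H
  open Sums vs

  -- The first argument of d, κ, R, Q is the vertex in whose link the count takes place.
  d : V → V → ℕ
  d b a = Sum 1 (E b a)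

  κ : V → V → V → ℕ
  κ b a c = Sum 1 λ w → E b a w * E b c w

  r : V → V → V → Bool
  r b a c = k ≤ᵇ κ b a c

  R nR : V → V → V → ℕ
  R b a c  = ι (r b a c)
  nR b a c = ι (not (r b a c))

  Q : V → V → ℕ
  Q b a = Sum 1 (R b a)

  -- For `w` adjacent to `a` in the link of `b`, the vertices related to `a` should be the
  -- neighbours of `w`. These are the two defects of that rule: `ε` counts the neighbours that are
  -- not related, `g` the related vertices that are not neighbours.
  ε g : V → V → V → ℕ
  ε b a w = Sum 1 λ c → E b w c * nR b a c
  g b a w = Sum 1 λ c → nE b w c * R b a c

  -- Triples on which E + R + R + R ≤ 1 is not attained. They are carried along because near
  -- extremality leaves few of them: for almost all triples one of the four alternatives then has to
  -- hold.
  ρ : V → V → V → ℕ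
  ρ a b c = ι (not (e a b c) ∧ not (r a b c) ∧ not (r b a c) ∧ not (r c a b))

  T P SQ SG Sε : ℕ
  T  = Sum 3 E
  P  = Sum 3 ρ
  SQ = Sum 2 Q
  SG = Sum 4 λ b a w c → E b a w * (nE b w c * R b a c)
  Sε = Sum 4 λ b a w c → E b a w * (E b w c * nR b a c)

  κ-sym : ∀ b a c → κ b a c ≡ κ b c a
  κ-sym b a c = ∑-cong vs (λ w → *-comm (E b a w) (E b c w))

  r-sym : ∀ b a c → r b a c ≡ r b c a
  r-sym b a c = cong (k ≤ᵇ_) (κ-sym b a c)

  d≤n : ∀ b a → d b a ≤ ∣vs∣
  d≤n b a = ≤-trans (∑-mono vs (λ w → ι≤1 (e b a w))) (≤-reflexive (∑-length vs))

  d-sym : ∀ b a → d b a ≡ d a b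
  d-sym b a = ∑-cong vs (λ w → cong ι (sym₁₂ b a w))

  Q+ε : ∀ b a w → Q b a + ε b a w ≡ d b w + g b a w
  Q+ε b a w = trans (sym (∑-+ vs _ _)) (trans (∑-cong vs (λ c → pt (r b a c) (e b w c))) (∑-+ vs _ _))
    where
    pt : ∀ x y → ι x + ι y * ι (not x) ≡ ι y + ι (not y) * ι x
    pt true  true  = refl
    pt true  false = refl
    pt false true  = refl
    pt false false = refl

  nR*κ≤k : ∀ b a c → nR b a c * κ b a c ≤ k
  nR*κ≤k b a c with k ≤ᵇ κ b a c in eq
  ... | true  = z≤n
  ... | false = ≤-trans (≤-reflexive (*-identityˡ _)) (<⇒≤ (≤ᵇ-false {k} eq))

  k*R≤κ : ∀ b a c → k * R b a c ≤ κ b a c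
  k*R≤κ b a c with k ≤ᵇ κ b a c in eq
  ... | true  = ≤-trans (≤-reflexive (*-identityʳ k)) (≤ᵇ-true eq)
  ... | false = ≤-trans (≤-reflexive (*-zeroʳ k)) z≤n

  -- Exchanging the sums counts, for every `c` unrelated to `a`, the common neighbours of `a` and
  -- `c`, of which there are fewer than `k`.
  ∑Eε≤ : ∀ b a → (Sum 1 λ w → E b a w * ε b a w) ≤ ∣vs∣ * k
  ∑Eε≤ b a = begin
    (Sum 1 λ w → E b a w * ε b a w)                              ≡⟨ sum-cong 1 (λ w → sym (∑-* vs (E b a w) _)) ⟩
    (Sum 2 λ w c → E b a w * (E b w c * nR b a c))               ≡⟨ perm 2 (0 ∷ []) (λ c w → E b a w * (E b w c * nR b a c)) ⟩
    (Sum 2 λ c w → E b a w * (E b w c * nR b a c))               ≡⟨ sum-cong 2 (λ c w → trans (cong (λ z → E b a w * (z * nR b a c)) (cong ι (sym₂₃ b w c))) (∑Eε≤-shuffle (E b a w) (E b c w) (nR b a c))) ⟩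
    (Sum 2 λ c w → nR b a c * (E b a w * E b c w))               ≡⟨ sum-cong 1 (λ c → ∑-* vs (nR b a c) _) ⟩
    (Sum 1 λ c → nR b a c * κ b a c)                             ≤⟨ sum-mono 1 (λ c → nR*κ≤k b a c) ⟩
    (Sum 1 λ c → k)                                              ≡⟨ ∑-const vs k ⟩
    ∣vs∣ * k                                                      ∎
    where
    open ≤-Reasoning

  -- A common neighbour `u` of a, c in the link of b and a common neighbour `w` of a, b in the link
  -- of c complete the cyclic sequence a u b c w.
  common-unique : ∀ {a b c u w} → e b a u ∧ e b c u ≡ true → e c a w ∧ e c b w ≡ true → u ≡ w
  common-unique {a} {b} {c} {u} {w} h₁ h₂ with ∧-true {e b a u} h₁ | ∧-true {e c a w} h₂
  ... | p , q | p′ , q′ = no5 (trans (sym (rotˡ b a u)) p) (trans (sym (rotʳ b c u)) q)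
                              (trans (sym₁₂ b c w) q′) (trans (sym₂₃ c w a) p′)

  κ-∧ : ∀ b a c → κ b a c ≡ ∑ vs (λ w → ι (e b a w ∧ e b c w))
  κ-∧ b a c = ∑-cong vs (λ w → sym (ι-∧ (e b a w) (e b c w)))

k*ER≤-shuffle : ∀ x y z → x * (y * z) ≡ y * (x * z)
k*ER≤-shuffle = solve-∀

upper-arith : ∀ t s p → t + 3 * s + p ≡ t + s + s + s + p
upper-arith = solve-∀

upper-arith′ : ∀ x → x + x + x ≡ 3 * x
upper-arith′ = solve-∀

module Inequality {V : Set} (H : Free V) (vs : List V) (uniq : Unique vs) (k : ℕ) (2≤k : 2 ≤ k) where

  open Free H
  open Sums vs
  open Counts H vs k

  -- A single common neighbour in the link of `c` determines every common neighbour in the link of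
  -- `b`, so the latter cannot number two. This is what the threshold `2 ≤ k` is for.
  exclusive : ∀ a b c → r b a c ≡ true → r c a b ≡ true → ⊥
  exclusive a b c h₁ h₂ with ∑-<⇒∃ vs (λ _ → 0) (λ w → ι (e c a w ∧ e c b w))
      (≤-trans (s≤s (≤-reflexive (trans (∑-const vs 0) (*-zeroʳ (length vs)))))
      (≤-trans (<⇒≤ 2≤k) (≤-trans (≤ᵇ-true h₂) (≤-reflexive (κ-∧ c a b)))))
  ... | w , h = <⇒≱ 2≤k (≤-trans (≤ᵇ-true h₁) (≤-trans (≤-reflexive (κ-∧ b a c))
      (∑-atMostOne vs uniq (λ u → e b a u ∧ e b c u)
        (λ x y p q → trans (common-unique {a} {b} p (true-of h)) (sym (common-unique {a} {b} q (true-of h)))))))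
    where
    true-of : ∀ {x} → 0 < ι x → x ≡ true
    true-of {true} _ = refl

  triple : ∀ a b c → ((E a b c + R a b c) + R b a c + R c a b) + ρ a b c
                   ≤ 1 + (E a b c * R a b c + E a b c * R b a c + E a b c * R c a b)
  triple a b c = go (e a b c) (r a b c) (r b a c) (r c a b)
      (λ p q → exclusive c a b (trans (r-sym a c b) p) (trans (r-sym b c a) q))
      (λ p q → exclusive b a c p (trans (r-sym c b a) q))
      (exclusive a b c)
    where
    go : ∀ f p q s → (p ≡ true → q ≡ true → ⊥) → (p ≡ true → s ≡ true → ⊥) → (q ≡ true → s ≡ true → ⊥) →
         ((ι f + ι p) + ι q + ι s) + ι (not f ∧ not p ∧ not q ∧ not s) ≤ 1 + (ι f * ι p + ι f * ι q + ι f * ι s)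
    go _     true  true  _     x _ _ = ⊥-elim (x refl refl)
    go _     true  false true  _ x _ = ⊥-elim (x refl refl)
    go _     false true  true  _ _ x = ⊥-elim (x refl refl)
    go true  true  false false _ _ _ = ≤-refl
    go true  false true  false _ _ _ = ≤-refl
    go true  false false true  _ _ _ = ≤-refl
    go true  false false false _ _ _ = ≤-refl
    go false true  false false _ _ _ = ≤-refl
    go false false true  false _ _ _ = ≤-refl
    go false false false true  _ _ _ = ≤-refl
    go false false false false _ _ _ = ≤-refl

  n : ℕ
  n = ∣vs∣

  Sum3-1 : (Sum 3 λ _ _ _ → 1) ≡ n * (n * n)
  Sum3-1 = trans (sum-drop 2 (λ _ _ → 1)) (cong (n *_) (trans (sum-drop 1 (λ _ → 1)) (cong (n *_) (∑-length vs))))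

  -- Two different apexes b and b′ for the same a, c, w would give the cyclic sequence a b c w b′.
  -- Consequently an edge can be related in one of its own links only rarely, as `k*ER≤` records.
  apexes : Sum 4 (λ a c w b → E a b c * (E b a w * E b c w)) ≤ n * (n * n)
  apexes = ≤-trans (sum-mono 3 inner) (≤-reflexive Sum3-1)
    where
    inner : ∀ a c w → ∑ vs (λ b → E a b c * (E b a w * E b c w)) ≤ 1
    inner a c w = ≤-trans (≤-reflexive (∑-cong vs (λ b → sym (trans (ι-∧ (e a b c) _) (cong (E a b c *_) (ι-∧ (e b a w) (e b c w)))))))
      (∑-atMostOne vs uniq (λ b → e a b c ∧ e b a w ∧ e b c w) same)
      where
      same : ∀ b b′ → e a b c ∧ e b a w ∧ e b c w ≡ true → e a b′ c ∧ e b′ a w ∧ e b′ c w ≡ true → b ≡ b′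
      same b b′ h h′ with ∧-true {e a b c} h | ∧-true {e a b′ c} h′
      ... | p , q | p′ , q′ with ∧-true {e b a w} q | ∧-true {e b′ a w} q′
      ... | q₁ , q₂ | q₁′ , q₂′ = no5 p q₂ (trans (sym (rotˡ b′ c w)) q₂′) (trans (sym (rotʳ b′ a w)) q₁′)

  ER : ℕ
  ER = Sum 3 λ a b c → E a b c * R b a c

  k*ER≤ : k * ER ≤ n * (n * n)
  k*ER≤ = begin
    k * ER                                                   ≡⟨ sum-* 3 k (λ a b c → E a b c * R b a c) ⟨
    (Sum 3 λ a b c → k * (E a b c * R b a c))                ≤⟨ sum-mono 3 (λ a b c → ≤-trans (≤-reflexive (k*ER≤-shuffle k (E a b c) _)) (E a b c ⊗ k*R≤κ b a c)) ⟩
    (Sum 3 λ a b c → E a b c * κ b a c)                      ≡⟨ sum-cong 3 (λ a b c → sym (∑-* vs (E a b c) _)) ⟩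
    (Sum 4 λ a b c w → E a b c * (E b a w * E b c w))        ≡⟨ perm 4 (1 ∷ 2 ∷ []) (λ a c w b → E a b c * (E b a w * E b c w)) ⟩
    (Sum 4 λ a c w b → E a b c * (E b a w * E b c w))        ≤⟨ apexes ⟩
    n * (n * n)                                              ∎
    where
    open ≤-Reasoning

  upper : T + 3 * SQ + P ≤ n * (n * n) + 3 * ER
  upper = begin
    T + 3 * SQ + P
      ≡⟨ upper-arith T SQ P ⟩
    T + SQ + SQ + SQ + P
      ≡⟨ cong (_+ P) (cong₂ _+_ (cong (T + SQ +_) (sym (perm 3 (0 ∷ []) R))) (sym (perm 3 (1 ∷ 0 ∷ []) R))) ⟩
    T + SQ + (Sum 3 λ a b c → R b a c) + (Sum 3 λ a b c → R c a b) + P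
      ≡⟨ trans (sum-+ 3 _ ρ) (cong (_+ P) (sum-+₄ 3 E R (λ a b c → R b a c) (λ a b c → R c a b))) ⟨
    (Sum 3 λ a b c → ((E a b c + R a b c) + R b a c + R c a b) + ρ a b c)
      ≤⟨ sum-mono 3 triple ⟩
    (Sum 3 λ a b c → 1 + (E a b c * R a b c + E a b c * R b a c + E a b c * R c a b))
      ≡⟨ trans (sum-+ 3 (λ _ _ _ → 1) _) (cong₂ _+_ Sum3-1 (trans (sum-+ 3 _ _) (cong (_+ (Sum 3 λ a b c → E a b c * R c a b)) (sum-+ 3 _ _)))) ⟩
    n * (n * n) + ((Sum 3 λ a b c → E a b c * R a b c) + ER + (Sum 3 λ a b c → E a b c * R c a b))
      ≡⟨ cong (n * (n * n) +_) (cong₂ (λ x y → x + ER + y) e₁ e₂) ⟩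
    n * (n * n) + (ER + ER + ER)
      ≡⟨ cong (n * (n * n) +_) (upper-arith′ ER) ⟩
    n * (n * n) + 3 * ER ∎
    where
    open ≤-Reasoning
    e₁ : (Sum 3 λ a b c → E a b c * R a b c) ≡ ER
    e₁ = trans (sum-cong 3 (λ a b c → cong (λ z → ι z * R a b c) (sym₁₂ a b c))) (perm 3 (0 ∷ []) (λ a b c → E a b c * R b a c))
    e₂ : (Sum 3 λ a b c → E a b c * R c a b) ≡ ER
    e₂ = trans (sum-cong 3 (λ a b c → cong (λ z → ι z * R c a b) (sym₂₃ a b c))) (perm 3 (1 ∷ []) (λ a b c → E a b c * R b a c))

-- The weighted AM-GM count and the asymptotic Turán bound.

square-gap : ∀ x y → x * x + y * y ≡ 2 * (x * y) + ∣ x - y ∣ * ∣ x - y ∣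
square-gap x y with ≤-total x y
... | inj₁ p = subst (λ z → x * x + z * z ≡ 2 * (x * z) + ∣ x - y ∣ * ∣ x - y ∣) (m+[n∸m]≡n p)
                 (trans (eq x (y ∸ x)) (cong (λ z → 2 * (x * (x + (y ∸ x))) + z * z) (sym (m≤n⇒∣m-n∣≡n∸m p))))
  where
  eq : ∀ x t → x * x + (x + t) * (x + t) ≡ 2 * (x * (x + t)) + t * t
  eq = solve-∀
... | inj₂ p = subst (λ z → z * z + y * y ≡ 2 * (z * y) + ∣ x - y ∣ * ∣ x - y ∣) (m+[n∸m]≡n p)
                 (trans (eq y (x ∸ y)) (cong (λ z → 2 * ((y + (x ∸ y)) * y) + z * z) (sym (m≤n⇒∣n-m∣≡n∸m p))))
  where
  eq : ∀ y t → (y + t) * (y + t) + y * y ≡ 2 * ((y + t) * y) + t * t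
  eq = solve-∀

2ab≤a²+b² : ∀ a b → 2 * (a * b) ≤ a * a + b * b
2ab≤a²+b² a b = ≤-trans (m≤m+n _ _) (≤-reflexive (sym (square-gap a b)))

2N≤-eq : ∀ N x y t → 2 * N * (x * y) + N * t ≡ N * (2 * (x * y)) + N * t
2N≤-eq = solve-∀

D*xy-eq : ∀ N x → N * (2 * x) ≡ 2 * N * x
D*xy-eq = solve-∀

Nδ²≤-eq : ∀ D n → D * (2 * n * (2 * n)) ≡ 4 * (n * n) * D
Nδ²≤-eq = solve-∀

ratio-eq₁ : ∀ l N x y δ → 4 * (l * (N * (y * (x + δ)))) ≡ 4 * (l * N) * (x * y) + N * (2 * ((2 * l * δ) * y))
ratio-eq₁ = solve-∀

ratio-eq₂ : ∀ l N x y δ → 4 * (l * N) * (x * y) + N * ((2 * l * δ) * (2 * l * δ) + y * y)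
    ≡ 4 * (l * N) * (x * y) + 4 * (l * (l * (N * (δ * δ)))) + N * (y * y)
ratio-eq₂ = solve-∀

ratio-eq₃ : ∀ l N x y D X → 4 * (l * N) * (x * y) + 4 * (l * (l * (D * (x * y)))) + X * x * (y * y)
    ≡ (4 * (l * N) + 4 * (l * (l * D)) + X * y) * (x * y)
ratio-eq₃ = solve-∀

-- X = N/x and Y = N/y for a common multiple N, so that D = N(x-y)²/(xy) measures the loss in x/y + y/x ≥ 2.
module AMGM {N x y X Y : ℕ} (1≤x : 1 ≤ x) (1≤y : 1 ≤ y) (Xx : X * x ≡ N) (Yy : Y * y ≡ N) where

  instance
    x≢0 : NonZero x
    x≢0 = >-nonZero 1≤x
    y≢0 : NonZero y
    y≢0 = >-nonZero 1≤y

  D : ℕ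
  D = (X * y + Y * x) ∸ 2 * N

  private
    δ : ℕ
    δ = ∣ x - y ∣

    scaled : (X * y + Y * x) * (x * y) ≡ N * (2 * (x * y)) + N * (δ * δ)
    scaled = begin
      (X * y + Y * x) * (x * y)             ≡⟨ solve (X ∷ Y ∷ x ∷ y ∷ []) ⟩
      (X * x) * (y * y) + (Y * y) * (x * x) ≡⟨ cong₂ (λ a b → a * (y * y) + b * (x * x)) Xx Yy ⟩
      N * (y * y) + N * (x * x)             ≡⟨ solve (N ∷ x ∷ y ∷ []) ⟩
      N * (x * x + y * y)                   ≡⟨ cong (N *_) (square-gap x y) ⟩
      N * (2 * (x * y) + δ * δ)             ≡⟨ *-distribˡ-+ N (2 * (x * y)) (δ * δ) ⟩
      N * (2 * (x * y)) + N * (δ * δ)       ∎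
      where open Relation.Binary.PropositionalEquality.≡-Reasoning

  2N≤ : 2 * N ≤ X * y + Y * x
  2N≤ = *-cancelʳ-≤ (2 * N) (X * y + Y * x) (x * y) {{m*n≢0 x y}}
    (≤-trans (m≤m+n _ _) (≤-reflexive (trans (2N≤-eq N x y (δ * δ)) (sym scaled))))

  2N+D : X * y + Y * x ≡ 2 * N + D
  2N+D = sym (m+[n∸m]≡n 2N≤)

  D*xy : D * (x * y) ≡ N * (δ * δ)
  D*xy = +-cancelˡ-≡ (2 * N * (x * y)) _ _ (begin
    2 * N * (x * y) + D * (x * y)   ≡⟨ *-distribʳ-+ (x * y) (2 * N) D ⟨
    (2 * N + D) * (x * y)           ≡⟨ cong (_* (x * y)) 2N+D ⟨
    (X * y + Y * x) * (x * y)       ≡⟨ scaled ⟩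
    N * (2 * (x * y)) + N * (δ * δ) ≡⟨ cong (_+ N * (δ * δ)) (D*xy-eq N (x * y)) ⟩
    2 * N * (x * y) + N * (δ * δ)   ∎)
    where
    open Relation.Binary.PropositionalEquality.≡-Reasoning

  Nδ²≤ : ∀ n → x ≤ 2 * n → y ≤ 2 * n → N * (δ * δ) ≤ 4 * (n * n) * D
  Nδ²≤ n p q = ≤-trans (≤-reflexive (sym D*xy)) (≤-trans (*-monoʳ-≤ D (*-mono-≤ p q)) (≤-reflexive (Nδ²≤-eq D n)))

  -- Divided by 4λN this is y/x ≤ 1 + λD/N + (y/x)/(4λ). It comes from y ≤ x + δ and 2(2λδ)y ≤
  -- (2λδ)² + y², and it trades an uncontrolled ratio for the loss D, whose total is small.
  ratio : ∀ λ′ → 4 * (λ′ * (X * y)) ≤ 4 * (λ′ * N) + 4 * (λ′ * (λ′ * D)) + X * y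
  ratio l = *-cancelʳ-≤ _ _ (x * y) {{m*n≢0 x y}} (begin
    4 * (l * (X * y)) * (x * y)
      ≡⟨ solve (l ∷ X ∷ x ∷ y ∷ []) ⟩
    4 * (l * ((X * x) * (y * y)))
      ≡⟨ cong (λ z → 4 * (l * (z * (y * y)))) Xx ⟩
    4 * (l * (N * (y * y)))
      ≤⟨ *-monoʳ-≤ 4 (*-monoʳ-≤ l (*-monoʳ-≤ N (*-monoʳ-≤ y y≤x+δ))) ⟩
    4 * (l * (N * (y * (x + δ))))
      ≡⟨ ratio-eq₁ l N x y δ ⟩
    4 * (l * N) * (x * y) + N * (2 * ((2 * l * δ) * y))
      ≤⟨ +-monoʳ-≤ _ (*-monoʳ-≤ N (2ab≤a²+b² (2 * l * δ) y)) ⟩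
    4 * (l * N) * (x * y) + N * ((2 * l * δ) * (2 * l * δ) + y * y)
      ≡⟨ ratio-eq₂ l N x y δ ⟩
    4 * (l * N) * (x * y) + 4 * (l * (l * (N * (δ * δ)))) + N * (y * y)
      ≡⟨ cong₂ (λ a b → 4 * (l * N) * (x * y) + 4 * (l * (l * a)) + b * (y * y)) (sym D*xy) (sym Xx) ⟩
    4 * (l * N) * (x * y) + 4 * (l * (l * (D * (x * y)))) + X * x * (y * y)
      ≡⟨ ratio-eq₃ l N x y D X ⟩
    (4 * (l * N) + 4 * (l * (l * D)) + X * y) * (x * y) ∎)
    where
    open ≤-Reasoning
    y≤x+δ : y ≤ x + δ
    y≤x+δ = m≤n+∣n-m∣ y x

local-eq : ∀ X d s Q a₁ a₂ → X * (d + s) * Q + a₁ + a₂ ≡ X * (s * Q) + ((X * Q) * d + a₁ + a₂)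
local-eq = solve-∀

local-eq₁ : ∀ e X q p s → e * (X * q) + e * (X * p) + e * (X * s) ≡ e * (X * (q + p + s))
local-eq₁ = solve-∀

local-eq₂ : ∀ e X dw g s → e * (X * (dw + g + s)) ≡ e * (X * (dw + s)) + e * (X * g)
local-eq₂ = solve-∀

kXε≤-eq₀ : ∀ n N → n * (n * (N * n)) ≡ N * (n * (n * n))
kXε≤-eq₀ = solve-∀

kXε≤-eq₁ : ∀ a b c → a * (b * c) ≡ b * (a * c)
kXε≤-eq₁ = solve-∀

kXε≤-eq₂ : ∀ k X n → k * (X * (n * k)) ≡ X * (k * k) * n
kXε≤-eq₂ = solve-∀

kXs≤-eq : ∀ k n N → k * (n * (n * (N * (k * k)))) ≡ N * (k * (k * k) * (n * n))
kXs≤-eq = solve-∀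

kXs≤-eq₁ : ∀ X s d → X * s * d ≡ X * d * s
kXs≤-eq₁ = solve-∀

2Y≡-eq : ∀ e N D → e * (2 * N + D) ≡ 2 * N * e + e * D
2Y≡-eq = solve-∀

slack-arith : ∀ N SQ T U₁ U₂ U₃ Y Xε Xs P ER n³ k → N * SQ + Xε + Xs ≡ U₁ + Y + U₂ → k * Xε ≤ N * n³ → k * Xs ≤ N * n³ →
        Y + Y ≡ 2 * (N * T) + U₃ → T + 3 * SQ + P ≤ n³ + 3 * ER → k * ER ≤ n³ →
        k * (6 * (U₁ + U₂) + 3 * U₃ + 2 * (N * P)) + 8 * (k * (N * T)) ≤ 2 * (k * (N * n³)) + 18 * (N * n³)
slack-arith N SQ T U₁ U₂ U₃ Y Xε Xs P ER n³ k h₁ h₂ h₃ h₄ h₅ h₆ =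
  lin 0 (((6 * k) ⊗ ≤-reflexive (sym h₁)) ⊕ (6 ⊗ h₂) ⊕ (6 ⊗ h₃) ⊕ ((3 * k) ⊗ ≤-reflexive (sym h₄)) ⊕ ((2 * k * N) ⊗ h₅) ⊕ ((6 * N) ⊗ h₆))
    (solve (N ∷ SQ ∷ T ∷ U₁ ∷ U₂ ∷ U₃ ∷ Y ∷ Xε ∷ Xs ∷ P ∷ ER ∷ n³ ∷ k ∷ []))

turán-eq : ∀ N k T → 2 * N * (4 * (k * T)) ≡ 8 * (k * (N * T))
turán-eq = solve-∀

turán-eq′ : ∀ N k n³ → 2 * (k * (N * n³)) + 18 * (N * n³) ≡ 2 * N * (k * n³ + 9 * n³)
turán-eq′ = solve-∀

near⇒slack-arith : ∀ N T Z n³ k → Z + 8 * (k * (N * T)) ≤ 2 * (k * (N * n³)) + 18 * (N * n³) → k * n³ ≤ 4 * (k * T) + n³ → Z ≤ 20 * (N * n³)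
near⇒slack-arith N T Z n³ k h₁ h₂ = lin 0 (h₁ ⊕ (2 * N) ⊗ h₂) (solve (N ∷ T ∷ Z ∷ n³ ∷ k ∷ []))

module Weights {V : Set} (H : Free V) (vs : List V) (uniq : Unique vs) (k : ℕ) (2≤k : 2 ≤ k)
               (k³≤n : k * (k * k) ≤ length vs) where

  open Free H
  open Sums vs
  open Counts H vs k
  open Inequality H vs uniq k 2≤k

  -- Every weight denominator d + k² is at most 2n and so divides `(2 * n) !`; the weights become
  -- integers. The shift by k² keeps the denominators positive and is just large enough that the
  -- error `ε`, of size n k for each pair by `∑Eε≤`, contributes at most N n / k after weighting.
  N s n³ : ℕ
  N  = (2 * n) !
  s  = k * k
  n³ = n * (n * n)

  inv : ℕ → ℕ
  inv zero    = 0
  inv (suc y) = N / suc y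

  inv-spec : ∀ {y} → 1 ≤ y → y ≤ 2 * n → inv y * y ≡ N
  inv-spec {suc y} _ h = m/n*n≡m (∣-trans (∣m⇒∣m*n (y !) ∣-refl) (m≤n⇒m!∣n! h))

  1≤N : 1 ≤ N
  1≤N = 1≤n! (2 * n)

  1≤s : 1 ≤ s
  1≤s = *-mono-≤ {1} (<⇒≤ 2≤k) (<⇒≤ 2≤k)

  s≤n : s ≤ n
  s≤n = ≤-trans (≤-trans (≤-reflexive (sym (*-identityˡ s))) (*-monoˡ-≤ s (<⇒≤ 2≤k))) k³≤n

  x X : V → V → ℕ
  x b a = d b a + s
  X b a = inv (x b a)

  1≤x : ∀ b a → 1 ≤ x b a
  1≤x b a = ≤-trans 1≤s (m≤n+m s (d b a))

  x≤2n : ∀ b a → x b a ≤ 2 * n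
  x≤2n b a = ≤-trans (d≤n b a ⊕ s≤n) (≤-reflexive (cong (n +_) (sym (+-identityʳ n))))

  Xx≡N : ∀ b a → X b a * x b a ≡ N
  Xx≡N b a = inv-spec (1≤x b a) (x≤2n b a)

  Xs≤N : ∀ b a → X b a * s ≤ N
  Xs≤N b a = ≤-trans (*-monoʳ-≤ (X b a) (m≤n+m s (d b a))) (≤-reflexive (Xx≡N b a))

  Xd≤N : ∀ b a → X b a * d b a ≤ N
  Xd≤N b a = ≤-trans (*-monoʳ-≤ (X b a) (m≤m+n (d b a) s)) (≤-reflexive (Xx≡N b a))

  module Loss (b a w : V) = AMGM {N} {x b a} {x b w} {X b a} {X b w} (1≤x b a) (1≤x b w) (Xx≡N b a) (Xx≡N b w)
  open Loss using (D)

  U₁ U₂ U₃ Y Xε Xs : ℕ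
  U₁ = Sum 2 λ b a → X b a * (s * Q b a)
  U₂ = Sum 3 λ b a w → E b a w * (X b a * g b a w)
  U₃ = Sum 3 λ b a w → E b a w * D b a w
  Y  = Sum 3 λ b a w → E b a w * (X b a * x b w)
  Xε = Sum 3 λ b a w → E b a w * (X b a * ε b a w)
  Xs = Sum 3 λ b a w → E b a w * (X b a * s)

  ∑E* : ∀ b a c → (Sum 1 λ w → E b a w * c) ≡ c * d b a
  ∑E* b a c = trans (∑-cong vs (λ w → *-comm (E b a w) c)) (∑-* vs c _)

  -- The identity `Q+ε`, weighted by `X b a` and summed over the neighbours w of a. As X (d + s) =
  -- N, the left side yields `N * Q b a` exactly, with the shift s as a correction on both sides.
  local : ∀ b a → N * Q b a + (Sum 1 λ w → E b a w * (X b a * ε b a w)) + (Sum 1 λ w → E b a w * (X b a * s))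
                ≡ X b a * (s * Q b a) + (Sum 1 λ w → E b a w * (X b a * x b w)) + (Sum 1 λ w → E b a w * (X b a * g b a w))
  local b a = begin
    N * Q b a + A₁ + A₂
      ≡⟨ cong (λ z → z * Q b a + A₁ + A₂) (Xx≡N b a) ⟨
    X b a * (d b a + s) * Q b a + A₁ + A₂
      ≡⟨ local-eq (X b a) (d b a) s (Q b a) A₁ A₂ ⟩
    X b a * (s * Q b a) + ((X b a * Q b a) * d b a + A₁ + A₂)
      ≡⟨ cong (λ z → X b a * (s * Q b a) + (z + A₁ + A₂)) (∑E* b a (X b a * Q b a)) ⟨
    X b a * (s * Q b a) + ((Sum 1 λ w → E b a w * (X b a * Q b a)) + A₁ + A₂)
      ≡⟨ cong (X b a * (s * Q b a) +_) (sum-+₃ 1 (λ w → E b a w * (X b a * Q b a)) (λ w → E b a w * (X b a * ε b a w)) (λ w → E b a w * (X b a * s))) ⟨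
    X b a * (s * Q b a) + (Sum 1 λ w → E b a w * (X b a * Q b a) + E b a w * (X b a * ε b a w) + E b a w * (X b a * s))
      ≡⟨ cong (X b a * (s * Q b a) +_) (sum-cong 1 (λ w → pt w)) ⟩
    X b a * (s * Q b a) + (Sum 1 λ w → E b a w * (X b a * x b w) + E b a w * (X b a * g b a w))
      ≡⟨ cong (X b a * (s * Q b a) +_) (sum-+ 1 (λ w → E b a w * (X b a * x b w)) (λ w → E b a w * (X b a * g b a w))) ⟩
    X b a * (s * Q b a) + ((Sum 1 λ w → E b a w * (X b a * x b w)) + (Sum 1 λ w → E b a w * (X b a * g b a w)))
      ≡⟨ +-assoc (X b a * (s * Q b a)) (Sum 1 λ w → E b a w * (X b a * x b w)) (Sum 1 λ w → E b a w * (X b a * g b a w)) ⟨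
    X b a * (s * Q b a) + (Sum 1 λ w → E b a w * (X b a * x b w)) + (Sum 1 λ w → E b a w * (X b a * g b a w)) ∎
    where
    open Relation.Binary.PropositionalEquality.≡-Reasoning
    A₁ A₂ : ℕ
    A₁ = Sum 1 λ w → E b a w * (X b a * ε b a w)
    A₂ = Sum 1 λ w → E b a w * (X b a * s)
    pt : ∀ w → E b a w * (X b a * Q b a) + E b a w * (X b a * ε b a w) + E b a w * (X b a * s)
             ≡ E b a w * (X b a * x b w) + E b a w * (X b a * g b a w)
    pt w = trans (local-eq₁ (E b a w) (X b a) (Q b a) (ε b a w) s)
          (trans (cong (λ z → E b a w * (X b a * (z + s))) (Q+ε b a w)) (local-eq₂ (E b a w) (X b a) (d b w) (g b a w) s))

  total : N * SQ + Xε + Xs ≡ U₁ + Y + U₂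
  total = trans (sym (trans (sum-+₃ 2 (λ b a → N * Q b a) _ _) (cong (λ z → z + Xε + Xs) (sum-* 2 N Q))))
         (trans (sum-cong 2 local) (sum-+₃ 2 (λ b a → X b a * (s * Q b a)) _ _))

  sum-const₂ : ∀ c → (Sum 2 λ _ _ → c) ≡ n * (n * c)
  sum-const₂ c = trans (sum-drop 1 (λ _ → c)) (cong (n *_) (∑-const vs c))

  kXε≤ : k * Xε ≤ N * n³
  kXε≤ = begin
    k * Xε                                                                ≡⟨ sum-* 2 k _ ⟨
    (Sum 2 λ b a → k * (Sum 1 λ w → E b a w * (X b a * ε b a w)))         ≤⟨ sum-mono 2 pt ⟩
    (Sum 2 λ b a → N * n)                                                 ≡⟨ sum-const₂ (N * n) ⟩
    n * (n * (N * n))                                                     ≡⟨ kXε≤-eq₀ n N ⟩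
    N * n³                                                                ∎
    where
    open ≤-Reasoning
    pt : ∀ b a → k * (Sum 1 λ w → E b a w * (X b a * ε b a w)) ≤ N * n
    pt b a = begin
      k * (Sum 1 λ w → E b a w * (X b a * ε b a w)) ≡⟨ cong (k *_) (sum-cong 1 (λ w → kXε≤-eq₁ (E b a w) (X b a) (ε b a w))) ⟩
      k * (Sum 1 λ w → X b a * (E b a w * ε b a w)) ≡⟨ cong (k *_) (∑-* vs (X b a) _) ⟩
      k * (X b a * (Sum 1 λ w → E b a w * ε b a w)) ≤⟨ *-monoʳ-≤ k (*-monoʳ-≤ (X b a) (∑Eε≤ b a)) ⟩
      k * (X b a * (n * k))                         ≡⟨ kXε≤-eq₂ k (X b a) n ⟩
      X b a * s * n                                 ≤⟨ *-monoˡ-≤ n (Xs≤N b a) ⟩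
      N * n                                         ∎

  kXs≤ : k * Xs ≤ N * n³
  kXs≤ = begin
    k * Xs                            ≤⟨ *-monoʳ-≤ k (sum-mono 2 pt) ⟩
    k * (Sum 2 λ b a → N * s)         ≡⟨ cong (k *_) (sum-const₂ (N * s)) ⟩
    k * (n * (n * (N * s)))           ≡⟨ kXs≤-eq k n N ⟩
    N * (k * (k * k) * (n * n))       ≤⟨ *-monoʳ-≤ N (*-monoˡ-≤ (n * n) k³≤n) ⟩
    N * n³                            ∎
    where
    open ≤-Reasoning
    pt : ∀ b a → (Sum 1 λ w → E b a w * (X b a * s)) ≤ N * s
    pt b a = ≤-trans (≤-reflexive (trans (∑E* b a (X b a * s)) (kXs≤-eq₁ (X b a) s (d b a)))) (*-monoˡ-≤ s (Xd≤N b a))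

  -- Every link edge is met from both of its ends, and the two weights add up to N (x/y + y/x) = 2N
  -- + D.
  2Y≡ : Y + Y ≡ 2 * (N * T) + U₃
  2Y≡ = begin
    Y + Y
      ≡⟨ cong (Y +_) (perm 3 (1 ∷ []) (λ b a w → E b a w * (X b a * x b w))) ⟨
    Y + (Sum 3 λ b a w → E b w a * (X b w * x b a))
      ≡⟨ sum-+ 3 (λ b a w → E b a w * (X b a * x b w)) _ ⟨
    (Sum 3 λ b a w → E b a w * (X b a * x b w) + E b w a * (X b w * x b a))
      ≡⟨ sum-cong 3 pt ⟩
    (Sum 3 λ b a w → 2 * N * E b a w + E b a w * D b a w)
      ≡⟨ sum-+ 3 (λ b a w → 2 * N * E b a w) _ ⟩
    (Sum 3 λ b a w → 2 * N * E b a w) + U₃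
      ≡⟨ cong (_+ U₃) (trans (sum-* 3 (2 * N) E) (*-assoc 2 N T)) ⟩
    2 * (N * T) + U₃ ∎
    where
    open Relation.Binary.PropositionalEquality.≡-Reasoning
    pt : ∀ b a w → E b a w * (X b a * x b w) + E b w a * (X b w * x b a) ≡ 2 * N * E b a w + E b a w * D b a w
    pt b a w = trans (cong (λ z → E b a w * (X b a * x b w) + ι z * (X b w * x b a)) (sym₂₃ b w a))
      (trans (sym (*-distribˡ-+ (E b a w) _ _))
      (trans (cong (E b a w *_) (Loss.2N+D b a w)) (2Y≡-eq (E b a w) N (D b a w))))

  -- The nonnegative losses stay on the left. Dropping them gives `turán`; keeping them shows that
  -- in a near-extremal graph each of them is small, and all of the later structure is extracted
  -- from this.
  slack : k * (6 * (U₁ + U₂) + 3 * U₃ + 2 * (N * P)) + 8 * (k * (N * T)) ≤ 2 * (k * (N * n³)) + 18 * (N * n³)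
  slack = slack-arith N SQ T U₁ U₂ U₃ Y Xε Xs P ER n³ k total kXε≤ kXs≤ 2Y≡ upper k*ER≤

  -- T counts every edge six times, so this is the bound (1/24 + o(1)) n³ on the number of edges.
  turán : 4 * (k * T) ≤ k * n³ + 9 * n³
  turán = *-cancelˡ-≤ (2 * N) {{m*n≢0 2 N {{_}} {{>-nonZero 1≤N}}}} (≤-trans
      (≤-trans (≤-reflexive (turán-eq N k T)) (m≤n+m _ (k * (6 * (U₁ + U₂) + 3 * U₃ + 2 * (N * P)))))
      (≤-trans slack (≤-reflexive (turán-eq′ N k n³))))

  near⇒slack : k * n³ ≤ 4 * (k * T) + n³ → k * (6 * (U₁ + U₂) + 3 * U₃ + 2 * (N * P)) ≤ 20 * (N * n³)
  near⇒slack h = near⇒slack-arith N T (k * (6 * (U₁ + U₂) + 3 * U₃ + 2 * (N * P))) n³ k slack h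

-- Consequences of small slack for the links.

kP≤-eq : ∀ N z → 20 * (N * z) ≡ N * (20 * z)
kP≤-eq = solve-∀

kSG≤-eq₁ : ∀ a b c → a * (b * c) ≡ b * (a * c)
kSG≤-eq₁ = solve-∀

kSG≤-eq₂ : ∀ X n e t → X * (2 * n) * (e * t) ≡ 2 * n * (e * (X * t))
kSG≤-eq₂ = solve-∀

kSG≤-eq₃ : ∀ k n u → k * (2 * n * u) ≡ 2 * n * (k * u)
kSG≤-eq₃ = solve-∀

kSG≤-eq₄ : ∀ n N z → 2 * n * (20 * (N * z)) ≡ N * (40 * (n * z))
kSG≤-eq₄ = solve-∀

kSε≤-eq : ∀ k n → k * (n * (n * (n * k))) ≡ k * k * (n * (n * n))
kSε≤-eq = solve-∀

kSF≤-eq : ∀ k n x y → k * (n * x + n * y) ≡ n * (k * x) + n * (k * y)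
kSF≤-eq = solve-∀

kSF≤-eq′ : ∀ n z → n * z + n * (40 * z) ≡ 41 * (n * z)
kSF≤-eq′ = solve-∀

kSΔ≤-eq₁ : ∀ a b c → a * (b * c) ≡ b * (a * c)
kSΔ≤-eq₁ = solve-∀

kSΔ≤-eq₂ : ∀ n N z → 4 * (n * n) * (20 * (N * z)) ≡ N * (80 * (n * (n * z)))
kSΔ≤-eq₂ = solve-∀

Q≲d-eq₁ : ∀ l N q → 4 * (l * (N * q)) ≡ 4 * l * (N * q)
Q≲d-eq₁ = solve-∀

Q≲d-arith : ∀ N l q d U₁ U₂ U₃ Y T z → 4 * l * N * q ≤ 4 * l * U₁ + 4 * l * U₂ + (4 * l * N * d + 4 * (l * l) * U₃ + Y) →
        l * U₁ ≤ 20 * (N * z) → l * U₂ ≤ 20 * (N * z) → l * (l * U₃) ≤ 20 * (N * z) → U₃ ≤ 20 * (N * z) →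
        Y + Y ≡ 2 * (N * T) + U₃ → T ≤ z → N * (l * q) ≤ N * (l * d + 65 * z)
Q≲d-arith N l q d U₁ U₂ U₃ Y T z h h₁ h₂ h₃ h₄ h₅ h₆ =
  linc 7 (18 * (N * z)) (2 ⊗ h ⊕ 8 ⊗ h₁ ⊕ 8 ⊗ h₂ ⊕ 8 ⊗ h₃ ⊕ h₄ ⊕ ≤-reflexive h₅ ⊕ (2 * N) ⊗ h₆)
    (solve (N ∷ l ∷ q ∷ d ∷ U₁ ∷ U₂ ∷ U₃ ∷ Y ∷ T ∷ z ∷ []))

module Near {V : Set} (H : Free V) (vs : List V) (uniq : Unique vs) (k : ℕ) (2≤k : 2 ≤ k)
            (k³≤n : k * (k * k) ≤ length vs)
            (near : k * (length vs * (length vs * length vs)) ≤ 4 * (k * Counts.T H vs k) + length vs * (length vs * length vs)) where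

  open Free H
  open Sums vs
  open Counts H vs k
  open Inequality H vs uniq k 2≤k
  open Weights H vs uniq k 2≤k k³≤n

  n⁴ n⁵ : ℕ
  n⁴ = n * n³
  n⁵ = n * n⁴

  instance
    N≢0 : NonZero N
    N≢0 = >-nonZero 1≤N

  private
    parts : ∀ k N U₁ U₂ U₃ P Z → k * (6 * (U₁ + U₂) + 3 * U₃ + 2 * (N * P)) ≤ Z →
            (k * U₁ ≤ Z) × (k * U₂ ≤ Z) × (k * U₃ ≤ Z) × (N * (k * P) ≤ Z)
    parts k N U₁ U₂ U₃ P Z h =
      lin (k * (5 * U₁ + 6 * U₂ + 3 * U₃ + 2 * (N * P))) h (solve (k ∷ N ∷ U₁ ∷ U₂ ∷ U₃ ∷ P ∷ Z ∷ [])) ,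
      lin (k * (6 * U₁ + 5 * U₂ + 3 * U₃ + 2 * (N * P))) h (solve (k ∷ N ∷ U₁ ∷ U₂ ∷ U₃ ∷ P ∷ Z ∷ [])) ,
      lin (k * (6 * U₁ + 6 * U₂ + 2 * U₃ + 2 * (N * P))) h (solve (k ∷ N ∷ U₁ ∷ U₂ ∷ U₃ ∷ P ∷ Z ∷ [])) ,
      lin (k * (6 * U₁ + 6 * U₂ + 3 * U₃ + N * P)) h (solve (k ∷ N ∷ U₁ ∷ U₂ ∷ U₃ ∷ P ∷ Z ∷ []))

    bounds = parts k N U₁ U₂ U₃ P (20 * (N * n³)) (near⇒slack near)

  kU₁≤ : k * U₁ ≤ 20 * (N * n³)
  kU₁≤ = proj₁ bounds

  kU₂≤ : k * U₂ ≤ 20 * (N * n³)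
  kU₂≤ = proj₁ (proj₂ bounds)

  kU₃≤ : k * U₃ ≤ 20 * (N * n³)
  kU₃≤ = proj₁ (proj₂ (proj₂ bounds))

  kP≤ : k * P ≤ 20 * n³
  kP≤ = *-cancelˡ-≤ N (≤-trans (proj₂ (proj₂ (proj₂ bounds))) (≤-reflexive (kP≤-eq N n³)))

  N≤X2n : ∀ b a → N ≤ X b a * (2 * n)
  N≤X2n b a = ≤-trans (≤-reflexive (sym (Xx≡N b a))) (*-monoʳ-≤ (X b a) (x≤2n b a))

  -- The weights are at least N/(2n), so the weighted excess `U₂` bounds the plain count at the
  -- price of a factor 2n.
  kSG≤ : k * SG ≤ 40 * n⁴
  kSG≤ = *-cancelˡ-≤ N (begin
    N * (k * SG)                                       ≡⟨ kSG≤-eq₁ N k SG ⟩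
    k * (N * SG)                                       ≡⟨ cong (k *_) (sum-* 4 N _) ⟨
    k * (Sum 4 λ b a w c → N * (E b a w * (nE b w c * R b a c)))
      ≤⟨ *-monoʳ-≤ k (sum-mono 4 λ b a w c → ≤-trans (*-monoˡ-≤ (E b a w * (nE b w c * R b a c)) (N≤X2n b a)) (≤-reflexive (kSG≤-eq₂ (X b a) n (E b a w) (nE b w c * R b a c)))) ⟩
    k * (Sum 4 λ b a w c → 2 * n * (E b a w * (X b a * (nE b w c * R b a c))))
      ≡⟨ cong (k *_) (trans (sum-* 4 (2 * n) _) (cong (2 * n *_) (sum-cong 3 λ b a w → trans (∑-* vs (E b a w) _) (cong (E b a w *_) (∑-* vs (X b a) _))))) ⟩
    k * (2 * n * U₂)                                   ≡⟨ kSG≤-eq₃ k n U₂ ⟩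
    2 * n * (k * U₂)                                   ≤⟨ *-monoʳ-≤ (2 * n) kU₂≤ ⟩
    2 * n * (20 * (N * n³))                            ≡⟨ kSG≤-eq₄ n N n³ ⟩
    N * (40 * n⁴)                                      ∎)
    where
    open ≤-Reasoning

  kSε≤ : k * Sε ≤ n⁴
  kSε≤ = begin
    k * Sε                                     ≡⟨ cong (k *_) (sum-cong 3 λ b a w → ∑-* vs (E b a w) _) ⟩
    k * (Sum 3 λ b a w → E b a w * ε b a w)    ≤⟨ *-monoʳ-≤ k (sum-mono 2 ∑Eε≤) ⟩
    k * (Sum 2 λ b a → n * k)                  ≡⟨ cong (k *_) (sum-const₂ (n * k)) ⟩
    k * (n * (n * (n * k)))                    ≡⟨ kSε≤-eq k n ⟩
    k * k * n³                                 ≤⟨ *-monoˡ-≤ n³ s≤n ⟩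
    n⁴                                         ∎
    where
    open ≤-Reasoning

  F : V → V → V → V → V → ℕ
  F b a w c w′ = E b a w * (E b w c * (E b a w′ * nE b w′ c))

  SF : ℕ
  SF = Sum 5 F

  -- `F` counts paths c w a w′ in a link that do not close to a 4-cycle. If `c` is related to `a`,
  -- then w′ exhibits an excess counted by `SG`; if not, w exhibits a deficit counted by `Sε`.
  -- Almost every path of length three in a link therefore closes.
  kSF≤ : k * SF ≤ 41 * n⁵
  kSF≤ = begin
    k * SF
      ≤⟨ *-monoʳ-≤ k (sum-mono₂ 5 (λ b a w c w′ → E b a w * (E b w c * nR b a c)) (λ b a w c w′ → E b a w′ * (nE b w′ c * R b a c))
           (λ b a w c w′ → byCases 5 (λ p q r s t → ι p * (ι q * (ι r * ι (not s)))) (λ p q r s t → ι p * (ι q * ι (not t)) + ι r * (ι (not s) * ι t)) refl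
              (e b a w) (e b w c) (e b a w′) (e b w′ c) (r b a c))) ⟩
    k * ((Sum 5 λ b a w c w′ → E b a w * (E b w c * nR b a c)) + (Sum 5 λ b a w c w′ → E b a w′ * (nE b w′ c * R b a c)))
      ≡⟨ cong₂ (λ y z → k * (y + z)) e₁ e₂ ⟩
    k * (n * Sε + n * SG)
      ≡⟨ kSF≤-eq k n Sε SG ⟩
    n * (k * Sε) + n * (k * SG)
      ≤⟨ *-monoʳ-≤ n kSε≤ ⊕ *-monoʳ-≤ n kSG≤ ⟩
    n * n⁴ + n * (40 * n⁴)
      ≡⟨ kSF≤-eq′ n n⁴ ⟩
    41 * n⁵ ∎
    where
    open ≤-Reasoning
    e₁ : (Sum 5 λ b a w c w′ → E b a w * (E b w c * nR b a c)) ≡ n * Sε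
    e₁ = trans (perm 5 (3 ∷ 2 ∷ 1 ∷ 0 ∷ []) (λ w′ b a w c → E b a w * (E b w c * nR b a c))) (sum-drop 4 (λ b a w c → E b a w * (E b w c * nR b a c)))
    e₂ : (Sum 5 λ b a w c w′ → E b a w′ * (nE b w′ c * R b a c)) ≡ n * SG
    e₂ = trans (perm 5 (3 ∷ 1 ∷ 0 ∷ []) (λ w b a w′ c → E b a w′ * (nE b w′ c * R b a c))) (sum-drop 4 (λ b a w′ c → E b a w′ * (nE b w′ c * R b a c)))

  δ : V → V → V → ℕ
  δ b a w = ∣ d b a - d b w ∣

  SΔ : ℕ
  SΔ = Sum 3 λ b a w → E b a w * (δ b a w * δ b a w)

  kSΔ≤ : k * SΔ ≤ 80 * n⁵
  kSΔ≤ = *-cancelˡ-≤ N (begin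
    N * (k * SΔ)                                                       ≡⟨ kSΔ≤-eq₁ N k SΔ ⟩
    k * (N * SΔ)                                                       ≡⟨ cong (k *_) (sum-* 3 N _) ⟨
    k * (Sum 3 λ b a w → N * (E b a w * (δ b a w * δ b a w)))          ≤⟨ *-monoʳ-≤ k (sum-mono 3 pt) ⟩
    k * (Sum 3 λ b a w → 4 * (n * n) * (E b a w * Loss.D b a w))       ≡⟨ cong (k *_) (sum-* 3 (4 * (n * n)) _) ⟩
    k * (4 * (n * n) * U₃)                                             ≡⟨ kSΔ≤-eq₁ k (4 * (n * n)) U₃ ⟩
    4 * (n * n) * (k * U₃)                                             ≤⟨ *-monoʳ-≤ (4 * (n * n)) kU₃≤ ⟩
    4 * (n * n) * (20 * (N * n³))                                      ≡⟨ kSΔ≤-eq₂ n N n³ ⟩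
    N * (80 * n⁵)                                                      ∎)
    where
    open ≤-Reasoning
    shift : ∀ b a w → ∣ x b a - x b w ∣ ≡ δ b a w
    shift b a w = trans (cong₂ ∣_-_∣ (+-comm (d b a) s) (+-comm (d b w) s)) (∣m+n-m+o∣≡∣n-o∣ s (d b a) (d b w))
    pt : ∀ b a w → N * (E b a w * (δ b a w * δ b a w)) ≤ 4 * (n * n) * (E b a w * Loss.D b a w)
    pt b a w = ≤-trans (≤-reflexive (kSΔ≤-eq₁ N (E b a w) _)) (≤-trans (*-monoʳ-≤ (E b a w)
        (subst (λ z → N * (z * z) ≤ 4 * (n * n) * Loss.D b a w) (shift b a w) (Loss.Nδ²≤ b a w n (x≤2n b a) (x≤2n b w))))
        (≤-reflexive (kSΔ≤-eq₁ (E b a w) (4 * (n * n)) _)))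

  T≤n³ : T ≤ n³
  T≤n³ = ≤-trans (sum-mono 3 (λ a b c → ι≤1 (e a b c))) (≤-reflexive Sum3-1)

  -- The exclusion count compares relations with degrees only over all pairs, whereas later the
  -- pairs between uncovered vertices and one neighbourhood matter. Restricted errors are bounded by
  -- the full sums, and `ratio` replaces `X b a * x b w` by `N` on the selected link edges.
  Q≲d : ∀ (p : V → V → Bool) l → l * l ≤ k →
        l * (Sum 2 λ b a → ι (p b a) * Q b a) ≤ l * (Sum 2 λ b a → ι (p b a) * d b a) + 65 * n³
  Q≲d p l l²≤k = *-cancelˡ-≤ N (Q≲d-arith N l SQp Sdp U₁ U₂ U₃ Y T n³ summed (bound U₁ kU₁≤) (bound U₂ kU₂≤) (bound² U₃ kU₃≤) kU₃′ 2Y≡ T≤n³)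
    where
    SQp Sdp : ℕ
    SQp = Sum 2 λ b a → ι (p b a) * Q b a
    Sdp = Sum 2 λ b a → ι (p b a) * d b a
    bound² : ∀ U → k * U ≤ 20 * (N * n³) → l * (l * U) ≤ 20 * (N * n³)
    bound² U h = ≤-trans (≤-reflexive (sym (*-assoc l l U))) (≤-trans (*-monoˡ-≤ U l²≤k) h)
    bound : ∀ U → k * U ≤ 20 * (N * n³) → l * U ≤ 20 * (N * n³)
    bound U h = ≤-trans (*-monoˡ-≤ U (l≤l² l)) (≤-trans (*-monoˡ-≤ U l²≤k) h)
      where
      l≤l² : ∀ l → l ≤ l * l
      l≤l² zero    = z≤n
      l≤l² (suc l) = m≤m+n (suc l) _
    kU₃′ : U₃ ≤ 20 * (N * n³)
    kU₃′ = ≤-trans (≤-trans (≤-reflexive (sym (*-identityˡ U₃))) (*-monoˡ-≤ U₃ (<⇒≤ 2≤k))) kU₃≤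
    edge≤ : ∀ b a w → 4 * l * (ι (p b a) * (E b a w * (X b a * x b w)))
                    ≤ (4 * l * N) * (ι (p b a) * E b a w) + 4 * (l * l) * (E b a w * Loss.D b a w) + E b a w * (X b a * x b w)
    edge≤ b a w with p b a
    ... | false = ≤-trans (≤-reflexive (*-zeroʳ (4 * l))) z≤n
    ... | true  = ≤-trans (≤-reflexive (eq l (E b a w) (X b a * x b w)))
                 (≤-trans (*-monoʳ-≤ (E b a w) (Loss.ratio b a w l)) (≤-reflexive (eq′ l N (E b a w) (Loss.D b a w) (X b a * x b w))))
      where
      eq : ∀ l e z → 4 * l * (1 * (e * z)) ≡ e * (4 * (l * z))
      eq = solve-∀
      eq′ : ∀ l N e D z → e * (4 * (l * N) + 4 * (l * (l * D)) + z) ≡ 4 * l * N * (1 * e) + 4 * (l * l) * (e * D) + e * z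
      eq′ = solve-∀
    A B C : V → V → ℕ
    A b a = X b a * (s * Q b a)
    B b a = Sum 1 λ w → E b a w * (X b a * x b w)
    C b a = Sum 1 λ w → E b a w * (X b a * g b a w)
    pt : ∀ b a → (4 * l * N) * (ι (p b a) * Q b a) ≤ 4 * l * A b a + 4 * l * C b a
                 + (Sum 1 λ w → 4 * l * (ι (p b a) * (E b a w * (X b a * x b w))))
    pt b a = begin
      4 * l * N * (ι (p b a) * Q b a)            ≡⟨ eq l N (ι (p b a)) (Q b a) ⟩
      4 * l * (ι (p b a) * (N * Q b a))          ≤⟨ *-monoʳ-≤ (4 * l) (*-monoʳ-≤ (ι (p b a)) (≤-trans (≤-trans (m≤m+n _ _) (m≤m+n _ _)) (≤-reflexive (local b a)))) ⟩
      4 * l * (ι (p b a) * (A b a + B b a + C b a)) ≤⟨ drop (p b a) (A b a) (B b a) (C b a) ⟩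
      4 * l * A b a + 4 * l * C b a + 4 * l * (ι (p b a) * B b a)
        ≡⟨ cong (4 * l * A b a + 4 * l * C b a +_) (trans (∑-* vs (4 * l) _) (cong (4 * l *_) (∑-* vs (ι (p b a)) _))) ⟨
      4 * l * A b a + 4 * l * C b a + (Sum 1 λ w → 4 * l * (ι (p b a) * (E b a w * (X b a * x b w)))) ∎
      where
      open ≤-Reasoning
      eq : ∀ l N i q → 4 * l * N * (i * q) ≡ 4 * l * (i * (N * q))
      eq = solve-∀
      drop : ∀ t a b c → 4 * l * (ι t * (a + b + c)) ≤ 4 * l * a + 4 * l * c + 4 * l * (ι t * b)
      drop true  a b c = ≤-reflexive (solve (l ∷ a ∷ b ∷ c ∷ []))
      drop false a b c = ≤-trans (≤-reflexive (*-zeroʳ (4 * l))) z≤n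
    summed : 4 * l * N * SQp ≤ 4 * l * U₁ + 4 * l * U₂ + (4 * l * N * Sdp + 4 * (l * l) * U₃ + Y)
    summed = begin
      4 * l * N * SQp
        ≡⟨ sum-* 2 (4 * l * N) _ ⟨
      (Sum 2 λ b a → 4 * l * N * (ι (p b a) * Q b a))
        ≤⟨ sum-mono₃ 2 (λ b a → 4 * l * A b a) (λ b a → 4 * l * C b a) (λ b a → Sum 1 λ w → 4 * l * (ι (p b a) * (E b a w * (X b a * x b w)))) pt ⟩
      (Sum 2 λ b a → 4 * l * A b a) + (Sum 2 λ b a → 4 * l * C b a) + (Sum 3 λ b a w → 4 * l * (ι (p b a) * (E b a w * (X b a * x b w))))
        ≤⟨ ≤-reflexive (cong₂ _+_ (sum-* 2 (4 * l) A) (sum-* 2 (4 * l) C))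
           ⊕ sum-mono₃ 3 (λ b a w → 4 * l * N * (ι (p b a) * E b a w)) (λ b a w → 4 * (l * l) * (E b a w * Loss.D b a w)) (λ b a w → E b a w * (X b a * x b w)) edge≤ ⟩
      4 * l * U₁ + 4 * l * U₂ + ((Sum 3 λ b a w → 4 * l * N * (ι (p b a) * E b a w)) + (Sum 3 λ b a w → 4 * (l * l) * (E b a w * Loss.D b a w)) + Y)
        ≡⟨ cong (λ z → 4 * l * U₁ + 4 * l * U₂ + (z + Y)) (cong₂ _+_
             (trans (sum-* 3 (4 * l * N) (λ b a w → ι (p b a) * E b a w)) (cong (4 * l * N *_) (sum-cong 2 λ b a → ∑-* vs (ι (p b a)) _)))
             (sum-* 3 (4 * (l * l)) (λ b a w → E b a w * Loss.D b a w))) ⟩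
      4 * l * U₁ + 4 * l * U₂ + (4 * l * N * Sdp + 4 * (l * l) * U₃ + Y) ∎
      where open ≤-Reasoning

-- Choice of a good edge xyz.

3F≤-arith : ∀ k S n F z → S ≤ n * F + n * F + n * F → k * F ≤ 41 * z → k * S ≤ 123 * (n * z)
3F≤-arith k S n F z h₁ h₂ = lin 0 (k ⊗ h₁ ⊕ (3 * n) ⊗ h₂) (solve (k ∷ S ∷ n ∷ F ∷ z ∷ []))

2F+G≤-arith : ∀ k S n F G z → S ≤ n * F + n * (n * G) + n * F → k * F ≤ 41 * (n * z) → k * G ≤ 40 * z → k * S ≤ 122 * (n * (n * z))
2F+G≤-arith k S n F G z h₁ h₂ h₃ = lin 0 (k ⊗ h₁ ⊕ (2 * n) ⊗ h₂ ⊕ (n * n) ⊗ h₃) (solve (k ∷ S ∷ n ∷ F ∷ G ∷ z ∷ []))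

W-*-eq : ∀ a b c → a * (b * c) ≡ b * (a * c)
W-*-eq = solve-∀

Wos-eq : ∀ a b c → 2 * a + 2 * b + 2 * c ≡ 2 * (a + b + c)
Wos-eq = solve-∀

Wovs-eq : ∀ a → 2 * a + a ≡ 3 * a
Wovs-eq = solve-∀

kWscore≤-arith : ∀ k n Δ m p q r v z → k * v ≤ n * v → k * Δ ≤ 80 * (n * (n * z)) → k * m ≤ 123 * (n * (n * (n * z))) → k * p ≤ 123 * (n * (n * (n * z))) →
  k * q ≤ 122 * (n * (n * (n * z))) → k * r ≤ 122 * (n * (n * (n * z))) → v ≤ n * (n * n) →
  k * (n * n * (2 * Δ) + n * (m + 2 * (p + q + r)) + z * (3 * v)) ≤ 1100 * (n * (n * (n * (n * z))))
kWscore≤-arith k n Δ m p q r v z h₀ h₁ h₂ h₃ h₄ h₅ h₆ =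
  lin (80 * (n * (n * (n * (n * z)))))
    ((3 * z) ⊗ h₀ ⊕ (2 * n * n) ⊗ h₁ ⊕ n ⊗ h₂ ⊕ (2 * n) ⊗ h₃ ⊕ (2 * n) ⊗ h₄ ⊕ (2 * n) ⊗ h₅ ⊕ (3 * z * n) ⊗ h₆)
    (solve (k ∷ n ∷ Δ ∷ m ∷ p ∷ q ∷ r ∷ v ∷ z ∷ []))

8nT≤-eq₁ : ∀ n T → 8 * (n * T) ≡ 8 * n * T
8nT≤-eq₁ = solve-∀

8nT≤-eq₂ : ∀ n d → 8 * n * d ≡ 2 * (4 * d * n)
8nT≤-eq₂ = solve-∀

8nT≤-eq₃ : ∀ d n → 4 * d * (4 * d) + n * n ≡ 16 * (d * d) + n * n
8nT≤-eq₃ = solve-∀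

scaled-seventh : ∀ n → n * (n * (n * (n * (n * (n * n))))) ≡ n * (n * (n * n) * (n * (n * n)))
scaled-seventh = solve-∀

scaled-arith : ∀ k n T L w D z → 8 * (n * T) ≤ 16 * D + n * z → k * w ≤ 1100 * (n * (z * z)) → k * z ≤ 4 * (k * T) + z → 26 + 1100 * L < k →
  k * (96 * (n * z) * T + L * w) + n * (z * z) ≤ k * (400 * (z * D))
scaled-arith k n T L w D z h₁ h₂ h₃ h₄ =
  lin 0 ((25 * (k * z)) ⊗ h₁ ⊕ L ⊗ h₂ ⊕ (26 * (n * z)) ⊗ h₃ ⊕ (n * (z * z)) ⊗ h₄) (solve (k ∷ n ∷ T ∷ L ∷ w ∷ D ∷ z ∷ []))

select-good-arith₁ : ∀ n z s γ → 96 * (n * z) + 400 * s ≤ 400 * (z * γ) → z * (6 * n) ≤ z * (25 * γ)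
select-good-arith₁ n z s γ h = linc 15 (400 * s) h (solve (n ∷ z ∷ s ∷ γ ∷ []))

select-good-arith₂ : ∀ n z s γ → 96 * (n * z) + 400 * s ≤ 400 * (z * γ) → γ ≤ n → s ≤ n * z
select-good-arith₂ n z s γ h h′ = linc 399 (96 * (n * z)) (h ⊕ (400 * z) ⊗ h′) (solve (n ∷ z ∷ s ∷ γ ∷ []))

module Select {V : Set} (H : Free V) (vs : List V) (uniq : Unique vs) (k : ℕ) (2≤k : 2 ≤ k)
              (k³≤n : k * (k * k) ≤ length vs)
              (near : k * (length vs * (length vs * length vs)) ≤ 4 * (k * Counts.T H vs k) + length vs * (length vs * length vs)) where

  open Free H
  open Sums vs
  open Counts H vs k
  open Inequality H vs uniq k 2≤k
  open Weights H vs uniq k 2≤k k³≤n hiding (x)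
  open Near H vs uniq k 2≤k k³≤n near

  -- For an edge xyz the parts are A = N(yz), B = N(xz), C = N(xy).
  miss o₁ o₂ o₃ ov : V → V → V → ℕ
  miss x y z = Sum 3 λ a b c → E y z a * (E x z b * (E x y c * nE a b c))
  o₁   x y z = Sum 3 λ v a b → E y z a * (E x z b * (nE x y v * E v a b))
  o₂   x y z = Sum 3 λ v a b → E y z a * (E x z b * (nE x z v * R a b v))
  o₃   x y z = Sum 3 λ v a b → E y z a * (E x z b * (nE y z v * R b a v))
  ov   x y z = Sum 1 λ v → E y z v * E x z v

  weigh : ∀ j (f : V → V → V → Fun j) →
          (Sum 3 λ x y z → E x y z * Sum j (f x y z)) ≡ (Sum 3 λ x y z → Sum j (scale j (E x y z) (f x y z)))
  weigh j f = sum-cong 3 λ x y z → sym (sum-* j (E x y z) (f x y z))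

  drop₁ : ∀ f → Sum 6 (λ _ → f) ≡ n * Sum 5 f
  drop₁ f = sum-drop 5 f

  n⁶ : ℕ
  n⁶ = n * n⁵

  private
    3F≤ : ∀ S → S ≤ n * SF + n * SF + n * SF → k * S ≤ 123 * n⁶
    3F≤ S h = 3F≤-arith k S n SF n⁵ h kSF≤

    2F+G≤ : ∀ S → S ≤ n * SF + n * (n * SG) + n * SF → k * S ≤ 122 * n⁶
    2F+G≤ S h = 2F+G≤-arith k S n SF SG n⁴ h kSF≤ kSG≤

  Smiss So₁ So₂ So₃ Sov : ℕ
  Smiss = Sum 3 λ x y z → E x y z * miss x y z
  So₁   = Sum 3 λ x y z → E x y z * o₁ x y z
  So₂   = Sum 3 λ x y z → E x y z * o₂ x y z
  So₃   = Sum 3 λ x y z → E x y z * o₃ x y z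
  Sov   = Sum 3 λ x y z → E x y z * ov x y z

  -- Closing a path in the link of x gives the edge xbc, then one in the link of z gives zab, and
  -- one in the link of b gives abc. Every failure of one of the three steps is counted by `SF`.
  kSmiss≤ : k * Smiss ≤ 123 * n⁶
  kSmiss≤ = 3F≤ Smiss (begin
    Smiss
      ≡⟨ weigh 3 (λ x y z a b c → E y z a * (E x z b * (E x y c * nE a b c))) ⟩
    (Sum 6 λ x y z a b c → E x y z * (E y z a * (E x z b * (E x y c * nE a b c))))
      ≤⟨ sum-mono₃ 6 (λ x y z a b c → F x z y c b) (λ x y z a b c → F z y x b a) (λ x y z a b c → F b x z a c) pt ⟩
    (Sum 6 λ x y z a b c → F x z y c b) + (Sum 6 λ x y z a b c → F z y x b a) + (Sum 6 λ x y z a b c → F b x z a c)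
      ≡⟨ cong₂ _+_ (cong₂ _+_
           (trans (perm 6 (2 ∷ 1 ∷ 0 ∷ 2 ∷ 4 ∷ []) (λ a x z y c b → F x z y c b)) (drop₁ F))
           (trans (perm 6 (4 ∷ 3 ∷ 2 ∷ 1 ∷ 0 ∷ 2 ∷ 1 ∷ 2 ∷ 4 ∷ []) (λ c z y x b a → F z y x b a)) (drop₁ F)))
           (trans (perm 6 (0 ∷ 3 ∷ 2 ∷ 1 ∷ []) (λ y b x z a c → F b x z a c)) (drop₁ F)) ⟩
    n * SF + n * SF + n * SF ∎)
    where
    open ≤-Reasoning
    pt : ∀ x y z a b c → E x y z * (E y z a * (E x z b * (E x y c * nE a b c))) ≤ F x z y c b + F z y x b a + F b x z a c
    pt x y z a b c rewrite sym₂₃ x z y | rev z y x | sym₁₂ z x b | sym₁₂ z y a | rotˡ b x z | rotˡ b z a | sym₁₂ b x c | rotʳ b c a =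
      byCases 7 (λ p q r s t u v → ι p * (ι q * (ι r * (ι s * ι (not t)))))
                (λ p q r s t u v → ι p * (ι s * (ι r * ι (not u))) + ι p * (ι r * (ι q * ι (not v))) + ι r * (ι v * (ι u * ι (not t)))) refl
                (e x y z) (e y z a) (e x z b) (e x y c) (e a b c) (e x b c) (e z a b)

  -- From an edge vab, closing paths in the links of z, a and y yields zab, avy and finally xyv,
  -- against the choice of v outside N(xy).
  kSo₁≤ : k * So₁ ≤ 123 * n⁶
  kSo₁≤ = 3F≤ So₁ (begin
    So₁
      ≡⟨ weigh 3 (λ x y z v a b → E y z a * (E x z b * (nE x y v * E v a b))) ⟩
    (Sum 6 λ x y z v a b → E x y z * (E y z a * (E x z b * (nE x y v * E v a b))))
      ≤⟨ sum-mono₃ 6 (λ x y z v a b → F z y x b a) (λ x y z v a b → F a b z y v) (λ x y z v a b → F y a z x v) pt ⟩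
    (Sum 6 λ x y z v a b → F z y x b a) + (Sum 6 λ x y z v a b → F a b z y v) + (Sum 6 λ x y z v a b → F y a z x v)
      ≡⟨ cong₂ _+_ (cong₂ _+_
           (trans (perm 6 (2 ∷ 1 ∷ 0 ∷ 2 ∷ 1 ∷ 2 ∷ 4 ∷ []) (λ v z y x b a → F z y x b a)) (drop₁ F))
           (trans (perm 6 (3 ∷ 2 ∷ 1 ∷ 4 ∷ 3 ∷ 2 ∷ 3 ∷ []) (λ x a b z y v → F a b z y v)) (drop₁ F)))
           (trans (perm 6 (4 ∷ 3 ∷ 2 ∷ 1 ∷ 0 ∷ 1 ∷ 4 ∷ 3 ∷ 2 ∷ 3 ∷ []) (λ b y a z x v → F y a z x v)) (drop₁ F)) ⟩
    n * SF + n * SF + n * SF ∎)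
    where
    open ≤-Reasoning
    pt : ∀ x y z v a b → E x y z * (E y z a * (E x z b * (nE x y v * E v a b))) ≤ F z y x b a + F a b z y v + F y a z x v
    pt x y z v a b rewrite rev z y x | sym₁₂ z x b | sym₁₂ z y a | rotʳ a b z | rev a z y | rotʳ a b v | sym₂₃ y a z | rotʳ y z x | rotˡ y a v | rotʳ y v x =
      byCases 7 (λ p q r s t u w → ι p * (ι q * (ι r * (ι (not s) * ι t))))
                (λ p q r s t u w → ι p * (ι r * (ι q * ι (not u))) + ι u * (ι q * (ι t * ι (not w))) + ι q * (ι p * (ι w * ι (not s)))) refl
                (e x y z) (e y z a) (e x z b) (e x y v) (e v a b) (e z a b) (e a v y)

  G : V → V → V → V → ℕ
  G b a w c = E b a w * (nE b w c * R b a c)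

  drop₂ : ∀ f → Sum 6 (λ _ _ → f) ≡ n * (n * Sum 4 f)
  drop₂ f = trans (sum-drop 5 (λ _ → f)) (cong (n *_) (sum-drop 4 f))

  -- As for `kSo₁≤`, except that the middle step starts from a relation: zab together with `R a b v`
  -- gives azv unless the excess counted by `G` occurs. Closing a path in the link of z then puts v
  -- into N(xz).
  kSo₂≤ : k * So₂ ≤ 122 * n⁶
  kSo₂≤ = 2F+G≤ So₂ (begin
    So₂
      ≡⟨ weigh 3 (λ x y z v a b → E y z a * (E x z b * (nE x z v * R a b v))) ⟩
    (Sum 6 λ x y z v a b → E x y z * (E y z a * (E x z b * (nE x z v * R a b v))))
      ≤⟨ sum-mono₃ 6 (λ x y z v a b → F z y x b a) (λ x y z v a b → G a b z v) (λ x y z v a b → F z a y x v) pt ⟩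
    (Sum 6 λ x y z v a b → F z y x b a) + (Sum 6 λ x y z v a b → G a b z v) + (Sum 6 λ x y z v a b → F z a y x v)
      ≡⟨ cong₂ _+_ (cong₂ _+_
           (trans (perm 6 (2 ∷ 1 ∷ 0 ∷ 2 ∷ 1 ∷ 2 ∷ 4 ∷ []) (λ v z y x b a → F z y x b a)) (drop₁ F))
           (trans (perm 6 (3 ∷ 2 ∷ 4 ∷ 3 ∷ []) (λ x y a b z v → G a b z v)) (drop₂ G)))
           (trans (perm 6 (4 ∷ 3 ∷ 2 ∷ 1 ∷ 0 ∷ 2 ∷ 1 ∷ 4 ∷ 3 ∷ 2 ∷ 3 ∷ []) (λ b z a y x v → F z a y x v)) (drop₁ F)) ⟩
    n * SF + n * (n * SG) + n * SF ∎)
    where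
    open ≤-Reasoning
    pt : ∀ x y z v a b → E x y z * (E y z a * (E x z b * (nE x z v * R a b v))) ≤ F z y x b a + G a b z v + F z a y x v
    pt x y z v a b rewrite rev z y x | sym₁₂ z x b | sym₁₂ z y a | rotʳ a b z | rotʳ z a y | sym₁₂ z a v | rotʳ z v x =
      byCases 7 (λ p q r s t u w → ι p * (ι q * (ι r * (ι (not s) * ι t))))
                (λ p q r s t u w → ι p * (ι r * (ι q * ι (not u))) + ι u * (ι (not w) * ι t) + ι q * (ι p * (ι w * ι (not s)))) refl
                (e x y z) (e y z a) (e x z b) (e x z v) (r a b v) (e z a b) (e a z v)

  kSo₃≤ : k * So₃ ≤ 122 * n⁶
  kSo₃≤ = 2F+G≤ So₃ (begin
    So₃
      ≡⟨ weigh 3 (λ x y z v a b → E y z a * (E x z b * (nE y z v * R b a v))) ⟩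
    (Sum 6 λ x y z v a b → E x y z * (E y z a * (E x z b * (nE y z v * R b a v))))
      ≤⟨ sum-mono₃ 6 (λ x y z v a b → F z y x b a) (λ x y z v a b → G b a z v) (λ x y z v a b → F z b x y v) pt ⟩
    (Sum 6 λ x y z v a b → F z y x b a) + (Sum 6 λ x y z v a b → G b a z v) + (Sum 6 λ x y z v a b → F z b x y v)
      ≡⟨ cong₂ _+_ (cong₂ _+_
           (trans (perm 6 (2 ∷ 1 ∷ 0 ∷ 2 ∷ 1 ∷ 2 ∷ 4 ∷ []) (λ v z y x b a → F z y x b a)) (drop₁ F))
           (trans (perm 6 (4 ∷ 3 ∷ 2 ∷ 4 ∷ 3 ∷ []) (λ x y b a z v → G b a z v)) (drop₂ G)))
           (trans (perm 6 (3 ∷ 2 ∷ 1 ∷ 0 ∷ 2 ∷ 1 ∷ 4 ∷ 3 ∷ 2 ∷ []) (λ a z b x y v → F z b x y v)) (drop₁ F)) ⟩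
    n * SF + n * (n * SG) + n * SF ∎)
    where
    open ≤-Reasoning
    pt : ∀ x y z v a b → E x y z * (E y z a * (E x z b * (nE y z v * R b a v))) ≤ F z y x b a + G b a z v + F z b x y v
    pt x y z v a b rewrite rev z y x | sym₁₂ z x b | sym₁₂ z y a | rev b a z | rotʳ z b x | rotˡ z x y | sym₁₂ z b v | rotʳ z v y =
      byCases 7 (λ p q r s t u w → ι p * (ι q * (ι r * (ι (not s) * ι t))))
                (λ p q r s t u w → ι p * (ι r * (ι q * ι (not u))) + ι u * (ι (not w) * ι t) + ι r * (ι p * (ι w * ι (not s)))) refl
                (e x y z) (e y z a) (e x z b) (e y z v) (r b a v) (e z a b) (e b z v)

  Sov≤ : Sov ≤ n³
  Sov≤ = ≤-trans (≤-reflexive (trans (weigh 1 (λ x y z v → E y z v * E x z v)) (trans (sum-cong 4 pt)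
           (perm 4 (2 ∷ []) (λ x y v z → E x z y * (E z x v * E z y v)))))) apexes
    where
    pt : ∀ x y z v → E x y z * (E y z v * E x z v) ≡ E x z y * (E z x v * E z y v)
    pt x y z v rewrite sym₂₃ x z y | sym₁₂ z x v | sym₁₂ z y v = cong (E x y z *_) (*-comm (E y z v) (E x z v))

  W : (V → V → V → ℕ) → ℕ
  W f = Sum 3 λ x y z → E x y z * f x y z

  W-+ : ∀ f h → W (λ x y z → f x y z + h x y z) ≡ W f + W h
  W-+ f h = trans (sum-cong 3 λ x y z → *-distribˡ-+ (E x y z) (f x y z) (h x y z)) (sum-+ 3 (λ x y z → E x y z * f x y z) _)

  W-* : ∀ c f → W (λ x y z → c * f x y z) ≡ c * W f
  W-* c f = trans (sum-cong 3 λ x y z → W-*-eq (E x y z) c (f x y z)) (sum-* 3 c (λ x y z → E x y z * f x y z))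

  W-yxz : ∀ f → W (λ x y z → f y x z) ≡ W f
  W-yxz f = trans (sum-cong 3 λ x y z → cong (λ t → ι t * f y x z) (sym₁₂ x y z)) (perm 3 (0 ∷ []) (λ x y z → E x y z * f x y z))

  W-xzy : ∀ f → W (λ x y z → f x z y) ≡ W f
  W-xzy f = trans (sum-cong 3 λ x y z → cong (λ t → ι t * f x z y) (sym₂₃ x y z)) (perm 3 (1 ∷ []) (λ x y z → E x y z * f x y z))

  W-zyx : ∀ f → W (λ x y z → f z y x) ≡ W f
  W-zyx f = trans (W-yxz (λ x y z → f z x y)) (trans (W-xzy (λ x y z → f y x z)) (W-yxz f))

  δ² ovs os : V → V → V → ℕ
  δ² x y z  = δ x y z * δ x y z
  ovs x y z = (ov x y z + ov x z y) + ov z y x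
  os x y z  = ((o₁ x y z + o₁ x z y) + (o₂ x y z + o₂ x z y)) + (o₃ x y z + o₃ x z y)

  -- Every summand has total degree 4 in n.
  score : V → V → V → ℕ
  score x y z = n * n * (δ² x y z + δ² y x z) + n * (miss x y z + os x y z) + n³ * ovs x y z

  n⁷ : ℕ
  n⁷ = n * n⁶

  Wscore : W score ≡ n * n * (2 * SΔ) + n * (Smiss + 2 * (So₁ + So₂ + So₃)) + n³ * (3 * Sov)
  Wscore = begin
    W score
      ≡⟨ W-+ (λ x y z → n * n * (δ² x y z + δ² y x z) + n * (miss x y z + os x y z)) (λ x y z → n³ * ovs x y z) ⟩
    W (λ x y z → n * n * (δ² x y z + δ² y x z) + n * (miss x y z + os x y z)) + W (λ x y z → n³ * ovs x y z)
      ≡⟨ cong₂ _+_ (trans (W-+ (λ x y z → n * n * (δ² x y z + δ² y x z)) (λ x y z → n * (miss x y z + os x y z)))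
            (cong₂ _+_ (W-* (n * n) (λ x y z → δ² x y z + δ² y x z)) (W-* n (λ x y z → miss x y z + os x y z)))) (W-* n³ ovs) ⟩
    n * n * W (λ x y z → δ² x y z + δ² y x z) + n * W (λ x y z → miss x y z + os x y z) + n³ * W ovs
      ≡⟨ cong₂ _+_ (cong₂ _+_ (cong (n * n *_) (trans (W-+ δ² (λ x y z → δ² y x z)) (double SΔ (W-yxz δ²)))) (cong (n *_) (trans (W-+ miss os) (cong (Smiss +_) Wos)))) (cong (n³ *_) Wovs) ⟩
    n * n * (2 * SΔ) + n * (Smiss + 2 * (So₁ + So₂ + So₃)) + n³ * (3 * Sov) ∎
    where
    open Relation.Binary.PropositionalEquality.≡-Reasoning
    double : ∀ a {b} → b ≡ a → a + b ≡ 2 * a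
    double a refl = cong (a +_) (sym (+-identityʳ a))
    pair : ∀ f → W (λ x y z → f x y z + f x z y) ≡ 2 * W f
    pair f = trans (W-+ f (λ x y z → f x z y)) (double (W f) (W-xzy f))
    Wos : W os ≡ 2 * (So₁ + So₂ + So₃)
    Wos = trans (W-+ (λ x y z → (o₁ x y z + o₁ x z y) + (o₂ x y z + o₂ x z y)) (λ x y z → o₃ x y z + o₃ x z y))
         (trans (cong₂ _+_ (trans (W-+ (λ x y z → o₁ x y z + o₁ x z y) (λ x y z → o₂ x y z + o₂ x z y)) (cong₂ _+_ (pair o₁) (pair o₂))) (pair o₃))
         (Wos-eq So₁ So₂ So₃))
    Wovs : W ovs ≡ 3 * Sov
    Wovs = trans (W-+ (λ x y z → ov x y z + ov x z y) (λ x y z → ov z y x))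
          (trans (cong₂ _+_ (pair ov) (W-zyx ov)) (Wovs-eq Sov))

  k≤n : k ≤ n
  k≤n = ≤-trans (≤-trans (≤-reflexive (sym (*-identityʳ k))) (*-monoʳ-≤ k (*-mono-≤ {1} (<⇒≤ 2≤k) (<⇒≤ 2≤k)))) k³≤n

  kWscore≤ : k * W score ≤ 1100 * n⁷
  kWscore≤ = ≤-trans (≤-reflexive (cong (k *_) Wscore))
    (kWscore≤-arith k n SΔ Smiss So₁ So₂ So₃ Sov n³ (*-monoˡ-≤ Sov k≤n) kSΔ≤ kSmiss≤ kSo₁≤ kSo₂≤ kSo₃≤ Sov≤)

  -- Averaging over the edges. By 2(4d)n ≤ 16d² + n² the mean codegree of a pair of vertices inside
  -- an edge is at least about n/4. The demand 96/400 = 0.24 stays below this and leaves room for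
  -- the penalty `L * score`.
  select : ∀ L → 26 + 1100 * L < k →
           Σ V λ x → Σ V λ y → Σ V λ z → e x y z ≡ true × 96 * n⁴ + L * score x y z ≤ 400 * (n³ * d x y)
  select L k-big = x₀ , y₀ , z₀ , edge-of (e x₀ y₀ z₀) found , bound-of (e x₀ y₀ z₀) found
    where
    SD : ℕ
    SD = Sum 2 λ x y → d x y * d x y
    lhs : (Sum 3 λ x y z → E x y z * (96 * n⁴ + L * score x y z)) ≡ 96 * n⁴ * T + L * W score
    lhs = trans (W-+ (λ _ _ _ → 96 * n⁴) (λ x y z → L * score x y z)) (cong₂ _+_
      (trans (sum-cong 3 λ x y z → *-comm (E x y z) (96 * n⁴)) (sum-* 3 (96 * n⁴) E)) (W-* L score))
    rhs : (Sum 3 λ x y z → E x y z * (400 * (n³ * d x y))) ≡ 400 * (n³ * SD)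
    rhs = trans (W-* 400 (λ x y z → n³ * d x y)) (cong (400 *_) (trans (W-* n³ (λ x y z → d x y))
      (cong (n³ *_) (sum-cong 2 λ x y → ∑E* x y (d x y)))))
    8nT≤ : 8 * (n * T) ≤ 16 * SD + n⁴
    8nT≤ = begin
      8 * (n * T)                                    ≡⟨ 8nT≤-eq₁ n T ⟩
      8 * n * T                                      ≡⟨ sum-* 2 (8 * n) d ⟨
      (Sum 2 λ x y → 8 * n * d x y)                  ≤⟨ sum-mono₂ 2 (λ x y → 16 * (d x y * d x y)) (λ x y → n * n) (λ x y → ≤-trans (≤-reflexive (8nT≤-eq₂ n (d x y))) (≤-trans (2ab≤a²+b² (4 * d x y) n) (≤-reflexive (8nT≤-eq₃ (d x y) n)))) ⟩
      (Sum 2 λ x y → 16 * (d x y * d x y)) + (Sum 2 λ x y → n * n) ≡⟨ cong₂ _+_ (sum-* 2 16 (λ x y → d x y * d x y)) (sum-const₂ (n * n)) ⟩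
      16 * SD + n⁴                                   ∎
      where
      open ≤-Reasoning
    1≤n⁷ : 1 ≤ n⁷
    1≤n⁷ = *-mono-≤ 1≤n (*-mono-≤ 1≤n (*-mono-≤ 1≤n (*-mono-≤ 1≤n (*-mono-≤ 1≤n (*-mono-≤ 1≤n 1≤n)))))
      where
      1≤n : 1 ≤ n
      1≤n = ≤-trans 1≤s s≤n
    scaled : k * (96 * n⁴ * T + L * W score) + n⁷ ≤ k * (400 * (n³ * SD))
    scaled = subst (λ m → k * (96 * n⁴ * T + L * W score) + m ≤ k * (400 * (n³ * SD))) (sym n⁷≡)
        (scaled-arith k n T L (W score) SD n³ 8nT≤ (subst (λ m → k * W score ≤ 1100 * m) n⁷≡ kWscore≤) near k-big)
      where
      n⁷≡ : n⁷ ≡ n * (n³ * n³)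
      n⁷≡ = scaled-seventh n
    strict : (Sum 3 λ x y z → E x y z * (96 * n⁴ + L * score x y z)) < (Sum 3 λ x y z → E x y z * (400 * (n³ * d x y)))
    strict = subst₂ _<_ (sym lhs) (sym rhs) (*-cancelˡ-< k _ _ (≤-trans (≤-trans (≤-reflexive (+-comm 1 _)) (+-monoʳ-≤ (k * (96 * n⁴ * T + L * W score)) 1≤n⁷)) scaled))
    edge-of : ∀ b {p q} → ι b * p < ι b * q → b ≡ true
    edge-of true  _ = refl
    edge-of false ()
    bound-of : ∀ b {p q} → ι b * p < ι b * q → p ≤ q
    bound-of true {p} {q} h = <⇒≤ (subst₂ _<_ (+-identityʳ p) (+-identityʳ q) h)
    bound-of false ()
    witness = sum-<⇒∃ (λ x y z → E x y z * (96 * n⁴ + L * score x y z)) (λ x y z → E x y z * (400 * (n³ * d x y))) strict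
    x₀ = proj₁ witness
    y₀ = proj₁ (proj₂ witness)
    z₀ = proj₁ (proj₂ (proj₂ witness))
    found = proj₂ (proj₂ (proj₂ witness))

  select-good : ∀ K → 26 + 1100 * (400 * K) < k →
                Σ V λ x → Σ V λ y → Σ V λ z → e x y z ≡ true × 6 * n ≤ 25 * d x y × K * score x y z ≤ n⁴
  select-good K h = x , y , z , proj₁ found ,
      *-cancelˡ-≤ n³ (select-good-arith₁ n n³ (K * score x y z) (d x y) chosen) , select-good-arith₂ n n³ (K * score x y z) (d x y) chosen (d≤n x y)
    where
    instance
      n³≢0 : NonZero n³
      n³≢0 = >-nonZero (*-mono-≤ {1} 1≤n (*-mono-≤ {1} 1≤n 1≤n))
        where
        1≤n : 1 ≤ n
        1≤n = ≤-trans 1≤s s≤n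
    picked = select (400 * K) h
    x = proj₁ picked
    y = proj₁ (proj₂ picked)
    z = proj₁ (proj₂ (proj₂ picked))
    found = proj₂ (proj₂ (proj₂ picked))
    chosen : 96 * (n * n³) + 400 * (K * score x y z) ≤ 400 * (n³ * d x y)
    chosen = subst (λ t → 96 * (n * n³) + t ≤ 400 * (n³ * d x y)) (*-assoc 400 K (score x y z)) (proj₂ found)

-- The near partition given by a good edge.

square-cancel : ∀ a b → a * a ≤ b * b → a ≤ b
square-cancel a b h = ≮⇒≥ λ b<a → <⇒≱ (*-mono-< b<a b<a) h

module Parts {V : Set} (H : Free V) (vs : List V) (p : V → Fin 3) where

  open Free H
  open Sums vs

  I : Fin 3 → V → ℕ
  I i v = ι (does (p v ≟ᶠ i))

  size : Fin 3 → ℕ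
  size i = Sum 1 (I i)

  missing : Fin 3 → Fin 3 → Fin 3 → ℕ
  missing i j h = Sum 3 λ a b c → I i a * (I j b * (I h c * nE a b c))

record Close {V : Set} (H : Free V) (vs : List V) (p : V → Fin 3) (J : ℕ) : Set where
  open Parts H vs p
  field
    size≤    : ∀ i → J * (3 * size i) ≤ J * length vs + length vs
    ≤size    : ∀ i → J * length vs ≤ J * (3 * size i) + length vs
    missing≤ : J * missing f0 (fs f0) (fs (fs f0)) ≤ length vs * (length vs * length vs)

nonrelᵇ-cases : ∀ p q r t f g h i j {i′ j′} → i′ ≡ i → j′ ≡ j →
  ι (not p ∧ not q ∧ not r) * (ι t * (ι f * ι (not h))) ≤ ι (not g ∧ not h ∧ not i ∧ not j) + ι t * (ι f * (ι (not r) * ι g)) + ι t * (ι f * (ι (not q) * ι i′)) + ι t * (ι f * (ι (not p) * ι j′))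
nonrelᵇ-cases p q r t f g h i j refl refl =
  byCases 9 (λ p q r t f g h i j → ι (not p ∧ not q ∧ not r) * (ι t * (ι f * ι (not h))))
            (λ p q r t f g h i j → ι (not g ∧ not h ∧ not i ∧ not j) + ι t * (ι f * (ι (not r) * ι g)) + ι t * (ι f * (ι (not q) * ι i)) + ι t * (ι f * (ι (not p) * ι j))) refl
            p q r t f g h i j

nonrelᶜ-cases : ∀ p q r t f g h i j {i′ j′ t′ p′} → i′ ≡ i → j′ ≡ j → t′ ≡ t → p′ ≡ p →
  ι (not p ∧ not q ∧ not r) * (ι t * (ι f * ι (not h))) ≤ ι (not g ∧ not h ∧ not i ∧ not j) + ι t′ * (ι f * (ι (not q) * ι g)) + ι t′ * (ι f * (ι (not r) * ι i′)) + ι t′ * (ι f * (ι (not p′) * ι j′))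
nonrelᶜ-cases p q r t f g h i j refl refl refl refl =
  byCases 9 (λ p q r t f g h i j → ι (not p ∧ not q ∧ not r) * (ι t * (ι f * ι (not h))))
            (λ p q r t f g h i j → ι (not g ∧ not h ∧ not i ∧ not j) + ι t * (ι f * (ι (not q) * ι g)) + ι t * (ι f * (ι (not r) * ι i)) + ι t * (ι f * (ι (not p) * ι j))) refl
            p q r t f g h i j

d-upper-cases : ∀ f g h a b c t s {t′} → t′ ≡ t →
  ι ((not f ∧ not g ∧ not h) ∧ t) * ι s ≤ ι (not f ∧ not g ∧ not h) * (ι t * ι (not a ∧ not b ∧ not c)) + ι (not f ∧ not g ∧ not h) * (ι t * (ι a * ι s)) + ι t * (ι b * (ι (not h) * ι s)) + ι t′ * (ι c * (ι (not g) * ι s))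
d-upper-cases f g h a b c t s refl =
  byCases 8 (λ f g h a b c t s → ι ((not f ∧ not g ∧ not h) ∧ t) * ι s)
            (λ f g h a b c t s → ι (not f ∧ not g ∧ not h) * (ι t * ι (not a ∧ not b ∧ not c)) + ι (not f ∧ not g ∧ not h) * (ι t * (ι a * ι s)) + ι t * (ι b * (ι (not h) * ι s)) + ι t * (ι c * (ι (not g) * ι s))) refl
            f g h a b c t s

disjoint-cases : ∀ a b c {a′ c′ b′} → a′ ≡ a → c′ ≡ c → b′ ≡ b →
  ι a + ι b + ι c + ι (not a ∧ not b ∧ not c) ≤ 1 + ι a * ι b + ι a′ * ι c + ι c′ * ι b′
disjoint-cases a b c refl refl refl =
  byCases 3 (λ a b c → ι a + ι b + ι c + ι (not a ∧ not b ∧ not c))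
            (λ a b c → 1 + ι a * ι b + ι a * ι c + ι c * ι b) refl
            a b c

root-eq : ∀ J t → J * t * (J * t) ≡ J * J * (t * t)
root-eq = solve-∀

disjoint-eq : ∀ n a b c → n + a + b + c ≡ n + ((a + b) + c)
disjoint-eq = solve-∀

room-arith : ∀ n α β γ ω θ s t → α + β + γ + ω ≤ n + θ → γ ≤ α + s → γ ≤ β + t → 45 * θ ≤ n → 45 * s ≤ n → 45 * t ≤ n → 6 * n ≤ 25 * γ →
        10 * ω + n ≤ 10 * (β + γ)
room-arith n α β γ ω θ s t h₁ h₂ h₃ h₄ h₅ h₆ h₇ =
  linc 8 n (90 ⊗ h₁ ⊕ 90 ⊗ h₂ ⊕ 180 ⊗ h₃ ⊕ 2 ⊗ h₄ ⊕ 2 ⊗ h₅ ⊕ 4 ⊗ h₆ ⊕ 18 ⊗ h₇) (solve (n ∷ α ∷ β ∷ γ ∷ ω ∷ θ ∷ s ∷ t ∷ []))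

Q≤d-eq : ∀ K s z → 65 * K * s + 65 * z ≡ 65 * (K * s + z)
Q≤d-eq = solve-∀

Knonrelᵇ≤-arith : ∀ K N P a a′ b b′ c c′ z → N ≤ P + a + b + c → K * P ≤ z → K * (((a + a′) + (b + b′)) + (c + c′)) ≤ z → K * N ≤ 2 * z
Knonrelᵇ≤-arith K N P a a′ b b′ c c′ z h₁ h₂ h₃ = lin (K * (a′ + b′ + c′)) (K ⊗ h₁ ⊕ h₂ ⊕ h₃) (solve (K ∷ N ∷ P ∷ a ∷ a′ ∷ b ∷ b′ ∷ c ∷ c′ ∷ z ∷ []))

Knonrel≤-arith : ∀ K N N′ P a a′ b b′ c c′ z → N ≤ P + a + b + c → N′ ≤ P + a′ + b′ + c′ → K * P ≤ z → K * (((a + a′) + (b + b′)) + (c + c′)) ≤ z → K * (N + N′) ≤ 3 * z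
Knonrel≤-arith K N N′ P a a′ b b′ c c′ z h₁ h₂ h₃ h₄ =
  lin 0 (K ⊗ h₁ ⊕ K ⊗ h₂ ⊕ 2 ⊗ h₃ ⊕ h₄) (solve (K ∷ N ∷ N′ ∷ P ∷ a ∷ a′ ∷ b ∷ b′ ∷ c ∷ c′ ∷ z ∷ []))

KYaa≤-arith : ∀ K n β Y N G o z → β * Y ≤ n * N + G + n * o → K * N ≤ 2 * z → K * G ≤ n * z → K * o ≤ z → 5 * β * (K * Y) ≤ n * (20 * z)
KYaa≤-arith K n β Y N G o z h₁ h₂ h₃ h₄ =
  lin 0 ((5 * K) ⊗ h₁ ⊕ (5 * n) ⊗ h₂ ⊕ 5 ⊗ h₃ ⊕ (5 * n) ⊗ h₄) (solve (K ∷ n ∷ β ∷ Y ∷ N ∷ G ∷ o ∷ z ∷ []))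

Kωα≤-arith : ∀ K n ω α β γ Q d N N′ bc Y o o′ z m → ω * (α * (β + γ)) ≤ Q + N + N′ + ω * (α * bc) → K * Q ≤ K * d + z → d ≤ ω * (α * ω) + Y + o + o′ →
        K * (N + N′) ≤ 3 * z → K * bc ≤ n → K * Y ≤ 20 * z → K * (o + o′) ≤ z → 10 * ω + n ≤ 10 * (β + γ) → m ≡ ω * α → ω * α * n ≤ z →
        K * (ω * (α * n)) ≤ 260 * z
Kωα≤-arith K n ω α β γ Q d N N′ bc Y o o′ z m h₁ h₂ h₃ h₄ h₅ h₆ h₇ h₈ _ h₉ =
  lin 0 ((10 * K) ⊗ h₁ ⊕ 10 ⊗ h₂ ⊕ (10 * K) ⊗ h₃ ⊕ 10 ⊗ h₄ ⊕ (10 * (ω * α)) ⊗ h₅ ⊕ 10 ⊗ h₆ ⊕ 10 ⊗ h₇ ⊕ (K * (ω * α)) ⊗ h₈ ⊕ 10 ⊗ h₉)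
    (solve (K ∷ n ∷ ω ∷ α ∷ β ∷ γ ∷ Q ∷ d ∷ N ∷ N′ ∷ bc ∷ Y ∷ o ∷ o′ ∷ z ∷ []))

Kω≤-arith : ∀ K n ω α → n ≤ 5 * α → K * (ω * (α * n)) ≤ 260 * (n * (n * n)) → n * n * (K * ω) ≤ n * n * (1300 * n)
Kω≤-arith K n ω α h₁ h₂ = lin 0 ((K * ω * n) ⊗ h₁ ⊕ 5 ⊗ h₂) (solve (K ∷ n ∷ ω ∷ α ∷ []))

Jω≤-arith : ∀ J K ω n → 1400 * J ≤ K → K * ω ≤ 1300 * n → J * ω ≤ n
Jω≤-arith J K ω n h₁ h₂ = linc 1299 (100 * (J * ω)) (ω ⊗ h₁ ⊕ h₂) (solve (J ∷ K ∷ ω ∷ n ∷ []))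

JM≤-arith : ∀ J K M m n ω z → M ≤ m + n * (n * ω) → K * m ≤ z → K * ω ≤ 1300 * n → 1400 * J ≤ K → z ≡ n * (n * n) → J * M ≤ z
JM≤-arith J K M m n ω _ h₁ h₂ h₃ h₄ refl = linc 1399 (99 * (n * (n * n))) (K ⊗ h₁ ⊕ h₂ ⊕ (n * n) ⊗ h₃ ⊕ M ⊗ h₄) (solve (J ∷ K ∷ M ∷ m ∷ n ∷ ω ∷ []))

close-arith₀ : ∀ J n α β γ ω θ s t → α + β + γ + ω ≤ n + θ → n ≤ α + β + γ + ω → γ ≤ α + s → α ≤ γ + s → γ ≤ β + t → β ≤ γ + t → J * s ≤ n → J * t ≤ n → J * θ ≤ n → J * ω ≤ n →
         (J * (3 * α) ≤ J * n + 15 * n) × (J * n ≤ J * (3 * α) + 15 * n)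
close-arith₀ J n α β γ ω θ s t h₁ h₂ a₁ a₂ b₁ b₂ Js Jt Jθ Jω =
  lin (J * ω + 11 * n) (J ⊗ h₁ ⊕ (2 * J) ⊗ a₂ ⊕ J ⊗ b₁ ⊕ 2 ⊗ Js ⊕ Jt ⊕ Jθ) (solve (J ∷ n ∷ α ∷ β ∷ γ ∷ ω ∷ θ ∷ s ∷ t ∷ [])) ,
  lin (11 * n) (J ⊗ h₂ ⊕ (2 * J) ⊗ a₁ ⊕ J ⊗ b₂ ⊕ 2 ⊗ Js ⊕ Jt ⊕ Jω) (solve (J ∷ n ∷ α ∷ β ∷ γ ∷ ω ∷ θ ∷ s ∷ t ∷ []))

close-arith₁ : ∀ J n α β γ ω θ s t u → α + β + γ + ω ≤ n + θ → n ≤ α + β + γ + ω → γ ≤ α + s → α ≤ γ + s → γ ≤ β + t → β ≤ γ + t → J * s ≤ n → J * t ≤ n → J * θ ≤ n → J * ω ≤ n →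
         u ≤ β → β ≤ u + θ → (J * (3 * u) ≤ J * n + 15 * n) × (J * n ≤ J * (3 * u) + 15 * n)
close-arith₁ J n α β γ ω θ s t u h₁ h₂ a₁ a₂ b₁ b₂ Js Jt Jθ Jω u₁ u₂ =
  lin (J * ω + 11 * n) (J ⊗ h₁ ⊕ (2 * J) ⊗ b₂ ⊕ J ⊗ a₁ ⊕ 2 ⊗ Jt ⊕ Js ⊕ Jθ ⊕ (3 * J) ⊗ u₁) (solve (J ∷ n ∷ α ∷ β ∷ γ ∷ ω ∷ θ ∷ s ∷ t ∷ u ∷ [])) ,
  lin (8 * n) (J ⊗ h₂ ⊕ (2 * J) ⊗ b₁ ⊕ J ⊗ a₂ ⊕ 2 ⊗ Jt ⊕ Js ⊕ Jω ⊕ (3 * J) ⊗ u₂ ⊕ 3 ⊗ Jθ) (solve (J ∷ n ∷ α ∷ β ∷ γ ∷ ω ∷ θ ∷ s ∷ t ∷ u ∷ []))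

close-arith₂ : ∀ J n α β γ ω θ s t u w → α + β + γ + ω ≤ n + θ → n ≤ α + β + γ + ω → γ ≤ α + s → α ≤ γ + s → γ ≤ β + t → β ≤ γ + t → J * s ≤ n → J * t ≤ n → J * θ ≤ n → J * ω ≤ n →
         u ≤ β → β ≤ u + θ → α + u + w ≡ n → (J * (3 * w) ≤ J * n + 15 * n) × (J * n ≤ J * (3 * w) + 15 * n)
close-arith₂ J n α β γ ω θ s t u w h₁ h₂ a₁ a₂ b₁ b₂ Js Jt Jθ Jω u₁ u₂ h₃ =
  lin (4 * n) (J ⊗ h₂ ⊕ (2 * J) ⊗ a₁ ⊕ J ⊗ b₂ ⊕ 2 ⊗ Js ⊕ Jt ⊕ Jω ⊕ J ⊗ h₂ ⊕ (2 * J) ⊗ b₁ ⊕ J ⊗ a₂ ⊕ 2 ⊗ Jt ⊕ Js ⊕ Jω ⊕ (3 * J) ⊗ u₂ ⊕ 3 ⊗ Jθ ⊕ (3 * J) ⊗ ≤-reflexive h₃)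
    (solve (J ∷ n ∷ α ∷ β ∷ γ ∷ ω ∷ θ ∷ s ∷ t ∷ u ∷ w ∷ [])) ,
  lin (2 * (J * ω) + 7 * n) (J ⊗ h₁ ⊕ (2 * J) ⊗ a₂ ⊕ J ⊗ b₁ ⊕ 2 ⊗ Js ⊕ Jt ⊕ Jθ ⊕ J ⊗ h₁ ⊕ (2 * J) ⊗ b₂ ⊕ J ⊗ a₁ ⊕ 2 ⊗ Jt ⊕ Js ⊕ Jθ ⊕ (3 * J) ⊗ u₁ ⊕ (3 * J) ⊗ ≤-reflexive (sym h₃))
    (solve (J ∷ n ∷ α ∷ β ∷ γ ∷ ω ∷ θ ∷ s ∷ t ∷ u ∷ w ∷ []))

close-eq : ∀ j t → 15 * j * t ≡ 15 * (j * t)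
close-eq = solve-∀

module Cover {V : Set} (H : Free V) (vs : List V) (uniq : Unique vs) (k : ℕ) (2≤k : 2 ≤ k)
             (k³≤n : k * (k * k) ≤ length vs)
             (near : k * (length vs * (length vs * length vs)) ≤ 4 * (k * Counts.T H vs k) + length vs * (length vs * length vs))
             (J K : ℕ) (45≤J : 45 ≤ J) (J²≤K : J * J ≤ K) (1400J≤K : 1400 * J ≤ K)
             (40K≤k : 40 * K ≤ k) (K²≤k : (65 * K) * (65 * K) ≤ k) (x y z : V)
             (γ≥ : 6 * length vs ≤ 25 * Counts.d H vs k x y)
             (K*score≤ : K * Select.score H vs uniq k 2≤k k³≤n near x y z ≤ length vs * (length vs * (length vs * length vs))) where

  open Free H
  open Sums vs
  open Counts H vs k
  open Inequality H vs uniq k 2≤k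
  open Weights H vs uniq k 2≤k k³≤n hiding (x)
  open Near H vs uniq k 2≤k k³≤n near
  open Select H vs uniq k 2≤k k³≤n near

  in-a in-b in-c out : V → Bool
  in-a = e y z
  in-b = e x z
  in-c = e x y
  out v = not (in-a v) ∧ not (in-b v) ∧ not (in-c v)

  A B C O : V → ℕ
  A v = ι (in-a v)
  B v = ι (in-b v)
  C v = ι (in-c v)
  O v = ι (out v)

  α β γ ω : ℕ
  α = Sum 1 A
  β = Sum 1 B
  γ = Sum 1 C
  ω = Sum 1 O

  1≤n : 1 ≤ n
  1≤n = ≤-trans 1≤s s≤n

  instance
    n≢0 : NonZero n
    n≢0 = >-nonZero 1≤n
    n³≢0 : NonZero n³
    n³≢0 = >-nonZero (*-mono-≤ {1} 1≤n (*-mono-≤ {1} 1≤n 1≤n))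

  private
    split : ∀ K n p q m o v → K * (n * n * (p + q) + n * (m + o) + n * (n * n) * v) ≤ n * (n * (n * n)) →
            (n * n * (K * p) ≤ n * n * (n * n)) × (n * n * (K * q) ≤ n * n * (n * n)) × (n * (K * m) ≤ n * (n * (n * n))) ×
            (n * (K * o) ≤ n * (n * (n * n))) × (n * (n * n) * (K * v) ≤ n * (n * n) * n)
    split K n p q m o v h =
      lin (K * (n * n * q + n * (m + o) + n * (n * n) * v)) h (solve (K ∷ n ∷ p ∷ q ∷ m ∷ o ∷ v ∷ [])) ,
      lin (K * (n * n * p + n * (m + o) + n * (n * n) * v)) h (solve (K ∷ n ∷ p ∷ q ∷ m ∷ o ∷ v ∷ [])) ,
      lin (K * (n * n * (p + q) + n * o + n * (n * n) * v)) h (solve (K ∷ n ∷ p ∷ q ∷ m ∷ o ∷ v ∷ [])) ,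
      lin (K * (n * n * (p + q) + n * m + n * (n * n) * v)) h (solve (K ∷ n ∷ p ∷ q ∷ m ∷ o ∷ v ∷ [])) ,
      lin (K * (n * n * (p + q) + n * (m + o))) h (solve (K ∷ n ∷ p ∷ q ∷ m ∷ o ∷ v ∷ []))

    pieces = split K n (δ² x y z) (δ² y x z) (miss x y z) (os x y z) (ovs x y z) K*score≤

    root : ∀ t → n * n * (K * (t * t)) ≤ n * n * (n * n) → J * t ≤ n
    root t h = square-cancel (J * t) n (≤-trans (≤-reflexive (root-eq J t)) (≤-trans (*-monoˡ-≤ (t * t) J²≤K) (*-cancelˡ-≤ (n * n) {{m*n≢0 n n}} h)))

  Jδβ : J * ∣ γ - β ∣ ≤ n
  Jδβ = root (δ x y z) (proj₁ pieces)

  Jδα : J * ∣ γ - α ∣ ≤ n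
  Jδα = subst (λ t → J * ∣ t - α ∣ ≤ n) (d-sym y x) (root (δ y x z) (proj₁ (proj₂ pieces)))

  Kmiss≤ : K * miss x y z ≤ n³
  Kmiss≤ = *-cancelˡ-≤ n (proj₁ (proj₂ (proj₂ pieces)))

  Kos≤ : K * os x y z ≤ n³
  Kos≤ = *-cancelˡ-≤ n (proj₁ (proj₂ (proj₂ (proj₂ pieces))))

  Kovs≤ : K * ovs x y z ≤ n
  Kovs≤ = *-cancelˡ-≤ n³ (proj₂ (proj₂ (proj₂ (proj₂ pieces))))

  KP≤ : K * P ≤ n³
  KP≤ = *-cancelˡ-≤ 40 (≤-trans (≤-reflexive (sym (*-assoc 40 K P))) (≤-trans (*-monoˡ-≤ P 40K≤k) (≤-trans kP≤ (*-monoˡ-≤ n³ (m≤m+n 20 20)))))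

  KSG≤ : K * SG ≤ n⁴
  KSG≤ = *-cancelˡ-≤ 40 (≤-trans (≤-reflexive (sym (*-assoc 40 K SG))) (≤-trans (*-monoˡ-≤ SG 40K≤k) kSG≤))

  nonrelᵇ nonrelᶜ : ℕ
  nonrelᵇ = Sum 3 λ v a b → O v * (A a * (B b * nR v a b))
  nonrelᶜ = Sum 3 λ v a c → O v * (A a * (C c * nR v a c))

  -- A triple v, a, b without `R v a b` is either one of the few counted by `ρ` or satisfies another
  -- of the four alternatives; each of these would place v in N(xy), N(xz) or N(yz), apart from the
  -- exceptions `o₁`, `o₂`, `o₃`.
  nonrelᵇ≤ : nonrelᵇ ≤ P + o₁ x y z + o₂ x y z + o₃ x y z
  nonrelᵇ≤ = sum-mono₄ 3 ρ (λ v a b → E y z a * (E x z b * (nE x y v * E v a b))) (λ v a b → E y z a * (E x z b * (nE x z v * R a b v)))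
      (λ v a b → E y z a * (E x z b * (nE y z v * R b a v))) pt
    where
    pt : ∀ v a b → O v * (A a * (B b * nR v a b)) ≤ ρ v a b + E y z a * (E x z b * (nE x y v * E v a b)) + E y z a * (E x z b * (nE x z v * R a b v))
                   + E y z a * (E x z b * (nE y z v * R b a v))
    pt v a b = nonrelᵇ-cases (e y z v) (e x z v) (e x y v) (e y z a) (e x z b) (e v a b) (r v a b) (r a v b) (r b v a) (r-sym a b v) (r-sym b a v)

  nonrelᶜ≤ : nonrelᶜ ≤ P + o₁ x z y + o₂ x z y + o₃ x z y
  nonrelᶜ≤ = sum-mono₄ 3 ρ (λ v a b → E z y a * (E x y b * (nE x z v * E v a b))) (λ v a b → E z y a * (E x y b * (nE x y v * R a b v)))
      (λ v a b → E z y a * (E x y b * (nE z y v * R b a v))) pt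
    where
    pt : ∀ v a b → O v * (A a * (C b * nR v a b)) ≤ ρ v a b + E z y a * (E x y b * (nE x z v * E v a b)) + E z y a * (E x y b * (nE x y v * R a b v))
                   + E z y a * (E x y b * (nE z y v * R b a v))
    pt v a b = nonrelᶜ-cases (e y z v) (e x z v) (e x y v) (e y z a) (e x y b) (e v a b) (r v a b) (r a v b) (r b v a)
                 (r-sym a b v) (r-sym b a v) (sym₁₂ z y a) (sym₁₂ z y v)

  bc : ℕ
  bc = Sum 1 λ u → B u * C u

  oa : V → V → Bool
  oa v a = out v ∧ in-a a

  SQp Sdp : ℕ
  SQp = Sum 2 λ v a → ι (oa v a) * Q v a
  Sdp = Sum 2 λ v a → ι (oa v a) * d v a

  prod₃ : ∀ (f g h : V → ℕ) → (Sum 3 λ a b c → f a * (g b * h c)) ≡ Sum 1 f * (Sum 1 g * Sum 1 h)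
  prod₃ f g h = trans (sum-cong 1 λ a → trans (sum-cong 1 λ b → trans (∑-* vs (f a) _) (cong (f a *_) (∑-* vs (g b) h))) (inner a))
                      (trans (∑-cong vs (λ a → *-comm (f a) (Sum 1 g * Sum 1 h))) (trans (∑-* vs (Sum 1 g * Sum 1 h) f) (*-comm _ (Sum 1 f))))
    where
    inner : ∀ a → (Sum 1 λ b → f a * (g b * Sum 1 h)) ≡ f a * (Sum 1 g * Sum 1 h)
    inner a = trans (∑-* vs (f a) _) (cong (f a *_) (trans (∑-cong vs (λ b → *-comm (g b) (Sum 1 h))) (trans (∑-* vs (Sum 1 h) g) (*-comm (Sum 1 h) (Sum 1 g)))))

  -- For an uncovered v and almost all a in A, nearly all vertices of B and C are related to a in
  -- the link of v, so `Q v a` is about β + γ. By `d-upper` the degree `d v a` is on average at most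
  -- about ω. Since relations do not outnumber degrees by `Q≲d`, and β + γ exceeds ω, few vertices
  -- can be uncovered.
  Q-lower : ω * (α * (β + γ)) ≤ SQp + nonrelᵇ + nonrelᶜ + ω * (α * bc)
  Q-lower = begin
    ω * (α * (β + γ))
      ≡⟨ cong (λ t → ω * (α * t)) (∑-+ vs B C) ⟨
    ω * (α * (Sum 1 λ u → B u + C u))
      ≡⟨ prod₃ O A (λ u → B u + C u) ⟨
    (Sum 3 λ v a u → O v * (A a * (B u + C u)))
      ≤⟨ sum-mono₄ 3 (λ v a u → ι (oa v a) * R v a u) (λ v a b → O v * (A a * (B b * nR v a b))) (λ v a c → O v * (A a * (C c * nR v a c))) (λ v a u → O v * (A a * (B u * C u))) pt ⟩
    (Sum 3 λ v a u → ι (oa v a) * R v a u) + nonrelᵇ + nonrelᶜ + (Sum 3 λ v a u → O v * (A a * (B u * C u)))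
      ≡⟨ cong₂ (λ s t → s + nonrelᵇ + nonrelᶜ + t) (sum-cong 2 λ v a → ∑-* vs (ι (oa v a)) _) (prod₃ O A (λ u → B u * C u)) ⟩
    SQp + nonrelᵇ + nonrelᶜ + ω * (α * bc) ∎
    where
    open ≤-Reasoning
    pt : ∀ v a u → O v * (A a * (B u + C u)) ≤ ι (oa v a) * R v a u + O v * (A a * (B u * nR v a u)) + O v * (A a * (C u * nR v a u)) + O v * (A a * (B u * C u))
    pt v a u = byCases 5 (λ o a b c r → ι o * (ι a * (ι b + ι c)))
                         (λ o a b c r → ι (o ∧ a) * ι r + ι o * (ι a * (ι b * ι (not r))) + ι o * (ι a * (ι c * ι (not r))) + ι o * (ι a * (ι b * ι c))) refl
                         (out v) (in-a a) (in-b u) (in-c u) (r v a u)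

  Yaa : ℕ
  Yaa = Sum 3 λ v a a′ → O v * (A a * (A a′ * E v a a′))

  d-upper : Sdp ≤ ω * (α * ω) + Yaa + o₁ x y z + o₁ x z y
  d-upper = begin
    Sdp
      ≡⟨ sum-cong 2 (λ v a → ∑-* vs (ι (oa v a)) _) ⟨
    (Sum 3 λ v a u → ι (oa v a) * E v a u)
      ≤⟨ sum-mono₄ 3 (λ v a u → O v * (A a * O u)) (λ v a a′ → O v * (A a * (A a′ * E v a a′)))
           (λ v a b → E y z a * (E x z b * (nE x y v * E v a b))) (λ v a b → E z y a * (E x y b * (nE x z v * E v a b))) pt ⟩
    (Sum 3 λ v a u → O v * (A a * O u)) + Yaa + o₁ x y z + o₁ x z y
      ≡⟨ cong (λ t → t + Yaa + o₁ x y z + o₁ x z y) (prod₃ O A O) ⟩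
    ω * (α * ω) + Yaa + o₁ x y z + o₁ x z y ∎
    where
    open ≤-Reasoning
    pt : ∀ v a u → ι (oa v a) * E v a u ≤ O v * (A a * O u) + O v * (A a * (A u * E v a u)) + E y z a * (E x z u * (nE x y v * E v a u)) + E z y a * (E x y u * (nE x z v * E v a u))
    pt v a u = d-upper-cases (e y z v) (e x z v) (e x y v) (e y z u) (e x z u) (e x y u) (e y z a) (e v a u) (sym₁₂ z y a)

  -- Every b in B tests an edge v a a′: either `R v a b` fails, or va′b is an edge, counted by `o₁`,
  -- or b belongs to the excess counted by `SG`. Because β is linear in n, this bounds `Yaa`.
  βYaa≤ : β * Yaa ≤ n * nonrelᵇ + SG + n * o₁ x y z
  βYaa≤ = begin
    β * Yaa
      ≡⟨ trans (sum-cong 3 λ v a a′ → trans (∑-* vs (O v * (A a * (A a′ * E v a a′))) B) (*-comm _ β)) (sum-* 3 β _) ⟨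
    (Sum 4 λ v a a′ b → (O v * (A a * (A a′ * E v a a′))) * B b)
      ≤⟨ sum-mono₃ 4 (λ v a a′ b → O v * (A a * (B b * nR v a b))) (λ v a a′ b → G v a a′ b) (λ v a a′ b → E y z a′ * (E x z b * (nE x y v * E v a′ b))) pt ⟩
    (Sum 4 λ v a a′ b → O v * (A a * (B b * nR v a b))) + SG + (Sum 4 λ v a a′ b → E y z a′ * (E x z b * (nE x y v * E v a′ b)))
      ≡⟨ cong₂ (λ s t → s + SG + t)
           (trans (perm 4 (1 ∷ 0 ∷ []) (λ _ v a b → O v * (A a * (B b * nR v a b)))) (sum-drop 3 (λ v a b → O v * (A a * (B b * nR v a b)))))
           (trans (perm 4 (0 ∷ []) (λ _ v a′ b → E y z a′ * (E x z b * (nE x y v * E v a′ b)))) (sum-drop 3 (λ v a′ b → E y z a′ * (E x z b * (nE x y v * E v a′ b))))) ⟩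
    n * nonrelᵇ + SG + n * o₁ x y z ∎
    where
    open ≤-Reasoning
    pt : ∀ v a a′ b → (O v * (A a * (A a′ * E v a a′))) * B b ≤ O v * (A a * (B b * nR v a b)) + G v a a′ b + E y z a′ * (E x z b * (nE x y v * E v a′ b))
    pt v a a′ b = byCases 9 (λ f g h a c b s r t → (ι (not f ∧ not g ∧ not h) * (ι a * (ι c * ι s))) * ι b)
                            (λ f g h a c b s r t → ι (not f ∧ not g ∧ not h) * (ι a * (ι b * ι (not r))) + ι s * (ι (not t) * ι r) + ι c * (ι b * (ι (not h) * ι t))) refl
                            (e y z v) (e x z v) (e x y v) (e y z a) (e y z a′) (e x z b) (e v a a′) (r v a b) (e v a′ b)

  cover : n ≤ α + β + γ + ω
  cover = ≤-trans (≤-reflexive (sym (∑-length vs))) (sum-mono₄ 1 A B C O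
    (λ v → byCases 3 (λ _ _ _ → 1) (λ a b c → ι a + ι b + ι c + ι (not a ∧ not b ∧ not c)) refl (e y z v) (e x z v) (e x y v)))

  disjoint : α + β + γ + ω ≤ n + ovs x y z
  disjoint = begin
    α + β + γ + ω
      ≡⟨ sum-+₄ 1 A B C O ⟨
    (Sum 1 λ v → A v + B v + C v + O v)
      ≤⟨ sum-mono₄ 1 (λ _ → 1) (λ v → E y z v * E x z v) (λ v → E z y v * E x y v) (λ v → E y x v * E z x v) pt ⟩
    (Sum 1 λ _ → 1) + ov x y z + ov x z y + ov z y x
      ≡⟨ trans (cong (λ t → t + ov x y z + ov x z y + ov z y x) (∑-length vs)) (disjoint-eq n (ov x y z) (ov x z y) (ov z y x)) ⟩
    n + ovs x y z ∎
    where
    open ≤-Reasoning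
    pt : ∀ v → A v + B v + C v + O v ≤ 1 + E y z v * E x z v + E z y v * E x y v + E y x v * E z x v
    pt v = disjoint-cases (e y z v) (e x z v) (e x y v) (sym₁₂ z y v) (sym₁₂ y x v) (sym₁₂ z x v)

  bc≤ : bc ≤ ovs x y z
  bc≤ = ≤-trans (≤-reflexive (∑-cong vs (λ v → trans (*-comm (B v) (C v)) (cong₂ (λ s t → ι s * ι t) (sym₁₂ x y v) (sym₁₂ x z v))))) (m≤n+m (ov z y x) _)

  private
    45≤K : 45 ≤ K
    45≤K = ≤-trans (≤-trans 45≤J (≤-trans (≤-reflexive (sym (*-identityʳ J))) (*-monoʳ-≤ J (≤-trans (s≤s z≤n) 45≤J)))) J²≤K

    J≤K : J ≤ K
    J≤K = ≤-trans (≤-trans (≤-reflexive (sym (*-identityʳ J))) (*-monoʳ-≤ J (≤-trans (s≤s z≤n) 45≤J))) J²≤K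

    tα tβ θ : ℕ
    tα = ∣ γ - α ∣
    tβ = ∣ γ - β ∣
    θ  = ovs x y z

    γ≤α+t : γ ≤ α + tα
    γ≤α+t = m≤n+∣m-n∣ γ α
    α≤γ+t : α ≤ γ + tα
    α≤γ+t = m≤n+∣n-m∣ α γ
    γ≤β+t : γ ≤ β + tβ
    γ≤β+t = m≤n+∣m-n∣ γ β
    β≤γ+t : β ≤ γ + tβ
    β≤γ+t = m≤n+∣n-m∣ β γ

    45t : ∀ {t} → J * t ≤ n → 45 * t ≤ n
    45t {t} h = ≤-trans (*-monoˡ-≤ t 45≤J) h

    large : ∀ n γ α t → 6 * n ≤ 25 * γ → γ ≤ α + t → 45 * t ≤ n → n ≤ 5 * α
    large n γ α t h₁ h₂ h₃ = linc 44 (4 * n) (9 ⊗ h₁ ⊕ 225 ⊗ h₂ ⊕ 5 ⊗ h₃) (solve (n ∷ γ ∷ α ∷ t ∷ []))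

    n≤5α : n ≤ 5 * α
    n≤5α = large n γ α tα γ≥ γ≤α+t (45t Jδα)

    n≤5β : n ≤ 5 * β
    n≤5β = large n γ β tβ γ≥ γ≤β+t (45t Jδβ)

    -- From γ ≥ 0.24n and nearly equal neighbourhoods, ω is at most about 0.28n while β + γ is at
    -- least about 0.48n. The factor 45 lets four error terms of size n/45 fit into the difference
    -- and still leave n/10.
    room : 10 * ω + n ≤ 10 * (β + γ)
    room = room-arith n α β γ ω θ tα tβ disjoint γ≤α+t γ≤β+t (≤-trans (*-monoˡ-≤ θ 45≤K) Kovs≤) (45t Jδα) (45t Jδβ) γ≥

    Q≤d : K * SQp ≤ K * Sdp + n³
    Q≤d = *-cancelˡ-≤ 65 (≤-trans (≤-reflexive (sym (*-assoc 65 K SQp))) (≤-trans (Q≲d oa (65 * K) K²≤k) (≤-reflexive (Q≤d-eq K Sdp n³))))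

    Knonrelᵇ≤ : K * nonrelᵇ ≤ 2 * n³
    Knonrelᵇ≤ = Knonrelᵇ≤-arith K nonrelᵇ P (o₁ x y z) (o₁ x z y) (o₂ x y z) (o₂ x z y) (o₃ x y z) (o₃ x z y) n³ nonrelᵇ≤ KP≤ Kos≤

    Knonrel≤ : K * (nonrelᵇ + nonrelᶜ) ≤ 3 * n³
    Knonrel≤ = Knonrel≤-arith K nonrelᵇ nonrelᶜ P (o₁ x y z) (o₁ x z y) (o₂ x y z) (o₂ x z y) (o₃ x y z) (o₃ x z y) n³ nonrelᵇ≤ nonrelᶜ≤ KP≤ Kos≤

    Ko₁≤ : K * (o₁ x y z + o₁ x z y) ≤ n³
    Ko₁≤ = ≤-trans (*-monoʳ-≤ K (≤-trans (m≤m+n _ (o₂ x y z + o₂ x z y)) (m≤m+n _ (o₃ x y z + o₃ x z y)))) Kos≤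

    KYaa≤ : K * Yaa ≤ 20 * n³
    KYaa≤ = *-cancelˡ-≤ n (≤-trans (*-monoˡ-≤ (K * Yaa) n≤5β)
        (KYaa≤-arith K n β Yaa nonrelᵇ SG (o₁ x y z) n³ βYaa≤ Knonrelᵇ≤ KSG≤ (≤-trans (*-monoʳ-≤ K (m≤m+n _ (o₁ x z y))) Ko₁≤)))

    ω≤n : ω ≤ n
    ω≤n = ≤-trans (∑-mono vs (λ v → ι≤1 (out v))) (≤-reflexive (∑-length vs))

    Kωα≤ : K * (ω * (α * n)) ≤ 260 * n³
    Kωα≤ = Kωα≤-arith K n ω α β γ SQp Sdp nonrelᵇ nonrelᶜ bc Yaa (o₁ x y z) (o₁ x z y) n³ (ω * α)
        Q-lower Q≤d d-upper Knonrel≤ (≤-trans (*-monoʳ-≤ K bc≤) Kovs≤) KYaa≤ Ko₁≤ room refl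
        (≤-trans (*-mono-≤ (*-mono-≤ ω≤n (d≤n y z)) ≤-refl) (≤-reflexive (*-assoc n n n)))

  Kω≤ : K * ω ≤ 1300 * n
  Kω≤ = *-cancelˡ-≤ (n * n) {{m*n≢0 n n}} (Kω≤-arith K n ω α n≤5α Kωα≤)

  Jω≤ : J * ω ≤ n
  Jω≤ = Jω≤-arith J K ω n 1400J≤K Kω≤

  -- Overlaps go to the first neighbourhood that applies and uncovered vertices fall into the third
  -- part. Both exceptional sets are small, by `Kovs≤` and `Jω≤`.
  part : V → Fin 3
  part v with in-a v | in-b v
  ... | true  | _     = f0
  ... | false | true  = fs f0
  ... | false | false = fs (fs f0)

  open Parts H vs part

  I₀≡ : ∀ v → I f0 v ≡ A v
  I₀≡ v with in-a v | in-b v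
  ... | true  | _     = refl
  ... | false | true  = refl
  ... | false | false = refl

  I₁≡ : ∀ v → I (fs f0) v ≡ ι (not (in-a v) ∧ in-b v)
  I₁≡ v with in-a v | in-b v
  ... | true  | _     = refl
  ... | false | true  = refl
  ... | false | false = refl

  I₂≡ : ∀ v → I (fs (fs f0)) v ≡ ι (not (in-a v) ∧ not (in-b v))
  I₂≡ v with in-a v | in-b v
  ... | true  | _     = refl
  ... | false | true  = refl
  ... | false | false = refl

  size₀ : size f0 ≡ α
  size₀ = ∑-cong vs I₀≡

  size₁≤ : size (fs f0) ≤ β
  size₁≤ = ∑-mono vs (λ v → ≤-trans (≤-reflexive (I₁≡ v)) (byCases 2 (λ a b → ι (not a ∧ b)) (λ a b → ι b) refl (in-a v) (in-b v)))

  β≤size₁ : β ≤ size (fs f0) + θ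
  β≤size₁ = ≤-trans (sum-mono₂ 1 (I (fs f0)) (λ v → E y z v * E x z v) (λ v → ≤-trans (byCases 2 (λ a b → ι b) (λ a b → ι (not a ∧ b) + ι a * ι b) refl (in-a v) (in-b v))
      (≤-reflexive (cong (_+ E y z v * E x z v) (sym (I₁≡ v)))))) (+-monoʳ-≤ (size (fs f0)) (≤-trans (m≤m+n _ (ov x z y)) (m≤m+n _ (ov z y x))))

  sizes : size f0 + size (fs f0) + size (fs (fs f0)) ≡ n
  sizes = trans (sym (sum-+₃ 1 (I f0) (I (fs f0)) (I (fs (fs f0))))) (trans (∑-cong vs one) (∑-length vs))
    where
    one : ∀ v → I f0 v + I (fs f0) v + I (fs (fs f0)) v ≡ 1
    one v with in-a v | in-b v
    ... | true  | _     = refl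
    ... | false | true  = refl
    ... | false | false = refl

  JM≤ : J * missing f0 (fs f0) (fs (fs f0)) ≤ n³
  JM≤ = JM≤-arith J K (missing f0 (fs f0) (fs (fs f0))) (miss x y z) n ω n³ M≤ Kmiss≤ Kω≤ 1400J≤K refl
    where
    M≤ : missing f0 (fs f0) (fs (fs f0)) ≤ miss x y z + n * (n * ω)
    M≤ = ≤-trans (sum-mono₂ 3 (λ a b c → A a * (B b * (C c * nE a b c))) (λ a b c → O c) pt)
         (≤-reflexive (cong (miss x y z +_) (trans (sum-drop 2 (λ _ → O)) (cong (n *_) (sum-drop 1 O)))))
      where
      pt : ∀ a b c → I f0 a * (I (fs f0) b * (I (fs (fs f0)) c * nE a b c)) ≤ A a * (B b * (C c * nE a b c)) + O c
      pt a b c = ≤-trans (≤-reflexive (cong₂ _*_ (I₀≡ a) (cong₂ _*_ (I₁≡ b) (cong (_* nE a b c) (I₂≡ c)))))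
        (byCases 7 (λ t u v f g h s → ι t * (ι (not u ∧ v) * (ι (not f ∧ not g) * ι s))) (λ t u v f g h s → ι t * (ι v * (ι h * ι s)) + ι (not f ∧ not g ∧ not h)) refl
          (in-a a) (in-a b) (in-b b) (in-a c) (in-b c) (in-c c) (not (e a b c)))

  close : ∀ j → J ≡ 15 * j → Close H vs part j
  close j J≡ = record { size≤ = upper′ ; ≤size = lower ; missing≤ = ≤-trans (*-monoˡ-≤ (missing f0 (fs f0) (fs (fs f0))) j≤J) JM≤ }
    where
    j≤J : j ≤ J
    j≤J = ≤-trans (m≤m+n j (14 * j)) (≤-reflexive (sym J≡))
    Jθ≤ : J * θ ≤ n
    Jθ≤ = ≤-trans (*-monoˡ-≤ θ J≤K) Kovs≤
    Bounds : ℕ → Set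
    Bounds s = (J * (3 * s) ≤ J * n + 15 * n) × (J * n ≤ J * (3 * s) + 15 * n)
    bounds : ∀ i → Bounds (size i)
    bounds f0           = subst Bounds (sym size₀) (close-arith₀ J n α β γ ω θ tα tβ disjoint cover γ≤α+t α≤γ+t γ≤β+t β≤γ+t Jδα Jδβ Jθ≤ Jω≤)
    bounds (fs f0)      = close-arith₁ J n α β γ ω θ tα tβ (size (fs f0)) disjoint cover γ≤α+t α≤γ+t γ≤β+t β≤γ+t Jδα Jδβ Jθ≤ Jω≤ size₁≤ β≤size₁
    bounds (fs (fs f0)) = close-arith₂ J n α β γ ω θ tα tβ (size (fs f0)) (size (fs (fs f0))) disjoint cover γ≤α+t α≤γ+t γ≤β+t β≤γ+t Jδα Jδβ Jθ≤ Jω≤ size₁≤ β≤size₁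
                            (subst (λ a → a + size (fs f0) + size (fs (fs f0)) ≡ n) size₀ sizes)
    upper′ : ∀ i → j * (3 * size i) ≤ j * n + n
    upper′ i = *-cancelˡ-≤ 15 (begin
      15 * (j * (3 * size i)) ≡⟨ close-eq j (3 * size i) ⟨
      15 * j * (3 * size i)   ≡⟨ cong (_* (3 * size i)) J≡ ⟨
      J * (3 * size i)        ≤⟨ proj₁ (bounds i) ⟩
      J * n + 15 * n          ≡⟨ cong (λ t → t * n + 15 * n) J≡ ⟩
      15 * j * n + 15 * n     ≡⟨ cong (_+ 15 * n) (close-eq j n) ⟩
      15 * (j * n) + 15 * n   ≡⟨ *-distribˡ-+ 15 (j * n) n ⟨
      15 * (j * n + n)        ∎)
      where open ≤-Reasoning
    lower : ∀ i → j * n ≤ j * (3 * size i) + n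
    lower i = *-cancelˡ-≤ 15 (begin
      15 * (j * n)                       ≡⟨ close-eq j n ⟨
      15 * j * n                         ≡⟨ cong (_* n) J≡ ⟨
      J * n                              ≤⟨ proj₂ (bounds i) ⟩
      J * (3 * size i) + 15 * n          ≡⟨ cong (λ t → t * (3 * size i) + 15 * n) J≡ ⟩
      15 * j * (3 * size i) + 15 * n     ≡⟨ cong (_+ 15 * n) (close-eq j (3 * size i)) ⟩
      15 * (j * (3 * size i)) + 15 * n   ≡⟨ *-distribˡ-+ 15 (j * (3 * size i)) n ⟨
      15 * (j * (3 * size i) + n)        ∎)
      where open ≤-Reasoning

pattern 0F = f0
pattern 1F = fs f0
pattern 2F = fs (fs f0)

edges : ∀ {V : Set} → Free V → List V → ℕ
edges H vs = Sums.Sum vs 3 (Free.E H)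

cube : ℕ → ℕ
cube n = n * (n * n)

-- edges counts every edge six times, so this says that there are at least (1 - 1/k) n³/24 edges.
NearExtremal : ∀ {V : Set} → Free V → List V → ℕ → Set
NearExtremal H vs k = k * cube (length vs) ≤ 4 * (k * edges H vs) + cube (length vs)

stable-at : ∀ j K k → 3 ≤ j → 15 * j * (15 * j) ≤ K → 1400 * (15 * j) ≤ K → 40 * K ≤ k → 65 * K * (65 * K) ≤ k → 26 + 1100 * (400 * K) < k →
  ∀ {V} (H : Free V) vs → Unique vs → 2 ≤ k → cube k ≤ length vs → NearExtremal H vs k → Σ (V → Fin 3) λ p → Close H vs p j
stable-at j K k 3≤j h₁ h₂ h₃ h₄ h₅ H vs uniq 2≤k k³≤n near = build (Select.select-good H vs uniq k 2≤k k³≤n near K h₅)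
  where
  build : _ → _
  build (x , y , z , _ , γ≥ , score≤) = C.part , C.close j refl
    where
    module C = Cover H vs uniq k 2≤k k³≤n near (15 * j) K (*-monoʳ-≤ 15 3≤j) h₁ h₂ h₃ h₄ x y z γ≥ score≤

summands : ∀ a b c d → (a ≤ a + b + c + d) × (b ≤ a + b + c + d) × (c ≤ a + b + c + d) × (d ≤ a + b + c + d)
summands a b c d =
  ≤-trans (m≤m+n a b) (≤-trans (m≤m+n (a + b) c) (m≤m+n (a + b + c) d)) ,
  ≤-trans (m≤n+m b a) (≤-trans (m≤m+n (a + b) c) (m≤m+n (a + b + c) d)) ,
  ≤-trans (m≤n+m c (a + b)) (m≤m+n (a + b + c) d) ,
  m≤n+m d (a + b + c)

stable : ∀ J k₀ → Σ ℕ λ k → k₀ ≤ k × 2 ≤ k × (∀ {V} (H : Free V) vs → Unique vs → cube k ≤ length vs → NearExtremal H vs k →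
         Σ (V → Fin 3) λ p → Close H vs p (3 + J))
stable J k₀ = k , ≤-trans (m≤m+n k₀ 2) last , ≤-trans (m≤n+m 2 k₀) last ,
    λ H vs uniq k³≤n near → stable-at (3 + J) K k (m≤m+n 3 J) (m≤n+m w u) (m≤m+n u w)
      (proj₁ large) (proj₁ (proj₂ large)) (proj₁ (proj₂ (proj₂ large)))
      H vs uniq (≤-trans (m≤n+m 2 k₀) last) k³≤n near
  where
  u w K k : ℕ
  u = 1400 * (15 * (3 + J))
  w = 15 * (3 + J) * (15 * (3 + J))
  K = u + w
  k = 40 * K + 65 * K * (65 * K) + suc (26 + 1100 * (400 * K)) + (k₀ + 2)
  large = summands (40 * K) (65 * K * (65 * K)) (suc (26 + 1100 * (400 * K))) (k₀ + 2)
  last : k₀ + 2 ≤ k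
  last = proj₂ (proj₂ (proj₂ large))

-- Forbidden configurations across a near partition.

Σ₃ : (Fin 3 → ℕ) → ℕ
Σ₃ f = f 0F + f 1F + f 2F

Σ₃-cong : ∀ {f g : Fin 3 → ℕ} → (∀ i → f i ≡ g i) → Σ₃ f ≡ Σ₃ g
Σ₃-cong h = cong₂ _+_ (cong₂ _+_ (h 0F) (h 1F)) (h 2F)

∑-Σ₃-eq : ∀ h a b c → h * (a + b + c) ≡ h * a + h * b + h * c
∑-Σ₃-eq = solve-∀

within₃-12-eq : ∀ x y z → x * (y * z) ≡ y * (x * z)
within₃-12-eq = solve-∀

within₃-23-eq : ∀ x y z → x * (y * z) ≡ y * (x * z)
within₃-23-eq = solve-∀

T-split-arith : ∀ a b c u01 u02 u10 u12 u20 u21 x {m1 m2 m3 m4 m5 m6 w1 w2 w3 w4 w5 w6 y1 y2 y3 y4 y5} →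
  m1 ≡ u01 → m2 ≡ u02 → m3 ≡ u10 → m4 ≡ u12 → m5 ≡ u20 → m6 ≡ u21 →
  w1 ≡ u01 → w2 ≡ u02 → w3 ≡ u10 → w4 ≡ u12 → w5 ≡ u20 → w6 ≡ u21 →
  y1 ≡ x → y2 ≡ x → y3 ≡ x → y4 ≡ x → y5 ≡ x →
  ((a + u01 + u02) + (m1 + w3 + x) + (m2 + y1 + w5)) + ((w1 + m3 + y2) + (u10 + b + u12) + (y3 + m4 + w6)) + ((w2 + y4 + m5) + (y5 + w4 + m6) + (u20 + u21 + c))
  ≡ (a + b + c) + 3 * (u01 + u02 + u10 + u12 + u20 + u21) + 6 * x
T-split-arith a b c u01 u02 u10 u12 u20 u21 x refl refl refl refl refl refl refl refl refl refl refl refl refl refl refl refl refl = solve (a ∷ b ∷ c ∷ u01 ∷ u02 ∷ u10 ∷ u12 ∷ u20 ∷ u21 ∷ x ∷ [])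

t+missing-eq : ∀ x y z b → x * (y * (z * ι b)) + x * (y * (z * ι (not b))) ≡ x * (y * z)
t+missing-eq x y z true  = solve (x ∷ y ∷ z ∷ [])
t+missing-eq x y z false = solve (x ∷ y ∷ z ∷ [])

module PartSums {V : Set} (H : Free V) (vs : List V) (p : V → Fin 3) where

  open Free H
  open Sums vs
  open Parts H vs p

  n : ℕ
  n = length vs

  split : ∀ (f : V → ℕ) → ∑ vs f ≡ Σ₃ λ i → ∑ vs (λ a → I i a * f a)
  split f = trans (∑-cong vs pt) (sum-+₃ 1 (λ a → I 0F a * f a) (λ a → I 1F a * f a) (λ a → I 2F a * f a))
    where
    pt : ∀ a → f a ≡ I 0F a * f a + I 1F a * f a + I 2F a * f a
    pt a with p a
    ... | 0F = eq (f a)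
      where
      eq : ∀ x → x ≡ 1 * x + 0 * x + 0 * x
      eq = solve-∀
    ... | 1F = eq (f a)
      where
      eq : ∀ x → x ≡ 0 * x + 1 * x + 0 * x
      eq = solve-∀
    ... | 2F = eq (f a)
      where
      eq : ∀ x → x ≡ 0 * x + 0 * x + 1 * x
      eq = solve-∀

  ∑-Σ₃ : ∀ (h : V → ℕ) (f : V → Fin 3 → ℕ) → ∑ vs (λ a → h a * Σ₃ (f a)) ≡ Σ₃ λ i → ∑ vs (λ a → h a * f a i)
  ∑-Σ₃ h f = trans (∑-cong vs (λ a → ∑-Σ₃-eq (h a) (f a 0F) (f a 1F) (f a 2F)))
                   (sum-+₃ 1 (λ a → h a * f a 0F) (λ a → h a * f a 1F) (λ a → h a * f a 2F))

  within₂ : (V → V → ℕ) → Fin 3 → Fin 3 → ℕ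
  within₂ f i j = Sum 2 λ a b → I i a * (I j b * f a b)

  within₃ : (V → V → V → ℕ) → Fin 3 → Fin 3 → Fin 3 → ℕ
  within₃ f i j l = Sum 3 λ a b c → I i a * (I j b * (I l c * f a b c))

  split₂ : ∀ f → Sum 2 f ≡ Σ₃ λ i → Σ₃ λ j → within₂ f i j
  split₂ f = trans (split (λ a → ∑ vs (f a))) (Σ₃-cong λ i → trans (∑-cong vs (λ a → cong (I i a *_) (split (f a))))
             (trans (∑-Σ₃ (I i) (λ a j → ∑ vs (λ b → I j b * f a b))) (Σ₃-cong λ j → ∑-cong vs λ a → sym (∑-* vs (I i a) (λ b → I j b * f a b)))))

  split₃ : ∀ f → Sum 3 f ≡ Σ₃ λ i → Σ₃ λ j → Σ₃ λ l → within₃ f i j l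
  split₃ f = trans (split (λ a → Sum 2 (f a))) (Σ₃-cong λ i → trans (∑-cong vs λ a → cong (I i a *_) (split₂ (f a)))
             (trans (∑-Σ₃ (I i) (λ a j → Σ₃ λ l → within₂ (f a) j l)) (Σ₃-cong λ j → trans (∑-Σ₃ (I i) (λ a l → within₂ (f a) j l)) (Σ₃-cong λ l → ∑-cong vs λ a → pull i j l a))))
    where
    pull : ∀ i j l a → I i a * (Sum 2 λ b c → I j b * (I l c * f a b c)) ≡ (Sum 2 λ b c → I i a * (I j b * (I l c * f a b c)))
    pull i j l a = sym (sum-* 2 (I i a) (λ b c → I j b * (I l c * f a b c)))

  t : Fin 3 → Fin 3 → Fin 3 → ℕ
  t = within₃ E

  within₃-12 : ∀ f → (∀ a b c → f a b c ≡ f b a c) → ∀ i j l → within₃ f i j l ≡ within₃ f j i l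
  within₃-12 f s i j l = trans (sum-cong 3 λ a b c → trans (cong (λ z → I i a * (I j b * (I l c * z))) (s a b c)) (within₃-12-eq (I i a) (I j b) (I l c * f b a c)))
                        (perm 3 (0 ∷ []) (λ b a c → I j b * (I i a * (I l c * f b a c))))

  within₃-23 : ∀ f → (∀ a b c → f a b c ≡ f a c b) → ∀ i j l → within₃ f i j l ≡ within₃ f i l j
  within₃-23 f s i j l = trans (sum-cong 3 λ a b c → trans (cong (λ z → I i a * (I j b * (I l c * z))) (s a b c)) (cong (I i a *_) (within₃-23-eq (I j b) (I l c) (f a c b))))
                        (perm 3 (1 ∷ []) (λ a c b → I i a * (I l c * (I j b * f a c b))))

  t-12 : ∀ i j l → t i j l ≡ t j i l
  t-12 = within₃-12 E (λ a b c → cong ι (sym₁₂ a b c))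

  t-23 : ∀ i j l → t i j l ≡ t i l j
  t-23 = within₃-23 E (λ a b c → cong ι (sym₂₃ a b c))

  missing-12 : ∀ i j l → missing i j l ≡ missing j i l
  missing-12 = within₃-12 nE (λ a b c → cong (λ z → ι (not z)) (sym₁₂ a b c))

  missing-23 : ∀ i j l → missing i j l ≡ missing i l j
  missing-23 = within₃-23 nE (λ a b c → cong (λ z → ι (not z)) (sym₂₃ a b c))

  -- Edges with exactly two vertices in one part.
  bad : ℕ
  bad = t 0F 0F 1F + t 0F 0F 2F + t 1F 1F 0F + t 1F 1F 2F + t 2F 2F 0F + t 2F 2F 1F

  -- In `bad` the odd vertex comes last; the factor 3 restores its other positions and the factor 6
  -- the orders of the three parts.
  T-split : Sum 3 E ≡ Σ₃ (λ i → t i i i) + 3 * bad + 6 * t 0F 1F 2F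
  T-split = trans (split₃ E) (T-split-arith (t 0F 0F 0F) (t 1F 1F 1F) (t 2F 2F 2F) (t 0F 0F 1F) (t 0F 0F 2F) (t 1F 1F 0F) (t 1F 1F 2F) (t 2F 2F 0F) (t 2F 2F 1F) (t 0F 1F 2F)
      (t-23 0F 1F 0F) (t-23 0F 2F 0F) (t-23 1F 0F 1F) (t-23 1F 2F 1F) (t-23 2F 0F 2F) (t-23 2F 1F 2F)
      (trans (t-12 1F 0F 0F) (t-23 0F 1F 0F)) (trans (t-12 2F 0F 0F) (t-23 0F 2F 0F)) (trans (t-12 0F 1F 1F) (t-23 1F 0F 1F))
      (trans (t-12 2F 1F 1F) (t-23 1F 2F 1F)) (trans (t-12 0F 2F 2F) (t-23 2F 0F 2F)) (trans (t-12 1F 2F 2F) (t-23 2F 1F 2F))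
      (t-23 0F 2F 1F) (t-12 1F 0F 2F) (trans (t-23 1F 2F 0F) (t-12 1F 0F 2F)) (trans (t-12 2F 0F 1F) (t-23 0F 2F 1F)) (trans (t-12 2F 1F 0F) (trans (t-23 1F 2F 0F) (t-12 1F 0F 2F))))

  part : Fin 3 → List V
  part h = filter (λ v → p v ≟ᶠ h) vs

  ∑-part : ∀ h f → ∑ (part h) f ≡ ∑ vs (λ v → I h v * f v)
  ∑-part h f = ∑-filter (λ v → p v ≟ᶠ h) vs f

  length-part : ∀ h → length (part h) ≡ size h
  length-part h = trans (sym (∑-length (part h))) (trans (∑-part h (λ _ → 1)) (∑-cong vs (λ v → *-identityʳ (I h v))))

  part₂ : ∀ h f → Sums.Sum (part h) 2 f ≡ within₂ f h h
  part₂ h f = trans (∑-part h _) (∑-cong vs λ a → trans (cong (I h a *_) (∑-part h (f a))) (sym (∑-* vs (I h a) _)))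

  part₃ : ∀ h f → Sums.Sum (part h) 3 f ≡ within₃ f h h h
  part₃ h f = trans (∑-part h _) (∑-cong vs λ a → trans (cong (I h a *_) (part₂ h (f a))) (sym (sum-* 2 (I h a) (λ b c → I h b * (I h c * f a b c)))))

  prod₃ : ∀ (f g h : V → ℕ) → (Sum 3 λ a b c → f a * (g b * h c)) ≡ Sum 1 f * (Sum 1 g * Sum 1 h)
  prod₃ f g h = trans (sum-cong 1 λ a → trans (sum-cong 1 λ b → trans (∑-* vs (f a) _) (cong (f a *_) (∑-* vs (g b) h))) (inner a))
                      (trans (∑-cong vs (λ a → *-comm (f a) (Sum 1 g * Sum 1 h))) (trans (∑-* vs (Sum 1 g * Sum 1 h) f) (*-comm _ (Sum 1 f))))
    where
    inner : ∀ a → (Sum 1 λ b → f a * (g b * Sum 1 h)) ≡ f a * (Sum 1 g * Sum 1 h)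
    inner a = trans (∑-* vs (f a) _) (cong (f a *_) (trans (∑-cong vs (λ b → *-comm (g b) (Sum 1 h))) (trans (∑-* vs (Sum 1 h) g) (*-comm (Sum 1 h) (Sum 1 g)))))

  t+missing : ∀ i j l → t i j l + missing i j l ≡ size i * (size j * size l)
  t+missing i j l = trans (sym (sum-+ 3 (λ a b c → I i a * (I j b * (I l c * E a b c))) _))
    (trans (sum-cong 3 λ a b c → t+missing-eq (I i a) (I j b) (I l c) (e a b c)) (prod₃ (I i) (I j) (I l)))

does-true : ∀ {P : Set} (P? : Relation.Nullary.Dec P) → does P? ≡ true → P
does-true (yes p) _ = p

link-sym-eq : ∀ x y z → x * (y * z) ≡ y * (x * z)
link-sym-eq = solve-∀

module Roles {V : Set} (_≟_ : DecidableEquality V) (H : Free V) (vs : List V) (uniq : Unique vs) (p : V → Fin 3) where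

  open Free H
  open Sums vs
  open Parts H vs p
  open PartSums H vs p

  same : V → V → ℕ
  same x y = ι (does (x ≟ y))

  ∑same≤1 : ∀ x → ∑ vs (same x) ≤ 1
  ∑same≤1 x = ∑-atMostOne vs uniq (λ y → does (x ≟ y)) (λ y z h h′ → trans (sym (does-true (x ≟ y) h)) (does-true (x ≟ z) h′))

  ι≤same : ∀ x y b → (b ≡ true → x ≡ y) → ι b ≤ same x y
  ι≤same x y false _ = z≤n
  ι≤same x y true  h = ≤-reflexive (cong ι (sym (dec-true (x ≟ y) (h refl))))

  ones₃ : (Sum 3 λ _ _ _ → 1) ≡ cube n
  ones₃ = trans (sum-drop 2 (λ _ _ → 1)) (cong (n *_) (trans (sum-drop 1 (λ _ → 1)) (cong (n *_) (∑-length vs))))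

  same₄ : (f : V → V → V → V) → (Sum 4 λ a b c d → same (f a b c) d) ≤ cube n
  same₄ f = ≤-trans (sum-mono 3 λ a b c → ∑same≤1 (f a b c)) (≤-reflexive ones₃)

  cycle : ∀ {a b c u w} → e a u b ∧ e u b c ∧ e b c w ∧ e c w a ≡ true → u ≡ w
  cycle {a} {b} {c} {u} {w} h with ∧-true {e a u b} h
  ... | h₁ , h′ with ∧-true {e u b c} h′
  ... | h₂ , h″ with ∧-true {e b c w} h″
  ... | h₃ , h₄ = no5 h₁ h₂ h₃ h₄

  cycle≤ : ∀ a b c u w → ι (e a u b ∧ e u b c ∧ e b c w ∧ e c w a) ≤ same u w
  cycle≤ a b c u w = ι≤same u w _ (cycle {a} {b} {c})

  link : V → Fin 3 → Fin 3 → ℕ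
  link v = within₂ (E v)

  link-sym : ∀ v i j → link v i j ≡ link v j i
  link-sym v i j = trans (sum-cong 2 λ a b → trans (cong (λ z → I i a * (I j b * ι z)) (sym₂₃ v a b)) (link-sym-eq (I i a) (I j b) (E v b a)))
                         (perm 2 (0 ∷ []) (λ b a → I j b * (I i a * E v b a)))

  prod₂₂ : ∀ (f g : V → V → ℕ) → (Sum 4 λ a b c d → f a b * g c d) ≡ Sum 2 f * Sum 2 g
  prod₂₂ f g = trans (sum-cong 2 λ a b → trans (sum-* 2 (f a b) g) (*-comm (f a b) (Sum 2 g))) (trans (sum-* 2 (Sum 2 g) f) (*-comm (Sum 2 g) (Sum 2 f)))

  -- For link edges zx and z′y with z and z′ in part i, the crossing triples zxy and z′xy complete
  -- the sequence v z x y z′. So z = z′ or a crossing triple is missing, and the links from part i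
  -- into the two other parts cannot both be dense.
  link*link : ∀ v i j h → link v i j * link v i h ≤ cube n + n * missing i j h + n * missing i j h
  link*link v i j h = begin
    link v i j * link v i h
      ≡⟨ prod₂₂ (λ z x → I i z * (I j x * E v z x)) (λ z′ y → I i z′ * (I h y * E v z′ y)) ⟨
    (Sum 4 λ z x z′ y → (I i z * (I j x * E v z x)) * (I i z′ * (I h y * E v z′ y)))
      ≤⟨ sum-mono₃ 4 (λ z x z′ y → same z z′) (λ z x z′ y → I i z * (I j x * (I h y * nE z x y))) (λ z x z′ y → I i z′ * (I j x * (I h y * nE z′ x y))) pt ⟩
    (Sum 4 λ z x z′ y → same z z′) + (Sum 4 λ z x z′ y → I i z * (I j x * (I h y * nE z x y))) + (Sum 4 λ z x z′ y → I i z′ * (I j x * (I h y * nE z′ x y)))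
      ≤⟨ ≤-trans (≤-reflexive (perm 4 (2 ∷ []) (λ z x y z′ → same z z′))) (same₄ (λ z x y → z))
         ⊕ ≤-reflexive (trans (perm 4 (1 ∷ 0 ∷ []) (λ z′ z x y → I i z * (I j x * (I h y * nE z x y)))) (sum-drop 3 (λ z x y → I i z * (I j x * (I h y * nE z x y)))))
         ⊕ ≤-reflexive (trans (perm 4 (1 ∷ []) (λ z z′ x y → I i z′ * (I j x * (I h y * nE z′ x y)))) (sum-drop 3 (λ z′ x y → I i z′ * (I j x * (I h y * nE z′ x y))))) ⟩
    cube n + n * missing i j h + n * missing i j h ∎
    where
    open ≤-Reasoning
    pt : ∀ z x z′ y → (I i z * (I j x * E v z x)) * (I i z′ * (I h y * E v z′ y))
       ≤ same z z′ + I i z * (I j x * (I h y * nE z x y)) + I i z′ * (I j x * (I h y * nE z′ x y))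
    pt z x z′ y = ≤-trans (byCases 8 (λ iz jx a iz′ hy b c d → (ι iz * (ι jx * ι a)) * (ι iz′ * (ι hy * ι b)))
          (λ iz jx a iz′ hy b c d → ι (a ∧ c ∧ d ∧ b) + ι iz * (ι jx * (ι hy * ι (not c))) + ι iz′ * (ι jx * (ι hy * ι (not d)))) refl
          (does (p z ≟ᶠ i)) (does (p x ≟ᶠ j)) (e v z x) (does (p z′ ≟ᶠ i)) (does (p y ≟ᶠ h)) (e v z′ y) (e z x y) (e z′ x y))
        (+-monoˡ-≤ _ (+-monoˡ-≤ _ (subst₂ (λ s t → ι (e v z x ∧ e z x y ∧ s ∧ t) ≤ same z z′) (sym (rotˡ z′ x y)) (sym (rev v z′ y)) (cycle≤ v x y z z′))))

  -- Pairs of link edges zz′ and zx, where z and z′ lie in part i and x in part j.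
  path : V → Fin 3 → Fin 3 → ℕ
  path v i j = Sum 3 λ z z′ x → I i z * (I i z′ * (I j x * (E v z z′ * E v z x)))

  -- If both crossing triples zxy and z′xy are present, the sequence z′ v z x y forces y = v. Thus
  -- almost every y in part h is charged to a missing triple.
  path*size : ∀ v i j h → size h * path v i j ≤ cube n + n * missing i j h + n * missing i j h
  path*size v i j h = begin
    size h * path v i j
      ≡⟨ trans (sum-cong 3 λ z z′ x → trans (∑-* vs (I i z * (I i z′ * (I j x * (E v z z′ * E v z x)))) (I h)) (*-comm _ (size h)))
               (sum-* 3 (size h) (λ z z′ x → I i z * (I i z′ * (I j x * (E v z z′ * E v z x))))) ⟨
    (Sum 4 λ z z′ x y → (I i z * (I i z′ * (I j x * (E v z z′ * E v z x)))) * I h y)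
      ≤⟨ sum-mono₃ 4 (λ z z′ x y → same v y) (λ z z′ x y → I i z * (I j x * (I h y * nE z x y))) (λ z z′ x y → I i z′ * (I j x * (I h y * nE z′ x y))) pt ⟩
    (Sum 4 λ z z′ x y → same v y) + (Sum 4 λ z z′ x y → I i z * (I j x * (I h y * nE z x y))) + (Sum 4 λ z z′ x y → I i z′ * (I j x * (I h y * nE z′ x y)))
      ≤⟨ same₄ (λ z z′ x → v)
         ⊕ ≤-reflexive (trans (perm 4 (0 ∷ []) (λ z′ z x y → I i z * (I j x * (I h y * nE z x y)))) (sum-drop 3 (λ z x y → I i z * (I j x * (I h y * nE z x y)))))
         ⊕ ≤-reflexive (sum-drop 3 (λ z′ x y → I i z′ * (I j x * (I h y * nE z′ x y)))) ⟩
    cube n + n * missing i j h + n * missing i j h ∎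
    where
    open ≤-Reasoning
    pt : ∀ z z′ x y → (I i z * (I i z′ * (I j x * (E v z z′ * E v z x)))) * I h y
       ≤ same v y + I i z * (I j x * (I h y * nE z x y)) + I i z′ * (I j x * (I h y * nE z′ x y))
    pt z z′ x y = ≤-trans (byCases 8 (λ iz jx a iz′ hy b c d → (ι iz * (ι iz′ * (ι jx * (ι b * ι a)))) * ι hy)
          (λ iz jx a iz′ hy b c d → ι (b ∧ a ∧ c ∧ d) + ι iz * (ι jx * (ι hy * ι (not c))) + ι iz′ * (ι jx * (ι hy * ι (not d)))) refl
          (does (p z ≟ᶠ i)) (does (p x ≟ᶠ j)) (e v z x) (does (p z′ ≟ᶠ i)) (does (p y ≟ᶠ h)) (e v z z′) (e z x y) (e z′ x y))
        (+-monoˡ-≤ _ (+-monoˡ-≤ _ (subst₂ (λ s t → ι (s ∧ e v z x ∧ e z x y ∧ t) ≤ same v y) (sym (rotʳ v z z′)) (sym (rotˡ z′ x y)) (cycle≤ z′ z x v y))))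

  n⁴ : ℕ
  n⁴ = n * cube n

  -- A mixed edge zz′x and the crossing triples zxc, zbc, z′bc form the sequence z′ x z c b, which
  -- forces b = x. For almost every choice of b and c a mixed edge therefore produces a missing
  -- triple.
  t*sizes : ∀ i j h → size h * size j * t i i j ≤ n⁴ + n * (n * missing i j h) + n * (n * missing i j h) + n * (n * missing i j h)
  t*sizes i j h = begin
    size h * size j * t i i j
      ≡⟨ trans (sum-cong 3 λ z z′ x → trans (sum-* 2 (I i z * (I i z′ * (I j x * E z z′ x))) (λ c b → I h c * I j b)) (cong (I i z * (I i z′ * (I j x * E z z′ x)) *_) prod))
          (trans (sum-cong 3 λ z z′ x → *-comm (I i z * (I i z′ * (I j x * E z z′ x))) (size h * size j)) (sum-* 3 (size h * size j) (λ z z′ x → I i z * (I i z′ * (I j x * E z z′ x))))) ⟨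
    (Sum 5 λ z z′ x c b → (I i z * (I i z′ * (I j x * E z z′ x))) * (I h c * I j b))
      ≤⟨ sum-mono₄ 5 (λ z z′ x c b → same x b) (λ z z′ x c b → I i z * (I j x * (I h c * nE z x c))) (λ z z′ x c b → I i z * (I j b * (I h c * nE z b c))) (λ z z′ x c b → I i z′ * (I j b * (I h c * nE z′ b c))) pt ⟩
    (Sum 5 λ z z′ x c b → same x b) + (Sum 5 λ z z′ x c b → I i z * (I j x * (I h c * nE z x c))) + (Sum 5 λ z z′ x c b → I i z * (I j b * (I h c * nE z b c))) + (Sum 5 λ z z′ x c b → I i z′ * (I j b * (I h c * nE z′ b c)))
      ≤⟨ ≤-trans (≤-reflexive (sum-drop 4 (λ z′ x c b → same x b))) (*-monoʳ-≤ n (same₄ (λ z′ x c → x)))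
         ⊕ ≤-reflexive (trans (perm 5 (3 ∷ 2 ∷ 1 ∷ 0 ∷ 1 ∷ []) (λ b z′ z x c → I i z * (I j x * (I h c * nE z x c)))) (drop (λ z x c → I i z * (I j x * (I h c * nE z x c)))))
         ⊕ ≤-reflexive (trans (perm 5 (0 ∷ 1 ∷ 3 ∷ []) (λ z′ x z b c → I i z * (I j b * (I h c * nE z b c)))) (drop (λ z b c → I i z * (I j b * (I h c * nE z b c)))))
         ⊕ ≤-reflexive (trans (perm 5 (1 ∷ 3 ∷ []) (λ z x z′ b c → I i z′ * (I j b * (I h c * nE z′ b c)))) (drop (λ z′ b c → I i z′ * (I j b * (I h c * nE z′ b c))))) ⟩
    n⁴ + n * (n * missing i j h) + n * (n * missing i j h) + n * (n * missing i j h) ∎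
    where
    open ≤-Reasoning
    prod : (Sum 2 λ c b → I h c * I j b) ≡ size h * size j
    prod = trans (∑-cong vs λ c → trans (∑-* vs (I h c) (I j)) (*-comm (I h c) (size j))) (trans (∑-* vs (size j) (I h)) (*-comm (size j) (size h)))
    drop : ∀ f → Sum 5 (λ _ _ → f) ≡ n * (n * Sum 3 f)
    drop f = trans (sum-drop 4 (λ _ → f)) (cong (n *_) (sum-drop 3 f))
    pt : ∀ z z′ x c b → (I i z * (I i z′ * (I j x * E z z′ x))) * (I h c * I j b)
       ≤ same x b + I i z * (I j x * (I h c * nE z x c)) + I i z * (I j b * (I h c * nE z b c)) + I i z′ * (I j b * (I h c * nE z′ b c))
    pt z z′ x c b = ≤-trans (byCases 9 (λ iz iz′ jx hc jb q r s t → (ι iz * (ι iz′ * (ι jx * ι q))) * (ι hc * ι jb))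
          (λ iz iz′ jx hc jb q r s t → ι (q ∧ r ∧ s ∧ t) + ι iz * (ι jx * (ι hc * ι (not r))) + ι iz * (ι jb * (ι hc * ι (not s))) + ι iz′ * (ι jb * (ι hc * ι (not t)))) refl
          (does (p z ≟ᶠ i)) (does (p z′ ≟ᶠ i)) (does (p x ≟ᶠ j)) (does (p c ≟ᶠ h)) (does (p b ≟ᶠ j)) (e z z′ x) (e z x c) (e z b c) (e z′ b c))
        (+-monoˡ-≤ _ (+-monoˡ-≤ _ (+-monoˡ-≤ _ (subst₂ (λ q r → ι (q ∧ r ∧ e z b c ∧ e z′ b c) ≤ same x b) (sym (rotˡ z z′ x)) (sym₁₂ x z c)
          (subst₂ (λ s t → ι (e z′ x z ∧ e x z c ∧ s ∧ t) ≤ same x b) (sym₂₃ z c b) (sym (rev z′ b c)) (cycle≤ z′ z c x b))))))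

data Distinct : Fin 3 → Fin 3 → Fin 3 → Set where
  d012 : Distinct 0F 1F 2F
  d021 : Distinct 0F 2F 1F
  d102 : Distinct 1F 0F 2F
  d120 : Distinct 1F 2F 0F
  d201 : Distinct 2F 0F 1F
  d210 : Distinct 2F 1F 0F

swap-23 : ∀ {i j h} → Distinct i j h → Distinct i h j
swap-23 d012 = d021
swap-23 d021 = d012
swap-23 d102 = d120
swap-23 d120 = d102
swap-23 d201 = d210
swap-23 d210 = d201

swap-12 : ∀ {i j h} → Distinct i j h → Distinct j i h
swap-12 d012 = d102
swap-12 d021 = d201
swap-12 d102 = d012
swap-12 d120 = d210
swap-12 d201 = d021
swap-12 d210 = d120

-- This is (N - a)(N - b) ≥ 0 without subtraction.
product-gap : ∀ N a b → a ≤ N → b ≤ N → N * (a + b) ≤ N * N + a * b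
product-gap N a b a≤N b≤N = subst (λ M → b ≤ M → M * (a + b) ≤ M * M + a * b) (m+[n∸m]≡n a≤N) (arith a b (N ∸ a)) b≤N
  where
  arith : ∀ a b c → b ≤ a + c → (a + c) * (a + b) ≤ (a + c) * (a + c) + a * b
  arith a b c h = lin 0 (c ⊗ h) (solve (a ∷ b ∷ c ∷ []))

n≤4size-arith : ∀ J n s → J * n ≤ J * (3 * s) + n → 4 ≤ J → J * n ≤ J * (4 * s)
n≤4size-arith J n s h₁ h₂ = linc 2 0 (4 ⊗ h₁ ⊕ n ⊗ h₂) (solve (J ∷ n ∷ s ∷ []))

link*link≤-arith : ∀ J n l M → l ≤ n * (n * n) + n * M + n * M → J * M ≤ n * (n * n) → J ≤ n → J * l ≤ 3 * (n * n * (n * n))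
link*link≤-arith J n l M h₁ h₂ h₃ = lin 0 (J ⊗ h₁ ⊕ (2 * n) ⊗ h₂ ⊕ (n * (n * n)) ⊗ h₃) (solve (J ∷ n ∷ l ∷ M ∷ []))

path≤-arith : ∀ J n s P M → s * P ≤ n * (n * n) + n * M + n * M → J * M ≤ n * (n * n) → J ≤ n → 4 * s * (J * P) ≤ n * (12 * (n * (n * n)))
path≤-arith J n s P M h₁ h₂ h₃ = lin 0 ((4 * J) ⊗ h₁ ⊕ (8 * n) ⊗ h₂ ⊕ (4 * (n * (n * n))) ⊗ h₃) (solve (J ∷ n ∷ s ∷ P ∷ M ∷ []))

t≤-arith : ∀ J n s s′ T M → s * s′ * T ≤ n * (n * (n * n)) + n * (n * M) + n * (n * M) + n * (n * M) → J * M ≤ n * (n * n) → J ≤ n →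
        4 * s * (4 * s′) * (J * T) ≤ n * n * (64 * (n * (n * n)))
t≤-arith J n s s′ T M h₁ h₂ h₃ = lin 0 ((16 * J) ⊗ h₁ ⊕ (48 * (n * n)) ⊗ h₂ ⊕ (16 * (n * (n * (n * n)))) ⊗ h₃) (solve (J ∷ n ∷ s ∷ s′ ∷ T ∷ M ∷ []))

bad≤-arith : ∀ J z a b c d e f → J * a ≤ 64 * z → J * b ≤ 64 * z → J * c ≤ 64 * z → J * d ≤ 64 * z → J * e ≤ 64 * z → J * f ≤ 64 * z → J * (a + b + c + d + e + f) ≤ 384 * z
bad≤-arith J z a b c d e f h₁ h₂ h₃ h₄ h₅ h₆ = lin 0 (h₁ ⊕ h₂ ⊕ h₃ ⊕ h₄ ⊕ h₅ ⊕ h₆) (solve (J ∷ z ∷ a ∷ b ∷ c ∷ d ∷ e ∷ f ∷ []))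

path≡-eq : ∀ a b c d e → a * (b * (c * (d * e))) ≡ a * ((b * d) * (c * e))
path≡-eq = solve-∀

main-arith : ∀ J n s l P → 3 * J * (J * n + n) * l ≤ (J * n + n) * (J * n + n) * s + 9 * (J * J) * P → J * (3 * s) ≤ J * n + n → J * P ≤ 12 * (n * (n * n)) → 1 ≤ J →
        n * J * (J + 1) * (9 * (J * l)) ≤ n * J * (J + 1) * (J * (n * n) + 400 * (n * n))
main-arith J n s l P h₁ h₂ h₃ h₄ = lin ((74 * (J * J) + 396 * J) * (n * (n * n)))
  ((3 * J) ⊗ h₁ ⊕ ((J * n + n) * (J * n + n)) ⊗ h₂ ⊕ (27 * (J * J)) ⊗ h₃ ⊕ (n * (n * n)) ⊗ h₄) (solve (J ∷ n ∷ s ∷ l ∷ P ∷ []))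

L-split-arith : ∀ a b c x y z {x′ y′ z′} → x′ ≡ x → y′ ≡ y → z′ ≡ z → (a + x + y) + (x′ + b + z) + (y′ + z′ + c) ≡ a + b + c + 2 * (x + y + z)
L-split-arith a b c x y z refl refl refl = solve (a ∷ b ∷ c ∷ x ∷ y ∷ z ∷ [])

L-split-p132 : ∀ x y z → x + y + z ≡ x + z + y
L-split-p132 = solve-∀

L-split-p213 : ∀ x y z → x + y + z ≡ y + x + z
L-split-p213 = solve-∀

L-split-p312 : ∀ x y z → x + y + z ≡ z + x + y
L-split-p312 = solve-∀

L-split-p231 : ∀ x y z → x + y + z ≡ y + z + x
L-split-p231 = solve-∀

L-split-p321 : ∀ x y z → x + y + z ≡ z + y + x
L-split-p321 = solve-∀

module Bounds {V : Set} (_≟_ : DecidableEquality V) (H : Free V) (vs : List V) (uniq : Unique vs) (p : V → Fin 3)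
              (J : ℕ) (4≤J : 4 ≤ J) (J≤n : J ≤ length vs) (close : Close H vs p J) where

  open Free H
  open Sums vs
  open Parts H vs p
  open PartSums H vs p
  open Roles _≟_ H vs uniq p
  open Close close

  n² n³ : ℕ
  n² = n * n
  n³ = cube n

  instance
    J≢0 : NonZero J
    J≢0 = >-nonZero (≤-trans (s≤s z≤n) 4≤J)
    n≢0 : NonZero n
    n≢0 = >-nonZero (≤-trans (≤-trans (s≤s z≤n) 4≤J) J≤n)

  n≤4size : ∀ i → n ≤ 4 * size i
  n≤4size i = *-cancelˡ-≤ J (n≤4size-arith J n (size i) (≤size i) 4≤J)

  JM≤ : ∀ {i j h} → Distinct i j h → J * missing i j h ≤ n³
  JM≤ d012 = missing≤
  JM≤ d021 = subst (λ m → J * m ≤ n³) (missing-23 0F 1F 2F) missing≤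
  JM≤ d102 = subst (λ m → J * m ≤ n³) (missing-12 0F 1F 2F) missing≤
  JM≤ d120 = subst (λ m → J * m ≤ n³) (trans (missing-12 0F 1F 2F) (missing-23 1F 0F 2F)) missing≤
  JM≤ d201 = subst (λ m → J * m ≤ n³) (trans (missing-23 0F 1F 2F) (missing-12 0F 2F 1F)) missing≤
  JM≤ d210 = subst (λ m → J * m ≤ n³) (trans (trans (missing-23 0F 1F 2F) (missing-12 0F 2F 1F)) (missing-23 2F 0F 1F)) missing≤

  link*link≤ : ∀ v {i j h} → Distinct i j h → J * (link v i j * link v i h) ≤ 3 * (n² * n²)
  link*link≤ v {i} {j} {h} D = link*link≤-arith J n (link v i j * link v i h) (missing i j h) (link*link v i j h) (JM≤ D) J≤n

  path≤ : ∀ v {i j h} → Distinct i j h → J * path v i j ≤ 12 * n³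
  path≤ v {i} {j} {h} D = *-cancelˡ-≤ n (≤-trans (*-monoˡ-≤ (J * path v i j) (n≤4size h))
      (path≤-arith J n (size h) (path v i j) (missing i j h) (path*size v i j h) (JM≤ D) J≤n))

  t≤ : ∀ {i j h} → Distinct i j h → J * t i i j ≤ 64 * n³
  t≤ {i} {j} {h} D = *-cancelˡ-≤ n² {{m*n≢0 n n}} (≤-trans (*-monoˡ-≤ (J * t i i j) (*-mono-≤ (n≤4size h) (n≤4size j)))
      (t≤-arith J n (size h) (size j) (t i i j) (missing i j h) (t*sizes i j h) (JM≤ D) J≤n))

  bad≤ : J * bad ≤ 384 * n³
  bad≤ = bad≤-arith J n³ (t 0F 0F 1F) (t 0F 0F 2F) (t 1F 1F 0F) (t 1F 1F 2F) (t 2F 2F 0F) (t 2F 2F 1F) (t≤ d012) (t≤ d021) (t≤ d102) (t≤ d120) (t≤ d201) (t≤ d210)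

  deg-in : V → Fin 3 → V → ℕ
  deg-in v j z = Sum 1 λ x → I j x * E v z x

  deg-in≤ : ∀ v j z → deg-in v j z ≤ size j
  deg-in≤ v j z = ∑-mono vs λ x → ≤-trans (*-monoʳ-≤ (I j x) (ι≤1 (e v z x))) (≤-reflexive (*-identityʳ (I j x)))

  link≡ : ∀ v i j → link v i j ≡ Sum 1 λ z → I i z * deg-in v j z
  link≡ v i j = ∑-cong vs λ z → ∑-* vs (I i z) _

  path≡ : ∀ v i j → path v i j ≡ Sum 1 λ z → I i z * (deg-in v i z * deg-in v j z)
  path≡ v i j = ∑-cong vs λ z → trans (sum-cong 2 λ z′ x → path≡-eq (I i z) (I i z′) (I j x) (E v z z′) (E v z x))
      (trans (sum-* 2 (I i z) (λ z′ x → (I i z′ * E v z z′) * (I j x * E v z x)))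
             (cong (I i z *_) (trans (sum-cong 1 λ z′ → trans (∑-* vs (I i z′ * E v z z′) _) (*-comm (I i z′ * E v z z′) (deg-in v j z)))
                              (trans (∑-* vs (deg-in v j z) _) (*-comm (deg-in v j z) (deg-in v i z))))))

  -- For z in part i the link of v meets, up to few exceptions, only one of the parts i and j, so that
  -- the two degrees q and p satisfy (m - p)(m - q) ≥ 0 with pq negligible on average, m being the part size.
  main : ∀ v {i j h} → Distinct i j h → 9 * (J * (link v i j + link v i i)) ≤ J * n² + 400 * n²
  main v {i} {j} {h} D = *-cancelˡ-≤ (n * J * (J + 1)) {{m*n≢0 (n * J) (J + 1) {{m*n≢0 n J}} {{>-nonZero (m≤n+m 1 J)}}}}
      (main-arith J n (size i) (link v i j + link v i i) (path v i j) summed (size≤ i) (path≤ v D) (≤-trans (s≤s z≤n) 4≤J))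
    where
    N : ℕ
    N = J * n + n
    scaled : ∀ {a i} → a ≤ size i → J * (3 * a) ≤ N
    scaled {a} {i} h = ≤-trans (*-monoʳ-≤ J (*-monoʳ-≤ 3 h)) (size≤ i)
    pt : ∀ z → 3 * J * N * (I i z * deg-in v j z + I i z * deg-in v i z) ≤ N * N * I i z + 9 * (J * J) * (I i z * (deg-in v i z * deg-in v j z))
    pt z = ≤-trans (≤-reflexive (eq₁ J N (I i z) (deg-in v i z) (deg-in v j z)))
          (≤-trans (*-monoʳ-≤ (I i z) (product-gap N (J * (3 * deg-in v i z)) (J * (3 * deg-in v j z)) (scaled (deg-in≤ v i z)) (scaled (deg-in≤ v j z))))
                   (≤-reflexive (eq₂ J N (I i z) (deg-in v i z) (deg-in v j z))))
      where
      eq₁ : ∀ J N ι q p → 3 * J * N * (ι * p + ι * q) ≡ ι * (N * (J * (3 * q) + J * (3 * p)))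
      eq₁ = solve-∀
      eq₂ : ∀ J N ι q p → ι * (N * N + J * (3 * q) * (J * (3 * p))) ≡ N * N * ι + 9 * (J * J) * (ι * (q * p))
      eq₂ = solve-∀
    summed : 3 * J * N * (link v i j + link v i i) ≤ N * N * size i + 9 * (J * J) * path v i j
    summed = begin
      3 * J * N * (link v i j + link v i i)
        ≡⟨ cong (3 * J * N *_) (trans (cong₂ _+_ (link≡ v i j) (link≡ v i i)) (sym (∑-+ vs _ _))) ⟩
      3 * J * N * (Sum 1 λ z → I i z * deg-in v j z + I i z * deg-in v i z)
        ≡⟨ ∑-* vs (3 * J * N) _ ⟨
      (Sum 1 λ z → 3 * J * N * (I i z * deg-in v j z + I i z * deg-in v i z))
        ≤⟨ sum-mono₂ 1 (λ z → N * N * I i z) (λ z → 9 * (J * J) * (I i z * (deg-in v i z * deg-in v j z))) pt ⟩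
      (Sum 1 λ z → N * N * I i z) + (Sum 1 λ z → 9 * (J * J) * (I i z * (deg-in v i z * deg-in v j z)))
        ≡⟨ cong₂ _+_ (∑-* vs (N * N) (I i)) (trans (∑-* vs (9 * (J * J)) _) (cong (9 * (J * J) *_) (sym (path≡ v i j)))) ⟩
      N * N * size i + 9 * (J * J) * path v i j ∎
      where open ≤-Reasoning

  module _ (τ : ℕ) (τ-small : 3 * (τ * τ) ≤ J) (v : V) where

    either-small : ∀ {i j h} → Distinct i j h → τ * link v i j ≤ n² ⊎ τ * link v i h ≤ n²
    either-small {i} {j} {h} D with τ * link v i j ≤? n² | τ * link v i h ≤? n²
    ... | yes q | _     = inj₁ q
    ... | _     | yes q = inj₂ q
    ... | no ¬q | no ¬r = ⊥-elim (<⇒≱ (*-mono-< (≰⇒> ¬q) (≰⇒> ¬r)) (*-cancelˡ-≤ 3 (begin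
        3 * (τ * link v i j * (τ * link v i h)) ≡⟨ eq τ (link v i j) (link v i h) ⟩
        3 * (τ * τ) * (link v i j * link v i h) ≤⟨ *-monoˡ-≤ _ τ-small ⟩
        J * (link v i j * link v i h)           ≤⟨ link*link≤ v D ⟩
        3 * (n² * n²)                           ∎)))
      where
      open ≤-Reasoning
      eq : ∀ t a b → 3 * (t * a * (t * b)) ≡ 3 * (t * t) * (a * b)
      eq = solve-∀

    -- By `either-small` no part meets two dense cross links, so at most one of the three cross
    -- links of v is dense. The home `h` is the part opposite to it, where v would belong in a
    -- complete tripartite pattern.
    record Home : Set where
      constructor home
      field
        {i j h}  : Fin 3
        distinct : Distinct i j h
        small₁   : τ * link v h i ≤ n²
        small₂   : τ * link v h j ≤ n²

    find-home : Home
    find-home with τ * link v 0F 1F ≤? n² | τ * link v 0F 2F ≤? n²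
    ... | yes q | yes r = home d120 q r
    ... | yes q | no ¬r = home d021 (flip 0F 1F q) (one-of (either-small d201))
      where
      flip : ∀ a b → τ * link v a b ≤ n² → τ * link v b a ≤ n²
      flip a b = subst (λ l → τ * l ≤ n²) (link-sym v a b)
      one-of : τ * link v 2F 0F ≤ n² ⊎ τ * link v 2F 1F ≤ n² → τ * link v 1F 2F ≤ n²
      one-of (inj₁ s) = ⊥-elim (¬r (flip 2F 0F s))
      one-of (inj₂ s) = flip 2F 1F s
    ... | no ¬q | _     = home d012 (flip 0F 2F (one-of (either-small d012))) (one-of′ (either-small d102))
      where
      flip : ∀ a b → τ * link v a b ≤ n² → τ * link v b a ≤ n²
      flip a b = subst (λ l → τ * l ≤ n²) (link-sym v a b)
      one-of : τ * link v 0F 1F ≤ n² ⊎ τ * link v 0F 2F ≤ n² → τ * link v 0F 2F ≤ n²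
      one-of (inj₁ s) = ⊥-elim (¬q s)
      one-of (inj₂ s) = s
      one-of′ : τ * link v 1F 0F ≤ n² ⊎ τ * link v 1F 2F ≤ n² → τ * link v 2F 1F ≤ n²
      one-of′ (inj₁ s) = ⊥-elim (¬q (flip 1F 0F s))
      one-of′ (inj₂ s) = flip 1F 2F s

  L-split : ∀ v {i j h} → Distinct i j h → Sum 2 (E v) ≡ link v i i + link v j j + link v h h + 2 * (link v i j + link v h i + link v h j)
  L-split v D = trans (split₂ (E v)) (go D)
    where
    base : Σ₃ (λ i → Σ₃ λ j → link v i j) ≡ link v 0F 0F + link v 1F 1F + link v 2F 2F + 2 * (link v 0F 1F + link v 0F 2F + link v 1F 2F)
    base = L-split-arith (link v 0F 0F) (link v 1F 1F) (link v 2F 2F) (link v 0F 1F) (link v 0F 2F) (link v 1F 2F) (link-sym v 1F 0F) (link-sym v 2F 0F) (link-sym v 2F 1F)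
    s01 = link-sym v 0F 1F
    s02 = link-sym v 0F 2F
    s12 = link-sym v 1F 2F
    eq : ∀ {a a′ x x′} → a ≡ a′ → x ≡ x′ → a + 2 * x ≡ a′ + 2 * x′
    eq refl refl = refl
    c₃ : ∀ {x y z x′ y′ z′} → x ≡ x′ → y ≡ y′ → z ≡ z′ → x + y + z ≡ x′ + y′ + z′
    c₃ refl refl refl = refl
    a b c x y z : ℕ
    a = link v 0F 0F
    b = link v 1F 1F
    c = link v 2F 2F
    x = link v 0F 1F
    y = link v 0F 2F
    z = link v 1F 2F
    go : ∀ {i j h} → Distinct i j h → Σ₃ (λ i → Σ₃ λ j → link v i j) ≡ link v i i + link v j j + link v h h + 2 * (link v i j + link v h i + link v h j)
    go d012 = trans base (eq (refl {x = a + b + c}) (c₃ (refl {x = x}) s02 s12))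
    go d021 = trans base (eq (L-split-p132 a b c) (trans (L-split-p213 x y z) (c₃ (refl {x = y}) s01 (refl {x = z}))))
    go d102 = trans base (eq (L-split-p213 a b c) (trans (L-split-p132 x y z) (c₃ s01 s12 s02)))
    go d120 = trans base (eq (L-split-p231 a b c) (trans (L-split-p312 x y z) (c₃ (refl {x = z}) (refl {x = x}) (refl {x = y}))))
    go d201 = trans base (eq (L-split-p312 a b c) (trans (L-split-p231 x y z) (c₃ s02 (refl {x = z}) s01)))
    go d210 = trans base (eq (L-split-p321 a b c) (trans (L-split-p321 x y z) (c₃ s12 (refl {x = y}) (refl {x = x}))))

-- Near extremality passes to the parts.

k≤cube : ∀ k → k ≤ cube k
k≤cube zero    = z≤n
k≤cube (suc k) = m≤m*n (suc k) (suc k * suc k)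

cube-mono : ∀ {a b} → a ≤ b → cube a ≤ cube b
cube-mono h = *-mono-≤ h (*-mono-≤ h h)

-- If s ≤ 4t nothing has to be shown. Otherwise the deficit s - 4t is at most c s / q, hence at most
-- s / k.
scale-down : ∀ c k q s t .{{_ : NonZero c}} → c * k ≤ q → q * s ≤ 4 * (q * t) + c * s → k * s ≤ 4 * (k * t) + s
scale-down c k q s t h₁ h₂ with ≤-total s (4 * t)
... | inj₁ le = ≤-trans (*-monoʳ-≤ k le) (≤-trans (≤-reflexive (eq k t)) (m≤m+n (4 * (k * t)) s))
  where
  eq : ∀ k t → k * (4 * t) ≡ 4 * (k * t)
  eq = solve-∀
... | inj₂ ge = subst (λ s → k * s ≤ 4 * (k * t) + s) (m+[n∸m]≡n ge)
                  (rearrange k t (s ∸ 4 * t) (cancelled (s ∸ 4 * t) (subst (λ s → q * s ≤ 4 * (q * t) + c * s) (sym (m+[n∸m]≡n ge)) h₂)))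
  where
  cancelled : ∀ d → q * (4 * t + d) ≤ 4 * (q * t) + c * (4 * t + d) → k * d ≤ 4 * t + d
  cancelled d h = *-cancelˡ-≤ c (arith′ c k q t d h₁ h)
    where
    arith′ : ∀ c k q t d → c * k ≤ q → q * (4 * t + d) ≤ 4 * (q * t) + c * (4 * t + d) → c * (k * d) ≤ c * (4 * t + d)
    arith′ c k q t d h₁ h₂ = lin 0 (d ⊗ h₁ ⊕ h₂) (solve (c ∷ k ∷ q ∷ t ∷ d ∷ []))
  rearrange : ∀ k t d → k * d ≤ 4 * t + d → k * (4 * t + d) ≤ 4 * (k * t) + (4 * t + d)
  rearrange k t d h = lin 0 h (solve (k ∷ t ∷ d ∷ []))

-- Crossing triples account for at most 6/27 of n³ and each part for at most 1/108, while the total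
-- is about 1/4 = 6/27 + 3/108. Hence no part can fall much short of its share. The bound
-- `z ≤ 64 * s₁` turns errors in n³ into errors in the cube of the part size, which is where the
-- large constant comes from.
near-part-bound : ∀ q z T a b c B x s₁ s₂ s₃ y → q * z ≤ 4 * (q * T) + z → T ≡ a + b + c + 3 * B + 6 * x → 4 * (q * b) ≤ q * s₂ + 9 * s₂ → 4 * (q * c) ≤ q * s₃ + 9 * s₃ →
  q * B ≤ 384 * z → 27 * (q * s₁) ≤ q * z + 7 * z → 27 * (q * s₂) ≤ q * z + 7 * z → 27 * (q * s₃) ≤ q * z + 7 * z → 27 * (q * y) ≤ q * z + 7 * z → x ≤ y → z ≤ 64 * s₁ →
  s₂ ≤ z → s₃ ≤ z → q * s₁ ≤ 4 * (q * a) + 300000 * s₁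
near-part-bound q z T a b c B x s₁ s₂ s₃ y h₁ h₂ h₃ h₄ h₅ h₆ h₇ h₈ h₉ h₁₀ h₁₁ h₁₂ h₁₃ = linc 26 (92448 * s₁) (27 ⊗ h₁ ⊕ (108 * q) ⊗ ≤-reflexive h₂ ⊕ 27 ⊗ h₃ ⊕ 27 ⊗ h₄ ⊕ 324 ⊗ h₅ ⊕ h₆ ⊕ h₇ ⊕ h₈ ⊕ 24 ⊗ h₉ ⊕ (648 * q) ⊗ h₁₀ ⊕ 125118 ⊗ h₁₁ ⊕ 243 ⊗ h₁₂ ⊕ 243 ⊗ h₁₃)
  (solve (q ∷ z ∷ T ∷ a ∷ b ∷ c ∷ B ∷ x ∷ s₁ ∷ s₂ ∷ s₃ ∷ y ∷ []))

unscale : ∀ c k q .{{_ : NonZero c}} → c * k ≤ q → k ≤ q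
unscale c k q h = ≤-trans (m≤n*m k c) h

record Partitioned {V : Set} (H : Free V) (vs : List V) (J k′ : ℕ) : Set where
  field
    p       : V → Fin 3
    close   : Close H vs p J
    J≤n     : J ≤ length vs
    near    : ∀ h → NearExtremal H (PartSums.part H vs p h) k′
    large   : ∀ h → cube k′ ≤ length (PartSums.part H vs p h)

q³≤size-eq : ∀ q → 8 * (q * (q * q)) ≡ 2 * q * (2 * q * (2 * q))
q³≤size-eq = solve-∀

q³≤size-arith : ∀ a b n s → 8 * a ≤ b → b ≤ n → n ≤ 4 * s → a ≤ s
q³≤size-arith a b n s h₁ h₂ h₃ = linc 3 (4 * a) (h₁ ⊕ h₂ ⊕ h₃) (solve (a ∷ b ∷ n ∷ s ∷ []))

near-q-arith : ∀ k q z T → q ≤ k → k * z ≤ 4 * (k * T) + z → k * (q * z) ≤ k * (4 * (q * T) + z)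
near-q-arith k q z T h₁ h₂ = lin 0 (z ⊗ h₁ ⊕ q ⊗ h₂) (solve (k ∷ q ∷ z ∷ T ∷ []))

sizes-q-eq₁ : ∀ J a b c → J * J * (27 * (J * (a * (b * c)))) ≡ J * (3 * a) * (J * (3 * b) * (J * (3 * c)))
sizes-q-eq₁ = solve-∀

sizes-q-cubic : ∀ J n → 1 ≤ J → (J * n + n) * ((J * n + n) * (J * n + n)) ≤ J * J * (J * (n * (n * n)) + 7 * (n * (n * n)))
sizes-q-cubic J n h = lin 0 ((3 * (J * (n * (n * n)))) ⊗ h ⊕ (n * (n * n)) ⊗ h ⊕ (J * (n * (n * n))) ⊗ h) (solve (J ∷ n ∷ []))

sizes-q-arith : ∀ J q a z → q ≤ J → 27 * (J * a) ≤ J * z + 7 * z → J * (27 * (q * a)) ≤ J * (q * z + 7 * z)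
sizes-q-arith J q a z h₁ h₂ = lin 0 (q ⊗ h₂ ⊕ (7 * z) ⊗ h₁) (solve (J ∷ q ∷ a ∷ z ∷ []))

n³≤64s³-eq : ∀ s → 4 * s * (4 * s * (4 * s)) ≡ 64 * (s * (s * s))
n³≤64s³-eq = solve-∀

near-part-rotate : ∀ a b c → a + b + c ≡ c + a + b
near-part-rotate = solve-∀

module PartsNear {V : Set} (_≟_ : DecidableEquality V) (H : Free V) (vs : List V) (uniq : Unique vs) (p : V → Fin 3)
                 (J : ℕ) (4≤J : 4 ≤ J) (J≤n : J ≤ length vs) (close : Close H vs p J)
                 (k k′ q : ℕ) (2≤q : 2 ≤ q) (q≤J : q ≤ J) (2q≤k : 2 * q ≤ k) (k′≪q : 300000 * k′ ≤ q)
                 (k³≤n : cube k ≤ length vs) (near : NearExtremal H vs k) where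

  open Free H
  open Sums vs
  open Parts H vs p
  open PartSums H vs p
  open Bounds _≟_ H vs uniq p J 4≤J J≤n close
  open Close close

  T : ℕ
  T = edges H vs

  instance
    q≢0 : NonZero q
    q≢0 = >-nonZero (<⇒≤ 2≤q)
    k≢0 : NonZero k
    k≢0 = >-nonZero (≤-trans (<⇒≤ 2≤q) (≤-trans (m≤m+n q (q + 0)) 2q≤k))

  q³≤size : ∀ h → cube q ≤ size h
  q³≤size h = q³≤size-arith (cube q) (cube k) n (size h) (≤-trans (≤-reflexive (q³≤size-eq q)) (cube-mono 2q≤k)) k³≤n (n≤4size h)

  near-q : q * n³ ≤ 4 * (q * T) + n³
  near-q = *-cancelˡ-≤ k (near-q-arith k q n³ T (≤-trans (m≤m+n q (q + 0)) 2q≤k) near)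

  part-turán : ∀ h → 4 * (q * t h h h) ≤ q * cube (size h) + 9 * cube (size h)
  part-turán h = subst₂ (λ T s → 4 * (q * T) ≤ q * cube s + 9 * cube s) (part₃ h E) (length-part h)
      (Weights.turán H (part h) (filter⁺ (λ v → p v ≟ᶠ h) uniq) q 2≤q (subst (cube q ≤_) (sym (length-part h)) (q³≤size h)))

  bad-q : q * bad ≤ 384 * n³
  bad-q = ≤-trans (*-monoˡ-≤ bad q≤J) bad≤

  sizes-q : ∀ i j h → 27 * (q * (size i * (size j * size h))) ≤ q * n³ + 7 * n³
  sizes-q i j h = *-cancelˡ-≤ J (sizes-q-arith J q (size i * (size j * size h)) n³ q≤J
      (*-cancelˡ-≤ (J * J) {{m*n≢0 J J}} (≤-trans (≤-reflexive (sizes-q-eq₁ J (size i) (size j) (size h)))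
        (≤-trans (*-mono-≤ (size≤ i) (*-mono-≤ (size≤ j) (size≤ h))) (sizes-q-cubic J n (≤-trans (s≤s z≤n) 4≤J))))))

  n³≤64s³ : ∀ h → n³ ≤ 64 * cube (size h)
  n³≤64s³ h = ≤-trans (cube-mono (n≤4size h)) (≤-reflexive (n³≤64s³-eq (size h)))

  crossing≤ : t 0F 1F 2F ≤ size 0F * (size 1F * size 2F)
  crossing≤ = ≤-trans (m≤m+n _ (missing 0F 1F 2F)) (≤-reflexive (t+missing 0F 1F 2F))

  private
    near-part′ : ∀ h i j → Σ₃ (λ i → t i i i) ≡ t h h h + t i i i + t j j j → k′ * cube (size h) ≤ 4 * (k′ * t h h h) + cube (size h)
    near-part′ h i j e = arith k′ q n³ T (t h h h) (t i i i) (t j j j) bad (t 0F 1F 2F) (cube (size h)) (cube (size i)) (cube (size j)) (size 0F * (size 1F * size 2F))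
        near-q (trans T-split (cong (λ z → z + 3 * bad + 6 * t 0F 1F 2F) e)) (part-turán i) (part-turán j) bad-q (sizes-q h h h) (sizes-q i i i) (sizes-q j j j) (sizes-q 0F 1F 2F)
        crossing≤ (n³≤64s³ h) (cube≤ i) (cube≤ j) k′≪q
      where
      cube≤ : ∀ i → cube (size i) ≤ n³
      cube≤ i = cube-mono (≤-trans (∑-mono vs (λ v → ι≤1 _)) (≤-reflexive (∑-length vs)))
      arith : ∀ k q z T a b c B x s₁ s₂ s₃ y → q * z ≤ 4 * (q * T) + z → T ≡ a + b + c + 3 * B + 6 * x → 4 * (q * b) ≤ q * s₂ + 9 * s₂ → 4 * (q * c) ≤ q * s₃ + 9 * s₃ →
              q * B ≤ 384 * z → 27 * (q * s₁) ≤ q * z + 7 * z → 27 * (q * s₂) ≤ q * z + 7 * z → 27 * (q * s₃) ≤ q * z + 7 * z → 27 * (q * y) ≤ q * z + 7 * z → x ≤ y → z ≤ 64 * s₁ →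
              s₂ ≤ z → s₃ ≤ z → 300000 * k ≤ q → k * s₁ ≤ 4 * (k * a) + s₁
      arith k q z T a b c B x s₁ s₂ s₃ y h₁ h₂ h₃ h₄ h₅ h₆ h₇ h₈ h₉ h₁₀ h₁₁ h₁₂ h₁₃ h₁₄ = scale-down 300000 k q s₁ a h₁₄ (near-part-bound q z T a b c B x s₁ s₂ s₃ y h₁ h₂ h₃ h₄ h₅ h₆ h₇ h₈ h₉ h₁₀ h₁₁ h₁₂ h₁₃)

  near-part : ∀ h → k′ * cube (size h) ≤ 4 * (k′ * t h h h) + cube (size h)
  near-part 0F = near-part′ 0F 1F 2F refl
  near-part 1F = near-part′ 1F 0F 2F (cong (_+ t 2F 2F 2F) (+-comm (t 0F 0F 0F) (t 1F 1F 1F)))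
  near-part 2F = near-part′ 2F 0F 1F (near-part-rotate (t 0F 0F 0F) (t 1F 1F 1F) (t 2F 2F 2F))

  k′≤q : k′ ≤ q
  k′≤q = unscale 300000 k′ q k′≪q

  partitioned : Partitioned H vs J k′
  partitioned = record
    { p     = p
    ; close = close
    ; J≤n   = J≤n
    ; near  = λ h → subst₂ (λ s T → k′ * cube s ≤ 4 * (k′ * T) + cube s) (sym (length-part h)) (sym (part₃ h E)) (near-part h)
    ; large = λ h → subst (cube k′ ≤_) (sym (length-part h)) (≤-trans (cube-mono k′≤q) (q³≤size h))
    }

Partitions : ℕ → ℕ → ℕ → Set₁
Partitions k J k′ = ∀ {V} (_≟_ : DecidableEquality V) (H : Free V) vs → Unique vs → cube k ≤ length vs → NearExtremal H vs k → Partitioned H vs J k′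

partition-at : ∀ k k′ q j → 2 ≤ q → 300000 * k′ ≤ q → q ≤ j → 1 ≤ j → 2 * q + (3 + j) ≤ k →
  (∀ {V} (H : Free V) vs → Unique vs → cube k ≤ length vs → NearExtremal H vs k → Σ (V → Fin 3) λ p → Close H vs p (3 + j)) →
  Partitions k (3 + j) k′
partition-at k k′ q j 2≤q q-large q≤j 1≤j k-large stab _≟_ H vs uniq k³≤n near = from (stab H vs uniq k³≤n near)
  where
  from : (Σ _ λ p → Close H vs p (3 + j)) → Partitioned H vs (3 + j) k′
  from (p , close) = PartsNear.partitioned _≟_ H vs uniq p (3 + j) (+-monoʳ-≤ 3 1≤j)
        (≤-trans (m≤n+m (3 + j) (2 * q)) (≤-trans k-large (≤-trans (k≤cube k) k³≤n))) close
        k k′ q 2≤q (≤-trans q≤j (m≤n+m j 3)) (≤-trans (m≤m+n (2 * q) (3 + j)) k-large) q-large k³≤n near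

partition-from : ∀ k′ q j → 2 ≤ q → 300000 * k′ ≤ q → q ≤ j → 1 ≤ j → Σ ℕ λ k → 2 ≤ k × Partitions k (3 + j) k′
partition-from k′ q j 2≤q q-large q≤j 1≤j =
  let k , k-large , 2≤k , stab = stable j (2 * q + (3 + j)) in
  k , 2≤k , λ {V} → partition-at k k′ q j 2≤q q-large q≤j 1≤j k-large stab {V}

partition : ∀ J₀ k′ → Σ ℕ λ k → Σ ℕ λ J → 2 ≤ k × J₀ ≤ J × 4 ≤ J × Partitions k J k′
partition J₀ k′ = with-q (300000 * k′ + 2) (m≤n+m 2 (300000 * k′)) (m≤m+n (300000 * k′) 2)
  where
  with-q : ∀ q → 2 ≤ q → 300000 * k′ ≤ q → Σ ℕ λ k → Σ ℕ λ J → 2 ≤ k × J₀ ≤ J × 4 ≤ J × Partitions k J k′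
  with-q q 2≤q q-large =
    let k , 2≤k , parts = partition-from k′ q (J₀ + q + 1) 2≤q q-large (≤-trans (m≤n+m q J₀) (m≤m+n (J₀ + q) 1)) (m≤n+m 1 (J₀ + q)) in
    k , 3 + (J₀ + q + 1) , 2≤k , ≤-trans (m≤m+n J₀ q) (≤-trans (m≤m+n (J₀ + q) 1) (m≤n+m (J₀ + q + 1) 3)) , +-monoʳ-≤ 3 (m≤n+m 1 (J₀ + q)) , λ {V} → parts {V}

-- The iterated vertex-degree bound.

DegreeAt : ℕ → ℕ → ℕ → ℕ → Set₁
DegreeAt u w m k = ∀ {V} (_≟_ : DecidableEquality V) (H : Free V) vs → Unique vs → cube k ≤ length vs → NearExtremal H vs k →
  ∀ v → m * (w * Sums.Sum vs 2 (Free.E H v)) ≤ m * (u * (length vs * length vs)) + length vs * length vs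

-- Up to o(n²), the ordered link of every vertex has at most (u/w) n² edges.
Degree : ℕ → ℕ → Set₁
Degree u w = ∀ m → Σ ℕ λ k → 2 ≤ k × DegreeAt u w m k

degree-trivial : Degree 1 1
degree-trivial m = 2 , ≤-refl , λ _ H vs _ _ _ v → ≤-trans (*-monoʳ-≤ m (+-monoˡ-≤ 0 (all-pairs H vs v))) (m≤m+n _ _)
  where
  all-pairs : ∀ {V : Set} (H : Free V) vs v → Sums.Sum vs 2 (Free.E H v) ≤ length vs * length vs
  all-pairs H vs v = ≤-trans (Sums.sum-mono vs 2 (λ a b → ι≤1 (Free.e H v a b))) (≤-reflexive (trans (Sums.sum-drop vs 1 (λ _ → 1)) (cong (length vs *_) (∑-length vs))))

-- Using `main` for i, j and for j, i bounds the two inner links together with twice the cross link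
-- by 2n²/9. The home part adds (u/w)(n/3)² by the previous pass and the remaining cross links are
-- negligible; the sum is (2w + u)/(9w) times n².
degree-arith : ∀ m u w J τ n s lij lii ljj lhh lhi lhj L → 4 ≤ J → 4 * (m * (800 * w + 3 * u)) ≤ J → 144 * (m * w) ≤ τ →
  9 * (J * (lij + lii)) ≤ J * (n * n) + 400 * (n * n) → 9 * (J * (lij + ljj)) ≤ J * (n * n) + 400 * (n * n) → τ * lhi ≤ n * n → τ * lhj ≤ n * n →
  16 * m * (w * lhh) ≤ 16 * m * (u * (s * s)) + s * s → J * (3 * s) ≤ J * n + n → L ≡ lii + ljj + lhh + 2 * (lij + lhi + lhj) →
  m * (9 * w * L) ≤ m * ((2 * w + u) * (n * n)) + n * n
degree-arith m u w J τ n s lij lii ljj lhh lhi lhj L 4≤J J-large τ-large h₁ h₂ h₃ h₄ h₅ h₆ refl = final m u w (n * n) (s * s) lij lii ljj lhh lhi lhj B C D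
  where
  instance
    J≢0 : NonZero J
    J≢0 = >-nonZero (≤-trans (s≤s z≤n) 4≤J)
  S : 9 * (J * (s * s)) ≤ J * (n * n) + 3 * (n * n)
  S = *-cancelˡ-≤ J (arith J n s (*-mono-≤ h₆ h₆) (≤-trans (s≤s z≤n) 4≤J))
    where
    arith : ∀ J n s → J * (3 * s) * (J * (3 * s)) ≤ (J * n + n) * (J * n + n) → 1 ≤ J → J * (9 * (J * (s * s))) ≤ J * (J * (n * n) + 3 * (n * n))
    arith J n s h g = lin 0 (h ⊕ (n * n) ⊗ g) (solve (J ∷ n ∷ s ∷ []))
  B : 4 * m * (9 * w * (2 * lij + lii + ljj) + 9 * u * (s * s)) ≤ 4 * m * ((2 * w + u) * (n * n)) + n * n
  B = *-cancelˡ-≤ J (arith m u w J (n * n) (s * s) lij lii ljj h₁ h₂ S J-large)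
    where
    arith : ∀ m u w J n² s² a b c → 9 * (J * (a + b)) ≤ J * n² + 400 * n² → 9 * (J * (a + c)) ≤ J * n² + 400 * n² → 9 * (J * s²) ≤ J * n² + 3 * n² →
            4 * (m * (800 * w + 3 * u)) ≤ J → J * (4 * m * (9 * w * (2 * a + b + c) + 9 * u * s²)) ≤ J * (4 * m * ((2 * w + u) * n²) + n²)
    arith m u w J n² s² a b c g₁ g₂ g₃ g₄ = lin 0 ((4 * m * w) ⊗ g₁ ⊕ (4 * m * w) ⊗ g₂ ⊕ (4 * m * u) ⊗ g₃ ⊕ n² ⊗ g₄) (solve (m ∷ u ∷ w ∷ J ∷ n² ∷ s² ∷ a ∷ b ∷ c ∷ []))
  C : 36 * m * (w * lhh) ≤ 36 * m * (u * (s * s)) + n * n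
  C = arith m (w * lhh) (u * (s * s)) (s * s) (n * n) h₅ (*-cancelˡ-≤ J (arith′ J (s * s) (n * n) S 4≤J))
    where
    arith′ : ∀ J s² n² → 9 * (J * s²) ≤ J * n² + 3 * n² → 4 ≤ J → J * (9 * s²) ≤ J * (2 * n²)
    arith′ J s² n² g₁ g₂ = lin n² (g₁ ⊕ n² ⊗ g₂) (solve (J ∷ s² ∷ n² ∷ []))
    arith : ∀ m x y s² n² → 16 * m * x ≤ 16 * m * y + s² → 9 * s² ≤ 2 * n² → 36 * m * x ≤ 36 * m * y + n²
    arith m x y s² n² g₁ g₂ = linc 3 (2 * n²) (9 ⊗ g₁ ⊕ g₂) (solve (m ∷ x ∷ y ∷ s² ∷ n² ∷ []))
  D : 72 * m * (w * (lhi + lhj)) ≤ n * n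
  D = arith (m * w) τ lhi lhj (n * n) m w refl τ-large h₃ h₄
    where
    arith : ∀ x τ a b n² m w → x ≡ m * w → 144 * x ≤ τ → τ * a ≤ n² → τ * b ≤ n² → 72 * m * (w * (a + b)) ≤ n²
    arith _ τ a b n² m w refl g₁ g₂ g₃ = linc 1 0 (a ⊗ g₁ ⊕ b ⊗ g₁ ⊕ g₂ ⊕ g₃) (solve (τ ∷ a ∷ b ∷ n² ∷ m ∷ w ∷ []))
  final : ∀ m u w n² s² lij lii ljj lhh lhi lhj → 4 * m * (9 * w * (2 * lij + lii + ljj) + 9 * u * s²) ≤ 4 * m * ((2 * w + u) * n²) + n² →
    36 * m * (w * lhh) ≤ 36 * m * (u * s²) + n² → 72 * m * (w * (lhi + lhj)) ≤ n² →
    m * (9 * w * (lii + ljj + lhh + 2 * (lij + lhi + lhj))) ≤ m * ((2 * w + u) * n²) + n²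
  final m u w n² s² lij lii ljj lhh lhi lhj B C D = linc 3 n² (B ⊕ C ⊕ D) (solve (m ∷ u ∷ w ∷ n² ∷ s² ∷ lij ∷ lii ∷ ljj ∷ lhh ∷ lhi ∷ lhj ∷ []))

module DegreeStep (u w m k k′ J τ : ℕ) (J-large : 4 * (m * (800 * w + 3 * u)) ≤ J) (τ-large : 144 * (m * w) ≤ τ) (τ-small : 3 * (τ * τ) ≤ J) (4≤J : 4 ≤ J)
  (bound : DegreeAt u w (16 * m) k′)
  {V : Set} (_≟_ : DecidableEquality V) (H : Free V) (vs : List V) (uniq : Unique vs) (P : Partitioned H vs J k′) (v : V) where

  open Partitioned P
  open Parts H vs p
  open PartSums H vs p
  open Roles _≟_ H vs uniq p
  open Bounds _≟_ H vs uniq p J 4≤J J≤n close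

  degree-bound : m * (9 * w * Sums.Sum vs 2 (Free.E H v)) ≤ m * ((2 * w + u) * (length vs * length vs)) + length vs * length vs
  degree-bound = at (find-home τ τ-small v)
    where
    at : Home τ τ-small v → m * (9 * w * Sums.Sum vs 2 (Free.E H v)) ≤ m * ((2 * w + u) * (length vs * length vs)) + length vs * length vs
    at (home {i} {j} {h} D s₁ s₂) = degree-arith m u w J τ n (size h) (link v i j) (link v i i) (link v j j) (link v h h) (link v h i) (link v h j)
      (Sums.Sum vs 2 (Free.E H v)) 4≤J J-large τ-large (main v D)
      (subst (λ l → 9 * (J * (l + link v j j)) ≤ J * (n * n) + 400 * (n * n)) (link-sym v j i) (main v (swap-12 D))) s₁ s₂
      (subst₂ (λ L s → 16 * m * (w * L) ≤ 16 * m * (u * (s * s)) + s * s) (part₂ h (Free.E H v)) (length-part h)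
        (bound _≟_ H (part h) (filter⁺ (λ v → p v ≟ᶠ h) uniq) (large h) (near h) v))
      (Close.size≤ close h) (L-split v D)

degree-step-at : ∀ u w m τ Q k′ → 144 * (m * w) ≤ τ → 4 * (m * (800 * w + 3 * u)) ≤ Q → DegreeAt u w (16 * m) k′ →
  (Σ ℕ λ k → Σ ℕ λ J → 2 ≤ k × Q + 3 * (τ * τ) ≤ J × 4 ≤ J × Partitions k J k′) → Σ ℕ λ k → 2 ≤ k × DegreeAt (2 * w + u) (9 * w) m k
degree-step-at u w m τ Q k′ τ-large Q-large bound (k , J , 2≤k , J-large , 4≤J , parts) = k , 2≤k , λ _≟_ H vs uniq k³≤n near v →
  DegreeStep.degree-bound u w m k k′ J τ (≤-trans Q-large (≤-trans (m≤m+n Q (3 * (τ * τ))) J-large)) τ-large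
    (≤-trans (m≤n+m (3 * (τ * τ)) Q) J-large) 4≤J bound _≟_ H vs uniq (parts _≟_ H vs uniq k³≤n near) v

degree-step : ∀ u w → Degree u w → Degree (2 * w + u) (9 * w)
degree-step u w deg m = from (deg (16 * m))
  where
  from : (Σ ℕ λ k′ → 2 ≤ k′ × DegreeAt u w (16 * m) k′) → Σ ℕ λ k → 2 ≤ k × DegreeAt (2 * w + u) (9 * w) m k
  from (k′ , _ , bound) = degree-step-at u w m (144 * (m * w)) (4 * (m * (800 * w + 3 * u))) k′ ≤-refl ≤-refl bound
                            (partition (4 * (m * (800 * w + 3 * u)) + 3 * (144 * (m * w) * (144 * (m * w)))) k′)

-- Mixed edges against missing crossing triples.

distribute : ∀ c a b d e → c * (a + b + d + e) ≡ c * a + c * b + c * d + c * e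
distribute = solve-∀

swap-coefficient : ∀ c a b → a * (c * b) ≡ c * (a * b)
swap-coefficient = solve-∀

times : ∀ c d e {a b} → c * a ≤ d * b → c * (e * a) ≤ d * (e * b)
times c d e {a} {b} h = subst₂ _≤_ (swap-coefficient c e a) (swap-coefficient d e b) (*-monoʳ-≤ e h)

-- A record, so that conversion checking compares a and b instead of unfolding multiplication by the numerals c and d.
record Scaled (c a d b : ℕ) : Set where
  constructor scaled
  field holds : c * a ≤ d * b

-- In units of N², the product of two part sizes is about 1/9 and the two missing degrees take away
-- at most 154/4500, leaving about 0.0769. Divided by a part size of 1/3 this is about 0.231, above
-- 137/600.
many-common : ∀ N g h x μ μ′ .{{_ : NonZero g}} → h * g ≤ h + g * x + μ + μ′ → Scaled 4500 μ 77 (N * N) → Scaled 4500 μ′ 77 (N * N) →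
  Scaled 1999 N 6000 h → Scaled 1999 N 6000 g → h ≤ N → 10000 ≤ N → Scaled 137 N 600 x
many-common N g h x μ μ′ h₁ (scaled h₂) (scaled h₃) (scaled h₄) (scaled h₅) h₆ h₇ = scaled (*-cancelˡ-≤ g (subst₂ _≤_ (sym (swap-coefficient 137 g N)) (sym (swap-coefficient 600 g x))
    (arith N (N * N) h (g * h) (g * N) (g * x) μ μ′ (≤-trans (≤-reflexive (*-comm g h)) h₁) h₂ h₃ (times 1999 6000 g h₄)
      (subst (λ t → 1999 * (N * N) ≤ 6000 * t) (*-comm N g) (times 1999 6000 N h₅)) h₆ (*-monoˡ-≤ N h₇))))
  where
  arith : ∀ N NN h gh gN gx μ μ′ → gh ≤ h + gx + μ + μ′ → 4500 * μ ≤ 77 * NN → 4500 * μ′ ≤ 77 * NN →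
    1999 * gN ≤ 6000 * gh → 1999 * NN ≤ 6000 * gN → h ≤ N → 10000 * N ≤ NN → 137 * gN ≤ 600 * gx
  arith N NN h gh gN gx μ μ′ h₁ h₂ h₃ h₄ h₅ h₆ h₇ = linc 479 (192 * gN + 110 * NN + 2000 * N)
    (≤-trans (288000 ⊗ h₁) (≤-reflexive (distribute 288000 h gx μ μ′)) ⊕ 64 ⊗ h₂ ⊕ 64 ⊗ h₃ ⊕ 48 ⊗ h₄ ⊕ 5 ⊗ h₅ ⊕ 288000 ⊗ h₆ ⊕ 29 ⊗ h₇) (solve (N ∷ NN ∷ h ∷ gh ∷ gN ∷ gx ∷ μ ∷ μ′ ∷ []))

-- One of the two factors μ is replaced by its bound: 137² = 18769 and 600² · 77/4500 = 6160.
squared : ∀ N t μ .{{_ : NonZero N}} → Scaled (137 * N * (137 * N)) t (600 * 600) (μ * μ) → Scaled 4500 μ 77 (N * N) → Scaled 18769 t 6160 μ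
squared N t μ (scaled h₁) (scaled h₂) = scaled (*-cancelˡ-≤ (N * N) {{m*n≢0 N N}} (subst₂ _≤_ (sym (swap-coefficient 18769 (N * N) t)) (sym (swap-coefficient 6160 (N * N) μ))
  (linear (N * N * t) (μ * μ) (N * N * μ) (≤-trans (≤-reflexive (square 137 N t)) h₁) (subst (λ s → 4500 * (μ * μ) ≤ 77 * s) (*-comm μ (N * N)) (times 4500 77 μ h₂)))))
  where
  square : ∀ c N t → c * c * (N * N * t) ≡ c * N * (c * N) * t
  square = solve-∀
  linear : ∀ a b c → 18769 * a ≤ 600 * 600 * b → 4500 * b ≤ 77 * c → 18769 * a ≤ 6160 * c
  linear a b c h₁ h₂ = lin 0 (h₁ ⊕ 80 ⊗ h₂) (solve (a ∷ b ∷ c ∷ []))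

six-sum : ∀ c d a₁ a₂ a₃ a₄ a₅ a₆ M → Scaled c a₁ d M → Scaled c a₂ d M → Scaled c a₃ d M → Scaled c a₄ d M → Scaled c a₅ d M → Scaled c a₆ d M →
  Scaled c (a₁ + a₂ + a₃ + a₄ + a₅ + a₆) (6 * d) M
six-sum c d a₁ a₂ a₃ a₄ a₅ a₆ M (scaled h₁) (scaled h₂) (scaled h₃) (scaled h₄) (scaled h₅) (scaled h₆) =
  scaled (lin 0 (h₁ ⊕ h₂ ⊕ h₃ ⊕ h₄ ⊕ h₅ ⊕ h₆) (solve (c ∷ d ∷ a₁ ∷ a₂ ∷ a₃ ∷ a₄ ∷ a₅ ∷ a₆ ∷ M ∷ [])))

guarded : ∀ c d x s t → (x ≡ true → Scaled c s d t) → c * (ι x * s) ≤ d * (ι x * t)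
guarded c d true  s t h = subst₂ (λ s t → c * s ≤ d * t) (sym (+-identityʳ s)) (sym (+-identityʳ t)) (Scaled.holds (h refl))
guarded c d false s t h = ≤-trans (≤-reflexive (*-zeroʳ c)) z≤n

guarded₃ : ∀ c d x y z s t → (x ≡ true → y ≡ true → z ≡ true → c ≤ d * s × c ≤ d * t) → c * c * (ι x * (ι y * ι z)) ≤ d * d * ((ι x * s) * (ι y * t))
guarded₃ c d true  true  true  s t h = ≤-trans (≤-reflexive (*-identityʳ (c * c)))
  (≤-trans (*-mono-≤ (proj₁ (h refl refl refl)) (proj₂ (h refl refl refl))) (≤-reflexive (squares d s t)))
  where
  squares : ∀ d s t → d * s * (d * t) ≡ d * d * ((1 * s) * (1 * t))
  squares = solve-∀
guarded₃ c d true  true  false s t h = ≤-trans (≤-reflexive (*-zeroʳ (c * c))) z≤n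
guarded₃ c d true  false z     s t h = ≤-trans (≤-reflexive (*-zeroʳ (c * c))) z≤n
guarded₃ c d false y     z     s t h = ≤-trans (≤-reflexive (*-zeroʳ (c * c))) z≤n

sum-over-part-eq : ∀ a b c d → a * (b * (c * d)) ≡ c * (a * (b * d))
sum-over-part-eq = solve-∀

module Exact {V : Set} (_≟_ : DecidableEquality V) (H : Free V) (vs : List V) (uniq : Unique vs) (p : V → Fin 3) (N : ℕ) (10⁴≤N : 10000 ≤ N)
             (size-large : ∀ i → Scaled 1999 N 6000 (Parts.size H vs p i)) (vs≤N : length vs ≤ N)
             (missing-small : ∀ b → b ∈ vs → ∀ {i j h} → p b ≡ h → Distinct i j h →
                Scaled 4500 (PartSums.within₂ H vs p (Free.nE H b) i j) 77 (N * N)) where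

  open Free H
  open Sums vs
  open Parts H vs p
  open PartSums H vs p
  open Roles _≟_ H vs uniq p

  m : Fin 3 → V → V → ℕ
  m h b a = Sum 1 λ c → I h c * nE b a c

  common : Fin 3 → V → V → V → ℕ
  common h b a a′ = Sum 1 λ c → I h c * (nE b a c * nE b a′ c)

  common≤ˡ : ∀ h b a a′ → common h b a a′ ≤ m h b a
  common≤ˡ h b a a′ = ∑-mono vs λ c → *-monoʳ-≤ (I h c) (≤-trans (*-monoʳ-≤ (nE b a c) (ι≤1 (not (e b a′ c)))) (≤-reflexive (*-identityʳ _)))

  common≤ʳ : ∀ h b a a′ → common h b a a′ ≤ m h b a′
  common≤ʳ h b a a′ = ∑-mono vs λ c → *-monoʳ-≤ (I h c) (≤-trans (*-monoˡ-≤ (nE b a′ c) (ι≤1 (not (e b a c)))) (≤-reflexive (*-identityˡ _)))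

  size≤N : ∀ h → size h ≤ N
  size≤N h = ≤-trans (≤-trans (∑-mono vs (λ v → ι≤1 _)) (≤-reflexive (∑-length vs))) vs≤N

  -- Let c lie in part h and b′ in part j. If bac or ba′c is an edge, then ab′c and a′b′c complete
  -- the sequence a′ b a c b′ or a b a′ c b′, so b′ = b. When a and a′ miss few crossing pairs, a
  -- large share of part h must therefore be missing at b from both a and a′.
  edge-weight : ∀ a a′ b j h → E a a′ b * (size h * size j) ≤ size h + size j * common h b a a′ + within₂ (nE a) j h + within₂ (nE a′) j h
  edge-weight a a′ b j h = begin
    E a a′ b * (size h * size j)
      ≡⟨ trans (sum-* 2 (E a a′ b) (λ c b′ → I h c * I j b′)) (cong (E a a′ b *_) prod) ⟨
    (Sum 2 λ c b′ → E a a′ b * (I h c * I j b′))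
      ≤⟨ sum-mono₄ 2 (λ c b′ → I h c * same b b′) (λ c b′ → (I h c * (nE b a c * nE b a′ c)) * I j b′) (λ c b′ → I j b′ * (I h c * nE a b′ c)) (λ c b′ → I j b′ * (I h c * nE a′ b′ c)) pt ⟩
    (Sum 2 λ c b′ → I h c * same b b′) + (Sum 2 λ c b′ → (I h c * (nE b a c * nE b a′ c)) * I j b′) + (Sum 2 λ c b′ → I j b′ * (I h c * nE a b′ c)) + (Sum 2 λ c b′ → I j b′ * (I h c * nE a′ b′ c))
      ≤⟨ ∑-mono vs (λ c → ≤-trans (≤-reflexive (∑-* vs (I h c) (same b))) (≤-trans (*-monoʳ-≤ (I h c) (∑same≤1 b)) (≤-reflexive (*-identityʳ (I h c)))))
         ⊕ ≤-reflexive (trans (sum-cong 1 λ c → trans (∑-* vs (I h c * (nE b a c * nE b a′ c)) (I j)) (*-comm (I h c * (nE b a c * nE b a′ c)) (size j))) (∑-* vs (size j) _))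
         ⊕ ≤-reflexive (perm 2 (0 ∷ []) (λ b′ c → I j b′ * (I h c * nE a b′ c)))
         ⊕ ≤-reflexive (perm 2 (0 ∷ []) (λ b′ c → I j b′ * (I h c * nE a′ b′ c))) ⟩
    size h + size j * common h b a a′ + within₂ (nE a) j h + within₂ (nE a′) j h ∎
    where
    open ≤-Reasoning
    prod : (Sum 2 λ c b → I h c * I j b) ≡ size h * size j
    prod = trans (∑-cong vs λ c → trans (∑-* vs (I h c) (I j)) (*-comm (I h c) (size j))) (trans (∑-* vs (size j) (I h)) (*-comm (size j) (size h)))
    pt : ∀ c b′ → E a a′ b * (I h c * I j b′) ≤ I h c * same b b′ + (I h c * (nE b a c * nE b a′ c)) * I j b′ + I j b′ * (I h c * nE a b′ c) + I j b′ * (I h c * nE a′ b′ c)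
    pt c b′ = ≤-trans (byCases 7 (λ hc jb q r r′ s s′ → ι q * (ι hc * ι jb))
        (λ hc jb q r r′ s s′ → ι hc * (ι ((q ∧ r ∧ s ∧ s′) Data.Bool.∨ (q ∧ r′ ∧ s′ ∧ s))) + (ι hc * (ι (not r) * ι (not r′))) * ι jb + ι jb * (ι hc * ι (not s)) + ι jb * (ι hc * ι (not s′))) refl
        (does (p c ≟ᶠ h)) (does (p b′ ≟ᶠ j)) (e a a′ b) (e b a c) (e b a′ c) (e a b′ c) (e a′ b′ c))
      (+-monoˡ-≤ _ (+-monoˡ-≤ _ (+-monoˡ-≤ _ (*-monoʳ-≤ (I h c) (ι≤same b b′ _ either)))))
      where
      ∨-elim : ∀ x y → x Data.Bool.∨ y ≡ true → (x ≡ true → b ≡ b′) → (y ≡ true → b ≡ b′) → b ≡ b′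
      ∨-elim true  y _ f g = f refl
      ∨-elim false y h f g = g h
      either : (e a a′ b ∧ e b a c ∧ e a b′ c ∧ e a′ b′ c) Data.Bool.∨ (e a a′ b ∧ e b a′ c ∧ e a′ b′ c ∧ e a b′ c) ≡ true → b ≡ b′
      either h = ∨-elim _ _ h
        (λ h₁ → cycle {a′} {a} {c} (subst (λ q → q ∧ e b a c ∧ e a c b′ ∧ e c b′ a′ ≡ true) (rotˡ a a′ b) (subst₂ (λ s t → e a a′ b ∧ e b a c ∧ s ∧ t ≡ true) (sym₂₃ a b′ c) (rev a′ b′ c) h₁)))
        (λ h₂ → cycle {a} {a′} {c} (subst (λ q → q ∧ e b a′ c ∧ e a′ c b′ ∧ e c b′ a ≡ true) (sym₂₃ a a′ b) (subst₂ (λ s t → e a a′ b ∧ e b a′ c ∧ s ∧ t ≡ true) (sym₂₃ a′ b′ c) (rev a b′ c) h₂)))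

  instance
    N≢0 : NonZero N
    N≢0 = >-nonZero (≤-trans (s≤s z≤n) 10⁴≤N)

  size≢0 : ∀ h → NonZero (size h)
  size≢0 h = positive N (size h) (size-large h)
    where
    positive : ∀ N s .{{_ : NonZero N}} → Scaled 1999 N 6000 s → NonZero s
    positive (suc N) zero    (scaled ())
    positive (suc N) (suc s) _ = _

  edge⇒common : ∀ a a′ b {i j h} → a ∈ vs → a′ ∈ vs → p a ≡ i → p a′ ≡ i → Distinct j h i → e a a′ b ≡ true → Scaled 137 N 600 (common h b a a′)
  edge⇒common a a′ b {i} {j} {h} a∈ a′∈ pa pa′ D edge = many-common N (size j) (size h) (common h b a a′) (within₂ (nE a) j h) (within₂ (nE a′) j h) {{size≢0 j}}
    (≤-trans (≤-reflexive (sym (trans (cong (λ t → ι t * (size h * size j)) edge) (*-identityˡ _)))) (edge-weight a a′ b j h))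
    (missing-small a a∈ pa D) (missing-small a′ a′∈ pa′ D) (size-large h) (size-large j) (size≤N h) 10⁴≤N

  t-at : Fin 3 → V → ℕ
  t-at i b = within₂ (λ a a′ → E a a′ b) i i

  -- Each counted edge has both `m h b a` and `m h b a′` large. Its weight is thus dominated by
  -- their product, and these products sum to the square of the missing degree of b, a quadratic
  -- gain over the obvious bound.
  ordered-pairs : ∀ c d b i h → (∀ a a′ → a ∈ vs → a′ ∈ vs → p a ≡ i → p a′ ≡ i → e a a′ b ≡ true → c ≤ d * common h b a a′) →
    Scaled (c * c) (t-at i b) (d * d) (within₂ (nE b) i h * within₂ (nE b) i h)
  ordered-pairs c d b i h hyp = scaled (begin
    c * c * t-at i b
      ≡⟨ sum-* 2 (c * c) (λ a a′ → I i a * (I i a′ * E a a′ b)) ⟨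
    (Sum 2 λ a a′ → c * c * (I i a * (I i a′ * E a a′ b)))
      ≤⟨ ∑-mono∈ vs (λ a a∈ → ∑-mono∈ vs (pt a a∈)) ⟩
    (Sum 2 λ a a′ → d * d * ((I i a * m h b a) * (I i a′ * m h b a′)))
      ≡⟨ sum-* 2 (d * d) (λ a a′ → (I i a * m h b a) * (I i a′ * m h b a′)) ⟩
    d * d * (Sum 2 λ a a′ → (I i a * m h b a) * (I i a′ * m h b a′))
      ≡⟨ cong (d * d *_) (trans (sum-cong 1 λ a → trans (∑-* vs (I i a * m h b a) (λ a′ → I i a′ * m h b a′)) (cong (I i a * m h b a *_) (sym μ≡)))
           (trans (∑-cong vs λ a → *-comm (I i a * m h b a) μ) (trans (∑-* vs μ _) (cong (μ *_) (sym μ≡))))) ⟩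
    d * d * (μ * μ) ∎)
    where
    open ≤-Reasoning
    μ : ℕ
    μ = within₂ (nE b) i h
    μ≡ : μ ≡ Sum 1 λ a → I i a * m h b a
    μ≡ = ∑-cong vs λ a → ∑-* vs (I i a) _
    pt : ∀ a → a ∈ vs → ∀ a′ → a′ ∈ vs → c * c * (I i a * (I i a′ * E a a′ b)) ≤ d * d * ((I i a * m h b a) * (I i a′ * m h b a′))
    pt a a∈ a′ a′∈ = guarded₃ c d (does (p a ≟ᶠ i)) (does (p a′ ≟ᶠ i)) (e a a′ b) (m h b a) (m h b a′) λ x y eq →
      let common≥ = hyp a a′ a∈ a′∈ (does-true (p a ≟ᶠ i) x) (does-true (p a′ ≟ᶠ i) y) eq in
      ≤-trans common≥ (*-monoʳ-≤ d (common≤ˡ h b a a′)) , ≤-trans common≥ (*-monoʳ-≤ d (common≤ʳ h b a a′))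

  sum-over-part : ∀ c d {i j h} → (∀ b → b ∈ vs → p b ≡ j → Scaled c (t-at i b) d (within₂ (nE b) i h)) → Scaled c (t i i j) d (missing j i h)
  sum-over-part c d {i} {j} {h} hyp = scaled (begin
    c * t i i j
      ≡⟨ cong (c *_) (perm 3 (0 ∷ 1 ∷ []) (λ a a′ b → I i a * (I i a′ * (I j b * E a a′ b)))) ⟨
    c * (Sum 3 λ b a a′ → I i a * (I i a′ * (I j b * E a a′ b)))
      ≡⟨ cong (c *_) (sum-cong 1 λ b → trans (sum-cong 2 λ a a′ → sum-over-part-eq (I i a) (I i a′) (I j b) (E a a′ b)) (sum-* 2 (I j b) (λ a a′ → I i a * (I i a′ * E a a′ b)))) ⟩
    c * (Sum 1 λ b → I j b * t-at i b)
      ≡⟨ ∑-* vs c (λ b → I j b * t-at i b) ⟨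
    (Sum 1 λ b → c * (I j b * t-at i b))
      ≤⟨ ∑-mono∈ vs (λ b b∈ → guarded c d (does (p b ≟ᶠ j)) (t-at i b) (within₂ (nE b) i h) λ x → hyp b b∈ (does-true (p b ≟ᶠ j) x)) ⟩
    (Sum 1 λ b → d * (I j b * within₂ (nE b) i h))
      ≡⟨ trans (∑-* vs d (λ b → I j b * within₂ (nE b) i h)) (cong (d *_) (sum-cong 1 λ b → sym (sum-* 2 (I j b) (λ a c → I i a * (I h c * nE b a c))))) ⟩
    d * missing j i h ∎)
    where
    open ≤-Reasoning

  t-bound : ∀ {i j h} → Distinct j h i → Scaled 18769 (t i i j) 6160 (missing j i h)
  t-bound {i} {j} {h} D = sum-over-part 18769 6160 λ b b∈ pb → squared N (t-at i b) (within₂ (nE b) i h)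
    (ordered-pairs (137 * N) 600 b i h λ a a′ a∈ a′∈ pa pa′ eq → Scaled.holds (edge⇒common a a′ b a∈ a′∈ pa pa′ D eq))
    (missing-small b b∈ pb (swap-12 (swap-23 (swap-12 D))))

  -- The ratio 6 · 6160 / 18769 is about 1.97; being below 2 is what `all-zero` exploits.
  bad-bound : Scaled 18769 bad (6 * 6160) (missing 0F 1F 2F)
  bad-bound = six-sum 18769 6160 (t 0F 0F 1F) (t 0F 0F 2F) (t 1F 1F 0F) (t 1F 1F 2F) (t 2F 2F 0F) (t 2F 2F 1F) (missing 0F 1F 2F)
      (step d120 (missing-12 1F 0F 2F)) (step d210 (trans (missing-12 2F 0F 1F) (missing-23 0F 2F 1F))) (step d021 refl)
      (step d201 (trans (missing-12 2F 1F 0F) (trans (missing-23 1F 2F 0F) (missing-12 1F 0F 2F)))) (step d012 (missing-23 0F 2F 1F)) (step d102 (trans (missing-23 1F 2F 0F) (missing-12 1F 0F 2F)))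
    where
    step : ∀ {i j h M} → Distinct j h i → missing j i h ≡ M → Scaled 18769 (t i i j) 6160 M
    step {i} {j} {h} D e = subst (Scaled 18769 (t i i j) 6160) e (t-bound D)

-- Each vertex has a heavy cross link or a small degree.

between : ∀ a b c → a ≤ b → b ≤ c → b * b + a * c ≤ a * b + b * c
between a b c h g = subst₂ (λ b c → b * b + a * c ≤ a * b + b * c) b≡ (trans (cong (_+ (c ∸ b)) b≡) (m+[n∸m]≡n g)) (arith a (b ∸ a) (c ∸ b))
  where
  b≡ : a + (b ∸ a) ≡ b
  b≡ = m+[n∸m]≡n h
  arith : ∀ a s t → (a + s) * (a + s) + a * (a + s + t) ≤ a * (a + s) + (a + s) * (a + s + t)
  arith a s t = lin {X = 0} {Y = 0} (s * t) ≤-refl (solve (a ∷ s ∷ t ∷ []))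

quadratic : ∀ J n z z′ a y Y N → z ≡ n * n → z′ ≡ n * (n * n) → 1 ≤ J → y ≤ z → N ≡ J * n + n → Y ≡ J * J * y + (2 * J + 1) * (n * n) →
  N * N * (9 * (J * J) * a) ≤ Y * Y + 648 * (J * J) * (N * z′) → J * (z * (9 * a)) ≤ J * (y * y) + 1311 * (z * z)
quadratic J n _ _ a y Y N refl refl 1≤J y≤z refl refl h = *-cancelˡ-≤ (J * (J * J)) {{m*n≢0 J (J * J) {{J≢0}} {{m*n≢0 J J {{J≢0}} {{J≢0}}}}}} (arith J (n * n) a y 1≤J y≤z
    (≤-trans (≤-reflexive (left J n a)) (≤-trans (*-monoˡ-≤ (9 * (J * J) * a) (*-mono-≤ (m≤m+n (J * n) n) (m≤m+n (J * n) n)))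
    (≤-trans h (≤-reflexive (right J n y))))))
  where
  J≢0 : NonZero J
  J≢0 = >-nonZero 1≤J
  left : ∀ J n a → J * J * (n * n) * (9 * (J * J) * a) ≡ J * n * (J * n) * (9 * (J * J) * a)
  left = solve-∀
  right : ∀ J n y → (J * J * y + (2 * J + 1) * (n * n)) * (J * J * y + (2 * J + 1) * (n * n)) + 648 * (J * J) * ((J * n + n) * (n * (n * n)))
        ≡ (J * J * y + (2 * J + 1) * (n * n)) * (J * J * y + (2 * J + 1) * (n * n)) + 648 * (J * J * (J * (n * n * (n * n)))) + 648 * (J * J * (n * n * (n * n)))
  right = solve-∀
  arith : ∀ J z a y → 1 ≤ J → y ≤ z → J * J * z * (9 * (J * J) * a) ≤ (J * J * y + (2 * J + 1) * z) * (J * J * y + (2 * J + 1) * z) + 648 * (J * J * (J * (z * z))) + 648 * (J * J * (z * z)) →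
          J * (J * J) * (J * (z * (9 * a))) ≤ J * (J * J) * (J * (y * y) + 1311 * (z * z))
  arith J z a y g₁ g₂ h = lin 0 (h ⊕ ((4 * (J * (J * J)) + 2 * (J * J)) * z) ⊗ g₂ ⊕ 659 ⊗ ((J * J * (z * z)) ⊗ g₁) ⊕ 5 ⊗ ((J * (z * z)) ⊗ g₁) ⊕ (z * z) ⊗ g₁)
    (solve (J ∷ z ∷ a ∷ y ∷ []))

-- Up to errors, a ≤ (n² - 9l)² / (9n²) for the inner link a and the cross link l of one part.
-- Quantifying over `Y` avoids truncated subtraction in N² - 9J²l.
record QuadraticBound (J N l a z : ℕ) : Set where
  constructor quadratic-bound
  field holds : ∀ Y → 9 * (J * J) * l + Y ≡ N * N → N * N * (9 * (J * J) * a) ≤ Y * Y + 648 * (J * J) * (N * z)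

record Refined (z a y : ℕ) : Set where
  constructor refined
  field holds : 8000 * (9 * (z * a)) ≤ 8000 * (y * y) + z * z

shrink-error : ∀ J z a y → Scaled 8000 1311 1 J → 1 ≤ J → J * (z * (9 * a)) ≤ J * (y * y) + 1311 * (z * z) → 8000 * (9 * (z * a)) ≤ 8000 * (y * y) + z * z
shrink-error J z a y (scaled h) 1≤J g = *-cancelˡ-≤ J {{>-nonZero 1≤J}} (begin
  J * (8000 * (9 * (z * a)))              ≡⟨ eq₁ J 8000 z a ⟩
  8000 * (J * (z * (9 * a)))              ≤⟨ *-monoʳ-≤ 8000 g ⟩
  8000 * (J * (y * y) + 1311 * (z * z))   ≡⟨ eq₂ 8000 1311 (J * (y * y)) (z * z) ⟩
  8000 * (J * (y * y)) + 8000 * 1311 * (z * z) ≤⟨ +-monoʳ-≤ (8000 * (J * (y * y))) (*-monoˡ-≤ (z * z) (≤-trans h (≤-reflexive (*-identityˡ J)))) ⟩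
  8000 * (J * (y * y)) + J * (z * z)      ≡⟨ eq₃ 8000 J (y * y) (z * z) ⟩
  J * (8000 * (y * y) + z * z)            ∎)
  where
  open ≤-Reasoning
  eq₁ : ∀ J c z a → J * (c * (9 * (z * a))) ≡ c * (J * (z * (9 * a)))
  eq₁ = solve-∀
  eq₂ : ∀ c d a b → c * (a + d * b) ≡ c * a + c * d * b
  eq₂ = solve-∀
  eq₃ : ∀ c J a b → c * (J * a) + J * b ≡ J * (c * a + b)
  eq₃ = solve-∀

expand-L : ∀ C z a b c l s t → C * (z * (a + b + c + 2 * (l + s + t))) ≡ C * (z * a) + C * (z * b) + C * (z * c) + 2 * C * (z * l) + 2 * C * (z * s) + 2 * C * (z * t)
expand-L = solve-∀

-- Here y = z - 9l lies between 0.152z, the image of the threshold 848/9000 for l, and 0.385z. The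
-- inner links a and b are at most about y²/(9z), and `between` replaces the convex y² by its chord
-- over this interval, so that only linear arithmetic remains.
light-middle : ∀ z y a b c l s t L → y + 9 * l ≡ z → 8000 * (9 * (z * a)) ≤ 8000 * (y * y) + z * z → 8000 * (9 * (z * b)) ≤ 8000 * (y * y) + z * z →
  90000 * c ≤ 2514 * z → 72000 * s ≤ z → 72000 * t ≤ z → 19 * z ≤ 125 * y → 1000 * y ≤ 385 * z → L ≡ a + b + c + 2 * (l + s + t) → z * (4500 * L) ≤ z * (998 * z)
light-middle z y a b c l s t L e ha hb hc hs ht hy hy′ refl =
  subst₂ _≤_ (sym (swap-coefficient 4500 z L)) (sym (swap-coefficient 998 z z))
    (*-cancelˡ-≤ 400 (≤-trans (≤-reflexive (trans (sym (*-assoc 400 4500 (z * L))) (expand-L 1800000 z a b c l s t)))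
      (arith (z * z) (y * z) (y * y) (z * a) (z * b) (z * c) (z * l) (z * s) (z * t) zl ha hb (times 90000 2514 z hc) (times₁ 72000 s hs) (times₁ 72000 t ht)
        (subst (λ u → 19 * (z * z) ≤ 125 * u) (*-comm z y) (times 19 125 z hy)) chord)))
  where
  times₁ : ∀ c s → c * s ≤ z → c * (z * s) ≤ z * z
  times₁ c s h = subst (_≤ z * z) (swap-coefficient c z s) (*-monoʳ-≤ z h)
  zl : 9 * (z * l) + y * z ≡ z * z
  zl = trans (eq z y l) (cong (z *_) e)
    where
    eq : ∀ z y l → 9 * (z * l) + y * z ≡ z * (y + 9 * l)
    eq = solve-∀
  chord : 25000 * (y * y) + 1463 * (z * z) ≤ 13425 * (y * z)
  chord = *-cancelˡ-≤ 40 (subst₂ _≤_ (eq₁ z y) (eq₂ z y) (between (152 * z) (1000 * y) (385 * z) (≤-trans (≤-reflexive (*-assoc 8 19 z)) (≤-trans (*-monoʳ-≤ 8 hy) (≤-reflexive (sym (*-assoc 8 125 y))))) hy′))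
    where
    sq : ∀ c y → c * y * (c * y) ≡ c * c * (y * y)
    sq = solve-∀
    cr : ∀ c d z y → c * z * (d * y) ≡ c * d * (y * z)
    cr = solve-∀
    cr′ : ∀ c d z y → c * y * (d * z) ≡ c * d * (y * z)
    cr′ = solve-∀
    cz : ∀ c d z → c * z * (d * z) ≡ c * d * (z * z)
    cz = solve-∀
    eq₁ : ∀ z y → 1000 * y * (1000 * y) + 152 * z * (385 * z) ≡ 40 * (25000 * (y * y) + 1463 * (z * z))
    eq₁ z y = trans (cong₂ _+_ (sq 1000 y) (cz 152 385 z)) (sym (trans (*-distribˡ-+ 40 (25000 * (y * y)) (1463 * (z * z))) (cong₂ _+_ (sym (*-assoc 40 25000 (y * y))) (sym (*-assoc 40 1463 (z * z))))))
    eq₂ : ∀ z y → 152 * z * (1000 * y) + 1000 * y * (385 * z) ≡ 40 * (13425 * (y * z))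
    eq₂ z y = trans (cong₂ _+_ (cr 152 1000 z y) (cr′ 1000 385 z y)) (trans (sym (*-distribʳ-+ (y * z) (152 * 1000) (1000 * 385))) (*-assoc 40 13425 (y * z)))
  arith : ∀ zz yz yy za zb zc zl zs zt → 9 * zl + yz ≡ zz → 8000 * (9 * za) ≤ 8000 * yy + zz → 8000 * (9 * zb) ≤ 8000 * yy + zz → 90000 * zc ≤ 2514 * zz →
    72000 * zs ≤ zz → 72000 * zt ≤ zz → 19 * zz ≤ 125 * yz → 25000 * yy + 1463 * zz ≤ 13425 * yz →
    1800000 * za + 1800000 * zb + 1800000 * zc + 2 * 1800000 * zl + 2 * 1800000 * zs + 2 * 1800000 * zt ≤ 400 * (998 * zz)
  arith zz yz yy za zb zc zl zs zt h₁ h₂ h₃ h₄ h₅ h₆ h₇ h₈ =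
    lin (317 * zz + 75 * yz) (≤-trans (≤-reflexive (sym (*-distribˡ-+ 400000 (9 * zl) yz))) (400000 ⊗ ≤-reflexive h₁) ⊕ 25 ⊗ h₂ ⊕ 25 ⊗ h₃ ⊕ 20 ⊗ h₄ ⊕ 50 ⊗ h₅ ⊕ 50 ⊗ h₆ ⊕ 1481 ⊗ h₇ ⊕ 16 ⊗ h₈)
      (solve (zz ∷ yz ∷ yy ∷ za ∷ zb ∷ zc ∷ zl ∷ zs ∷ zt ∷ []))

-- For y ≥ 0.385z the cross link is so thin that the crude bound for all three inner links is
-- enough.
light-low : ∀ z y a b c l s t L → y + 9 * l ≡ z → 90000 * a ≤ 2514 * z → 90000 * b ≤ 2514 * z → 90000 * c ≤ 2514 * z → 72000 * s ≤ z → 72000 * t ≤ z → 385 * z ≤ 1000 * y →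
  L ≡ a + b + c + 2 * (l + s + t) → 4500 * L ≤ 998 * z
light-low z y a b c l s t L e ha hb hc hs ht hy refl = *-cancelˡ-≤ 20 (≤-trans (≤-reflexive (trans (sym (*-assoc 20 4500 L)) (expand 90000 a b c l s t)))
    (arith z y a b c l s t e ha hb hc hs ht hy))
  where
  expand : ∀ C a b c l s t → C * (a + b + c + 2 * (l + s + t)) ≡ C * a + C * b + C * c + 2 * C * l + 2 * C * s + 2 * C * t
  expand = solve-∀
  arith : ∀ z y a b c l s t → y + 9 * l ≡ z → 90000 * a ≤ 2514 * z → 90000 * b ≤ 2514 * z → 90000 * c ≤ 2514 * z → 72000 * s ≤ z → 72000 * t ≤ z → 385 * z ≤ 1000 * y →
    90000 * a + 90000 * b + 90000 * c + 2 * 90000 * l + 2 * 90000 * s + 2 * 90000 * t ≤ 20 * (998 * z)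
  arith z y a b c l s t h₁ ha hb hc hs ht hy =
    lin (112 * z + 36000 * s + 36000 * t) (≤-trans (≤-reflexive (sym (*-distribˡ-+ 20000 y (9 * l)))) (20000 ⊗ ≤-reflexive h₁) ⊕ ha ⊕ hb ⊕ hc ⊕ 3 ⊗ hs ⊕ 3 ⊗ ht ⊕ 20 ⊗ hy) (solve (z ∷ y ∷ a ∷ b ∷ c ∷ l ∷ s ∷ t ∷ []))

record DegreeBound (m w u l s : ℕ) : Set where
  constructor degree-bound
  field holds : m * (w * l) ≤ m * (u * (s * s)) + s * s

-- The degree bound inside one part: 183/729 of (n/3)² is about 0.02789n², just below 2514/90000.
inner-degree : ∀ J n s l → Scaled 3000 1 1 J → 1 ≤ J → J * (3 * s) ≤ J * n + n → DegreeBound 100 729 183 l s → Scaled 90000 l 2514 (n * n)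
inner-degree J n s l (scaled J-large) 1≤J h (degree-bound g) = scaled (arith l (s * s) (n * n) g (*-cancelˡ-≤ J {{>-nonZero 1≤J}} (below J (s * s) (n * n) (*-cancelˡ-≤ J {{>-nonZero 1≤J}} (square J n s (*-mono-≤ h h) 1≤J)) (≤-trans J-large (≤-reflexive (*-identityˡ J))))))
  where
  square : ∀ J n s → J * (3 * s) * (J * (3 * s)) ≤ (J * n + n) * (J * n + n) → 1 ≤ J → J * (9 * (J * (s * s))) ≤ J * (J * (n * n) + 3 * (n * n))
  square J n s h g = lin 0 (h ⊕ (n * n) ⊗ g) (solve (J ∷ n ∷ s ∷ []))
  below : ∀ J q z → 9 * (J * q) ≤ J * z + 3 * z → 3000 ≤ J → J * (9000 * q) ≤ J * (1001 * z)
  below J q z h g = subst₂ _≤_ (sym (swap-coefficient 9000 J q)) (sym (swap-coefficient 1001 J z)) (combine (J * q) (J * z) z h (*-monoˡ-≤ z g))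
    where
    combine : ∀ a b z → 9 * a ≤ b + 3 * z → 3000 * z ≤ b → 9000 * a ≤ 1001 * b
    combine a b z h₁ h₂ = lin 0 (1000 ⊗ h₁ ⊕ h₂) (solve (a ∷ b ∷ z ∷ []))
  arith : ∀ l q z → 100 * (729 * l) ≤ 100 * (183 * q) + q → 9000 * q ≤ 1001 * z → 90000 * l ≤ 2514 * z
  arith l q z h₁ h₂ = linc 404 (153 * z + 2500 * q) (500 ⊗ coefficients ⊕ 1017 ⊗ h₂) (solve (l ∷ q ∷ z ∷ []))
    where
    coefficients : 72900 * l ≤ 18301 * q
    coefficients = subst₂ _≤_ (sym (*-assoc 100 729 l)) (trans (cong (_+ q) (sym (*-assoc 100 183 q))) (+-comm (18300 * q) q)) h₁

refine : ∀ J n z z′ l a y → z ≡ n * n → z′ ≡ n * (n * n) → Scaled 8000 1311 1 J → 1 ≤ J → QuadraticBound J (J * n + n) l a z′ → y + 9 * l ≡ z → Refined z a y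
refine J n z z′ l a y refl z′≡ J-large 1≤J (quadratic-bound q) y≡ = refined (shrink-error J z a y J-large 1≤J
  (quadratic J n z z′ a y (J * J * y + (2 * J + 1) * z) (J * n + n) refl z′≡ 1≤J (≤-trans (m≤m+n y _) (≤-reflexive y≡)) refl refl
    (q (J * J * y + (2 * J + 1) * z) (eq J n l y y≡))))
  where
  eq : ∀ J n l y → y + 9 * l ≡ n * n → 9 * (J * J) * l + (J * J * y + (2 * J + 1) * (n * n)) ≡ (J * n + n) * (J * n + n)
  eq J n l y e = trans (cong (λ z → 9 * (J * J) * l + (J * J * y + (2 * J + 1) * z)) (sym e)) (trans (factor J l y) (trans (cong ((J + 1) * (J + 1) *_) e) (square J n)))
    where
    factor : ∀ J l y → 9 * (J * J) * l + (J * J * y + (2 * J + 1) * (y + 9 * l)) ≡ (J + 1) * (J + 1) * (y + 9 * l)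
    factor = solve-∀
    square : ∀ J n → (J + 1) * (J + 1) * (n * n) ≡ (J * n + n) * (J * n + n)
    square = solve-∀

large-or-light : ∀ {A : Set} z l a b c s t L .{{_ : NonZero z}} → (Scaled 848 z 9000 l → A) →
  (∀ y → y + 9 * l ≡ z → Refined z a y) → (∀ y → y + 9 * l ≡ z → Refined z b y) →
  Scaled 90000 a 2514 z → Scaled 90000 b 2514 z → Scaled 90000 c 2514 z → Scaled 72000 s 1 z → Scaled 72000 t 1 z → L ≡ a + b + c + 2 * (l + s + t) →
  A ⊎ Scaled 4500 L 998 z
large-or-light {A} z l a b c s t L found ha hb (scaled ha′) (scaled hb′) (scaled hc) (scaled hs′) (scaled ht′) hL = from (≤-total (848 * z) (9000 * l))
  where
  hs : 72000 * s ≤ z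
  hs = ≤-trans hs′ (≤-reflexive (*-identityˡ z))
  ht : 72000 * t ≤ z
  ht = ≤-trans ht′ (≤-reflexive (*-identityˡ z))
  light : 9000 * l ≤ 848 * z → 4500 * L ≤ 998 * z
  light small = by-size (≤-total (385 * z) (1000 * y))
    where
    y : ℕ
    y = z ∸ 9 * l
    9l≤z : 9 * l ≤ z
    9l≤z = *-cancelˡ-≤ 1000 (≤-trans (≤-reflexive (sym (*-assoc 1000 9 l))) (≤-trans small (*-monoˡ-≤ z (m≤m+n 848 152))))
    y≡ : y + 9 * l ≡ z
    y≡ = m∸n+n≡m 9l≤z
    19z≤125y : 19 * z ≤ 125 * y
    19z≤125y = arith z y l y≡ small
      where
      arith : ∀ z y l → y + 9 * l ≡ z → 9000 * l ≤ 848 * z → 19 * z ≤ 125 * y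
      arith z y l h₁ h₂ = linc 7 0 (1000 ⊗ ≤-reflexive (sym h₁) ⊕ h₂) (solve (z ∷ y ∷ l ∷ []))
    by-size : 385 * z ≤ 1000 * y ⊎ 1000 * y ≤ 385 * z → 4500 * L ≤ 998 * z
    by-size (inj₁ q) = light-low z y a b c l s t L y≡ ha′ hb′ hc hs ht q hL
    by-size (inj₂ q) = *-cancelˡ-≤ z (light-middle z y a b c l s t L y≡ (Refined.holds (ha y y≡)) (Refined.holds (hb y y≡)) hc hs ht 19z≤125y q hL)
  from : 848 * z ≤ 9000 * l ⊎ 9000 * l ≤ 848 * z → A ⊎ Scaled 4500 L 998 z
  from (inj₁ q) = inj₁ (found (scaled q))
  from (inj₂ q) = inj₂ (scaled (light q))

scale-link : ∀ τ l z → Scaled 72000 1 1 τ → τ * l ≤ z → Scaled 72000 l 1 z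
scale-link τ l z (scaled τ-large) h = scaled (≤-trans (*-monoˡ-≤ l (≤-trans τ-large (≤-reflexive (*-identityˡ τ)))) (≤-trans h (≤-reflexive (sym (*-identityˡ z)))))

cross-eq₁ : ∀ a b e J d → (a * (b * e)) * (J * (3 * d)) ≡ J * (3 * (a * d)) * (b * e)
cross-eq₁ = solve-∀

cross-eq₂ : ∀ J a d q → J * (3 * (a * d)) * q ≡ J * 3 * (a * (q * d))
cross-eq₂ = solve-∀

cross′-eq : ∀ x y z → x * (y * z) ≡ y * (x * z)
cross′-eq = solve-∀

C+l-eq : ∀ J x d → J * 3 * (x * d) ≡ x * (J * (3 * d))
C+l-eq = solve-∀

3JC≤Y-arith′ : ∀ J N s l C Y → C + J * (3 * l) ≡ N * s → J * (3 * s) ≤ N → 9 * (J * J) * l + Y ≡ N * N → J * (3 * C) ≤ Y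
3JC≤Y-arith′ J N s l C Y h₁ h₂ h₃ = lin 0 ((3 * J) ⊗ ≤-reflexive h₁ ⊕ N ⊗ h₂ ⊕ ≤-reflexive (sym h₃)) (solve (J ∷ N ∷ s ∷ l ∷ C ∷ Y ∷ []))

link-quadratic-arith : ∀ J N Y a C P z → N * N * a ≤ C * C + N * (J * (3 * P)) + N * (J * (3 * P)) → J * (3 * C) ≤ Y → J * P ≤ 12 * z →
        N * N * (9 * (J * J) * a) ≤ Y * Y + 648 * (J * J) * (N * z)
link-quadratic-arith J N Y a C P z h₁ h₂ h₃ = lin 0 ((9 * (J * J)) ⊗ h₁ ⊕ *-mono-≤ h₂ h₂ ⊕ (54 * (J * J) * N) ⊗ h₃) (solve (J ∷ N ∷ Y ∷ a ∷ C ∷ P ∷ z ∷ []))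

module Vertex {V : Set} (_≟_ : DecidableEquality V) (H : Free V) (vs : List V) (uniq : Unique vs) (J k′ τ : ℕ) (4≤J : 4 ≤ J)
  (J-large : Scaled 8000 1311 1 J) (J-large′ : Scaled 3000 1 1 J) (τ-large : Scaled 72000 1 1 τ) (τ-small : 3 * (τ * τ) ≤ J)
  (degree : DegreeAt 183 729 100 k′) (P : Partitioned H vs J k′) where

  open Free H
  open Sums vs
  open Partitioned P
  open Parts H vs p
  open PartSums H vs p
  open Roles _≟_ H vs uniq p
  open Bounds _≟_ H vs uniq p J 4≤J J≤n close
  open Close close using (size≤)

  1≤J : 1 ≤ J
  1≤J = ≤-trans (s≤s z≤n) 4≤J

  inside : ∀ v h → Scaled 90000 (link v h h) 2514 n²
  inside v h = inner-degree J n (size h) (link v h h) J-large′ 1≤J (size≤ h)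
    (subst₂ (DegreeBound 100 729 183) (part₂ h (E v)) (length-part h)
      (degree-bound (degree _≟_ H (part h) (filter⁺ (λ v → p v ≟ᶠ h) uniq) (large h) (near h) v)))

  -- For an edge zz′ inside part i, the numbers of link edges from z and z′ to part j are small on average,
  -- so E ≤ (1 - P z/N)(1 - P z′/N) up to a negligible error.
  link-quadratic : ∀ v {i j h} → Distinct i j h → QuadraticBound J (J * n + n) (link v i j) (link v i i) n³
  link-quadratic v {i} {j} {h} D = quadratic-bound λ Y Y≡ → link-quadratic-arith J N Y (link v i i) C (path v i j) n³ base (3JC≤Y Y Y≡) (path≤ v D)
    where
    N : ℕ
    N = J * n + n
    P₀ c : V → ℕ
    P₀ z = J * (3 * deg-in v j z)
    c z  = N ∸ P₀ z
    c+P : ∀ z → c z + P₀ z ≡ N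
    c+P z = m∸n+n≡m (≤-trans (*-monoʳ-≤ J (*-monoʳ-≤ 3 (deg-in≤ v j z))) (size≤ j))
    C : ℕ
    C = Sum 1 λ z → I i z * c z
    pt : ∀ z z′ → N * N * (I i z * (I i z′ * E v z z′)) ≤ (I i z * c z) * (I i z′ * c z′) + N * ((I i z * (I i z′ * E v z z′)) * P₀ z) + N * ((I i z * (I i z′ * E v z z′)) * P₀ z′)
    pt z z′ = cases (does (p z ≟ᶠ i)) (does (p z′ ≟ᶠ i)) (e v z z′) N (c z) (P₀ z) (c z′) (P₀ z′) (c+P z) (c+P z′)
      where
      cases : ∀ x y b N c P c′ P′ → c + P ≡ N → c′ + P′ ≡ N →
        N * N * (ι x * (ι y * ι b)) ≤ (ι x * c) * (ι y * c′) + N * ((ι x * (ι y * ι b)) * P) + N * ((ι x * (ι y * ι b)) * P′)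
      cases true  true  true  N c P c′ P′ e e′ = ≤-trans (≤-reflexive (trans (*-identityʳ (N * N)) (sym (cong₂ _*_ e e′))))
        (subst₂ (λ M M′ → (c + P) * (c′ + P′) ≤ (1 * c) * (1 * c′) + M * (1 * P) + M′ * (1 * P′)) e′ e (expand c P c′ P′))
        where
        expand : ∀ c P c′ P′ → (c + P) * (c′ + P′) ≤ (1 * c) * (1 * c′) + (c′ + P′) * (1 * P) + (c + P) * (1 * P′)
        expand c P c′ P′ = lin {X = 0} {Y = 0} (P * P′) ≤-refl (solve (c ∷ P ∷ c′ ∷ P′ ∷ []))
      cases true  true  false N c P c′ P′ _ _ = ≤-trans (≤-reflexive (*-zeroʳ (N * N))) z≤n
      cases true  false b     N c P c′ P′ _ _ = ≤-trans (≤-reflexive (*-zeroʳ (N * N))) z≤n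
      cases false y     b     N c P c′ P′ _ _ = ≤-trans (≤-reflexive (*-zeroʳ (N * N))) z≤n
    cross : (Sum 2 λ z z′ → (I i z * (I i z′ * E v z z′)) * P₀ z) ≡ J * (3 * path v i j)
    cross = trans (sum-cong 1 λ z → trans (sum-cong 1 λ z′ → cross-eq₁ (I i z) (I i z′) (E v z z′) J (deg-in v j z)) (trans (∑-* vs (J * (3 * (I i z * deg-in v j z))) (λ z′ → I i z′ * E v z z′))
        (cross-eq₂ J (I i z) (deg-in v j z) (deg-in v i z)))) (trans (sum-* 1 (J * 3) (λ z → I i z * (deg-in v i z * deg-in v j z))) (trans (*-assoc J 3 (Sum 1 λ z → I i z * (deg-in v i z * deg-in v j z))) (cong (λ t → J * (3 * t)) (sym (path≡ v i j)))))
    cross′ : (Sum 2 λ z z′ → (I i z * (I i z′ * E v z z′)) * P₀ z′) ≡ J * (3 * path v i j)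
    cross′ = trans (sum-cong 2 λ z z′ → cong (_* P₀ z′) (trans (cong (λ b → I i z * (I i z′ * ι b)) (sym₂₃ v z z′)) (cross′-eq (I i z) (I i z′) (E v z′ z))))
        (trans (perm 2 (0 ∷ []) (λ z′ z → (I i z′ * (I i z * E v z′ z)) * P₀ z′)) cross)
    base : N * N * link v i i ≤ C * C + N * (J * (3 * path v i j)) + N * (J * (3 * path v i j))
    base = begin
      N * N * link v i i
        ≡⟨ sum-* 2 (N * N) (λ z z′ → I i z * (I i z′ * E v z z′)) ⟨
      (Sum 2 λ z z′ → N * N * (I i z * (I i z′ * E v z z′)))
        ≤⟨ sum-mono₃ 2 (λ z z′ → (I i z * c z) * (I i z′ * c z′)) (λ z z′ → N * ((I i z * (I i z′ * E v z z′)) * P₀ z)) (λ z z′ → N * ((I i z * (I i z′ * E v z z′)) * P₀ z′)) pt ⟩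
      (Sum 2 λ z z′ → (I i z * c z) * (I i z′ * c z′)) + (Sum 2 λ z z′ → N * ((I i z * (I i z′ * E v z z′)) * P₀ z)) + (Sum 2 λ z z′ → N * ((I i z * (I i z′ * E v z z′)) * P₀ z′))
        ≡⟨ cong₂ _+_ (cong₂ _+_ (trans (sum-cong 1 λ z → trans (∑-* vs (I i z * c z) (λ z′ → I i z′ * c z′)) (*-comm (I i z * c z) C)) (∑-* vs C (λ z → I i z * c z)))
             (trans (sum-* 2 N (λ z z′ → (I i z * (I i z′ * E v z z′)) * P₀ z)) (cong (N *_) cross))) (trans (sum-* 2 N (λ z z′ → (I i z * (I i z′ * E v z z′)) * P₀ z′)) (cong (N *_) cross′)) ⟩
      C * C + N * (J * (3 * path v i j)) + N * (J * (3 * path v i j)) ∎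
      where open ≤-Reasoning
    C+l : C + J * (3 * link v i j) ≡ N * size i
    C+l = trans (cong (C +_) (trans (cong (λ t → J * (3 * t)) (link≡ v i j)) (trans (sym (*-assoc J 3 _)) (trans (sym (∑-* vs (J * 3) _)) (∑-cong vs λ z → C+l-eq J (I i z) (deg-in v j z))))))
         (trans (sym (∑-+ vs (λ z → I i z * c z) (λ z → I i z * P₀ z))) (trans (∑-cong vs λ z → trans (sym (*-distribˡ-+ (I i z) (c z) (P₀ z))) (trans (cong (I i z *_) (c+P z)) (*-comm (I i z) N))) (∑-* vs N (I i))))
    3JC≤Y : ∀ Y → 9 * (J * J) * link v i j + Y ≡ N * N → J * (3 * C) ≤ Y
    3JC≤Y Y Y≡ = 3JC≤Y-arith′ J N (size i) (link v i j) C Y C+l (size≤ i) Y≡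

  inside-refined : ∀ v {i j h} → Distinct i j h → ∀ y → y + 9 * link v i j ≡ n² → Refined n² (link v i i) y
  inside-refined v {i} {j} D y y≡ = refine J n n² n³ (link v i j) (link v i i) y refl refl J-large 1≤J (link-quadratic v D) y≡

  data HeavyPair (v : V) : Set where
    heavy : ∀ {i j h} → Distinct i j h → Scaled 848 n² 9000 (link v i j) → HeavyPair v

  heavy-or-light : ∀ v → HeavyPair v ⊎ Scaled 4500 (Sum 2 (E v)) 998 n²
  heavy-or-light v = from (find-home τ τ-small v)
    where
    from : Home τ τ-small v → HeavyPair v ⊎ Scaled 4500 (Sum 2 (E v)) 998 n²
    from (home {i} {j} {h} D s₁ s₂) = large-or-light n² (link v i j) (link v i i) (link v j j) (link v h h) (link v h i) (link v h j) (Sum 2 (E v))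
        {{m*n≢0 n n}} (heavy D) (λ y e → inside-refined v D y e) (λ y e → inside-refined v (swap-12 D) y (trans (cong (λ l → y + 9 * l) (link-sym v j i)) e))
        (inside v i) (inside v j) (inside v h) (small s₁) (small s₂) (L-split v D)
      where
      small : ∀ {l} → τ * l ≤ n² → Scaled 72000 l 1 n²
      small {l} h = scale-link τ l n² τ-large h

-- The join of graphs along a partition.

eq₃ : Fin 3 → Fin 3 → Bool
eq₃ i j = does (i ≟ᶠ j)

all-distinct all-same : Fin 3 → Fin 3 → Fin 3 → Bool
all-distinct i j h = not (eq₃ i j) ∧ not (eq₃ j h) ∧ not (eq₃ i h)
all-same i j h = eq₃ i j ∧ eq₃ j h

BFin : ℕ → Set
BFin zero    = Bool
BFin (suc k) = Fin 3 → BFin k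

finCheck : ∀ k → BFin k → Bool
finCheck zero    f = f
finCheck (suc k) f = finCheck k (f 0F) ∧ finCheck k (f 1F) ∧ finCheck k (f 2F)

Holds : ∀ k → BFin k → Set
Holds zero    f = f ≡ true
Holds (suc k) f = ∀ i → Holds k (f i)

byFinCases : ∀ k f → finCheck k f ≡ true → Holds k f
byFinCases zero    f h    = h
byFinCases (suc k) f h 0F = byFinCases k (f 0F) (proj₁ (∧-true h))
byFinCases (suc k) f h 1F = byFinCases k (f 1F) (proj₁ (∧-true (proj₂ (∧-true {finCheck k (f 0F)} h))))
byFinCases (suc k) f h 2F = byFinCases k (f 2F) (proj₂ (∧-true {finCheck k (f 1F)} (proj₂ (∧-true {finCheck k (f 0F)} h))))

implies : ∀ {a b} → not a ∨ b ≡ true → a ≡ true → b ≡ true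
implies {true} h refl = h

∧-intro : ∀ {a b} → a ≡ true → b ≡ true → a ∧ b ≡ true
∧-intro refl refl = refl

eq₃-true : ∀ {i j} → eq₃ i j ≡ true → i ≡ j
eq₃-true {i} {j} h with i ≟ᶠ j
... | yes p = p

module _ {V W : Set} (p : V → Fin 3) (φ : V → W) (inj : ∀ {x y} → p x ≡ p y → φ x ≡ φ y → x ≡ y) (G : Free W) where

  -- Since φ is injective only within the parts, one construction serves twice: with the identity it
  -- gives the graph compared with an extremal one, with `third` on the residue classes modulo 3 it
  -- gives the iterated construction.
  join-edge : V → V → V → Bool
  join-edge x y z = all-distinct (p x) (p y) (p z) ∨ (all-same (p x) (p y) (p z) ∧ Free.e G (φ x) (φ y) (φ z))

  private
    data Kind (x y z : V) : Set where
      across : all-distinct (p x) (p y) (p z) ≡ true → Kind x y z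
      inside : all-same (p x) (p y) (p z) ≡ true → Free.e G (φ x) (φ y) (φ z) ≡ true → Kind x y z

    kind : ∀ x y z → join-edge x y z ≡ true → Kind x y z
    kind x y z h with all-distinct (p x) (p y) (p z) in eq
    ... | true  = across eq
    ... | false = inside (proj₁ (∧-true h)) (proj₂ (∧-true {all-same (p x) (p y) (p z)} h))

    different-kind : ∀ i j h k → all-distinct i j h ≡ true → all-same j h k ≡ true → ⊥
    different-kind i j h k p q with implies (byFinCases 4 (λ i j h k → not (all-distinct i j h ∧ all-same j h k) ∨ false) refl i j h k) (∧-intro p q)
    ... | ()

    different-kind′ : ∀ i j h k → all-same i j h ≡ true → all-distinct j h k ≡ true → ⊥
    different-kind′ i j h k p q with implies (byFinCases 4 (λ i j h k → not (all-same i j h ∧ all-distinct j h k) ∨ false) refl i j h k) (∧-intro p q)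
    ... | ()

    no-crossing-cycle : ∀ a u b c w → all-distinct a u b ≡ true → all-distinct u b c ≡ true → all-distinct b c w ≡ true → all-distinct c w a ≡ true → ⊥
    no-crossing-cycle a u b c w h₁ h₂ h₃ h₄
      with implies (byFinCases 5 (λ a u b c w → not (all-distinct a u b ∧ all-distinct u b c ∧ all-distinct b c w ∧ all-distinct c w a) ∨ false) refl a u b c w)
             (∧-intro h₁ (∧-intro h₂ (∧-intro h₃ h₄)))
    ... | ()

    -- Consecutive triples of the sequence share two vertices, so they are all crossing or all
    -- inside one part. If all are crossing, aub and ubc put a and c into the same part, against
    -- cwa; if all are inside, `G` decides.
    join-no5 : ∀ {a b c u w} → Kind a u b → Kind u b c → Kind b c w → Kind c w a → u ≡ w
    join-no5 {a} {b} {c} {u} {w} (across h₁) (across h₂) (across h₃) (across h₄) = ⊥-elim (no-crossing-cycle (p a) (p u) (p b) (p c) (p w) h₁ h₂ h₃ h₄)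
    join-no5 {a} {b} {c} {u} {w} (inside h₁ e₁) (inside h₂ e₂) (inside h₃ e₃) (inside _ e₄) =
      inj (eq₃-true (implies (byFinCases 4 (λ b c u w → not (all-same u b c ∧ all-same b c w) ∨ eq₃ u w) refl (p b) (p c) (p u) (p w)) (∧-intro h₂ h₃)))
          (Free.no5 G e₁ e₂ e₃ e₄)
    join-no5 {a} {b} {c} {u} {w} (across h₁) (inside h₂ _) _ _ = ⊥-elim (different-kind (p a) (p u) (p b) (p c) h₁ h₂)
    join-no5 {a} {b} {c} {u} {w} (inside h₁ _) (across h₂) _ _ = ⊥-elim (different-kind′ (p a) (p u) (p b) (p c) h₁ h₂)
    join-no5 {a} {b} {c} {u} {w} (across _) (across h₂) (inside h₃ _) _ = ⊥-elim (different-kind (p u) (p b) (p c) (p w) h₂ h₃)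
    join-no5 {a} {b} {c} {u} {w} (inside _ _) (inside h₂ _) (across h₃) _ = ⊥-elim (different-kind′ (p u) (p b) (p c) (p w) h₂ h₃)
    join-no5 {a} {b} {c} {u} {w} (across _) (across _) (across h₃) (inside h₄ _) = ⊥-elim (different-kind (p b) (p c) (p w) (p a) h₃ h₄)
    join-no5 {a} {b} {c} {u} {w} (inside _ _) (inside _ _) (inside h₃ _) (across h₄) = ⊥-elim (different-kind′ (p b) (p c) (p w) (p a) h₃ h₄)

    eqᵇ : Bool → Bool → Bool
    eqᵇ true  b = b
    eqᵇ false b = not b

    eqᵇ-true : ∀ a b → eqᵇ a b ≡ true → a ≡ b
    eqᵇ-true true  true  _ = refl
    eqᵇ-true false false _ = refl

  join : Free V
  join = record
    { e     = join-edge
    ; sym₁₂ = λ x y z → cong₂ _∨_ (eqᵇ-true (all-distinct (p x) (p y) (p z)) (all-distinct (p y) (p x) (p z)) (byFinCases 3 (λ i j h → eqᵇ (all-distinct i j h) (all-distinct j i h)) refl (p x) (p y) (p z)))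
                (cong₂ _∧_ (eqᵇ-true (all-same (p x) (p y) (p z)) (all-same (p y) (p x) (p z)) (byFinCases 3 (λ i j h → eqᵇ (all-same i j h) (all-same j i h)) refl (p x) (p y) (p z))) (Free.sym₁₂ G (φ x) (φ y) (φ z)))
    ; sym₂₃ = λ x y z → cong₂ _∨_ (eqᵇ-true (all-distinct (p x) (p y) (p z)) (all-distinct (p x) (p z) (p y)) (byFinCases 3 (λ i j h → eqᵇ (all-distinct i j h) (all-distinct i h j)) refl (p x) (p y) (p z)))
                (cong₂ _∧_ (eqᵇ-true (all-same (p x) (p y) (p z)) (all-same (p x) (p z) (p y)) (byFinCases 3 (λ i j h → eqᵇ (all-same i j h) (all-same i h j)) refl (p x) (p y) (p z))) (Free.sym₂₃ G (φ x) (φ y) (φ z)))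
    ; no5   = λ {a} {b} {c} {u} {w} h₁ h₂ h₃ h₄ → join-no5 (kind a u b h₁) (kind u b c h₂) (kind b c w h₃) (kind c w a h₄)
    }

  join-loopless : (∀ x z → Free.e G x x z ≡ false) → ∀ x z → join-edge x x z ≡ false
  join-loopless loopless x z = trans (cong₂ (λ a b → a ∨ (all-same (p x) (p x) (p z) ∧ b))
      (not-distinct (p x) (p z)) (loopless (φ x) (φ z))) (∧-false (all-same (p x) (p x) (p z)))
    where
    not-distinct : ∀ i h → all-distinct i i h ≡ false
    not-distinct 0F h = refl
    not-distinct 1F h = refl
    not-distinct 2F h = refl
    ∧-false : ∀ b → b ∧ false ≡ false
    ∧-false true  = refl
    ∧-false false = refl

  module JoinCount (vs : List V) where

    open Sums vs
    open Parts join vs p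
    open PartSums join vs p
    open Free join

    crossing : t 0F 1F 2F ≡ size 0F * (size 1F * size 2F)
    crossing = trans (sum-cong 3 λ a b c → pt (p a) (p b) (p c) _) (prod₃ (I 0F) (I 1F) (I 2F))
      where
      pt : ∀ i j h b → ι (eq₃ i 0F) * (ι (eq₃ j 1F) * (ι (eq₃ h 2F) * ι (all-distinct i j h ∨ b))) ≡ ι (eq₃ i 0F) * (ι (eq₃ j 1F) * ι (eq₃ h 2F))
      pt 0F 1F 2F b = refl
      pt 0F 1F 0F b = refl
      pt 0F 1F 1F b = refl
      pt 0F 0F h  b = refl
      pt 0F 2F h  b = refl
      pt 1F j  h  b = refl
      pt 2F j  h  b = refl

    within : ∀ i → within₃ (λ a b c → Free.E G (φ a) (φ b) (φ c)) i i i ≡ t i i i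
    within i = sum-cong 3 λ a b c → pt (p a) (p b) (p c) i (Free.e G (φ a) (φ b) (φ c))
      where
      pt′ : ∀ j k l i b → eq₃ j i ≡ true → eq₃ k i ≡ true → eq₃ l i ≡ true → ι b ≡ ι (all-distinct j k l ∨ (all-same j k l ∧ b))
      pt′ j k l i b h₁ h₂ h₃ = diagonal (eq₃-true {j} h₁) (eq₃-true {k} h₂) (eq₃-true {l} h₃)
        where
        same-part : ∀ i → ι b ≡ ι (all-distinct i i i ∨ (all-same i i i ∧ b))
        same-part 0F = refl
        same-part 1F = refl
        same-part 2F = refl
        diagonal : j ≡ i → k ≡ i → l ≡ i → ι b ≡ ι (all-distinct j k l ∨ (all-same j k l ∧ b))
        diagonal refl refl refl = same-part j
      pt : ∀ j k l i b → ι (eq₃ j i) * (ι (eq₃ k i) * (ι (eq₃ l i) * ι b)) ≡ ι (eq₃ j i) * (ι (eq₃ k i) * (ι (eq₃ l i) * ι (all-distinct j k l ∨ (all-same j k l ∧ b))))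
      pt j k l i b with eq₃ j i in h₁ | eq₃ k i in h₂ | eq₃ l i in h₃
      ... | false | _     | _     = refl
      ... | true  | false | _     = refl
      ... | true  | true  | false = refl
      ... | true  | true  | true  = cong (λ x → 1 * (1 * (1 * x))) (pt′ j k l i b h₁ h₂ h₃)

    join-edges : 6 * (size 0F * (size 1F * size 2F)) + Σ₃ (λ i → within₃ (λ a b c → Free.E G (φ a) (φ b) (φ c)) i i i) ≤ edges join vs
    join-edges = ≤-trans (≤-reflexive (cong₂ (λ x y → 6 * x + y) (sym crossing) (Σ₃-cong within)))
      (≤-trans (arith (t 0F 1F 2F) (Σ₃ λ i → t i i i) bad) (≤-reflexive (sym T-split)))
      where
      arith : ∀ x s b → 6 * x + s ≤ s + 3 * b + 6 * x
      arith x s b = lin {X = 0} {Y = 0} (3 * b) ≤-refl (solve (x ∷ s ∷ b ∷ []))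

-- Reassigning the vertices by their heavy links.

bigᵇ : ℕ → ℕ → Bool
bigᵇ z l = 848 * z ≤ᵇ 9000 * l

big-true : ∀ {z l} → Scaled 848 z 9000 l → bigᵇ z l ≡ true
big-true {z} {l} (scaled h) = T⇒≡ (≤⇒≤ᵇ h)
  where
  T⇒≡ : ∀ {b} → Data.Bool.T b → b ≡ true
  T⇒≡ {true} _ = refl

true-big : ∀ {z l} → bigᵇ z l ≡ true → Scaled 848 z 9000 l
true-big h = scaled (≤ᵇ-true h)

small-not-big : ∀ {z l} .{{_ : NonZero z}} → Scaled 72000 l 1 z → bigᵇ z l ≡ false
small-not-big {z} {l} (scaled h) = from (bigᵇ z l) refl
  where
  impossible : ∀ z l → 0 < z → 72000 * l ≤ 1 * z → 848 * z ≤ 9000 * l → ⊥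
  impossible z l 0<z h g = <⇒≱ 0<z (arith z l h g)
    where
    arith : ∀ z l → 72000 * l ≤ 1 * z → 848 * z ≤ 9000 * l → z ≤ 0
    arith z l h g = linc 6782 0 (h ⊕ 8 ⊗ g) (solve (z ∷ l ∷ []))
  from : ∀ b → bigᵇ z l ≡ b → b ≡ false
  from false _ = refl
  from true  e = ⊥-elim (impossible z l (n≢0⇒n>0′ z) h (≤ᵇ-true e))
    where
    n≢0⇒n>0′ : ∀ z .{{_ : NonZero z}} → 0 < z
    n≢0⇒n>0′ (suc z) = s≤s z≤n

typical-link : ∀ J n s s′ l μ → Scaled 3000 1 1 J → 1 ≤ J → J * n ≤ J * (3 * s) + n → J * n ≤ J * (3 * s′) + n → s ≤ n → s′ ≤ n → l + μ ≡ s * s′ → 100 * μ ≤ n * n → Scaled 848 (n * n) 9000 l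
typical-link J n s s′ l μ (scaled J-large) 1≤J h h′ s≤n s′≤n e hμ = scaled (final (n * n) (s * s′) l μ product e hμ)
  where
  square : ∀ J n s s′ → J * n * (J * n) ≤ (J * (3 * s) + n) * (J * (3 * s′) + n) → s ≤ n → s′ ≤ n → 1 ≤ J → J * (J * (n * n)) ≤ J * (9 * (J * (s * s′)) + 7 * (n * n))
  square J n s s′ h g g′ 1≤J = lin 0 (h ⊕ (3 * J * n) ⊗ g ⊕ (3 * J * n) ⊗ g′ ⊕ (n * n) ⊗ 1≤J) (solve (J ∷ n ∷ s ∷ s′ ∷ []))
  product : 2993 * (n * n) ≤ 27000 * (s * s′)
  product = *-cancelˡ-≤ J {{>-nonZero 1≤J}} (subst₂ _≤_ (sym (swap-coefficient 2993 J (n * n))) (sym (swap-coefficient 27000 J (s * s′)))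
    (combine (J * (n * n)) (J * (s * s′)) (n * n) (*-cancelˡ-≤ J {{>-nonZero 1≤J}} (square J n s s′ (*-mono-≤ h h′) s≤n s′≤n 1≤J))
      (*-monoˡ-≤ (n * n) (≤-trans J-large (≤-reflexive (*-identityˡ J))))))
    where
    combine : ∀ a b z → a ≤ 9 * b + 7 * z → 3000 * z ≤ a → 2993 * a ≤ 27000 * b
    combine a b z h g = lin 0 (3000 ⊗ h ⊕ 7 ⊗ g) (solve (a ∷ b ∷ z ∷ []))
  final : ∀ z q l μ → 2993 * z ≤ 27000 * q → l + μ ≡ q → 100 * μ ≤ z → 848 * z ≤ 9000 * l
  final z _ l μ h refl g = linc 2 (179 * z) (h ⊕ 270 ⊗ g) (solve (z ∷ l ∷ μ ∷ []))

missing-degree : ∀ J n s s′ l μ W X → Scaled 8000 1311 1 J → 1 ≤ J → J * (3 * s) ≤ J * n + n → J * (3 * s′) ≤ J * n + n → l + μ ≡ s * s′ → Scaled 848 (n * n) 9000 l →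
  W ≤ μ + (n * X + n * X) → J * X ≤ 300 * n → Scaled 4500 W 77 (n * n)
missing-degree J n s s′ l μ W X (scaled J-large) 1≤J h h′ e (scaled hl) hW hX = scaled (*-cancelˡ-≤ J {{>-nonZero 1≤J}}
    (subst₂ _≤_ (sym (swap-coefficient 4500 J W)) (sym (swap-coefficient 77 J (n * n)))
      (combine (J * W) (J * μ) (J * (n * X)) (J * l) (J * (s * s′)) (J * (n * n)) (n * n) hW′ (trans (sym (*-distribˡ-+ J l μ)) (cong (J *_) e)) hX′
        (*-cancelˡ-≤ J {{>-nonZero 1≤J}} (square J n s s′ (*-mono-≤ h h′) 1≤J)) (times 848 9000 J hl)
        (*-monoˡ-≤ (n * n) (≤-trans J-large (≤-reflexive (*-identityˡ J)))))))
  where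
  square : ∀ J n s s′ → J * (3 * s) * (J * (3 * s′)) ≤ (J * n + n) * (J * n + n) → 1 ≤ J → J * (9 * (J * (s * s′))) ≤ J * (J * (n * n) + 3 * (n * n))
  square J n s s′ h 1≤J = lin 0 (h ⊕ (n * n) ⊗ 1≤J) (solve (J ∷ n ∷ s ∷ s′ ∷ []))
  hW′ : J * W ≤ J * μ + (J * (n * X) + J * (n * X))
  hW′ = ≤-trans (*-monoʳ-≤ J hW) (≤-reflexive (eq J μ (n * X)))
    where
    eq : ∀ J μ x → J * (μ + (x + x)) ≡ J * μ + (J * x + J * x)
    eq = solve-∀
  hX′ : J * (n * X) ≤ 300 * (n * n)
  hX′ = subst₂ _≤_ (eq n J X) (swap-coefficient 300 n n) (*-monoʳ-≤ n hX)
    where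
    eq : ∀ n J X → n * (J * X) ≡ J * (n * X)
    eq = solve-∀
  combine : ∀ W μ x l q Z z → W ≤ μ + (x + x) → l + μ ≡ q → x ≤ 300 * z → 9 * q ≤ Z + 3 * z → 848 * Z ≤ 9000 * l → 8000 * 1311 * z ≤ Z → 4500 * W ≤ 77 * Z
  combine W μ x l _ Z z h₁ refl h₃ h₄ h₅ h₆ = linc 1 (15573000 * z)
    (≤-trans (9000 ⊗ h₁) (≤-reflexive (distr₁ 9000 μ x)) ⊕ 18000 ⊗ h₃ ⊕ subst₂ _≤_ (distr₂ 1000 l μ) (distr₃ 1000 Z z) (1000 ⊗ h₄) ⊕ h₅ ⊕ 2 ⊗ h₆) (solve (W ∷ μ ∷ x ∷ l ∷ Z ∷ z ∷ []))
    where
    distr₁ : ∀ c a b → c * (a + (b + b)) ≡ c * a + 2 * c * b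
    distr₁ = solve-∀
    distr₂ : ∀ c a b → c * (9 * (a + b)) ≡ 9 * c * a + 9 * c * b
    distr₂ = solve-∀
    distr₃ : ∀ c a b → c * (a + 3 * b) ≡ c * a + 3 * c * b
    distr₃ = solve-∀

remaining-size : ∀ J n s g X → Scaled 8000 1311 1 J → 1 ≤ J → J * n ≤ J * (3 * s) + n → s ≤ g + X → J * X ≤ 300 * n → Scaled 1999 n 6000 g
remaining-size J n s g X (scaled J-large) 1≤J h₁ h₂ h₃ = scaled (*-cancelˡ-≤ J {{>-nonZero 1≤J}} (subst₂ _≤_ (sym (swap-coefficient 1999 J n)) (sym (swap-coefficient 6000 J g))
    (combine (J * n) (J * s) (J * g) (J * X) n (≤-trans h₁ (≤-reflexive (cong (_+ n) (swap-coefficient 3 J s)))) (≤-trans (*-monoʳ-≤ J h₂) (≤-reflexive (*-distribˡ-+ J g X))) h₃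
      (*-monoˡ-≤ n (≤-trans J-large (≤-reflexive (*-identityˡ J)))))))
  where
  combine : ∀ a s g x n → a ≤ 3 * s + n → s ≤ g + x → x ≤ 300 * n → 8000 * 1311 * n ≤ a → 1999 * a ≤ 6000 * g
  combine a s g x n h₁ h₂ h₃ h₄ = lin (8686000 * n) (2000 ⊗ h₁ ⊕ ≤-trans (6000 ⊗ h₂) (≤-reflexive (*-distribˡ-+ 6000 g x)) ⊕ 6000 ⊗ h₃ ⊕ h₄) (solve (a ∷ s ∷ g ∷ x ∷ n ∷ []))

-- 998/4500 is about 0.22178, while twice the square of 1999/6000 is about 0.22200. The strict gap,
-- expressed by the summand 1, is what makes every light vertex count as a gain in `exhausted`.
light-degree : ∀ N g g′ L → 10000 ≤ N → Scaled 1999 N 6000 g → Scaled 1999 N 6000 g′ → Scaled 4500 L 998 (N * N) → L + 1 ≤ 2 * (g * g′)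
light-degree N g g′ L 10⁴≤N (scaled h₁) (scaled h₂) (scaled h₃) = arith (N * N) (N * g′) (g * g′) L (*-mono-≤ (≤-trans (m≤m+n 100 9900) 10⁴≤N) (≤-trans (m≤m+n 100 9900) 10⁴≤N)) h₃
    (subst₂ (λ a b → 1999 * a ≤ 6000 * b) (*-comm g′ N) (*-comm g′ g) (times 1999 6000 g′ h₁)) (times 1999 6000 N h₂)
  where
  arith : ∀ Q P G L → 10000 ≤ Q → 4500 * L ≤ 998 * Q → 1999 * P ≤ 6000 * G → 1999 * Q ≤ 6000 * P → L + 1 ≤ 2 * G
  arith Q P G L h₀ h₁ h₂ h₃ = linc 8999 (Q + 1000) (2 ⊗ h₁ ⊕ 3 ⊗ h₂ ⊕ h₀ ⊕ middle) (solve (Q ∷ P ∷ G ∷ L ∷ []))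
    where
    middle : 1998 * Q ≤ 5997 * P
    middle = subst₂ _≤_ (sym (*-assoc 3 666 Q)) (sym (*-assoc 3 1999 P)) (3 ⊗ linc 5999 {666 * Q} {1999 * P} Q (1999 ⊗ h₃) (solve (Q ∷ P ∷ [])))

-- Compares the join with the graph itself. The join gains 6 for each missing triple and loses 3 for
-- each unit of `B`; the light vertices lose 3Λ but gain 6ζg₁g₂ as members of the first part, a
-- surplus of at least 3ζ.
exhausted : ∀ g₀ g₁g₂ ζ S T B t M Λ → 6 * ((g₀ + ζ) * g₁g₂) + S ≤ T → T ≤ S + 3 * B + 6 * t + 3 * Λ → t + M ≡ g₀ * g₁g₂ → Λ + ζ ≤ ζ * (2 * g₁g₂) → 2 * M + ζ ≤ B
exhausted g₀ G ζ S T B t M Λ h₁ h₂ h₃ h₄ = linc 2 0 (h₁ ⊕ h₂ ⊕ 6 ⊗ ≤-reflexive h₃ ⊕ 3 ⊗ h₄) (solve (g₀ ∷ G ∷ ζ ∷ S ∷ T ∷ B ∷ t ∷ M ∷ Λ ∷ []))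

all-zero : ∀ M ζ B → 2 * M + ζ ≤ B → Scaled 18769 B (6 * 6160) M → M ≡ 0 × ζ ≡ 0 × B ≡ 0
all-zero M ζ B h (scaled g) = M≡0 , ζ≡0 , B≡0
  where
  expand : ∀ c M ζ → c * (2 * M + ζ) ≡ 2 * c * M + c * ζ
  expand = solve-∀
  -- 578 = 2 · 18769 - 6 · 6160 is the whole margin of the argument.
  both : 578 * M + 18769 * ζ ≤ 0
  both = arith M ζ (18769 * B) (subst (_≤ 18769 * B) (expand 18769 M ζ) (18769 ⊗ h)) g
    where
    arith : ∀ M ζ x → 2 * 18769 * M + 18769 * ζ ≤ x → x ≤ 6 * 6160 * M → 578 * M + 18769 * ζ ≤ 0
    arith M ζ x h g = lin 0 (h ⊕ g) (solve (M ∷ ζ ∷ x ∷ []))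
  factor-zero : ∀ c m .{{_ : NonZero c}} → c * m ≤ 0 → m ≡ 0
  factor-zero c m h = n≤0⇒n≡0 (≤-trans (m≤n*m m c) h)
  M≡0 : M ≡ 0
  M≡0 = factor-zero 578 M (≤-trans (m≤m+n (578 * M) (18769 * ζ)) both)
  ζ≡0 : ζ ≡ 0
  ζ≡0 = factor-zero 18769 ζ (≤-trans (m≤n+m (18769 * ζ) (578 * M)) both)
  B≡0 : B ≡ 0
  B≡0 = factor-zero 18769 B (≤-trans g (≤-reflexive (trans (cong (6 * 6160 *_) M≡0) (*-zeroʳ (6 * 6160)))))

-- The default matters: vertices without a heavy pair receive part 0, and the comparison counts them
-- as additional vertices of that part.
choose : Bool → Bool → Bool → Fin 3
choose true  _     _     = 0F
choose false true  _     = 1F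
choose false false true  = 2F
choose false false false = 0F

pick : Fin 3 → Bool → Bool → Bool → Bool
pick 0F a b c = a
pick 1F a b c = b
pick 2F a b c = c

pick-chosen : ∀ a b c → a ∨ b ∨ c ≡ true → pick (choose a b c) a b c ≡ true
pick-chosen true  _     _    _ = refl
pick-chosen false true  _    _ = refl
pick-chosen false false true _ = refl

none-chosen : ∀ a b c → a ∨ b ∨ c ≡ false → choose a b c ≡ 0F
none-chosen false false false _ = refl

stays : ∀ a b c h → pick h a b c ≡ true → (h ≡ 1F → a ≡ false) → (h ≡ 2F → a ≡ false × b ≡ false) → not ((a ∨ b ∨ c) ∧ eq₃ (choose a b c) h) ≡ false
stays true  b     c     0F _ _ _ = refl
stays a     b     c     1F q f _ = at a b (f refl) q
  where
  at : ∀ a b → a ≡ false → b ≡ true → not ((a ∨ b ∨ c) ∧ eq₃ (choose a b c) 1F) ≡ false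
  at false true _ _ = refl
stays a     b     c     2F q _ f = at a b c (proj₁ (f refl)) (proj₂ (f refl)) q
  where
  at : ∀ a b c → a ≡ false → b ≡ false → c ≡ true → not ((a ∨ b ∨ c) ∧ eq₃ (choose a b c) 2F) ≡ false
  at false false true _ _ _ = refl

link+missing-eq : ∀ x y b → x * (y * ι b) + x * (y * ι (not b)) ≡ x * y
link+missing-eq x y true  = solve (x ∷ y ∷ [])
link+missing-eq x y false = solve (x ∷ y ∷ [])

JX≤-arith : ∀ J n X a b c → n * n * X ≤ 100 * a + 100 * b + 100 * c → J * a ≤ n * (n * n) → J * b ≤ n * (n * n) → J * c ≤ n * (n * n) → n * n * (J * X) ≤ n * n * (300 * n)
JX≤-arith J n X a b c h h₁ h₂ h₃ = lin 0 (J ⊗ h ⊕ 100 ⊗ h₁ ⊕ 100 ⊗ h₂ ⊕ 100 ⊗ h₃) (solve (J ∷ n ∷ X ∷ a ∷ b ∷ c ∷ []))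

module Clean {V : Set} (_≟_ : DecidableEquality V) (H : Free V) (vs : List V) (uniq : Unique vs) (J k′ τ : ℕ) (4≤J : 4 ≤ J)
  (J-large : Scaled 8000 1311 1 J) (J-large′ : Scaled 3000 1 1 J) (τ-large : Scaled 72000 1 1 τ) (τ-small : 3 * (τ * τ) ≤ J) (10⁴≤n : 10000 ≤ length vs)
  (degree : DegreeAt 183 729 100 k′) (P : Partitioned H vs J k′)
  (extremal : ∀ (q : V → Fin 3) → edges (join q (λ x → x) (λ _ eq → eq) H) vs ≤ edges H vs) where

  open Free H
  open Sums vs
  open Partitioned P
  open Parts H vs p
  open PartSums H vs p
  open Roles _≟_ H vs uniq p
  open Bounds _≟_ H vs uniq p J 4≤J J≤n close
  open Close close using (size≤; ≤size)
  open Vertex _≟_ H vs uniq J k′ τ 4≤J J-large J-large′ τ-large τ-small degree P using (HeavyPair; heavy; heavy-or-light; 1≤J)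

  -- A vertex belongs opposite to its dense cross link. The threshold, about 0.0942n² against n²/9
  -- for a complete one, is low enough that a vertex with no big pair is light, and high enough that
  -- a good vertex lacks little more than 152n²/9000, hence at most 77n²/4500, of the pairs crossing
  -- its home.
  big₀ big₁ big₂ good : V → Bool
  big₀ v = bigᵇ n² (link v 1F 2F)
  big₁ v = bigᵇ n² (link v 0F 2F)
  big₂ v = bigᵇ n² (link v 0F 1F)
  good v = big₀ v ∨ big₁ v ∨ big₂ v

  home-of : V → Fin 3
  home-of v = choose (big₀ v) (big₁ v) (big₂ v)

  changed : V → Bool
  changed v = not (good v ∧ eq₃ (home-of v) (p v))

  picked-big : ∀ v {i j h} → Distinct i j h → pick h (big₀ v) (big₁ v) (big₂ v) ≡ true → Scaled 848 n² 9000 (link v i j)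
  picked-big v d012 b = true-big b
  picked-big v d021 b = true-big b
  picked-big v d120 b = true-big b
  picked-big v d102 b = subst (Scaled 848 n² 9000) (link-sym v 0F 1F) (true-big b)
  picked-big v d201 b = subst (Scaled 848 n² 9000) (link-sym v 0F 2F) (true-big b)
  picked-big v d210 b = subst (Scaled 848 n² 9000) (link-sym v 1F 2F) (true-big b)

  big-picked : ∀ v {i j h} → Distinct i j h → Scaled 848 n² 9000 (link v i j) → pick h (big₀ v) (big₁ v) (big₂ v) ≡ true
  big-picked v d012 b = big-true b
  big-picked v d021 b = big-true b
  big-picked v d120 b = big-true b
  big-picked v d102 b = big-true (subst (Scaled 848 n² 9000) (link-sym v 1F 0F) b)
  big-picked v d201 b = big-true (subst (Scaled 848 n² 9000) (link-sym v 2F 0F) b)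
  big-picked v d210 b = big-true (subst (Scaled 848 n² 9000) (link-sym v 2F 1F) b)

  n²≢0 : NonZero n²
  n²≢0 = m*n≢0 n n

  home-heavy : ∀ v {i j} → good v ≡ true → Distinct i j (home-of v) → Scaled 848 n² 9000 (link v i j)
  home-heavy v g D = picked-big v D (pick-chosen (big₀ v) (big₁ v) (big₂ v) g)

  not-good-light : ∀ v → good v ≡ false → Scaled 4500 (Sum 2 (E v)) 998 n²
  not-good-light v g = from (heavy-or-light v)
    where
    pick≤or : ∀ h a b c → pick h a b c ≡ true → a ∨ b ∨ c ≡ true
    pick≤or 0F true  _     _    _ = refl
    pick≤or 1F true  true  _    _ = refl
    pick≤or 1F false true  _    _ = refl
    pick≤or 2F true  _     true _ = refl
    pick≤or 2F false true  true _ = refl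
    pick≤or 2F false false true _ = refl
    clash : ∀ {b} → b ≡ false → b ≡ true → ⊥
    clash refl ()
    from : HeavyPair v ⊎ Scaled 4500 (Sum 2 (E v)) 998 n² → Scaled 4500 (Sum 2 (E v)) 998 n²
    from (inj₂ l) = l
    from (inj₁ (heavy {i} {j} {h} D b)) = ⊥-elim (clash g (pick≤or h (big₀ v) (big₁ v) (big₂ v) (big-picked v D b)))

  other-small : ∀ v {i j h} → Distinct i j h → Scaled 848 n² 9000 (link v i j) → bigᵇ n² (link v i h) ≡ false
  other-small v {i} {j} {h} D b = from (either-small τ τ-small v D)
    where
    clash : ∀ {b} → b ≡ false → b ≡ true → ⊥
    clash refl ()
    from : τ * link v i j ≤ n² ⊎ τ * link v i h ≤ n² → bigᵇ n² (link v i h) ≡ false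
    from (inj₁ s) = ⊥-elim (clash (small-not-big {{n²≢0}} (scale-link τ (link v i j) n² τ-large s)) (big-true b))
    from (inj₂ s) = small-not-big {{n²≢0}} (scale-link τ (link v i h) n² τ-large s)

  bigᵇ-sym : ∀ v i j → bigᵇ n² (link v i j) ≡ bigᵇ n² (link v j i)
  bigᵇ-sym v i j = cong (bigᵇ n²) (link-sym v i j)

  link+missing : ∀ v i j → link v i j + within₂ (nE v) i j ≡ size i * size j
  link+missing v i j = trans (sym (sum-+ 2 (λ a b → I i a * (I j b * E v a b)) _)) (trans (sum-cong 2 λ a b → link+missing-eq (I i a) (I j b) (e v a b))
      (trans (∑-cong vs λ a → trans (∑-* vs (I i a) (I j)) (*-comm (I i a) (size j))) (trans (∑-* vs (size j) (I i)) (*-comm (size j) (size i)))))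

  size≤n : ∀ i → size i ≤ n
  size≤n i = ≤-trans (∑-mono vs (λ v → ι≤1 _)) (≤-reflexive (∑-length vs))

  typical-heavy : ∀ v i j → 100 * within₂ (nE v) i j ≤ n² → Scaled 848 n² 9000 (link v i j)
  typical-heavy v i j h = typical-link J n (size i) (size j) (link v i j) (within₂ (nE v) i j) J-large′ 1≤J (≤size i) (≤size j) (size≤n i) (size≤n j) (link+missing v i j) h

  -- A cross link of about n²/9 remains above the threshold after losing n²/100, and `other-small`
  -- prevents a competing part from being chosen first.
  typical-unchanged : ∀ v {i j h} → Distinct i j h → p v ≡ h → 100 * within₂ (nE v) i j ≤ n² → changed v ≡ false
  typical-unchanged v {i} {j} {h} D pv small = trans (cong (λ i → not (good v ∧ eq₃ (home-of v) i)) pv) (stays (big₀ v) (big₁ v) (big₂ v) h (big-picked v D b) (one D b) (two D b))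
    where
    b : Scaled 848 n² 9000 (link v i j)
    b = typical-heavy v i j small
    flip : ∀ {i j} → Scaled 848 n² 9000 (link v i j) → Scaled 848 n² 9000 (link v j i)
    flip {i} {j} = subst (Scaled 848 n² 9000) (link-sym v i j)
    one : ∀ {i j h} → Distinct i j h → Scaled 848 n² 9000 (link v i j) → h ≡ 1F → big₀ v ≡ false
    one d021 b refl = trans (bigᵇ-sym v 1F 2F) (other-small v d201 (flip b))
    one d201 b refl = trans (bigᵇ-sym v 1F 2F) (other-small v d201 b)
    two : ∀ {i j h} → Distinct i j h → Scaled 848 n² 9000 (link v i j) → h ≡ 2F → big₀ v ≡ false × big₁ v ≡ false
    two d012 b refl = other-small v d102 (flip b) , other-small v d012 b
    two d102 b refl = other-small v d102 b , other-small v d012 (flip b)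

  X : ℕ
  X = Sum 1 λ v → ι (changed v)

  -- A changed vertex lacks at least n²/100 of its crossing pairs by `typical-unchanged`, so the few
  -- missing triples allow few changed vertices.
  changed-cost : ∀ v → n² * ι (changed v) ≤ 100 * (I 0F v * within₂ (nE v) 1F 2F) + 100 * (I 1F v * within₂ (nE v) 0F 2F) + 100 * (I 2F v * within₂ (nE v) 0F 1F)
  changed-cost v = from (p v) refl
    where
    u₀ u₁ u₂ : ℕ
    u₀ = 100 * (I 0F v * within₂ (nE v) 1F 2F)
    u₁ = 100 * (I 1F v * within₂ (nE v) 0F 2F)
    u₂ = 100 * (I 2F v * within₂ (nE v) 0F 1F)
    bound : ∀ {i j h} → Distinct i j h → p v ≡ h → n² * ι (changed v) ≤ 100 * within₂ (nE v) i j
    bound {i} {j} D pv = cases (≤-total (100 * within₂ (nE v) i j) n²)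
      where
      cases : 100 * within₂ (nE v) i j ≤ n² ⊎ n² ≤ 100 * within₂ (nE v) i j → n² * ι (changed v) ≤ 100 * within₂ (nE v) i j
      cases (inj₁ s) = ≤-trans (≤-reflexive (trans (cong (λ b → n² * ι b) (typical-unchanged v D pv s)) (*-zeroʳ n²))) z≤n
      cases (inj₂ s) = ≤-trans (*-monoʳ-≤ n² (ι≤1 (changed v))) (≤-trans (≤-reflexive (*-identityʳ n²)) s)
    own : ∀ h m → p v ≡ h → 100 * m ≤ 100 * (I h v * m)
    own h m pv = ≤-reflexive (cong (100 *_) (sym (trans (cong (λ b → ι b * m) (trans (cong (λ i → eq₃ i h) pv) (diag h))) (*-identityˡ m))))
      where
      diag : ∀ h → eq₃ h h ≡ true
      diag 0F = refl
      diag 1F = refl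
      diag 2F = refl
    from : ∀ h → p v ≡ h → n² * ι (changed v) ≤ 100 * (I 0F v * within₂ (nE v) 1F 2F) + 100 * (I 1F v * within₂ (nE v) 0F 2F) + 100 * (I 2F v * within₂ (nE v) 0F 1F)
    from 0F pv = ≤-trans (bound d120 pv) (≤-trans (own 0F (within₂ (nE v) 1F 2F) pv) (≤-trans (m≤m+n u₀ u₁) (m≤m+n (u₀ + u₁) u₂)))
    from 1F pv = ≤-trans (bound d021 pv) (≤-trans (own 1F (within₂ (nE v) 0F 2F) pv) (≤-trans (m≤n+m u₁ u₀) (m≤m+n (u₀ + u₁) u₂)))
    from 2F pv = ≤-trans (bound d012 pv) (≤-trans (own 2F (within₂ (nE v) 0F 1F) pv) (m≤n+m u₂ (u₀ + u₁)))

  missing-pull : ∀ h i j → (Sum 1 λ v → 100 * (I h v * within₂ (nE v) i j)) ≡ 100 * missing h i j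
  missing-pull h i j = trans (∑-* vs 100 _) (cong (100 *_) (sum-cong 1 λ v → sym (sum-* 2 (I h v) (λ a b → I i a * (I j b * nE v a b)))))

  JX≤ : J * X ≤ 300 * n
  JX≤ = *-cancelˡ-≤ n² {{n²≢0}} (JX≤-arith J n X (missing 0F 1F 2F) (missing 1F 0F 2F) (missing 2F 0F 1F) summed (JM≤ d012) (JM≤ d102) (JM≤ d201))
    where
    summed : n² * X ≤ 100 * missing 0F 1F 2F + 100 * missing 1F 0F 2F + 100 * missing 2F 0F 1F
    summed = ≤-trans (≤-reflexive (sym (∑-* vs n² _))) (≤-trans (sum-mono₃ 1 (λ v → 100 * (I 0F v * within₂ (nE v) 1F 2F)) (λ v → 100 * (I 1F v * within₂ (nE v) 0F 2F)) (λ v → 100 * (I 2F v * within₂ (nE v) 0F 1F)) changed-cost)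
      (≤-reflexive (cong₂ _+_ (cong₂ _+_ (missing-pull 0F 1F 2F) (missing-pull 1F 0F 2F)) (missing-pull 2F 0F 1F))))

-- Extremality forces the exact structure.

does-≟true : ∀ b → does (b ≟ᵇ true) ≡ b
does-≟true true  = refl
does-≟true false = refl

moved-in : ∀ g q h i → ι g * ι (eq₃ q i) ≤ ι (eq₃ h i) + ι (not (g ∧ eq₃ q h))
moved-in true  q h i = ≤ᵇ-true (byFinCases 3 (λ q h i → (1 * ι (eq₃ q i)) ≤ᵇ (ι (eq₃ h i) + ι (not (eq₃ q h)))) refl q h i)
moved-in false q h i = z≤n

moved-out : ∀ g q h i → ι (eq₃ h i) ≤ ι g * ι (eq₃ q i) + ι (not (g ∧ eq₃ q h))
moved-out true  q h i = ≤ᵇ-true (byFinCases 3 (λ q h i → ι (eq₃ h i) ≤ᵇ (1 * ι (eq₃ q i) + ι (not (eq₃ q h)))) refl q h i)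
moved-out false q h i = ι≤1 (eq₃ h i)

product-moved : ∀ u w x y A B b → x ≤ A + ι u → y ≤ B + ι w → x ≤ 1 → y ≤ 1 → x * (y * ι b) ≤ A * (B * ι b) + ι u + ι w
product-moved u w x y A B b hx hy x≤1 y≤1 = cases u w hx hy
  where
  le-one : x * (y * ι b) ≤ 1
  le-one = *-mono-≤ x≤1 (*-mono-≤ y≤1 (ι≤1 b))
  cases : ∀ u w → x ≤ A + ι u → y ≤ B + ι w → x * (y * ι b) ≤ A * (B * ι b) + ι u + ι w
  cases true  w     _  _  = ≤-trans le-one (≤-trans (m≤n+m 1 (A * (B * ι b))) (m≤m+n _ (ι w)))
  cases false true  _  _  = ≤-trans le-one (m≤n+m 1 (A * (B * ι b) + 0))
  cases false false hx hy = ≤-trans (*-mono-≤ (≤-trans hx (≤-reflexive (+-identityʳ A))) (*-monoˡ-≤ (ι b) (≤-trans hy (≤-reflexive (+-identityʳ B)))))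
                              (≤-reflexive (sym (trans (+-identityʳ _) (+-identityʳ _))))

ι*ι≤1 : ∀ a b → ι a * ι b ≤ 1
ι*ι≤1 a b = *-mono-≤ (ι≤1 a) (ι≤1 b)

∑-filter≤ : ∀ {V : Set} {P : V → Set} (P? : ∀ x → Relation.Nullary.Dec (P x)) xs (f : V → ℕ) → ∑ (filter P? xs) f ≤ ∑ xs f
∑-filter≤ P? xs f = ≤-trans (≤-reflexive (∑-filter P? xs f)) (∑-mono xs λ x → ≤-trans (*-monoˡ-≤ (f x) (ι≤1 (does (P? x)))) (≤-reflexive (*-identityˡ (f x))))

recolour : ∀ J s s′ X n → J * (3 * s) ≤ J * n + n → J * X ≤ 300 * n → s′ ≤ s + X → J * (3 * s′) ≤ J * n + 901 * n
recolour J s s′ X n h₁ h₂ h₃ = lin 0 (h₁ ⊕ 3 ⊗ h₂ ⊕ (3 * J) ⊗ h₃) (solve (J ∷ s ∷ s′ ∷ X ∷ n ∷ []))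

recolour′ : ∀ J s s′ X n → J * n ≤ J * (3 * s) + n → J * X ≤ 300 * n → s ≤ s′ + X → J * n ≤ J * (3 * s′) + 901 * n
recolour′ J s s′ X n h₁ h₂ h₃ = lin 0 (h₁ ⊕ 3 ⊗ h₂ ⊕ (3 * J) ⊗ h₃) (solve (J ∷ s ∷ s′ ∷ X ∷ n ∷ []))

few-missing-eq : ∀ a b c d e → a * (b * (c * (d * e))) ≡ (a * c) * ((b * d) * e)
few-missing-eq = solve-∀

edges-split-eq : ∀ a b → a + b + b + b ≡ a + 3 * b
edges-split-eq = solve-∀

module Finish {V : Set} (_≟_ : DecidableEquality V) (H : Free V) (vs : List V) (uniq : Unique vs) (J k′ τ : ℕ) (4≤J : 4 ≤ J)
  (J-large : Scaled 8000 1311 1 J) (J-large′ : Scaled 3000 1 1 J) (τ-large : Scaled 72000 1 1 τ) (τ-small : 3 * (τ * τ) ≤ J) (10⁴≤n : 10000 ≤ length vs)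
  (degree : DegreeAt 183 729 100 k′) (P : Partitioned H vs J k′)
  (extremal : ∀ (q : V → Fin 3) → edges (join q (λ x → x) (λ _ eq → eq) H) vs ≤ edges H vs) where

  open Free H
  open Sums vs
  open Partitioned P
  open Parts H vs p
  open PartSums H vs p
  open Roles _≟_ H vs uniq p using (link)
  open Bounds _≟_ H vs uniq p J 4≤J J≤n close using (n²)
  open Close close using (size≤; ≤size)
  open Clean _≟_ H vs uniq J k′ τ 4≤J J-large J-large′ τ-large τ-small 10⁴≤n degree P extremal

  1≤J : 1 ≤ J
  1≤J = ≤-trans (s≤s z≤n) 4≤J

  -- The estimate of `Exact` requires a small missing degree at every vertex, so vertices without a
  -- heavy pair are set aside and enter only through `ζ` and `Λ`.
  vs₀ : List V
  vs₀ = filter (λ v → good v ≟ᵇ true) vs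

  uniq₀ : Unique vs₀
  uniq₀ = filter⁺ (λ v → good v ≟ᵇ true) uniq

  module S₀ = Parts H vs₀ home-of
  module P₀ = PartSums H vs₀ home-of
  module S′ = Parts H vs home-of
  module P′ = PartSums H vs home-of

  g ng : V → ℕ
  g v  = ι (good v)
  ng v = ι (not (good v))

  ∑₀ : ∀ f → ∑ vs₀ f ≡ ∑ vs (λ v → g v * f v)
  ∑₀ f = trans (∑-filter (λ v → good v ≟ᵇ true) vs f) (∑-cong vs λ v → cong (λ b → ι b * f v) (does-≟true (good v)))

  size≤size₀+X : ∀ i → size i ≤ S₀.size i + X
  size≤size₀+X i = ≤-trans (sum-mono₂ 1 (λ v → g v * S₀.I i v) (λ v → ι (changed v)) λ v → moved-out (good v) (home-of v) (p v) i)
    (≤-reflexive (cong (_+ X) (sym (∑₀ (S₀.I i)))))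

  size-large : ∀ i → Scaled 1999 n 6000 (S₀.size i)
  size-large i = remaining-size J n (size i) (S₀.size i) X J-large 1≤J (≤size i) (size≤size₀+X i) JX≤

  few-missing : ∀ b i j → P₀.within₂ (nE b) i j ≤ within₂ (nE b) i j + (n * X + n * X)
  few-missing b i j = begin
    P₀.within₂ (nE b) i j
      ≡⟨ trans (∑₀ _) (∑-cong vs λ a → trans (cong (g a *_) (∑₀ _)) (sym (∑-* vs (g a) _))) ⟩
    (Sum 2 λ a c → g a * (g c * (S₀.I i a * (S₀.I j c * nE b a c))))
      ≤⟨ sum-mono₃ 2 (λ a c → I i a * (I j c * nE b a c)) (λ a c → ι (changed a)) (λ a c → ι (changed c)) pt ⟩
    within₂ (nE b) i j + (Sum 2 λ a c → ι (changed a)) + (Sum 2 λ a c → ι (changed c))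
      ≡⟨ trans (cong₂ (λ x y → within₂ (nE b) i j + x + y) (trans (perm 2 (0 ∷ []) (λ c a → ι (changed a))) (sum-drop 1 (λ a → ι (changed a)))) (sum-drop 1 (λ c → ι (changed c))))
               (+-assoc (within₂ (nE b) i j) (n * X) (n * X)) ⟩
    within₂ (nE b) i j + (n * X + n * X) ∎
    where
    open ≤-Reasoning
    pt : ∀ a c → g a * (g c * (S₀.I i a * (S₀.I j c * nE b a c))) ≤ I i a * (I j c * nE b a c) + ι (changed a) + ι (changed c)
    pt a c = ≤-trans (≤-reflexive (few-missing-eq (g a) (g c) (S₀.I i a) (S₀.I j c) (nE b a c)))
      (product-moved (changed a) (changed c) (g a * S₀.I i a) (g c * S₀.I j c) (I i a) (I j c) (not (e b a c))
        (moved-in (good a) (home-of a) (p a) i) (moved-in (good c) (home-of c) (p c) j) (ι*ι≤1 (good a) (eq₃ (home-of a) i)) (ι*ι≤1 (good c) (eq₃ (home-of c) j)))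

  missing-small : ∀ b → b ∈ vs₀ → ∀ {i j h} → home-of b ≡ h → Distinct i j h → Scaled 4500 (P₀.within₂ (nE b) i j) 77 (n * n)
  missing-small b b∈ {i} {j} hb D = missing-degree J n (size i) (size j) (link b i j) (within₂ (nE b) i j) (P₀.within₂ (nE b) i j) X J-large 1≤J (size≤ i) (size≤ j)
    (link+missing b i j) (home-heavy b (proj₂ (∈-filter⁻ (λ v → good v ≟ᵇ true) {xs = vs} b∈)) (subst (Distinct i j) (sym hb) D)) (few-missing b i j) JX≤

  vs₀≤n : length vs₀ ≤ n
  vs₀≤n = length-filter (λ v → good v ≟ᵇ true) vs

  M₀ ζ Λ G : ℕ
  M₀ = S₀.missing 0F 1F 2F
  ζ  = Sum 1 ng
  Λ  = Sum 1 λ v → ng v * Sum 2 (E v)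
  G  = S₀.size 1F * S₀.size 2F

  bad₀-bound : Scaled 18769 P₀.bad (6 * 6160) M₀
  bad₀-bound = Exact.bad-bound _≟_ H vs₀ uniq₀ home-of n 10⁴≤n size-large vs₀≤n missing-small

  Λ+ζ≤ : Λ + ζ ≤ ζ * (2 * G)
  Λ+ζ≤ = begin
    Λ + ζ                                        ≡⟨ ∑-+ vs (λ v → ng v * Sum 2 (E v)) ng ⟨
    (Sum 1 λ v → ng v * Sum 2 (E v) + ng v)      ≤⟨ ∑-mono vs pt ⟩
    (Sum 1 λ v → 2 * G * ng v)                   ≡⟨ trans (∑-* vs (2 * G) ng) (*-comm (2 * G) ζ) ⟩
    ζ * (2 * G)                                  ∎
    where
    open ≤-Reasoning
    guard : ∀ b l m → (b ≡ false → l + 1 ≤ m) → ι (not b) * l + ι (not b) ≤ m * ι (not b)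
    guard true  l m h = z≤n
    guard false l m h = ≤-trans (≤-reflexive (cong (_+ 1) (*-identityˡ l))) (≤-trans (h refl) (≤-reflexive (sym (*-identityʳ m))))
    pt : ∀ v → ng v * Sum 2 (E v) + ng v ≤ 2 * G * ng v
    pt v = guard (good v) (Sum 2 (E v)) (2 * G) λ b → light-degree n (S₀.size 1F) (S₀.size 2F) (Sum 2 (E v)) 10⁴≤n (size-large 1F) (size-large 2F) (not-good-light v b)

  edges-split : edges H vs ≤ edges H vs₀ + 3 * Λ
  edges-split = begin
    Sum 3 E
      ≤⟨ sum-mono₄ 3 (λ a b c → g a * (g b * (g c * E a b c))) (λ a b c → ng a * E a b c) (λ a b c → ng b * E a b c) (λ a b c → ng c * E a b c)
           (λ a b c → byCases 4 (λ x y z w → ι w) (λ x y z w → ι x * (ι y * (ι z * ι w)) + ι (not x) * ι w + ι (not y) * ι w + ι (not z) * ι w) refl (good a) (good b) (good c) (e a b c)) ⟩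
    (Sum 3 λ a b c → g a * (g b * (g c * E a b c))) + (Sum 3 λ a b c → ng a * E a b c) + (Sum 3 λ a b c → ng b * E a b c) + (Sum 3 λ a b c → ng c * E a b c)
      ≡⟨ cong₂ _+_ (cong₂ _+_ (cong₂ _+_ inner at₁) at₂) at₃ ⟩
    edges H vs₀ + Λ + Λ + Λ
      ≡⟨ edges-split-eq (edges H vs₀) Λ ⟩
    edges H vs₀ + 3 * Λ ∎
    where
    open ≤-Reasoning
    inner : (Sum 3 λ a b c → g a * (g b * (g c * E a b c))) ≡ edges H vs₀
    inner = sym (trans (∑₀ _) (∑-cong vs λ a → trans (cong (g a *_) (trans (∑₀ _) (∑-cong vs λ b → trans (cong (g b *_) (∑₀ _)) (sym (∑-* vs (g b) _))))) (sym (sum-* 2 (g a) (λ b c → g b * (g c * E a b c))))))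
    at₁ : (Sum 3 λ a b c → ng a * E a b c) ≡ Λ
    at₁ = sum-cong 1 λ a → sum-* 2 (ng a) (E a)
    at₂ : (Sum 3 λ a b c → ng b * E a b c) ≡ Λ
    at₂ = trans (sum-cong 3 λ a b c → cong (λ t → ng b * ι t) (sym₁₂ a b c)) (trans (perm 3 (0 ∷ []) (λ b a c → ng b * E b a c)) at₁)
    at₃ : (Sum 3 λ a b c → ng c * E a b c) ≡ Λ
    at₃ = trans (sum-cong 3 λ a b c → cong (λ t → ng c * ι t) (rotʳ a b c)) (trans (perm 3 (1 ∷ 0 ∷ []) (λ c a b → ng c * E c a b)) at₁)

  size₀≤size′ : ∀ i → S₀.size i ≤ S′.size i
  size₀≤size′ i = ∑-filter≤ (λ v → good v ≟ᵇ true) vs (S′.I i)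

  size₀+ζ≤size′ : S₀.size 0F + ζ ≤ S′.size 0F
  size₀+ζ≤size′ = ≤-trans (≤-reflexive (trans (cong (_+ ζ) (∑₀ (S₀.I 0F))) (sym (∑-+ vs (λ v → g v * S₀.I 0F v) ng)))) (∑-mono vs pt)
    where
    guard : ∀ b q → (b ≡ false → q ≡ 0F) → ι b * ι (eq₃ q 0F) + ι (not b) ≤ ι (eq₃ q 0F)
    guard true  q h = ≤-reflexive (trans (+-identityʳ _) (*-identityˡ _))
    guard false q h = ≤-reflexive (sym (cong (λ i → ι (eq₃ i 0F)) (h refl)))
    pt : ∀ v → g v * S₀.I 0F v + ng v ≤ S′.I 0F v
    pt v = guard (good v) (home-of v) (none-chosen (big₀ v) (big₁ v) (big₂ v))

  t₀≤t′ : ∀ i → P₀.t i i i ≤ P′.t i i i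
  t₀≤t′ i = ≤-trans (∑-filter≤ Q vs _) (∑-mono vs λ a → ≤-trans (∑-filter≤ Q vs _) (∑-mono vs λ b → ∑-filter≤ Q vs _))
    where
    Q = λ v → good v ≟ᵇ true

  -- Extremality is applied to the join along `home-of` on all vertices. There the set-aside
  -- vertices enlarge the first part, which accounts for the summand ζ; whatever edges they have
  -- inside a part are dropped.
  lower-edges : 6 * ((S₀.size 0F + ζ) * G) + Σ₃ (λ i → P₀.t i i i) ≤ edges H vs
  lower-edges = ≤-trans
    (*-monoʳ-≤ 6 (*-mono-≤ size₀+ζ≤size′ (*-mono-≤ (size₀≤size′ 1F) (size₀≤size′ 2F))) ⊕ (t₀≤t′ 0F ⊕ t₀≤t′ 1F ⊕ t₀≤t′ 2F))
    (≤-trans (JoinCount.join-edges home-of (λ x → x) (λ _ eq → eq) H vs) (extremal home-of))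

  everything-zero : M₀ ≡ 0 × ζ ≡ 0 × P₀.bad ≡ 0
  everything-zero = all-zero M₀ ζ P₀.bad
    (exhausted (S₀.size 0F) G ζ (Σ₃ λ i → P₀.t i i i) (edges H vs) P₀.bad (P₀.t 0F 1F 2F) M₀ Λ lower-edges
      (≤-trans edges-split (≤-reflexive (cong (_+ 3 * Λ) P₀.T-split))) (P₀.t+missing 0F 1F 2F) Λ+ζ≤)
    bad₀-bound

  all-good : ∀ {v} → v ∈ vs → v ∈ vs₀
  all-good {v} v∈ = ∈-filter⁺ (λ v → good v ≟ᵇ true) v∈ (positive (good v) (∑≡0 vs (proj₁ (proj₂ everything-zero)) v∈))
    where
    positive : ∀ b → ι (not b) ≡ 0 → b ≡ true
    positive true _ = refl

  missing₀≡0 : ∀ {i j h} → Distinct i j h → S₀.missing i j h ≡ 0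
  missing₀≡0 d012 = proj₁ everything-zero
  missing₀≡0 d021 = trans (P₀.missing-23 0F 2F 1F) (proj₁ everything-zero)
  missing₀≡0 d102 = trans (P₀.missing-12 1F 0F 2F) (proj₁ everything-zero)
  missing₀≡0 d120 = trans (P₀.missing-23 1F 2F 0F) (trans (P₀.missing-12 1F 0F 2F) (proj₁ everything-zero))
  missing₀≡0 d201 = trans (P₀.missing-12 2F 0F 1F) (trans (P₀.missing-23 0F 2F 1F) (proj₁ everything-zero))
  missing₀≡0 d210 = trans (P₀.missing-12 2F 1F 0F) (trans (P₀.missing-23 1F 2F 0F) (trans (P₀.missing-12 1F 0F 2F) (proj₁ everything-zero)))

  term-zero : ∀ (f : V → V → V → ℕ) i j h → P₀.within₃ f i j h ≡ 0 → ∀ {a b c} → a ∈ vs → b ∈ vs → c ∈ vs → home-of a ≡ i → home-of b ≡ j → home-of c ≡ h → f a b c ≡ 0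
  term-zero f i j h z {a} {b} {c} a∈ b∈ c∈ refl refl refl = units (S₀.I i a) (S₀.I j b) (S₀.I h c) (f a b c) (diag i) (diag j) (diag h)
      (∑≡0 vs₀ (∑≡0 vs₀ (∑≡0 vs₀ z (all-good a∈)) (all-good b∈)) (all-good c∈))
    where
    diag : ∀ i → ι (eq₃ i i) ≡ 1
    diag 0F = refl
    diag 1F = refl
    diag 2F = refl
    units : ∀ x y z t → x ≡ 1 → y ≡ 1 → z ≡ 1 → x * (y * (z * t)) ≡ 0 → t ≡ 0
    units _ _ _ t refl refl refl h = trans (sym (trans (*-identityˡ _) (trans (*-identityˡ _) (*-identityˡ t)))) h

  crossing-edge : ∀ {a b c} → a ∈ vs → b ∈ vs → c ∈ vs → Distinct (home-of a) (home-of b) (home-of c) → e a b c ≡ true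
  crossing-edge {a} {b} {c} a∈ b∈ c∈ D = present (e a b c) (term-zero nE _ _ _ (missing₀≡0 D) a∈ b∈ c∈ refl refl refl)
    where
    present : ∀ b → ι (not b) ≡ 0 → b ≡ true
    present true _ = refl

  t₀≡0 : ∀ {i j h} → Distinct i j h → P₀.t i i j ≡ 0
  t₀≡0 D = from D (proj₂ (proj₂ everything-zero))
    where
    sum-zero : ∀ {a b c d e f} → a + b + c + d + e + f ≡ 0 → a ≡ 0 × b ≡ 0 × c ≡ 0 × d ≡ 0 × e ≡ 0 × f ≡ 0
    sum-zero {zero} {zero} {zero} {zero} {zero} {zero} _ = refl , refl , refl , refl , refl , refl
    from : ∀ {i j h} → Distinct i j h → P₀.bad ≡ 0 → P₀.t i i j ≡ 0
    from D h = pickone D (sum-zero {P₀.t 0F 0F 1F} {P₀.t 0F 0F 2F} {P₀.t 1F 1F 0F} {P₀.t 1F 1F 2F} {P₀.t 2F 2F 0F} {P₀.t 2F 2F 1F} h)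
      where
      pickone : ∀ {i j h} → Distinct i j h → P₀.t 0F 0F 1F ≡ 0 × P₀.t 0F 0F 2F ≡ 0 × P₀.t 1F 1F 0F ≡ 0 × P₀.t 1F 1F 2F ≡ 0 × P₀.t 2F 2F 0F ≡ 0 × P₀.t 2F 2F 1F ≡ 0 → P₀.t i i j ≡ 0
      pickone d012 (q , _) = q
      pickone d021 (_ , q , _) = q
      pickone d102 (_ , _ , q , _) = q
      pickone d120 (_ , _ , _ , q , _) = q
      pickone d201 (_ , _ , _ , _ , q , _) = q
      pickone d210 (_ , _ , _ , _ , _ , q) = q

  mixed-non-edge : ∀ {a b c h} → a ∈ vs → b ∈ vs → c ∈ vs → home-of a ≡ home-of b → Distinct (home-of a) (home-of c) h → e a b c ≡ false
  mixed-non-edge {a} {b} {c} a∈ b∈ c∈ same D = absent (e a b c) (term-zero E _ _ _ (t₀≡0 D) a∈ b∈ c∈ refl (sym same) refl)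
    where
    absent : ∀ b → ι b ≡ 0 → b ≡ false
    absent false _ = refl

  -- 901 = 1 + 3 · 300: the error of the original partition and three times the at most 300n/J
  -- changed vertices.
  size′≤ : ∀ i → J * (3 * S′.size i) ≤ J * n + 901 * n
  size′≤ i = recolour J (size i) (S′.size i) X n (size≤ i) JX≤ (sum-mono₂ 1 (I i) (λ v → ι (changed v)) λ v → moved (good v) (home-of v) (p v))
    where
    moved : ∀ g q h → ι (eq₃ q i) ≤ ι (eq₃ h i) + ι (not (g ∧ eq₃ q h))
    moved true  q h = ≤-trans (≤-reflexive (sym (*-identityˡ _))) (moved-in true q h i)
    moved false q h = ≤-trans (ι≤1 (eq₃ q i)) (m≤n+m 1 (ι (eq₃ h i)))

  ≤size′ : ∀ i → J * n ≤ J * (3 * S′.size i) + 901 * n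
  ≤size′ i = recolour′ J (size i) (S′.size i) X n (≤size i) JX≤ (sum-mono₂ 1 (S′.I i) (λ v → ι (changed v)) λ v →
    ≤-trans (moved-out (good v) (home-of v) (p v) i) (+-monoˡ-≤ _ (≤-trans (*-monoˡ-≤ (S′.I i v) (ι≤1 (good v))) (≤-reflexive (*-identityˡ (S′.I i v))))))

-- Translation between `ThreeGraph` and `Free`.

open import Defs

module _ {n : ℕ} (H : ThreeGraph n) where

  private
    true≢false : ∀ {b} → b ≡ true → b ≡ false → ⊥
    true≢false refl ()

  edge-12 : ∀ {x y z} → edge H x y z ≡ true → x ≢ y
  edge-12 {x} {z = z} h refl = true≢false h (loopless H x z)

  edge-23 : ∀ {x y z} → edge H x y z ≡ true → y ≢ z
  edge-23 {x} {y} {z} h refl = edge-12 {y} {y} {x} (trans (sym (sym₂₃ H y x y)) (trans (sym (sym₁₂ H x y y)) h)) refl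

  edge-13 : ∀ {x y z} → edge H x y z ≡ true → x ≢ z
  edge-13 {x} {y} h = edge-12 (trans (sym (sym₂₃ H x y _)) h)

  -- Any two of the five vertices other than u and w lie in a common edge of the sequence and are
  -- distinct because there are no loops. So u = w is the only coincidence that can prevent a
  -- genuine copy.
  toFree : C5minusFree H → Free (Fin n)
  toFree free = record { e = edge H ; sym₁₂ = sym₁₂ H ; sym₂₃ = sym₂₃ H ; no5 = no5 }
    where
    no5 : ∀ {a b c u w} → edge H a u b ≡ true → edge H u b c ≡ true → edge H b c w ≡ true → edge H c w a ≡ true → u ≡ w
    no5 {a} {b} {c} {u} {w} h₁ h₂ h₃ h₄ = from (u ≟ᶠ w)
      where
      f : Fin 5 → Fin n
      f f0 = a
      f (fs f0) = u
      f (fs (fs f0)) = b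
      f (fs (fs (fs f0))) = c
      f (fs (fs (fs (fs f0)))) = w
      injective : u ≢ w → ∀ i j → f i ≡ f j → i ≡ j
      injective u≢w f0 f0 _ = refl
      injective u≢w f0 (fs f0) h = ⊥-elim (edge-12 h₁ h)
      injective u≢w f0 (fs (fs f0)) h = ⊥-elim (edge-13 h₁ h)
      injective u≢w f0 (fs (fs (fs f0))) h = ⊥-elim (edge-13 h₄ (sym h))
      injective u≢w f0 (fs (fs (fs (fs f0)))) h = ⊥-elim (edge-23 h₄ (sym h))
      injective u≢w (fs f0) f0 h = ⊥-elim (edge-12 h₁ (sym h))
      injective u≢w (fs f0) (fs f0) _ = refl
      injective u≢w (fs f0) (fs (fs f0)) h = ⊥-elim (edge-12 h₂ h)
      injective u≢w (fs f0) (fs (fs (fs f0))) h = ⊥-elim (edge-13 h₂ h)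
      injective u≢w (fs f0) (fs (fs (fs (fs f0)))) h = ⊥-elim (u≢w h)
      injective u≢w (fs (fs f0)) f0 h = ⊥-elim (edge-13 h₁ (sym h))
      injective u≢w (fs (fs f0)) (fs f0) h = ⊥-elim (edge-12 h₂ (sym h))
      injective u≢w (fs (fs f0)) (fs (fs f0)) _ = refl
      injective u≢w (fs (fs f0)) (fs (fs (fs f0))) h = ⊥-elim (edge-12 h₃ h)
      injective u≢w (fs (fs f0)) (fs (fs (fs (fs f0)))) h = ⊥-elim (edge-13 h₃ h)
      injective u≢w (fs (fs (fs f0))) f0 h = ⊥-elim (edge-13 h₄ h)
      injective u≢w (fs (fs (fs f0))) (fs f0) h = ⊥-elim (edge-13 h₂ (sym h))
      injective u≢w (fs (fs (fs f0))) (fs (fs f0)) h = ⊥-elim (edge-12 h₃ (sym h))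
      injective u≢w (fs (fs (fs f0))) (fs (fs (fs f0))) _ = refl
      injective u≢w (fs (fs (fs f0))) (fs (fs (fs (fs f0)))) h = ⊥-elim (edge-12 h₄ h)
      injective u≢w (fs (fs (fs (fs f0)))) f0 h = ⊥-elim (edge-23 h₄ h)
      injective u≢w (fs (fs (fs (fs f0)))) (fs f0) h = ⊥-elim (u≢w (sym h))
      injective u≢w (fs (fs (fs (fs f0)))) (fs (fs f0)) h = ⊥-elim (edge-13 h₃ (sym h))
      injective u≢w (fs (fs (fs (fs f0)))) (fs (fs (fs f0))) h = ⊥-elim (edge-12 h₄ (sym h))
      injective u≢w (fs (fs (fs (fs f0)))) (fs (fs (fs (fs f0)))) _ = refl
      from : Dec (u ≡ w) → u ≡ w
      from (yes p) = p
      from (no ¬p) = ⊥-elim (free (f , injective ¬p , h₁ , h₂ , h₃ , h₄))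

module _ {n : ℕ} (G : Free (Fin n)) (loopless′ : ∀ x z → Free.e G x x z ≡ false) where

  toThreeGraph : ThreeGraph n
  toThreeGraph = record { edge = Free.e G ; sym₁₂ = Free.sym₁₂ G ; sym₂₃ = Free.sym₂₃ G ; loopless = loopless′ }

  toThreeGraph-free : C5minusFree toThreeGraph
  toThreeGraph-free (f , injective , h₁ , h₂ , h₃ , h₄) with injective _ _ (Free.no5 G h₁ h₂ h₃ h₄)
  ... | ()

length-concatMap-filter : ∀ {A B : Set} {P : B → Set} (P? : ∀ b → Dec (P b)) (g : A → List B) xs →
  length (filter P? (concatMap g xs)) ≡ ∑ xs (λ x → length (filter P? (g x)))
length-concatMap-filter P? g []       = refl
length-concatMap-filter P? g (x ∷ xs) = trans (cong length (filter-++ P? (g x) (concatMap g xs)))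
  (trans (length-++ (filter P? (g x))) (cong (length (filter P? (g x)) +_) (length-concatMap-filter P? g xs)))

length-map-filter : ∀ {A B : Set} {P : B → Set} (P? : ∀ b → Dec (P b)) (g : A → B) xs →
  length (filter P? (map g xs)) ≡ ∑ xs (λ x → ι (does (P? (g x))))
length-map-filter P? g []       = refl
length-map-filter P? g (x ∷ xs) with does (P? (g x))
... | true  = cong suc (length-map-filter P? g xs)
... | false = length-map-filter P? g xs

count-triples : ∀ n {P : Fin n × Fin n × Fin n → Set} (P? : ∀ t → Dec (P t)) →
  length (filter P? (triples n)) ≡ Sums.Sum (allFin n) 3 (λ x y z → ι (does (P? (x , y , z))))
count-triples n P? = trans (length-concatMap-filter P? _ (allFin n)) (∑-cong (allFin n) λ x →
  trans (length-concatMap-filter P? _ (allFin n)) (∑-cong (allFin n) λ y → length-map-filter P? (λ z → x , y , z) (allFin n)))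

sum-edges-eq : ∀ t → t + t + t + t + t + t ≡ 6 * t
sum-edges-eq = solve-∀

module _ {n : ℕ} (H : ThreeGraph n) where

  open Sums (allFin n)

  private
    lt : Fin n → Fin n → Bool
    lt x y = does (x <ᶠ? y)

    lt-flip : ∀ {x y} → x ≢ y → lt y x ≡ not (lt x y)
    lt-flip {x} {y} x≢y with <ᶠ-cmp x y
    ... | tri< p _ _ = trans (dec-false (y <ᶠ? x) (<ᶠ-asym p)) (cong not (sym (dec-true (x <ᶠ? y) p)))
    ... | tri≈ _ q _ = ⊥-elim (x≢y q)
    ... | tri> ¬p _ q = trans (dec-true (y <ᶠ? x) q) (cong not (sym (dec-false (x <ᶠ? y) ¬p)))

    lt-trans : ∀ {x y z} → lt x y ≡ true → lt y z ≡ true → lt x z ≡ true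
    lt-trans {x} {y} {z} h g = dec-true (x <ᶠ? z) (<ᶠ-trans (does-true (x <ᶠ? y) h) (does-true (y <ᶠ? z) g))

    ordered : Fin n → Fin n → Fin n → ℕ
    ordered x y z = ι (lt x y ∧ lt y z ∧ edge H x y z)

  numEdges≡ : numEdges H ≡ Sum 3 ordered
  numEdges≡ = trans (count-triples n _) (sum-cong 3 λ x y z → cong (λ b → ι (lt x y ∧ lt y z ∧ b)) (does-≟true (edge H x y z)))

  private
    -- Here a, b, c stand for x < y, y < z and x < z. The two implications rule out the cyclic
    -- patterns, and exactly one of the six orders is increasing in each remaining case.
    six : ∀ a b c → (a ≡ true → b ≡ true → c ≡ true) → (not a ≡ true → not b ≡ true → not c ≡ true) →
      1 ≡ ι (a ∧ b) + ι (c ∧ not b) + ι (not a ∧ c) + ι (b ∧ not c) + ι (not c ∧ a) + ι (not b ∧ not a)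
    six true  true  true  _ _ = refl
    six true  true  false f _ with f refl refl
    ... | ()
    six true  false true  _ _ = refl
    six true  false false _ _ = refl
    six false true  true  _ _ = refl
    six false true  false _ _ = refl
    six false false true  _ g with g refl refl
    ... | ()
    six false false false _ _ = refl

    orders : ∀ x y z → ι (edge H x y z) ≡ ordered x y z + ordered x z y + ordered y x z + ordered y z x + ordered z x y + ordered z y x
    orders x y z = from (edge H x y z) refl
      where
      rewrite-edge : ∀ b → edge H x y z ≡ b → ordered x y z + ordered x z y + ordered y x z + ordered y z x + ordered z x y + ordered z y x
        ≡ ι (lt x y ∧ lt y z ∧ b) + ι (lt x z ∧ lt z y ∧ b) + ι (lt y x ∧ lt x z ∧ b) + ι (lt y z ∧ lt z x ∧ b) + ι (lt z x ∧ lt x y ∧ b) + ι (lt z y ∧ lt y x ∧ b)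
      rewrite-edge b h = cong₂ _+_ (cong₂ _+_ (cong₂ _+_ (cong₂ _+_ (cong₂ _+_
        (cong (λ c → ι (lt x y ∧ lt y z ∧ c)) h)
        (cong (λ c → ι (lt x z ∧ lt z y ∧ c)) (trans (sym (sym₂₃ H x y z)) h)))
        (cong (λ c → ι (lt y x ∧ lt x z ∧ c)) (trans (sym (sym₁₂ H x y z)) h)))
        (cong (λ c → ι (lt y z ∧ lt z x ∧ c)) (trans (sym (sym₂₃ H y x z)) (trans (sym (sym₁₂ H x y z)) h))))
        (cong (λ c → ι (lt z x ∧ lt x y ∧ c)) (trans (sym (sym₁₂ H x z y)) (trans (sym (sym₂₃ H x y z)) h))))
        (cong (λ c → ι (lt z y ∧ lt y x ∧ c)) (trans (sym (sym₁₂ H y z x)) (trans (sym (sym₂₃ H y x z)) (trans (sym (sym₁₂ H x y z)) h))))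
      ∧-falseʳ : ∀ a b → ι (a ∧ b ∧ false) ≡ 0
      ∧-falseʳ true  true  = refl
      ∧-falseʳ true  false = refl
      ∧-falseʳ false b     = refl
      ∧-trueʳ : ∀ a b → ι (a ∧ b ∧ true) ≡ ι (a ∧ b)
      ∧-trueʳ true  true  = refl
      ∧-trueʳ true  false = refl
      ∧-trueʳ false b     = refl
      from : ∀ b → edge H x y z ≡ b → ι (edge H x y z) ≡ ordered x y z + ordered x z y + ordered y x z + ordered y z x + ordered z x y + ordered z y x
      from false h = trans (cong ι h) (sym (trans (rewrite-edge false h)
        (cong₂ _+_ (cong₂ _+_ (cong₂ _+_ (cong₂ _+_ (cong₂ _+_ (∧-falseʳ (lt x y) (lt y z)) (∧-falseʳ (lt x z) (lt z y))) (∧-falseʳ (lt y x) (lt x z))) (∧-falseʳ (lt y z) (lt z x))) (∧-falseʳ (lt z x) (lt x y))) (∧-falseʳ (lt z y) (lt y x)))))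
      from true  h = trans (cong ι h) (sym (trans (rewrite-edge true h) (trans
        (cong₂ _+_ (cong₂ _+_ (cong₂ _+_ (cong₂ _+_ (cong₂ _+_ (∧-trueʳ (lt x y) (lt y z)) (∧-trueʳ (lt x z) (lt z y))) (∧-trueʳ (lt y x) (lt x z))) (∧-trueʳ (lt y z) (lt z x))) (∧-trueʳ (lt z x) (lt x y))) (∧-trueʳ (lt z y) (lt y x)))
        (trans (cong₂ _+_ (cong₂ _+_ (cong₂ _+_ (cong₂ _+_ (cong₂ _+_ refl (cong (λ t → ι (lt x z ∧ t)) yz)) (cong (λ t → ι (t ∧ lt x z)) xy)) (cong (λ t → ι (lt y z ∧ t)) xz)) (cong (λ t → ι (t ∧ lt x y)) xz)) (cong₂ (λ s t → ι (s ∧ t)) yz xy))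
        (sym (six (lt x y) (lt y z) (lt x z) (lt-trans {x} {y} {z})
          (λ p q → trans (sym xz) (lt-trans {z} {y} {x} (trans yz q) (trans xy p)))))))))
        where
        xy : lt y x ≡ not (lt x y)
        xy = lt-flip (edge-12 H h)
        yz : lt z y ≡ not (lt y z)
        yz = lt-flip (edge-23 H h)
        xz : lt z x ≡ not (lt x z)
        xz = lt-flip (edge-13 H h)

  sum-edges : Sum 3 (λ x y z → ι (edge H x y z)) ≡ 6 * numEdges H
  sum-edges = trans (sum-cong 3 orders) (trans (sum-+ 3 _ (λ x y z → ordered z y x)) (trans (cong₂ _+_ (trans (sum-+ 3 _ (λ x y z → ordered z x y))
      (cong₂ _+_ (trans (sum-+ 3 _ (λ x y z → ordered y z x)) (cong₂ _+_ (sum-+₃ 3 ordered (λ x y z → ordered x z y) (λ x y z → ordered y x z)) (perm 3 (0 ∷ 1 ∷ []) ordered))) (perm 3 (1 ∷ 0 ∷ []) ordered)))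
      (perm 3 (0 ∷ 1 ∷ 0 ∷ []) ordered)) (trans (cong₂ (λ s t → T + s + t + T + T + T) (perm 3 (1 ∷ []) ordered) (perm 3 (0 ∷ []) ordered)) (trans (sum-edges-eq T) (cong (6 *_) (sym numEdges≡))))))
    where
    T : ℕ
    T = Sum 3 ordered

-- The iterated construction as a lower bound for extremal graphs.

range : ℕ → List ℕ
range zero    = []
range (suc n) = n ∷ range n

-- Residue modulo 3, with `third` as the quotient: vertex v of the blow-up is the copy of `third v`
-- in part `digit v`.
digit : ℕ → Fin 3
digit 0 = 0F
digit 1 = 1F
digit 2 = 2F
digit (suc (suc (suc n))) = digit n

third : ℕ → ℕ
third 0 = 0
third 1 = 0
third 2 = 0
third (suc (suc (suc n))) = suc (third n)

digit+third : ∀ n → toℕ (digit n) + third n * 3 ≡ n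
digit+third 0 = refl
digit+third 1 = refl
digit+third 2 = refl
digit+third (suc (suc (suc n))) = trans (eq (toℕ (digit n)) (third n)) (cong (3 +_) (digit+third n))
  where
  eq : ∀ d t → d + suc t * 3 ≡ 3 + (d + t * 3)
  eq = solve-∀

digit-third-injective : ∀ {x y} → digit x ≡ digit y → third x ≡ third y → x ≡ y
digit-third-injective {x} {y} h g = trans (sym (digit+third x)) (trans (cong₂ (λ d t → toℕ d + t * 3) h g) (digit+third y))

thirds : ∀ m f → ∑ (range (m * 3)) f ≡ ∑ (range m) (λ x → f (2 + x * 3) + (f (1 + x * 3) + f (x * 3)))
thirds zero    f = refl
thirds (suc m) f = trans (cong (λ s → f (2 + m * 3) + (f (1 + m * 3) + (f (m * 3) + s))) (thirds m f)) (eq (f (2 + m * 3)) (f (1 + m * 3)) (f (m * 3)) _)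
  where
  eq : ∀ a b c s → a + (b + (c + s)) ≡ (a + (b + c)) + s
  eq = solve-∀

range-mono : ∀ q n f → ∑ (range n) f ≤ ∑ (range (q + n)) f
range-mono zero    n f = ≤-refl
range-mono (suc q) n f = ≤-trans (range-mono q n f) (m≤n+m _ (f (q + n)))

digit-third : ∀ x → (digit (2 + x * 3) ≡ 2F × third (2 + x * 3) ≡ x) × (digit (1 + x * 3) ≡ 1F × third (1 + x * 3) ≡ x) × (digit (x * 3) ≡ 0F × third (x * 3) ≡ x)
digit-third zero = (refl , refl) , (refl , refl) , (refl , refl)
digit-third (suc x) with digit-third x
... | (a , b) , (c , d) , (e , f) = (a , cong suc b) , (c , cong suc d) , (e , cong suc f)

pull-back : ∀ q m i f → ∑ (range m) f ≤ ∑ (range (q + m * 3)) (λ v → ι (eq₃ (digit v) i) * f (third v))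
pull-back q m i f = ≤-trans (≤-trans (∑-mono (range m) (λ x → pt i x (digit-third x))) (≤-reflexive (sym (thirds m (F i))))) (range-mono q (m * 3) (F i))
  where
  F : Fin 3 → ℕ → ℕ
  F i v = ι (eq₃ (digit v) i) * f (third v)
  value : ∀ v i x → digit v ≡ i → third v ≡ x → f x ≤ ι (eq₃ (digit v) i) * f (third v)
  value v i x h g = ≤-reflexive (sym (trans (cong₂ (λ d t → ι (eq₃ d i) * f t) h g) (trans (cong (λ b → ι b * f x) (diag i)) (*-identityˡ (f x)))))
    where
    diag : ∀ i → eq₃ i i ≡ true
    diag 0F = refl
    diag 1F = refl
    diag 2F = refl
  pt : ∀ i x → (digit (2 + x * 3) ≡ 2F × third (2 + x * 3) ≡ x) × (digit (1 + x * 3) ≡ 1F × third (1 + x * 3) ≡ x) × (digit (x * 3) ≡ 0F × third (x * 3) ≡ x) →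
    f x ≤ ι (eq₃ (digit (2 + x * 3)) i) * f (third (2 + x * 3)) + (ι (eq₃ (digit (1 + x * 3)) i) * f (third (1 + x * 3)) + ι (eq₃ (digit (x * 3)) i) * f (third (x * 3)))
  pt 2F x ((a , b) , _) = ≤-trans (value (2 + x * 3) 2F x a b) (m≤m+n (F 2F (2 + x * 3)) (F 2F (1 + x * 3) + F 2F (x * 3)))
  pt 1F x (_ , (a , b) , _) = ≤-trans (value (1 + x * 3) 1F x a b) (≤-trans (m≤m+n (F 1F (1 + x * 3)) (F 1F (x * 3))) (m≤n+m (F 1F (1 + x * 3) + F 1F (x * 3)) (F 1F (2 + x * 3))))
  pt 0F x (_ , _ , (a , b)) = ≤-trans (value (x * 3) 0F x a b) (≤-trans (m≤n+m (F 0F (x * 3)) (F 0F (1 + x * 3))) (m≤n+m (F 0F (1 + x * 3) + F 0F (x * 3)) (F 0F (2 + x * 3))))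

length-range : ∀ n → length (range n) ≡ n
length-range zero    = refl
length-range (suc n) = cong suc (length-range n)

-- The graph lives on all of ℕ and only its edges on `range n` are counted, so the vertex type does
-- not change in the recursion.
record Dense (n : ℕ) : Set where
  field
    graph    : Free ℕ
    no-loops : ∀ x z → Free.e graph x x z ≡ false
    dense    : cube n ≤ 4 * edges graph (range n) + 18 * (n * n)

empty : Free ℕ
empty = record { e = λ _ _ _ → false ; sym₁₂ = λ _ _ _ → refl ; sym₂₃ = λ _ _ _ → refl ; no5 = λ () }

-- An error c n² reproduces itself when 9c ≥ 3c + 54, the 54m² coming from the expansion of (3m +
-- 2)³; c = 18 leaves room for the lower terms.
density-step : ∀ q m T S → q ≤ 2 → 6 * cube m + 3 * S ≤ T → cube m ≤ 4 * S + 18 * (m * m) → cube (q + m * 3) ≤ 4 * T + 18 * ((q + m * 3) * (q + m * 3))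
density-step 0 m T S _ h g = arith m T S h g
  where
  arith : ∀ m T S → 6 * (m * (m * m)) + 3 * S ≤ T → m * (m * m) ≤ 4 * S + 18 * (m * m) → m * 3 * (m * 3 * (m * 3)) ≤ 4 * T + 18 * (m * 3 * (m * 3))
  arith m T S h g = lin (108 * (m * m)) (4 ⊗ h ⊕ 3 ⊗ g) (solve (m ∷ T ∷ S ∷ []))
density-step 1 m T S _ h g = subst (λ n → cube n ≤ 4 * T + 18 * (n * n)) (+-comm (m * 3) 1) (arith m T S h g)
  where
  arith : ∀ m T S → 6 * (m * (m * m)) + 3 * S ≤ T → m * (m * m) ≤ 4 * S + 18 * (m * m) →
    (m * 3 + 1) * ((m * 3 + 1) * (m * 3 + 1)) ≤ 4 * T + 18 * ((m * 3 + 1) * (m * 3 + 1))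
  arith m T S h g = lin (81 * (m * m) + 99 * m + 17) (4 ⊗ h ⊕ 3 ⊗ g) (solve (m ∷ T ∷ S ∷ []))
density-step 2 m T S _ h g = subst (λ n → cube n ≤ 4 * T + 18 * (n * n)) (+-comm (m * 3) 2) (arith m T S h g)
  where
  arith : ∀ m T S → 6 * (m * (m * m)) + 3 * S ≤ T → m * (m * m) ≤ 4 * S + 18 * (m * m) →
    (m * 3 + 2) * ((m * 3 + 2) * (m * 3 + 2)) ≤ 4 * T + 18 * ((m * 3 + 2) * (m * 3 + 2))
  arith m T S h g = lin (54 * (m * m) + 180 * m + 64) (4 ⊗ h ⊕ 3 ⊗ g) (solve (m ∷ T ∷ S ∷ []))
density-step (suc (suc (suc q))) m T S (s≤s (s≤s ())) h g

-- The iterated construction: join three copies of a dense graph on ⌊n/3⌋ vertices.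
blow-up : ∀ q m → q ≤ 2 → Dense m → Dense (q + m * 3)
blow-up q m q≤2 D = record
  { graph    = joined
  ; no-loops = join-loopless digit third digit-third-injective graph no-loops
  ; dense    = density-step q m (edges joined vs) (edges graph (range m)) q≤2 counted dense
  }
  where
  open Dense D
  vs : List ℕ
  vs = range (q + m * 3)
  joined : Free ℕ
  joined = join digit third digit-third-injective graph
  size≥ : ∀ i → m ≤ Parts.size joined vs digit i
  size≥ i = ≤-trans (≤-reflexive (sym (trans (∑-length (range m)) (length-range m)))) (≤-trans (pull-back q m i (λ _ → 1)) (≤-reflexive (∑-cong vs (λ v → *-identityʳ _))))
  within≥ : ∀ i → edges graph (range m) ≤ PartSums.within₃ joined vs digit (λ a b c → Free.E graph (third a) (third b) (third c)) i i i
  within≥ i = ≤-trans (∑-mono (range m) λ x → ∑-mono (range m) λ y → pull-back q m i (Free.E graph x y))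
    (≤-trans (∑-mono (range m) λ x → pull-back q m i (λ y → ∑ vs λ c → I c * Free.E graph x y (third c)))
    (≤-trans (pull-back q m i (λ x → ∑ vs λ b → I b * ∑ vs λ c → I c * Free.E graph x (third b) (third c)))
      (≤-reflexive (∑-cong vs λ a → trans (sym (∑-* vs (I a) _)) (∑-cong vs λ b → trans (cong (I a *_) (sym (∑-* vs (I b) _))) (sym (∑-* vs (I a) _)))))))
    where
    I : ℕ → ℕ
    I v = ι (eq₃ (digit v) i)
  counted : 6 * cube m + 3 * edges graph (range m) ≤ edges joined vs
  counted = ≤-trans (*-monoʳ-≤ 6 (*-mono-≤ (size≥ 0F) (*-mono-≤ (size≥ 1F) (size≥ 2F))) ⊕ ≤-trans (≤-reflexive (eq (edges graph (range m)))) (within≥ 0F ⊕ within≥ 1F ⊕ within≥ 2F))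
    (JoinCount.join-edges digit third digit-third-injective graph vs)
    where
    eq : ∀ x → 3 * x ≡ x + x + x
    eq = solve-∀

dense-graph : ∀ fuel n → n ≤ fuel → Dense n
dense-graph fuel       zero    _ = record { graph = empty ; no-loops = λ _ _ → refl ; dense = z≤n }
dense-graph (suc fuel) (suc n) h = subst Dense (sym (m≡m%n+[m/n]*n (suc n) 3)) (blow-up (suc n % 3) (suc n / 3) (≤-pred (m%n<n (suc n) 3))
  (dense-graph fuel (suc n / 3) (≤-pred (≤-trans (m/n<m (suc n) 3 (s≤s (s≤s z≤n))) h))))

range-shift : ∀ n f → ∑ (range (suc n)) f ≡ f 0 + ∑ (range n) (f ∘ suc)
range-shift zero    f = refl
range-shift (suc n) f = trans (cong (f (suc n) +_) (range-shift n f)) (eq (f (suc n)) (f 0) _)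
  where
  eq : ∀ a b c → a + (b + c) ≡ b + (a + c)
  eq = solve-∀

∑-tabulate : ∀ {A : Set} n (g : Fin n → A) (F : A → ℕ) f → (∀ i → F (g i) ≡ f (toℕ i)) → ∑ (tabulate g) F ≡ ∑ (range n) f
∑-tabulate zero    g F f h = refl
∑-tabulate (suc n) g F f h = trans (cong₂ _+_ (h f0) (∑-tabulate n (g ∘ fs) F (f ∘ suc) (h ∘ fs))) (sym (range-shift n f))

∑-allFin : ∀ n f → ∑ (allFin n) (f ∘ toℕ) ≡ ∑ (range n) f
∑-allFin n f = ∑-tabulate n (λ i → i) (f ∘ toℕ) f (λ _ → refl)

pulled-back : ∀ n → Free ℕ → Free (Fin n)
pulled-back n G = record
  { e     = λ x y z → Free.e G (toℕ x) (toℕ y) (toℕ z)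
  ; sym₁₂ = λ x y z → Free.sym₁₂ G (toℕ x) (toℕ y) (toℕ z)
  ; sym₂₃ = λ x y z → Free.sym₂₃ G (toℕ x) (toℕ y) (toℕ z)
  ; no5   = λ h₁ h₂ h₃ h₄ → toℕ-injective (Free.no5 G h₁ h₂ h₃ h₄)
  }

edges-pulled-back : ∀ n G → edges (pulled-back n G) (allFin n) ≡ edges G (range n)
edges-pulled-back n G = trans (∑-allFin n (λ x → ∑ (allFin n) λ y → ∑ (allFin n) λ z → Free.E G x (toℕ y) (toℕ z)))
  (∑-cong (range n) λ x → trans (∑-allFin n (λ y → ∑ (allFin n) λ z → Free.E G x y (toℕ z))) (∑-cong (range n) λ y → ∑-allFin n (Free.E G x y)))

module _ {n : ℕ} (H : ThreeGraph n) (extremal : IsExtremal H) where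

  freeOf : Free (Fin n)
  freeOf = toFree H (proj₁ extremal)

  maximal : (G : Free (Fin n)) → (∀ x z → Free.e G x x z ≡ false) → edges G (allFin n) ≤ edges freeOf (allFin n)
  maximal G no-loops = ≤-trans (≤-reflexive (sum-edges (toThreeGraph G no-loops)))
    (≤-trans (*-monoʳ-≤ 6 (proj₂ extremal (toThreeGraph G no-loops) (toThreeGraph-free G no-loops))) (≤-reflexive (sym (sum-edges H))))

  maximal-join : ∀ (q : Fin n → Fin 3) → edges (join q (λ x → x) (λ _ eq → eq) freeOf) (allFin n) ≤ edges freeOf (allFin n)
  maximal-join q = maximal (join q (λ x → x) (λ _ eq → eq) freeOf) (join-loopless q (λ x → x) (λ _ eq → eq) freeOf (loopless H))

  dense-extremal : cube n ≤ 4 * edges freeOf (allFin n) + 18 * (n * n)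
  dense-extremal = ≤-trans dense (+-monoˡ-≤ _ (*-monoʳ-≤ 4 (≤-trans (≤-reflexive (sym (edges-pulled-back n graph)))
    (maximal (pulled-back n graph) (λ x z → no-loops (toℕ x) (toℕ z))))))
    where open Dense (dense-graph n n ≤-refl)

-- From scaled inequalities in ℕ to the rational bound on part sizes.

open import Data.Integer as ℤ using (+[1+_]; _⊖_)
open import Data.Rational as ℚ using (ℚ; mkℚ; Positive; toℚᵘ)
open import Data.Rational.Unnormalised as ℚᵘ using (mkℚᵘ; *≤*; _≃_)
import Data.Integer.Properties as ℤ
import Data.Rational.Properties as ℚ
import Data.Rational.Unnormalised.Properties as ℚᵘ

∣⊖∣-bound : ∀ k a b c → k * a ≤ k * b + c → k * b ≤ k * a + c → k * ℤ.∣ a ⊖ b ∣ ≤ c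
∣⊖∣-bound k a b c upper lower with ≤-total a b
... | inj₁ a≤b = begin
  k * ℤ.∣ a ⊖ b ∣  ≡⟨ cong (k *_) (ℤ.∣⊖∣-≤ a≤b) ⟩
  k * (b ∸ a)      ≡⟨ *-distribˡ-∸ k b a ⟩
  k * b ∸ k * a    ≤⟨ m≤n+o⇒m∸n≤o (k * b) (k * a) lower ⟩
  c                ∎
  where open ≤-Reasoning
... | inj₂ b≤a = begin
  k * ℤ.∣ a ⊖ b ∣  ≡⟨ cong (k *_) (trans (ℤ.∣m⊖n∣≡∣n⊖m∣ a b) (ℤ.∣⊖∣-≤ b≤a)) ⟩
  k * (a ∸ b)      ≡⟨ *-distribˡ-∸ k a b ⟩
  k * a ∸ k * b    ≤⟨ m≤n+o⇒m∸n≤o (k * a) (k * b) upper ⟩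
  c                ∎
  where open ≤-Reasoning

difference : ∀ s n → ℤ.+ s ℤ.* ℤ.+ 3 ℤ.+ (ℤ.- ℤ.+ n) ℤ.* ℤ.+ 1 ≡ (3 * s) ⊖ n
difference s n = begin
  ℤ.+ s ℤ.* ℤ.+ 3 ℤ.+ (ℤ.- ℤ.+ n) ℤ.* ℤ.+ 1  ≡⟨ cong₂ ℤ._+_ (sym (ℤ.pos-* s 3)) (ℤ.*-identityʳ (ℤ.- ℤ.+ n)) ⟩
  ℤ.+ (s * 3) ℤ.- ℤ.+ n                  ≡⟨ ℤ.m-n≡m⊖n (s * 3) n ⟩
  (s * 3) ⊖ n                        ≡⟨ cong (_⊖ n) (*-comm s 3) ⟩
  (3 * s) ⊖ n                        ∎
  where open ≡-Reasoning

natural≃ : ∀ m → toℚᵘ (ℕtoℚ m) ≃ mkℚᵘ (ℤ.+ m) 0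
natural≃ m = ℚ.toℚᵘ-fromℚᵘ (mkℚᵘ (ℤ.+ m) 0)

third≃ : ∀ n → toℚᵘ ((ℤ.+ n) ℚ./ 3) ≃ mkℚᵘ (ℤ.+ n) 2
third≃ n = ℚ.toℚᵘ-fromℚᵘ (mkℚᵘ (ℤ.+ n) 2)

left≃ : ∀ s n → toℚᵘ ℚ.∣ ℕtoℚ s ℚ.- (ℤ.+ n) ℚ./ 3 ∣ ≃ mkℚᵘ (ℤ.+ ℤ.∣ (3 * s) ⊖ n ∣) 2
left≃ s n = ℚᵘ.≃-trans (ℚ.toℚᵘ-homo-∣-∣ (ℕtoℚ s ℚ.- (ℤ.+ n) ℚ./ 3))
  (ℚᵘ.≃-trans (ℚᵘ.∣-∣-cong {toℚᵘ (ℕtoℚ s ℚ.- (ℤ.+ n) ℚ./ 3)} {mkℚᵘ (ℤ.+ s) 0 ℚᵘ.- mkℚᵘ (ℤ.+ n) 2}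
      (ℚᵘ.≃-trans (ℚ.toℚᵘ-homo-+ (ℕtoℚ s) (ℚ.- ((ℤ.+ n) ℚ./ 3)))
        (ℚᵘ.+-cong (natural≃ s)
          (ℚᵘ.≃-trans (ℚ.toℚᵘ-homo‿- ((ℤ.+ n) ℚ./ 3)) (ℚᵘ.-‿cong (third≃ n))))))
    (ℚᵘ.≃-reflexive (cong (λ i → mkℚᵘ (ℤ.+ ℤ.∣ i ∣) 2) (difference s n))))

right≃ : ∀ ε n → toℚᵘ (ε ℚ.* ℕtoℚ n) ≃ toℚᵘ ε ℚᵘ.* mkℚᵘ (ℤ.+ n) 0
right≃ ε n = ℚᵘ.≃-trans (ℚ.toℚᵘ-homo-* ε (ℕtoℚ n)) (ℚᵘ.*-congˡ {toℚᵘ ε} (natural≃ n))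

fraction-bound : ∀ p d a n → suc d * a ≤ n → mkℚᵘ (ℤ.+ a) 2 ℚᵘ.≤ mkℚᵘ +[1+ p ] d ℚᵘ.* mkℚᵘ (ℤ.+ n) 0
fraction-bound p d a n da≤n = *≤* (subst₂ ℤ._≤_ (ℤ.pos-* a (suc (d * 1)))
    (trans (ℤ.pos-* (suc p * n) 3) (cong (ℤ._* ℤ.+ 3) (ℤ.pos-* (suc p) n)))
    (ℤ.+≤+ (begin
      a * suc (d * 1)  ≡⟨ cong (λ x → a * suc x) (*-identityʳ d) ⟩
      a * suc d        ≡⟨ *-comm a (suc d) ⟩
      suc d * a        ≤⟨ da≤n ⟩
      n                ≤⟨ m≤m+n n (p * n) ⟩
      suc p * n        ≤⟨ m≤m*n (suc p * n) 3 ⟩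
      suc p * n * 3    ∎)))
  where open ≤-Reasoning

near-third : ∀ ε → Positive ε → Σ ℕ λ K → 1 ≤ K ×
  (∀ s n → K * (3 * s) ≤ K * n + n → K * n ≤ K * (3 * s) + n →
    ℚ.∣ ℕtoℚ s ℚ.- (ℤ.+ n) ℚ./ 3 ∣ ℚ.≤ ε ℚ.* ℕtoℚ n)
-- `K` is the denominator of ε. As the numerator is at least 1, a deviation of n/(3K) is below εn.
near-third ε@(mkℚ +[1+ p ] d _) _ = suc d , s≤s z≤n , λ s n upper lower →
  ℚ.toℚᵘ-cancel-≤ (ℚᵘ.≤-respˡ-≃ (ℚᵘ.≃-sym (left≃ s n)) (ℚᵘ.≤-respʳ-≃ (ℚᵘ.≃-sym (right≃ ε n))
    (fraction-bound p d ℤ.∣ (3 * s) ⊖ n ∣ n (∣⊖∣-bound (suc d) (3 * s) n n upper lower))))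

-- From vanishing counts to the partition of an extremal graph.

third-part : ∀ i j → i ≢ j → Σ (Fin 3) (Distinct i j)
third-part 0F 0F ne = ⊥-elim (ne refl)
third-part 0F 1F _  = 2F , d012
third-part 0F 2F _  = 1F , d021
third-part 1F 0F _  = 2F , d102
third-part 1F 1F ne = ⊥-elim (ne refl)
third-part 1F 2F _  = 0F , d120
third-part 2F 0F _  = 1F , d201
third-part 2F 1F _  = 0F , d210
third-part 2F 2F ne = ⊥-elim (ne refl)

distinct : ∀ i j h → i ≢ j → j ≢ h → i ≢ h → Distinct i j h
distinct i j h i≢j j≢h i≢h = from (third-part i j i≢j) h j≢h i≢h
  where
  from : ∀ {i j} → Σ (Fin 3) (Distinct i j) → ∀ h → j ≢ h → i ≢ h → Distinct i j h
  from (_ , d012) 0F _ b = ⊥-elim (b refl)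
  from (_ , d012) 1F a _ = ⊥-elim (a refl)
  from (_ , d012) 2F _ _ = d012
  from (_ , d021) 0F _ b = ⊥-elim (b refl)
  from (_ , d021) 1F _ _ = d021
  from (_ , d021) 2F a _ = ⊥-elim (a refl)
  from (_ , d102) 0F a _ = ⊥-elim (a refl)
  from (_ , d102) 1F _ b = ⊥-elim (b refl)
  from (_ , d102) 2F _ _ = d102
  from (_ , d120) 0F _ _ = d120
  from (_ , d120) 1F _ b = ⊥-elim (b refl)
  from (_ , d120) 2F a _ = ⊥-elim (a refl)
  from (_ , d201) 0F a _ = ⊥-elim (a refl)
  from (_ , d201) 1F _ _ = d201
  from (_ , d201) 2F _ b = ⊥-elim (b refl)
  from (_ , d210) 0F _ _ = d210
  from (_ , d210) 1F a _ = ⊥-elim (a refl)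
  from (_ , d210) 2F _ b = ⊥-elim (b refl)

true≢false : ∀ {b} → b ≡ true → b ≡ false → ⊥
true≢false refl ()

module Crossing {n : ℕ} (H : ThreeGraph n) (p : Fin n → Fin 3)
  (crossing : ∀ x y z → Distinct (p x) (p y) (p z) → edge H x y z ≡ true)
  (not-mixed : ∀ x y z h → p x ≡ p y → Distinct (p x) (p z) h → edge H x y z ≡ false) where

  no-mixed-edge : ∀ x y z → edge H x y z ≡ true → p x ≡ p y → p x ≢ p z → ⊥
  no-mixed-edge x y z e eq ne = from (third-part (p x) (p z) ne)
    where
    from : Σ (Fin 3) (Distinct (p x) (p z)) → ⊥
    from (h , D) = true≢false e (not-mixed x y z h eq D)

  characterization : ∀ x y z → (edge H x y z ≡ true × ¬ (p x ≡ p y × p y ≡ p z)) ⇔ (p x ≢ p y × p y ≢ p z × p x ≢ p z)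
  characterization x y z = mk⇔ forward backward
    where
    forward : edge H x y z ≡ true × ¬ (p x ≡ p y × p y ≡ p z) → p x ≢ p y × p y ≢ p z × p x ≢ p z
    forward (e , not-inside) = xy , yz , xz
      where
      xy : p x ≢ p y
      xy eq = no-mixed-edge x y z e eq λ xz → not-inside (eq , trans (sym eq) xz)
      xz : p x ≢ p z
      xz eq = no-mixed-edge x z y (trans (sym (sym₂₃ H x y z)) e) eq xy
      yz : p y ≢ p z
      yz eq = no-mixed-edge y z x (trans (sym (sym₂₃ H y x z)) (trans (sym (sym₁₂ H x y z)) e)) eq (xy ∘ sym)
    backward : p x ≢ p y × p y ≢ p z × p x ≢ p z → edge H x y z ≡ true × ¬ (p x ≡ p y × p y ≡ p z)
    backward (xy , yz , xz) = crossing x y z (distinct (p x) (p y) (p z) xy yz xz) , xy ∘ proj₁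

ScaledSize : ℕ → ℕ → ℕ → Set
ScaledSize K s n = K * (3 * s) ≤ K * n + n × K * n ≤ K * (3 * s) + n

cancel-scale : ∀ c J K a b n .{{_ : NonZero J}} → c * K ≤ J → J * a ≤ J * b + c * n → K * a ≤ K * b + n
cancel-scale c J K a b n cK≤J h = *-cancelˡ-≤ J (begin
  J * (K * a)                ≡⟨ solve (J ∷ K ∷ a ∷ []) ⟩
  K * (J * a)                ≤⟨ *-monoʳ-≤ K h ⟩
  K * (J * b + c * n)        ≡⟨ solve (J ∷ K ∷ b ∷ c ∷ n ∷ []) ⟩
  J * (K * b) + c * K * n    ≤⟨ +-monoʳ-≤ (J * (K * b)) (*-monoˡ-≤ n cK≤J) ⟩
  J * (K * b) + J * n        ≡⟨ solve (J ∷ K ∷ b ∷ n ∷ []) ⟩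
  J * (K * b + n)            ∎)
  where open ≤-Reasoning

near-extremal : ∀ k n T → 18 * k ≤ n → cube n ≤ 4 * T + 18 * (n * n) → k * cube n ≤ 4 * (k * T) + cube n
near-extremal k n T 18k≤n h = begin
  k * cube n                     ≤⟨ *-monoʳ-≤ k h ⟩
  k * (4 * T + 18 * (n * n))     ≡⟨ solve (k ∷ n ∷ T ∷ []) ⟩
  4 * (k * T) + 18 * k * (n * n) ≤⟨ +-monoʳ-≤ (4 * (k * T)) (*-monoˡ-≤ (n * n) 18k≤n) ⟩
  4 * (k * T) + n * (n * n)      ∎
  where open ≤-Reasoning

HasPartition : ∀ {n} → ThreeGraph n → ℕ → Set
HasPartition {n} H K = Σ (Fin n → Fin 3) λ p → (∀ i → ScaledSize K (partSize p i) n) ×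
  (∀ x y z → (edge H x y z ≡ true × ¬ (p x ≡ p y × p y ≡ p z)) ⇔ (p x ≢ p y × p y ≢ p z × p x ≢ p z))

module Extremal (K k J k′ τ : ℕ) (K-large : 901 * K ≤ J) (4≤J : 4 ≤ J)
  (J-large : Scaled 8000 1311 1 J) (J-large′ : Scaled 3000 1 1 J) (τ-large : Scaled 72000 1 1 τ) (τ-small : 3 * (τ * τ) ≤ J)
  (degree : DegreeAt 183 729 100 k′) (parts : Partitions k J k′)
  {n : ℕ} (k³≤n : cube k ≤ n) (18k≤n : 18 * k ≤ n) (10⁴≤n : 10000 ≤ n) (H : ThreeGraph n) (extremal : IsExtremal H) where

  length-allFin : length (allFin n) ≡ n
  length-allFin = length-tabulate (λ (x : Fin n) → x)

  large-allFin : ∀ {m} → m ≤ n → m ≤ length (allFin n)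
  large-allFin = subst (_ ≤_) (sym length-allFin)

  near : NearExtremal (freeOf H extremal) (allFin n) k
  near = subst (λ m → k * cube m ≤ 4 * (k * edges (freeOf H extremal) (allFin n)) + cube m) (sym length-allFin)
           (near-extremal k n (edges (freeOf H extremal) (allFin n)) 18k≤n (dense-extremal H extremal))

  open Clean _≟ᶠ_ (freeOf H extremal) (allFin n) (allFin⁺ n) J k′ τ 4≤J J-large J-large′ τ-large τ-small (large-allFin 10⁴≤n) degree
         (parts _≟ᶠ_ (freeOf H extremal) (allFin n) (allFin⁺ n) (large-allFin k³≤n) near) (maximal-join H extremal) using (home-of)
  open Finish _≟ᶠ_ (freeOf H extremal) (allFin n) (allFin⁺ n) J k′ τ 4≤J J-large J-large′ τ-large τ-small (large-allFin 10⁴≤n) degree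
         (parts _≟ᶠ_ (freeOf H extremal) (allFin n) (allFin⁺ n) (large-allFin k³≤n) near) (maximal-join H extremal)
         using (crossing-edge; mixed-non-edge; size′≤; ≤size′)

  size : ∀ i → Parts.size (freeOf H extremal) (allFin n) home-of i ≡ partSize home-of i
  size i = sym (PartSums.length-part (freeOf H extremal) (allFin n) home-of i)

  instance
    J≢0 : NonZero J
    J≢0 = >-nonZero (≤-trans (s≤s z≤n) 4≤J)

  sizes : ∀ i → ScaledSize K (partSize home-of i) n
  sizes i =
    cancel-scale 901 J K (3 * partSize home-of i) n n K-large
      (subst₂ (λ s m → J * (3 * s) ≤ J * m + 901 * m) (size i) length-allFin (size′≤ i)) ,
    cancel-scale 901 J K n (3 * partSize home-of i) n K-large
      (subst₂ (λ s m → J * m ≤ J * (3 * s) + 901 * m) (size i) length-allFin (≤size′ i))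

  has-partition : HasPartition H K
  has-partition = home-of , sizes , Crossing.characterization H home-of
    (λ x y z → crossing-edge (∈-allFin x) (∈-allFin y) (∈-allFin z))
    (λ x y z h → mixed-non-edge (∈-allFin x) (∈-allFin y) (∈-allFin z))

large-enough : ∀ K τ J c → 72000 * 1 ≤ τ → c ≡ 8000 * 1311 → c + 3 * (τ * τ) + 901 * K + 3000 ≤ J →
  901 * K ≤ J × Scaled 8000 1311 1 J × Scaled 3000 1 1 J × Scaled 72000 1 1 τ × 3 * (τ * τ) ≤ J
large-enough K τ J c hτ hc h =
  ≤-trans (m≤n+m (901 * K) (c + 3 * (τ * τ))) le₃ ,
  scaled (≤-trans (≤-reflexive (sym hc)) (≤-trans le₁ (≤-reflexive (sym (*-identityˡ J))))) ,
  scaled (≤-trans (≤-trans (m≤n+m 3000 (c + 3 * (τ * τ) + 901 * K)) h) (≤-reflexive (sym (*-identityˡ J)))) ,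
  scaled (≤-trans hτ (≤-reflexive (sym (*-identityˡ τ)))) ,
  ≤-trans (m≤n+m (3 * (τ * τ)) c) le₂
  where
  le₃ : c + 3 * (τ * τ) + 901 * K ≤ J
  le₃ = ≤-trans (m≤m+n _ 3000) h
  le₂ : c + 3 * (τ * τ) ≤ J
  le₂ = ≤-trans (m≤m+n _ (901 * K)) le₃
  le₁ : c ≤ J
  le₁ = ≤-trans (m≤m+n c (3 * (τ * τ))) le₂

degree-183 : Degree 183 729
degree-183 = degree-step 21 81 (degree-step 3 9 (degree-step 1 1 degree-trivial))

Eventually : ℕ → Set
Eventually K = Σ ℕ λ n₀ → ∀ n → n₀ ≤ n → (H : ThreeGraph n) → IsExtremal H → HasPartition H K

extremal-partition-at : ∀ K τ c k′ → 72000 * 1 ≤ τ → c ≡ 8000 * 1311 → DegreeAt 183 729 100 k′ →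
  (Σ ℕ λ k → Σ ℕ λ J → 2 ≤ k × c + 3 * (τ * τ) + 901 * K + 3000 ≤ J × 4 ≤ J × Partitions k J k′) → Eventually K
extremal-partition-at K τ c k′ hτ hc degree (k , J , 2≤k , J-large , 4≤J , parts) = from (large-enough K τ J c hτ hc J-large)
  where
  from : 901 * K ≤ J × Scaled 8000 1311 1 J × Scaled 3000 1 1 J × Scaled 72000 1 1 τ × 3 * (τ * τ) ≤ J → Eventually K
  from (h₁ , h₂ , h₃ , h₄ , h₅) = cube k + 18 * k + 10000 , λ n n-large H extremal →
    Extremal.has-partition K k J k′ τ h₁ 4≤J h₂ h₃ h₄ h₅ degree parts
      (≤-trans (m≤m+n (cube k) (18 * k)) (≤-trans (m≤m+n _ 10000) n-large))
      (≤-trans (m≤n+m (18 * k) (cube k)) (≤-trans (m≤m+n _ 10000) n-large))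
      (≤-trans (m≤n+m 10000 (cube k + 18 * k)) n-large) H extremal

-- The large numerals enter as variables tied by hypotheses and are supplied only at the end, so
-- that type checking does not compute with them.
extremal-partition : ∀ K τ c → 72000 * 1 ≤ τ → c ≡ 8000 * 1311 → Eventually K
extremal-partition K τ c hτ hc = from (degree-183 100)
  where
  from : (Σ ℕ λ k′ → 2 ≤ k′ × DegreeAt 183 729 100 k′) → Eventually K
  from (k′ , _ , degree) = extremal-partition-at K τ c k′ hτ hc degree (partition (c + 3 * (τ * τ) + 901 * K + 3000) k′)

theorem1p3 : (ε : ℚ) → Positive ε →
    Σ ℕ λ n₀ → ∀ (n : ℕ) → n ≥ n₀ → (H : ThreeGraph n) → IsExtremal H →
    Σ (Fin n → Fin 3) λ p →
    (∀ (i : Fin 3) → ℚ.∣ ℕtoℚ (partSize p i) ℚ.- (ℤ.+ n) ℚ./ 3 ∣ ℚ.≤ ε ℚ.* ℕtoℚ n) ×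
    (∀ (x y z : Fin n) →
    ((edge H x y z ≡ true × ¬ (p x ≡ p y × p y ≡ p z))
    ⇔ (p x ≢ p y × p y ≢ p z × p x ≢ p z)))
theorem1p3 ε ε>0 = from (near-third ε ε>0)
  where
  Near : ℕ → Set
  Near K = 1 ≤ K × (∀ s n → K * (3 * s) ≤ K * n + n → K * n ≤ K * (3 * s) + n → ℚ.∣ ℕtoℚ s ℚ.- (ℤ.+ n) ℚ./ 3 ∣ ℚ.≤ ε ℚ.* ℕtoℚ n)
  Goal : ∀ n → ThreeGraph n → Set
  Goal n H = Σ (Fin n → Fin 3) λ p →
    (∀ (i : Fin 3) → ℚ.∣ ℕtoℚ (partSize p i) ℚ.- (ℤ.+ n) ℚ./ 3 ∣ ℚ.≤ ε ℚ.* ℕtoℚ n) ×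
    (∀ (x y z : Fin n) → ((edge H x y z ≡ true × ¬ (p x ≡ p y × p y ≡ p z)) ⇔ (p x ≢ p y × p y ≢ p z × p x ≢ p z)))
  convert : ∀ K → Near K → ∀ n (H : ThreeGraph n) → HasPartition H K → Goal n H
  convert K (_ , close) n H (p , sizes , crossing) = p , (λ i → close (partSize p i) n (proj₁ (sizes i)) (proj₂ (sizes i))) , crossing
  at : ∀ K → Near K → Eventually K → Σ ℕ λ n₀ → ∀ (n : ℕ) → n ≥ n₀ → (H : ThreeGraph n) → IsExtremal H → Goal n H
  at K near (n₀ , partitioned) = n₀ , λ n n≥n₀ H extremal → convert K near n H (partitioned n n≥n₀ H extremal)
  from : Σ ℕ Near → Σ ℕ λ n₀ → ∀ (n : ℕ) → n ≥ n₀ → (H : ThreeGraph n) → IsExtremal H → Goal n H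
  from (K , near) = at K near (extremal-partition K 72000 (8000 * 1311) ≤-refl refl)
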